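{- Let $p>3$ be a prime and let $E/\mathbb{F}_p$ be an elliptic curve of the form $E: y^2=x^3+ax+b$ with $a,b\in\mathbb{F}_p$ and $j$-invariant $j(E)\neq 0,1728$. Then, as an equality in $\mathbb{Q}_p$, $$a_p(E)=\phi(b)\cdot p\cdot {_{2}G_{2}}\biggl[\begin{array}{cc}\frac14, & \frac34\\ \frac13, & \frac23\end{array}\Big|\; -\frac{27b^2}{4a^3}\biggr]_p .$$
   Context: $a_p(E):=p+1-\#E(\mathbb{F}_p)$, where $\#E(\mathbb{F}_p)$ counts the projective points (including the point at infinity). $\phi$ denotes the Legendre symbol modulo $p$. Let $\Gamma_p$ denote Morita's $p$-adic gamma function: for $n\in\mathbb{Z}^+$, $\Gamma_p(n):=(-1)^n\prod_{0<j<n,\ p\nmid j} j$, $\Gamma_p(0):=1$, extended continuously to $\mathbb{Z}_p$ by $\Gamma_p(x)=\lim_{n\to x}\Gamma_p(n)$. Let $\omega:\mathbb{F}_p\to\mathbb{Z}_p^*\cup\{0\}$ be the Teichmüller character, i.e. the multiplicative character with $\omega(x)\equiv x \pmod p$ for $x\in\{0,1,\dots,p-1\}$ (so $\omega(0)=0$), and $\bar\omega$ its inverse (with $\bar\omega^j(0)=0$ for all $j$, including $j=0$). For $x\in\mathbb{Q}$, $\lfloor x\rfloor$ is the greatest integer $\le x$ and $\langle x\rangle=x-\lfloor x\rfloor$. For an odd prime $p$, $t\in\mathbb{F}_p$, $n\in\mathbb{Z}^+$ and $a_i,b_i\in\mathbb{Q}\cap\mathbb{Z}_p$ ($1\le i\le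 n$), define $${_{n}G_{n}}\biggl[\begin{array}{ccc}a_1,&\dots,&a_n\\ b_1,&\dots,&b_n\end{array}\Big|\; t\biggr]_p:=\frac{ -1}{p-1}\sum_{j=0}^{p-2}(-1)^{jn}\,\bar\omega^j(t)\prod_{i=1}^n\frac{\Gamma_p(\langle a_i-\frac{j}{p-1}\rangle)}{\Gamma_p(\langle a_i\rangle)}\frac{\Gamma_p(\langle -b_i+\frac{j}{p-1}\rangle)}{\Gamma_p(\langle -b_i\rangle)}(-p)^{ -\lfloor\langle a_i\rangle-\frac{j}{p-1}\rfloor-\lfloor\langle -b_i\rangle+\frac{j}{p-1}\rfloor}.$$ -}

module Defs where

open import Data.Bool using (Bool; true; false; if_then_else_)
open import Data.Nat as ℕ using (ℕ; zero; suc; _≡ᵇ_)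
import Data.Nat.DivMod as ℕD
open import Data.Integer as ℤ using (ℤ; +_; -[1+_]; ∣_∣)
import Data.Integer.DivMod as ℤD
open import Data.Rational as ℚ using (ℚ; ↥_; ↧ₙ_; floor)
open import Data.List as L using (List; []; _∷_; upTo; map; zipWith; foldr; length)
open import Data.Nat.ListAction using (sum)
open import Data.Bool.ListAction using (any)
open import Relation.Nullary.Decidable using (does)
open import Data.Nat.Divisibility using (_∣?_)

-- Modular reduction helpers (modulus 0 is a junk case, never used).

modN : ℕ → ℕ → ℕ
modN x zero    = 0
modN x (suc m) = ℕD._%_ x (suc m)

modZ : ℤ → ℕ → ℕ
modZ x zero    = 0
modZ x (suc m) = ℤD._%ℕ_ x (suc m)

sumℤ : List ℤ → ℤ
sumℤ = foldr ℤ._+_ (+ 0)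

prodℤ : List ℤ → ℤ
prodℤ = foldr ℤ._*_ (+ 1)

-- Elliptic curve y^2 = x^3 + a x + b over F_p  (a, b given by naturals,
-- read modulo p).

affineCount : ℕ → ℕ → ℕ → ℕ
affineCount p a b =
  sum (map (λ x → sum (map (λ y →
     if modN (y ℕ.* y) p ≡ᵇ modN (x ℕ.* x ℕ.* x ℕ.+ a ℕ.* x ℕ.+ b) p
     then 1 else 0) (upTo p))) (upTo p))

-- #E(F_p): projective points, including the point at infinity
#E : ℕ → ℕ → ℕ → ℕ
#E p a b = suc (affineCount p a b)

aₚ : ℕ → ℕ → ℕ → ℤ
aₚ p a b = + (suc p) ℤ.- + (#E p a b)

-- inverse in F_p (Fermat), as a representative in [0,p)
invFp : ℕ → ℕ → ℕ
invFp p x = modN (x ℕ.^ (p ℕ.∸ 2)) p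

-- 4a^3 + 27b^2 mod p (nonzero iff the curve is nonsingular)
discE : ℕ → ℕ → ℕ → ℕ
discE p a b = modN (4 ℕ.* (a ℕ.^ 3) ℕ.+ 27 ℕ.* (b ℕ.^ 2)) p

jInv : ℕ → ℕ → ℕ → ℕ
jInv p a b = modN (1728 ℕ.* 4 ℕ.* (a ℕ.^ 3) ℕ.* invFp p (discE p a b)) p

legendre : ℕ → ℕ → ℤ
legendre p b =
  if modN b p ≡ᵇ 0 then + 0
  else if any (λ x → modN (x ℕ.* x) p ≡ᵇ modN b p) (upTo p) then + 1
  else -[1+ 0 ]

tArg : ℕ → ℕ → ℕ → ℕ
tArg p a b =
  modN ((p ℕ.∸ modN (27 ℕ.* b ℕ.* b) p) ℕ.* invFp p (modN (4 ℕ.* (a ℕ.^ 3)) p)) p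

-- p-adic quantities, described by their residues modulo p^k.
-- An element z of Z_p is determined by the family (z mod p^k)_k; all
-- definitions below give an integer congruent modulo p^k to the p-adic
-- quantity named (for p an odd prime).

Γₚℕ : ℕ → ℕ → ℤ
Γₚℕ p n =
  (-[1+ 0 ] ℤ.^ n) ℤ.*
  prodℤ (map (λ j → if does (p ∣? j) then + 1 else + j)
             (L.drop 1 (upTo n)))

-- Euler's φ(p^k) for p prime, k ≥ 1
φpk : ℕ → ℕ → ℕ
φpk p k = p ℕ.^ (k ℕ.∸ 1) ℕ.* (p ℕ.∸ 1)

-- inverse modulo p^k of a p-adic unit u (Euler)
invMod : ℕ → ℕ → ℤ → ℤ
invMod p k u = + modZ (u ℤ.^ (φpk p k ℕ.∸ 1)) (p ℕ.^ k)

-- the natural number in [0,p^k) congruent modulo p^k to a rational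
-- x ∈ Q ∩ Z_p (denominator prime to p)
ratRep : ℕ → ℕ → ℚ → ℕ
ratRep p k x =
  modN (modZ (↥ x) (p ℕ.^ k) ℕ.* modN ((↧ₙ x) ℕ.^ (φpk p k ℕ.∸ 1)) (p ℕ.^ k))
       (p ℕ.^ k)

-- Γ_p(x) modulo p^k for x ∈ Q ∩ Z_p:  Γ_p(x) ≡ Γ_p(n) (mod p^k) whenever
-- n ≡ x (mod p^k), by continuity of Γ_p (|Γ_p(x)-Γ_p(y)| ≤ |x-y|, p odd).
Γₚ : ℕ → ℕ → ℚ → ℤ
Γₚ p k x = Γₚℕ p (ratRep p k x)

-- Teichmüller character modulo p^k: ω(t) ≡ t^(p^(k-1)) (mod p^k)
ωₖ : ℕ → ℕ → ℕ → ℤ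
ωₖ p k t = + modN (t ℕ.^ (p ℕ.^ (k ℕ.∸ 1))) (p ℕ.^ k)

-- ω̄^j(t) modulo p^k, with ω̄^j(0) = 0 for all j (including j = 0)
ω̄^ : ℕ → ℕ → ℕ → ℕ → ℤ
ω̄^ p k j t =
  if modN t p ≡ᵇ 0 then + 0 else (ωₖ p k (invFp p (modN t p)) ℤ.^ j)

⟨_⟩ : ℚ → ℚ
⟨ x ⟩ = x ℚ.- (floor x ℚ./ 1)

-- j / m as a rational (m = p - 1 > 0 in use; m = 0 is junk)
_over_ : ℕ → ℕ → ℚ
j over zero    = ℚ.0ℚ
j over (suc m) = (+ j) ℚ./ suc m

-- The finite field hypergeometric function nGn[a;b|t]_p.
--
-- G-scaled p k as bs t  ≡  (-p)^n · (-(p-1)) · nGn[as;bs|t]_p   (mod p^k),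
-- where n = length as (= length bs).  Multiplying by (-p)^n makes every
-- power of (-p) nonnegative (each exponent is ≥ -n), so the sum lies in Z_p;
-- the factor -(p-1) clears the prefactor -1/(p-1).

Gfactor : ℕ → ℕ → ℕ → ℚ → ℚ → ℤ
Gfactor p k j a b =
  Γₚ p k ⟨ a ℚ.- (j over (p ℕ.∸ 1)) ⟩ ℤ.* invMod p k (Γₚ p k ⟨ a ⟩) ℤ.*
  (Γₚ p k ⟨ ℚ.- b ℚ.+ (j over (p ℕ.∸ 1)) ⟩ ℤ.* invMod p k (Γₚ p k ⟨ ℚ.- b ⟩))

Gexp : ℕ → ℕ → ℚ → ℚ → ℤ
Gexp p j a b =
  ℤ.- floor (⟨ a ⟩ ℚ.- (j over (p ℕ.∸ 1)))
  ℤ.- floor (⟨ ℚ.- b ⟩ ℚ.+ (j over (p ℕ.∸ 1)))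

Gscaled : ℕ → ℕ → List ℚ → List ℚ → ℕ → ℤ
Gscaled p k as bs t =
  sumℤ (map (λ j →
      (-[1+ 0 ] ℤ.^ (j ℕ.* n)) ℤ.* ω̄^ p k j t ℤ.*
      prodℤ (zipWith (Gfactor p k j) as bs) ℤ.*
      ((ℤ.- (+ p)) ℤ.^ ∣ + n ℤ.+ sumℤ (zipWith (Gexp p j) as bs) ∣))
    (upTo (p ℕ.∸ 1)))
  where
  n = length as

{-# OPTIONS --safe #-}
module Submission where

-- Let Dwork's series be exp(t + tᵖ/p) = Σ cₙ tⁿ. By the functional equation of Γₚ its coefficients
-- c_{a+pk} are, up to powers of -p, the Newton coefficients of k ↦ Γₚ(-a-pk), and these are p-adically
-- small; summation by parts then gives the Gross–Koblitz formula
--   (1-p) Σₙ (-p)ⁿ c_{a+(p-1)n} = Γₚ(a/(p-1))   (0 ≤ a < p-1).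
-- If ϖᵖ⁻¹ = -p, then ψ(u) = exp(u t + u tᵖ/p) at t = ϖ is an additive character of 𝔽ₚ on Teichmüller
-- representatives u, and its ϖ-components are these values of Γₚ. Comparing the components of
-- ϖ^((p-1)/2) in ψ(x³) ψ(a x) ψ(b) = ψ(x³ + a x + b) expresses φ(x³ + a x + b) through triple products of
-- Γₚ-values. Summing over x keeps, by orthogonality, one free index j; the duplication,
-- triplication and reflection formulas for Γₚ turn the j-th summand into the j-th term of ₂G₂.

open import Defs
open import Algebra.Bundles using (CommutativeRing)
import Algebra.Solver.Ring as RingSolver
open import Algebra.Solver.Ring.AlmostCommutativeRing using (fromCommutativeRing; _-Raw-AlmostCommutative⟶_)
open import Algebra.Structures using (IsCommutativeRing)
open import Data.Bool using (Bool; true; false; if_then_else_)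
import Data.Bool as Bool
open import Data.Bool.ListAction using (any)
open import Data.Empty using (⊥; ⊥-elim)
open import Data.Integer as ℤ using (ℤ; +_; -[1+_]; ∣_∣)
open import Data.Integer using () renaming (+_ to pos)
open import Data.Integer.Divisibility using (_∣_)
open import Data.Integer.Divisibility.Signed using (divides; ∣ᵤ⇒∣; ∣⇒∣ᵤ) renaming (_∣_ to _∣ℤ_)
import Data.Integer.DivMod as ℤM
import Data.Integer.Properties as ℤP
open import Data.Integer.Tactic.RingSolver using (solve-∀)
open import Data.List using ([]; _∷_; upTo; applyUpTo; map; zipWith)
open import Data.Maybe using (Maybe; just; nothing)
open import Data.Nat as ℕ using (ℕ; zero; suc; _<_; _>_; _≤_; z≤n; s≤s; NonZero; _≡ᵇ_; ⌈_/2⌉)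
import Data.Nat.Coprimality as Coprime
import Data.Nat.Divisibility as ℕD
import Data.Nat.DivMod as ℕM
open import Data.Nat.Induction using (<-rec)
open import Data.Nat.ListAction using (sum)
open import Data.Nat.Primality using (Prime; euclidsLemma; prime⇒irreducible)
import Data.Nat.Properties as ℕP
open import Data.Nat.Tactic.RingSolver using () renaming (solve-∀ to solveℕ-∀)
open import Data.Product using (_×_; _,_; proj₁; proj₂; ∃-syntax)
open import Data.Rational as ℚ using (ℚ; mkℚ; floor; toℚᵘ)
import Data.Rational.Properties as ℚP
open import Data.Rational.Unnormalised using (mkℚᵘ; *≡*; _≃_)
import Data.Rational.Unnormalised.Properties as ℚᵘP
import Data.Sum as Sum
open import Data.Sum using (_⊎_; inj₁; inj₂; [_,_]′)
open import Data.Unit using (tt)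
open import Function using (_∘_; case_of_; id)
open import Level using (0ℓ)
open import Relation.Binary.Bundles using (Setoid)
open import Relation.Binary.PropositionalEquality hiding (setoid; J)
open import Relation.Nullary using (yes; no; ¬_; Dec; does)
open import Relation.Nullary.Decidable using (dec-true; dec-false)

-- Neither a p-adic field nor its extension by ϖ is constructed. All p-adic statements are
-- congruences modulo p^K for a fixed K; a power series is its sequence of coefficients, and
-- "evaluate at ϖ and take a coordinate" is a linear functional on such sequences. Every convergent
-- sum is cut off, and the lengths in multiples of K are the points from which the tail vanishes
-- modulo p^K. Convergence at ϖ is the obstacle: the recursion n cₙ = cₙ₋₁ + cₙ₋ₚ divides by n and
-- shows no bound on denominators. The bound comes from the gamma side, where Wilson's theorem makes
-- every finite difference gain half a factor p, while n! has at most n/4 of them because p ≥ 5.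
-- Teichmüller representatives add up only modulo p. The defect is absorbed by a factor exp(σxt -
-- x′tᵖ) with σ = -p, which is 1 at t = ϖ because ϖᵖ = σϖ. Two boundary terms stay outside the
-- pattern: x = 0, which has no unit representative, and the j = 0 term of ₂G₂, which is too large
-- by a factor p. They cancel in the last step.

module FiniteSums where

  -- Sums and finite differences in a commutative ring.

  record ℤ-Algebra : Set₁ where
    infixl 6 _+_
    infixl 7 _*_
    infix 8 -_
    field
      Carrier : Set
      _+_ _*_ : Carrier → Carrier → Carrier
      -_ : Carrier → Carrier
      0# 1# : Carrier
      isCommutativeRing : IsCommutativeRing _≡_ _+_ _*_ -_ 0# 1#
      ι : ℤ → Carrier
      ι-+ : ∀ x y → ι (x ℤ.+ y) ≡ ι x + ι y
      ι-* : ∀ x y → ι (x ℤ.* y) ≡ ι x * ι y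
      ι-neg : ∀ x → ι (ℤ.- x) ≡ - ι x
      ι-0 : ι (+ 0) ≡ 0#
      ι-1 : ι (+ 1) ≡ 1#

  integers : ℤ-Algebra
  integers = record
    { isCommutativeRing = ℤP.+-*-isCommutativeRing
    ; ι = λ x → x
    ; ι-+ = λ _ _ → refl ; ι-* = λ _ _ → refl ; ι-neg = λ _ → refl
    ; ι-0 = refl ; ι-1 = refl
    }

  module Algebraic (A : ℤ-Algebra) where

    open ℤ-Algebra A public
    open IsCommutativeRing isCommutativeRing public
      using (+-identityˡ; +-identityʳ; *-identityˡ; *-identityʳ; +-assoc; +-comm; *-assoc; *-comm; zeroˡ; zeroʳ; distribˡ; distribʳ; -‿inverseˡ; -‿inverseʳ)

    commutativeRing : CommutativeRing 0ℓ 0ℓ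
    commutativeRing = record { isCommutativeRing = isCommutativeRing }

    private
      morphism : CommutativeRing.rawRing ℤP.+-*-commutativeRing -Raw-AlmostCommutative⟶ fromCommutativeRing commutativeRing
      morphism = record
        { ⟦_⟧ = ι ; +-homo = ι-+ ; *-homo = ι-* ; -‿homo = ι-neg ; 0-homo = ι-0 ; 1-homo = ι-1 }

      decide : ∀ x y → Maybe (ι x ≡ ι y)
      decide x y with x ℤP.≟ y
      ... | yes e = just (cong ι e)
      ... | no _ = nothing

    module Solver = RingSolver (CommutativeRing.rawRing ℤP.+-*-commutativeRing) (fromCommutativeRing commutativeRing) morphism
      decide

    open Solver

    infixl 6 _-_
    _-_ : Carrier → Carrier → Carrier
    x - y = x + - y

    infixr 8 _^_
    _^_ : Carrier → ℕ → Carrier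
    x ^ zero = 1#
    x ^ suc n = x * x ^ n

    n̂ : ℕ → Carrier
    n̂ n = ι (+ n)

    n̂-suc : ∀ n → n̂ (suc n) ≡ 1# + n̂ n
    n̂-suc n = trans (ι-+ (+ 1) (+ n)) (cong (_+ n̂ n) ι-1)

    n̂-+ : ∀ m n → n̂ (m ℕ.+ n) ≡ n̂ m + n̂ n
    n̂-+ m n = ι-+ (+ m) (+ n)

    n̂-* : ∀ m n → n̂ (m ℕ.* n) ≡ n̂ m * n̂ n
    n̂-* m n = trans (cong ι (ℤP.pos-* m n)) (ι-* (+ m) (+ n))

    ^-+ : ∀ x m n → x ^ (m ℕ.+ n) ≡ x ^ m * x ^ n
    ^-+ x zero n = sym (*-identityˡ _)
    ^-+ x (suc m) n = trans (cong (x *_) (^-+ x m n)) (sym (*-assoc _ _ _))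

    *-^ : ∀ x y n → (x * y) ^ n ≡ x ^ n * y ^ n
    *-^ x y zero = sym (*-identityˡ _)
    *-^ x y (suc n) = trans (cong (x * y *_) (*-^ x y n))
      (solve 4 (λ x y z w → x :* y :* (z :* w) := x :* z :* (y :* w)) refl x y (x ^ n) (y ^ n))

    1^ : ∀ n → 1# ^ n ≡ 1#
    1^ zero = refl
    1^ (suc n) = trans (*-identityˡ _) (1^ n)

    Σ : ℕ → (ℕ → Carrier) → Carrier
    Σ zero f = 0#
    Σ (suc n) f = Σ n f + f n

    Σ-cong< : ∀ n {f g} → (∀ i → i < n → f i ≡ g i) → Σ n f ≡ Σ n g
    Σ-cong< zero e = refl
    Σ-cong< (suc n) e = cong₂ _+_ (Σ-cong< n (λ i l → e i (ℕP.m<n⇒m<1+n l))) (e n (ℕP.n<1+n n))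

    Σ-cong : ∀ n {f g} → (∀ i → f i ≡ g i) → Σ n f ≡ Σ n g
    Σ-cong n e = Σ-cong< n (λ i _ → e i)

    Σ-zero : ∀ n {f} → (∀ i → i < n → f i ≡ 0#) → Σ n f ≡ 0#
    Σ-zero zero e = refl
    Σ-zero (suc n) e = trans (cong₂ _+_ (Σ-zero n (λ i l → e i (ℕP.m<n⇒m<1+n l))) (e n (ℕP.n<1+n n))) (+-identityˡ _)

    Σ-+ : ∀ n f g → Σ n (λ i → f i + g i) ≡ Σ n f + Σ n g
    Σ-+ zero f g = sym (+-identityˡ _)
    Σ-+ (suc n) f g = trans (cong (_+ (f n + g n)) (Σ-+ n f g))
      (solve 4 (λ a b c d → a :+ b :+ (c :+ d) := a :+ c :+ (b :+ d)) refl _ _ _ _)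

    Σ-*ˡ : ∀ n c f → c * Σ n f ≡ Σ n (λ i → c * f i)
    Σ-*ˡ zero c f = zeroʳ c
    Σ-*ˡ (suc n) c f = trans (distribˡ c _ _) (cong (_+ c * f n) (Σ-*ˡ n c f))

    Σ-*ʳ : ∀ n c f → Σ n f * c ≡ Σ n (λ i → f i * c)
    Σ-*ʳ n c f = trans (*-comm _ _) (trans (Σ-*ˡ n c f) (Σ-cong n (λ i → *-comm _ _)))

    Σ-neg : ∀ n f → Σ n (λ i → - f i) ≡ - Σ n f
    Σ-neg zero f = trans (sym (-‿inverseˡ 0#)) (+-identityʳ _)
    Σ-neg (suc n) f = trans (cong (_+ - f n) (Σ-neg n f)) (solve 2 (λ a b → :- a :+ :- b := :- (a :+ b)) refl _ _)

    Σ-swap : ∀ n m (f : ℕ → ℕ → Carrier) → Σ n (λ i → Σ m (f i)) ≡ Σ m (λ j → Σ n (λ i → f i j))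
    Σ-swap zero m f = sym (Σ-zero m (λ _ _ → refl))
    Σ-swap (suc n) m f = trans (cong (_+ Σ m (f n)) (Σ-swap n m f)) (sym (Σ-+ m _ _))

    Σ-front : ∀ n f → Σ (suc n) f ≡ f 0 + Σ n (f ∘ suc)
    Σ-front zero f = trans (+-identityˡ _) (sym (+-identityʳ _))
    Σ-front (suc n) f = trans (cong (_+ f (suc n)) (Σ-front n f)) (+-assoc _ _ _)

    Σ-split : ∀ m n f → Σ (m ℕ.+ n) f ≡ Σ m f + Σ n (λ i → f (m ℕ.+ i))
    Σ-split m zero f = trans (cong (λ k → Σ k f) (ℕP.+-identityʳ m)) (sym (+-identityʳ _))
    Σ-split m (suc n) f = trans (cong (λ k → Σ k f) (ℕP.+-suc m n))
      (trans (cong (_+ f (m ℕ.+ n)) (Σ-split m n f)) (+-assoc _ _ _))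

    Σ-blocks : ∀ L n f → Σ (L ℕ.* n) f ≡ Σ L (λ k → Σ n (λ i → f (k ℕ.* n ℕ.+ i)))
    Σ-blocks zero n f = refl
    Σ-blocks (suc L) n f = trans (cong (λ k → Σ k f) (ℕP.+-comm n (L ℕ.* n)))
      (trans (Σ-split (L ℕ.* n) n f) (cong (_+ Σ n (λ i → f (L ℕ.* n ℕ.+ i))) (Σ-blocks L n f)))

    Σ-single : ∀ n j f → j < n → (∀ i → i < n → i ≢ j → f i ≡ 0#) → Σ n f ≡ f j
    Σ-single (suc n) j f j<n z with j ℕ.≟ n
    ... | yes refl = trans (cong (_+ f j) (Σ-zero n (λ i l → z i (ℕP.m<n⇒m<1+n l) (λ { refl → ℕP.<-irrefl refl l })))) (+-identityˡ _)
    ... | no j≢n = trans (cong₂ _+_ (Σ-single n j f (ℕP.≤∧≢⇒< (ℕP.≤-pred j<n) j≢n) (λ i l → z i (ℕP.m<n⇒m<1+n l))) (z n (ℕP.n<1+n n) (λ e → j≢n (sym e)))) (+-identityʳ _)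

    Σ-reverse : ∀ n f → Σ n f ≡ Σ n (λ i → f (n ℕ.∸ suc i))
    Σ-reverse zero f = refl
    Σ-reverse (suc n) f = sym (trans (Σ-front n (λ i → f (n ℕ.∸ i))) (trans (+-comm _ _) (cong (_+ f n) (sym (Σ-reverse n f)))))

    Σ-closed : ∀ {ℓ} (P : Carrier → Set ℓ) → P 0# → (∀ {x y} → P x → P y → P (x + y)) →
      ∀ n {f} → (∀ i → i < n → P (f i)) → P (Σ n f)
    Σ-closed P z a zero h = z
    Σ-closed P z a (suc n) h = a (Σ-closed P z a n (λ i l → h i (ℕP.m<n⇒m<1+n l))) (h n (ℕP.n<1+n n))

    Δ : (ℕ → Carrier) → ℕ → Carrier
    Δ f k = f (suc k) - f k

    Δ^ : ℕ → (ℕ → Carrier) → ℕ → Carrier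
    Δ^ zero f = f
    Δ^ (suc n) f = Δ^ n (Δ f)

    Δ^-suc : ∀ n f k → Δ^ (suc n) f k ≡ Δ^ n f (suc k) - Δ^ n f k
    Δ^-suc zero f k = refl
    Δ^-suc (suc n) f k = Δ^-suc n (Δ f) k

    Δ^-cong : ∀ n {f g} → (∀ k → f k ≡ g k) → ∀ k → Δ^ n f k ≡ Δ^ n g k
    Δ^-cong zero e k = e k
    Δ^-cong (suc n) e k = Δ^-cong n (λ j → cong₂ _-_ (e (suc j)) (e j)) k

    Δ^-+ : ∀ n f g k → Δ^ n (λ j → f j + g j) k ≡ Δ^ n f k + Δ^ n g k
    Δ^-+ zero f g k = refl
    Δ^-+ (suc n) f g k = trans (Δ^-cong n (λ j → solve 4 (λ a b c d → a :+ b :+ :- (c :+ d) := a :+ :- c :+ (b :+ :- d)) refl _ _ _ _) k) (Δ^-+ n (Δ f) (Δ g) k)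

    Δ^-* : ∀ n c f k → Δ^ n (λ j → c * f j) k ≡ c * Δ^ n f k
    Δ^-* zero c f k = refl
    Δ^-* (suc n) c f k = trans (Δ^-cong n (λ j → solve 3 (λ a b c → c :* a :+ :- (c :* b) := c :* (a :+ :- b)) refl _ _ _) k) (Δ^-* n c (Δ f) k)

    -- The second difference of the sequence j ↦ j is zero, so the Leibniz rule has just two terms.
    -- At k = 0 it produces the recursion of the Newton coefficients in `H̃-step`.
    Δ^-leibniz : ∀ n f k → Δ^ (suc n) (λ j → n̂ j * f j) k ≡ n̂ k * Δ^ (suc n) f k + n̂ (suc n) * Δ^ n f (suc k)
    Δ^-leibniz zero f k rewrite n̂-suc k | ι-1 =
      solve 4 (λ o k a b → (o :+ k) :* a :+ :- (k :* b) := k :* (a :+ :- b) :+ o :* a) refl 1# (n̂ k) (f (suc k)) (f k)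
    Δ^-leibniz (suc n) f k = begin
      Δ^ (suc (suc n)) (λ j → n̂ j * f j) k
        ≡⟨ Δ^-suc (suc n) _ k ⟩
      Δ^ (suc n) (λ j → n̂ j * f j) (suc k) - Δ^ (suc n) (λ j → n̂ j * f j) k
        ≡⟨ cong₂ _-_ (Δ^-leibniz n f (suc k)) (Δ^-leibniz n f k) ⟩
      (n̂ (suc k) * Δ^ (suc n) f (suc k) + n̂ (suc n) * Δ^ n f (suc (suc k))) - (n̂ k * a + n̂ (suc n) * Δ^ n f (suc k))
        ≡⟨ cong (λ z → (n̂ (suc k) * b + n̂ (suc n) * z) - (n̂ k * a + n̂ (suc n) * Δ^ n f (suc k))) e₁ ⟩
      (n̂ (suc k) * b + n̂ (suc n) * (b + c)) - (n̂ k * a + n̂ (suc n) * c)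
        ≡⟨ cong₂ (λ x y → (x * b + y * (b + c)) - (n̂ k * a + y * c)) (n̂-suc k) refl ⟩
      ((1# + n̂ k) * b + n̂ (suc n) * (b + c)) - (n̂ k * a + n̂ (suc n) * c)
        ≡⟨ solve 6 (λ o k n a b c → ((o :+ k) :* b :+ n :* (b :+ c)) :+ :- (k :* a :+ n :* c) := k :* (b :+ :- a) :+ (o :+ n) :* b) refl 1# (n̂ k) (n̂ (suc n)) a b c ⟩
      n̂ k * (b - a) + (1# + n̂ (suc n)) * b
        ≡⟨ cong₂ (λ x y → n̂ k * x + y * b) (sym (Δ^-suc (suc n) f k)) (sym (n̂-suc (suc n))) ⟩
      n̂ k * Δ^ (suc (suc n)) f k + n̂ (suc (suc n)) * b ∎
      where
      open ≡-Reasoning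
      a = Δ^ (suc n) f k
      b = Δ^ (suc n) f (suc k)
      c = Δ^ n f (suc k)
      e₁ : Δ^ n f (suc (suc k)) ≡ b + c
      e₁ = trans (solve 2 (λ x y → x := x :+ :- y :+ y) refl _ c) (cong (_+ c) (sym (Δ^-suc n f (suc k))))

    n! : ℕ → Carrier
    n! zero = 1#
    n! (suc n) = n̂ (suc n) * n! n

    -- The two claims feed each other: the Leibniz rule for j · jⁿ needs both at n, and a constant
    -- has difference zero. They replace root counting over the field of p elements: `wilson` and
    -- `non-root` both rest on them.
    Δ^-pow-top : ∀ n k → Δ^ n (λ j → n̂ j ^ n) k ≡ n! n
    Δ^-pow-above : ∀ n k → Δ^ (suc n) (λ j → n̂ j ^ n) k ≡ 0#
    Δ^-pow-top zero k = refl
    Δ^-pow-top (suc n) k = trans (Δ^-leibniz n _ k) (trans (cong₂ (λ x y → n̂ k * x + n̂ (suc n) * y) (Δ^-pow-above n k) (Δ^-pow-top n (suc k)))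
      (trans (cong (_+ n̂ (suc n) * n! n) (zeroʳ _)) (+-identityˡ _)))
    Δ^-pow-above n k = trans (Δ^-suc n _ k) (trans (cong₂ _-_ (Δ^-pow-top n (suc k)) (Δ^-pow-top n k)) (-‿inverseʳ _))

    Δ^-pow-vanish : ∀ m d k → Δ^ (suc (m ℕ.+ d)) (λ j → n̂ j ^ m) k ≡ 0#
    Δ^-pow-vanish m zero k rewrite ℕP.+-identityʳ m = Δ^-pow-above m k
    Δ^-pow-vanish m (suc d) k rewrite ℕP.+-suc m d = trans (Δ^-suc (suc (m ℕ.+ d)) _ k) (trans (cong₂ _-_ (Δ^-pow-vanish m d (suc k)) (Δ^-pow-vanish m d k)) (-‿inverseʳ 0#))

-- Newton expansions, and exponential series as coefficient sequences.

module ExponentialSequences where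

  open FiniteSums

  -- `recip n` inverts n + 1, so zero never has to be excluded. Injectivity of `ι` is what lets a
  -- divisibility found in the algebra be read back in ℤ, see `V-recover`.
  record ℚ-Algebra : Set₁ where
    field
      algebra : ℤ-Algebra
    open ℤ-Algebra algebra
    field
      recip : ℕ → Carrier
      recip-inverse : ∀ n → ι (pos (suc n)) * recip n ≡ 1#
      ι-injective : ∀ {x y} → ι x ≡ ι y → x ≡ y

  -- The falling factorial is taken at integers because the summation by parts evaluates it at k₀ -
  -- n with n beyond k₀ as well.
  fall : ℤ → ℕ → ℤ
  fall x zero = pos 1
  fall x (suc s) = fall x s ℤ.* (x ℤ.- pos s)

  fall-front : ∀ x s → fall x (suc s) ≡ x ℤ.* fall (x ℤ.- pos 1) s
  fall-front x zero = lemma x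
    where
    lemma : ∀ x → pos 1 ℤ.* (x ℤ.- pos 0) ≡ x ℤ.* pos 1
    lemma = solve-∀
  fall-front x (suc s) = trans (cong (ℤ._* (x ℤ.- pos (suc s))) (fall-front x s)) (lemma x (fall (x ℤ.- pos 1) s) (pos s))
    where
    lemma : ∀ x f s → x ℤ.* f ℤ.* (x ℤ.- (pos 1 ℤ.+ s)) ≡ x ℤ.* (f ℤ.* (x ℤ.- pos 1 ℤ.- s))
    lemma = solve-∀

  fall-suc : ∀ k s → fall (pos (suc k)) (suc s) ≡ fall (pos k) (suc s) ℤ.+ pos (suc s) ℤ.* fall (pos k) s
  fall-suc k s = trans (fall-front (pos (suc k)) s) (lemma (pos k) (fall (pos k) s) (pos s))
    where
    lemma : ∀ k f s → (pos 1 ℤ.+ k) ℤ.* f ≡ f ℤ.* (k ℤ.- s) ℤ.+ (pos 1 ℤ.+ s) ℤ.* f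
    lemma = solve-∀

  fall-0 : ∀ s → fall (pos 0) (suc s) ≡ pos 0
  fall-0 s = trans (fall-front (pos 0) s) (ℤP.*-zeroˡ (fall (pos 0 ℤ.- pos 1) s))

  module Rational (F : ℚ-Algebra) where

    open ℚ-Algebra F public using (recip; recip-inverse; ι-injective)
    open Algebraic (ℚ-Algebra.algebra F) public
    open Solver
    open ≡-Reasoning

    cancel-suc : ∀ n {x y} → n̂ (suc n) * x ≡ n̂ (suc n) * y → x ≡ y
    cancel-suc n {x} {y} e = trans (lemma x) (trans (cong (recip n *_) e) (sym (lemma y)))
      where
      lemma : ∀ z → z ≡ recip n * (n̂ (suc n) * z)
      lemma z = sym (trans (sym (*-assoc _ _ _)) (trans (cong (_* z) (trans (*-comm _ _) (recip-inverse n))) (*-identityˡ z)))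

    recip! : ℕ → Carrier
    recip! zero = 1#
    recip! (suc n) = recip n * recip! n

    n!-recip! : ∀ n → n! n * recip! n ≡ 1#
    n!-recip! zero = *-identityˡ 1#
    n!-recip! (suc n) = trans (solve 4 (λ a b c d → a :* b :* (c :* d) := (a :* c) :* (b :* d)) refl _ _ _ _)
      (trans (cong₂ _*_ (recip-inverse n) (n!-recip! n)) (*-identityˡ 1#))

    suc-recip! : ∀ n → n̂ (suc n) * recip! (suc n) ≡ recip! n
    suc-recip! n = trans (sym (*-assoc _ _ _)) (trans (cong (_* recip! n) (recip-inverse n)) (*-identityˡ _))

    -- Coefficients with respect to falling factorials instead of binomials: s! is divided out, and
    -- it is these quotients that obey the recursion of Dwork's series.
    newtonCoeff : (ℕ → Carrier) → ℕ → Carrier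
    newtonCoeff f s = Δ^ s f 0 * recip! s

    newtonCoeff-Δ : ∀ f s → newtonCoeff (Δ f) s ≡ n̂ (suc s) * newtonCoeff f (suc s)
    newtonCoeff-Δ f s = trans (cong (Δ^ (suc s) f 0 *_) (sym (suc-recip! s)))
      (solve 3 (λ a b c → a :* (b :* c) := b :* (a :* c)) refl _ _ _)

    -- Induction on k through f (k + 1) = f k + Δ f k; the two expansions merge by `fall-suc`. The
    -- falling factorial of k vanishes beyond s = k, so any length M > k serves, and the truncations
    -- later choose it freely.
    newton : ∀ k f M → k < M → f k ≡ Σ M (λ s → ι (fall (pos k) s) * newtonCoeff f s)
    newton zero f (suc M) _ = sym (begin
      Σ (suc M) (λ s → ι (fall (pos 0) s) * newtonCoeff f s)
        ≡⟨ Σ-front M _ ⟩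
      ι (pos 1) * (f 0 * 1#) + Σ M (λ s → ι (fall (pos 0) (suc s)) * newtonCoeff f (suc s))
        ≡⟨ cong₂ _+_ (trans (cong₂ _*_ ι-1 (*-identityʳ _)) (*-identityˡ _)) (Σ-zero M (λ s _ → trans (cong (_* newtonCoeff f (suc s)) (trans (cong ι (fall-0 s)) ι-0)) (zeroˡ _))) ⟩
      f 0 + 0# ≡⟨ +-identityʳ _ ⟩
      f 0 ∎)
    newton (suc k) f (suc M) (s≤s k<M) = begin
      f (suc k) ≡⟨ solve 2 (λ a b → a := b :+ (a :+ :- b)) refl (f (suc k)) (f k) ⟩
      f k + Δ f k ≡⟨ cong₂ _+_ (newton k f (suc M) (ℕP.m<n⇒m<1+n k<M)) (newton k (Δ f) M k<M) ⟩
      Σ (suc M) t + Σ M (λ s → ι (fall (pos k) s) * newtonCoeff (Δ f) s)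
        ≡⟨ cong₂ _+_ (Σ-front M t) refl ⟩
      t 0 + Σ M (t ∘ suc) + Σ M (λ s → ι (fall (pos k) s) * newtonCoeff (Δ f) s)
        ≡⟨ trans (+-assoc _ _ _) (cong (_+_ (t 0)) (sym (Σ-+ M _ _))) ⟩
      t 0 + Σ M (λ s → t (suc s) + ι (fall (pos k) s) * newtonCoeff (Δ f) s)
        ≡⟨ cong (_+_ (t 0)) (Σ-cong M step) ⟩
      t 0 + Σ M (λ s → ι (fall (pos (suc k)) (suc s)) * newtonCoeff f (suc s))
        ≡⟨ sym (Σ-front M _) ⟩
      Σ (suc M) (λ s → ι (fall (pos (suc k)) s) * newtonCoeff f s) ∎
      where
      t : ℕ → Carrier
      t s = ι (fall (pos k) s) * newtonCoeff f s
      step : ∀ s → t (suc s) + ι (fall (pos k) s) * newtonCoeff (Δ f) s ≡ ι (fall (pos (suc k)) (suc s)) * newtonCoeff f (suc s)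
      step s = begin
        t (suc s) + ι (fall (pos k) s) * newtonCoeff (Δ f) s ≡⟨ cong (λ z → t (suc s) + ι (fall (pos k) s) * z) (newtonCoeff-Δ f s) ⟩
        t (suc s) + ι (fall (pos k) s) * (n̂ (suc s) * newtonCoeff f (suc s))
          ≡⟨ solve 4 (λ a b c d → a :* d :+ b :* (c :* d) := (a :+ c :* b) :* d) refl _ _ _ _ ⟩
        (ι (fall (pos k) (suc s)) + n̂ (suc s) * ι (fall (pos k) s)) * newtonCoeff f (suc s)
          ≡⟨ cong (_* newtonCoeff f (suc s)) (sym (trans (cong ι (fall-suc k s)) (trans (ι-+ _ _) (cong (_+_ (ι (fall (pos k) (suc s)))) (ι-* _ _))))) ⟩
        ι (fall (pos (suc k)) (suc s)) * newtonCoeff f (suc s) ∎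

    -- The Cauchy product, by recursion on the index of the first factor, so that shifts and the
    -- Leibniz rule follow by induction without subtracting indices.
    conv : (ℕ → Carrier) → (ℕ → Carrier) → ℕ → Carrier
    conv f g zero = f 0 * g 0
    conv f g (suc n) = f 0 * g (suc n) + conv (f ∘ suc) g n

    -- Multiplication of a series by t; accordingly `sh^ k` is multiplication by the k-th power of
    -- t.
    sh : (ℕ → Carrier) → ℕ → Carrier
    sh f zero = 0#
    sh f (suc n) = f n

    sh^ : ℕ → (ℕ → Carrier) → ℕ → Carrier
    sh^ zero f = f
    sh^ (suc k) f = sh (sh^ k f)

    sh-cong : ∀ {f g} → (∀ n → f n ≡ g n) → ∀ n → sh f n ≡ sh g n
    sh-cong e zero = refl
    sh-cong e (suc n) = e n

    sh^-agree : ∀ k {f g} n → (∀ m → m ≤ n → f m ≡ g m) → sh^ k f n ≡ sh^ k g n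
    sh^-agree zero n e = e n ℕP.≤-refl
    sh^-agree (suc k) zero e = refl
    sh^-agree (suc k) (suc n) e = sh^-agree k n (λ m l → e m (ℕP.m≤n⇒m≤1+n l))

    conv-cong : ∀ {f f′ g g′} → (∀ n → f n ≡ f′ n) → (∀ n → g n ≡ g′ n) → ∀ n → conv f g n ≡ conv f′ g′ n
    conv-cong e e′ zero = cong₂ _*_ (e 0) (e′ 0)
    conv-cong e e′ (suc n) = cong₂ _+_ (cong₂ _*_ (e 0) (e′ (suc n))) (conv-cong (λ j → e (suc j)) e′ n)

    conv-linˡ : ∀ a b f f′ g n → conv (λ i → a * f i + b * f′ i) g n ≡ a * conv f g n + b * conv f′ g n
    conv-linˡ a b f f′ g zero = solve 5 (λ a b x y z → (a :* x :+ b :* y) :* z := a :* (x :* z) :+ b :* (y :* z)) refl a b (f 0) (f′ 0) (g 0)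
    conv-linˡ a b f f′ g (suc n) = trans (cong (_+_ ((a * f 0 + b * f′ 0) * g (suc n))) (conv-linˡ a b (f ∘ suc) (f′ ∘ suc) g n))
      (solve 7 (λ a b x y z u v → (a :* x :+ b :* y) :* z :+ (a :* u :+ b :* v) := a :* (x :* z :+ u) :+ b :* (y :* z :+ v)) refl a b (f 0) (f′ 0) (g (suc n)) _ _)

    conv-linʳ : ∀ a b f g g′ n → conv f (λ i → a * g i + b * g′ i) n ≡ a * conv f g n + b * conv f g′ n
    conv-linʳ a b f g g′ zero = solve 5 (λ a b x y z → z :* (a :* x :+ b :* y) := a :* (z :* x) :+ b :* (z :* y)) refl a b (g 0) (g′ 0) (f 0)
    conv-linʳ a b f g g′ (suc n) = trans (cong (_+_ (f 0 * (a * g (suc n) + b * g′ (suc n)))) (conv-linʳ a b (f ∘ suc) g g′ n))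
      (solve 7 (λ a b x y z u v → z :* (a :* x :+ b :* y) :+ (a :* u :+ b :* v) := a :* (z :* x :+ u) :+ b :* (z :* y :+ v)) refl a b (g (suc n)) (g′ (suc n)) (f 0) _ _)

    conv-shˡ : ∀ f g n → conv (sh f) g n ≡ sh (conv f g) n
    conv-shˡ f g zero = zeroˡ _
    conv-shˡ f g (suc n) = trans (cong (_+ conv f g n) (zeroˡ _)) (+-identityˡ _)

    conv-shʳ : ∀ f g n → conv f (sh g) n ≡ sh (conv f g) n
    conv-shʳ f g zero = zeroʳ _
    conv-shʳ f g (suc zero) = trans (cong (_+_ (f 0 * g 0)) (zeroʳ _)) (+-identityʳ _)
    conv-shʳ f g (suc (suc n)) = cong (_+_ (f 0 * g (suc n))) (conv-shʳ (f ∘ suc) g (suc n))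

    conv-sh^ˡ : ∀ k f g n → conv (sh^ k f) g n ≡ sh^ k (conv f g) n
    conv-sh^ˡ zero f g n = refl
    conv-sh^ˡ (suc k) f g n = trans (conv-shˡ (sh^ k f) g n) (sh-cong (conv-sh^ˡ k f g) n)

    conv-sh^ʳ : ∀ k f g n → conv f (sh^ k g) n ≡ sh^ k (conv f g) n
    conv-sh^ʳ zero f g n = refl
    conv-sh^ʳ (suc k) f g n = trans (conv-shʳ f (sh^ k g) n) (sh-cong (conv-sh^ʳ k f g) n)

    -- The operator t d/dt. It preserves the degree, so a differential equation becomes one
    -- recursion per index.
    θ : (ℕ → Carrier) → ℕ → Carrier
    θ f n = n̂ n * f n

    θ-leibniz : ∀ f g n → θ (conv f g) n ≡ conv (θ f) g n + conv f (θ g) n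
    θ-leibniz f g zero rewrite ι-0 = trans (zeroˡ _) (sym (trans (cong₂ _+_ (trans (cong (_* g 0) (zeroˡ _)) (zeroˡ _)) (trans (cong (f 0 *_) (zeroˡ _)) (zeroʳ _))) (+-identityˡ _)))
    θ-leibniz f g (suc n) = begin
      n̂ (suc n) * (f 0 * g (suc n) + c)
        ≡⟨ cong (λ z → z * (f 0 * g (suc n) + c)) (n̂-suc n) ⟩
      (1# + n̂ n) * (f 0 * g (suc n) + c)
        ≡⟨ solve 5 (λ o n f g c → (o :+ n) :* (f :* g :+ c) := (f :* ((o :+ n) :* g)) :+ (o :* c :+ n :* c)) refl 1# (n̂ n) (f 0) (g (suc n)) c ⟩
      f 0 * ((1# + n̂ n) * g (suc n)) + (1# * c + n̂ n * c)
        ≡⟨ cong₂ (λ x y → f 0 * (x * g (suc n)) + (1# * c + y)) (sym (n̂-suc n)) (θ-leibniz (f ∘ suc) g n) ⟩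
      f 0 * θ g (suc n) + (1# * c + (conv (θ (f ∘ suc)) g n + conv (f ∘ suc) (θ g) n))
        ≡⟨ solve 4 (λ a b c d → a :+ (b :+ (c :+ d)) := (b :+ c) :+ (a :+ d)) refl _ _ _ _ ⟩
      (1# * c + conv (θ (f ∘ suc)) g n) + (f 0 * θ g (suc n) + conv (f ∘ suc) (θ g) n)
        ≡⟨ cong (_+ (f 0 * θ g (suc n) + conv (f ∘ suc) (θ g) n)) e ⟩
      (θ f 0 * g (suc n) + conv (θ f ∘ suc) g n) + (f 0 * θ g (suc n) + conv (f ∘ suc) (θ g) n) ∎
      where
      c = conv (f ∘ suc) g n
      e₁ : ∀ i → θ f (suc i) ≡ 1# * f (suc i) + 1# * θ (f ∘ suc) i
      e₁ i = trans (cong (_* f (suc i)) (n̂-suc i)) (trans (distribʳ _ _ _) (cong (_+_ (1# * f (suc i))) (sym (*-identityˡ _))))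
      e : 1# * c + conv (θ (f ∘ suc)) g n ≡ θ f 0 * g (suc n) + conv (θ f ∘ suc) g n
      e = begin
        1# * c + conv (θ (f ∘ suc)) g n ≡⟨ cong (_+_ (1# * c)) (sym (*-identityˡ _)) ⟩
        1# * c + 1# * conv (θ (f ∘ suc)) g n ≡⟨ sym (conv-linˡ 1# 1# (f ∘ suc) (θ (f ∘ suc)) g n) ⟩
        conv (λ i → 1# * f (suc i) + 1# * θ (f ∘ suc) i) g n ≡⟨ conv-cong (λ i → sym (e₁ i)) (λ _ → refl) n ⟩
        conv (θ f ∘ suc) g n ≡⟨ sym (+-identityˡ _) ⟩
        0# + conv (θ f ∘ suc) g n ≡⟨ cong (_+ conv (θ f ∘ suc) g n) (sym (trans (cong (λ z → z * f 0 * g (suc n)) ι-0) (trans (cong (_* g (suc n)) (zeroˡ _)) (zeroˡ _)))) ⟩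
        θ f 0 * g (suc n) + conv (θ f ∘ suc) g n ∎

    -- X is a linear functional applied to a product of series. Grouping by the index of the first
    -- factor gives the triangle n + m < B, whence the inner length B ∸ n.
    Σ-conv : ∀ B (X f g : ℕ → Carrier) →
      Σ B (λ N → X N * conv f g N) ≡ Σ B (λ n → Σ (B ℕ.∸ n) (λ m → f n * X (n ℕ.+ m) * g m))
    Σ-conv zero X f g = refl
    Σ-conv (suc B) X f g = begin
      Σ (suc B) (λ N → X N * conv f g N)
        ≡⟨ Σ-front B _ ⟩
      X 0 * (f 0 * g 0) + Σ B (λ N → X (suc N) * (f 0 * g (suc N) + conv (f ∘ suc) g N))
        ≡⟨ cong₂ _+_ (solve 3 (λ x f g → x :* (f :* g) := f :* x :* g) refl _ _ _)
             (trans (Σ-cong B (λ N → solve 4 (λ x f g c → x :* (f :* g :+ c) := f :* x :* g :+ x :* c) refl _ _ _ _)) (Σ-+ B _ _)) ⟩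
      f 0 * X 0 * g 0 + (Σ B (λ N → f 0 * X (suc N) * g (suc N)) + Σ B (λ N → X (suc N) * conv (f ∘ suc) g N))
        ≡⟨ sym (+-assoc _ _ _) ⟩
      f 0 * X 0 * g 0 + Σ B (λ N → f 0 * X (suc N) * g (suc N)) + Σ B (λ N → X (suc N) * conv (f ∘ suc) g N)
        ≡⟨ cong₂ _+_ (sym (Σ-front B (λ m → f 0 * X m * g m))) (Σ-conv B (X ∘ suc) (f ∘ suc) g) ⟩
      Σ (suc B) (λ m → f 0 * X m * g m) + Σ B (λ n → Σ (B ℕ.∸ n) (λ m → f (suc n) * X (suc n ℕ.+ m) * g m))
        ≡⟨ sym (Σ-front B _) ⟩
      Σ (suc B) (λ n → Σ (suc B ℕ.∸ n) (λ m → f n * X (n ℕ.+ m) * g m)) ∎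

    -- The coefficient sequence of the power series exp(s t + q tᵖ/p).
    record IsExp (p : ℕ) (s q : Carrier) (y : ℕ → Carrier) : Set where
      field
        start : y 0 ≡ 1#
        step : ∀ n → θ y n ≡ s * sh y n + q * sh^ p y n

    open IsExp public

    -- The derivation `θ` turns the product into a sum and both shifts move out of `conv`, so the
    -- two differential equations add: exponents add under multiplication.
    IsExp-conv : ∀ {p s q y s′ q′ y′} → IsExp p s q y → IsExp p s′ q′ y′ → IsExp p (s + s′) (q + q′) (conv y y′)
    IsExp-conv {p} {s} {q} {y} {s′} {q′} {y′} P P′ = record
      { start = trans (cong₂ _*_ (start P) (start P′)) (*-identityˡ 1#)
      ; step = λ n → begin
          θ (conv y y′) n
            ≡⟨ θ-leibniz y y′ n ⟩
          conv (θ y) y′ n + conv y (θ y′) n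
            ≡⟨ cong₂ _+_ (conv-cong (step P) (λ _ → refl) n) (conv-cong (λ _ → refl) (step P′) n) ⟩
          conv (λ i → s * sh y i + q * sh^ p y i) y′ n + conv y (λ i → s′ * sh y′ i + q′ * sh^ p y′ i) n
            ≡⟨ cong₂ _+_ (conv-linˡ s q (sh y) (sh^ p y) y′ n) (conv-linʳ s′ q′ y (sh y′) (sh^ p y′) n) ⟩
          s * conv (sh y) y′ n + q * conv (sh^ p y) y′ n + (s′ * conv y (sh y′) n + q′ * conv y (sh^ p y′) n)
            ≡⟨ cong₂ _+_ (cong₂ (λ a b → s * a + q * b) (conv-shˡ y y′ n) (conv-sh^ˡ p y y′ n))
                         (cong₂ (λ a b → s′ * a + q′ * b) (conv-shʳ y y′ n) (conv-sh^ʳ p y y′ n)) ⟩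
          s * sh c n + q * sh^ p c n + (s′ * sh c n + q′ * sh^ p c n)
            ≡⟨ solve 6 (λ s q s′ q′ a b → s :* a :+ q :* b :+ (s′ :* a :+ q′ :* b) := (s :+ s′) :* a :+ (q :+ q′) :* b) refl s q s′ q′ _ _ ⟩
          (s + s′) * sh c n + (q + q′) * sh^ p c n ∎
      }
      where c = conv y y′

    -- The equation at n + 1 expresses (n + 1) y (n + 1) by earlier entries; the exponent `suc p`
    -- ensures that the second shift also looks strictly back. This turns an identity between
    -- exponents into one between series, without composing series.
    IsExp-unique : ∀ {p s q y y′} → IsExp (suc p) s q y → IsExp (suc p) s q y′ → ∀ n → y n ≡ y′ n
    IsExp-unique {p} {s} {q} {y} {y′} P P′ = <-rec _ go
      where
      go : ∀ n → (∀ {m} → m < n → y m ≡ y′ m) → y n ≡ y′ n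
      go zero _ = trans (start P) (sym (start P′))
      go (suc n) ih = cancel-suc n (trans (step P (suc n)) (trans
        (cong₂ (λ a b → s * a + q * b) (ih (ℕP.n<1+n n)) (sh^-agree p n (λ m l → ih (s≤s l))))
        (sym (step P′ (suc n)))))

-- Congruences, and the theorems of Fermat and Wilson.

module Congruences where

  open FiniteSums

  module ℤ-Alg = Algebraic integers
  open ℤ-Alg using (Σ; Δ; Δ^)

  ^≡ : ∀ x n → x ℤ-Alg.^ n ≡ x ℤ.^ n
  ^≡ x zero = refl
  ^≡ x (suc n) = cong (x ℤ.*_) (^≡ x n)

  pos-^ : ∀ m n → + (m ℕ.^ n) ≡ (+ m) ℤ.^ n
  pos-^ m zero = refl
  pos-^ m (suc n) = trans (ℤP.pos-* m (m ℕ.^ n)) (cong ((+ m) ℤ.*_) (pos-^ m n))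

  module Congruence (m : ℤ) where

    infix 4 _≈_
    -- The quotient is kept as data because the correction term x′ in `additiveℤ` is computed from
    -- the quotients of the congruences uᵖ ≡ u.
    record _≈_ (x y : ℤ) : Set where
      constructor by
      field
        quotient : ℤ
        equation : x ≡ y ℤ.+ quotient ℤ.* m

    ≡⇒≈ : ∀ {x y} → x ≡ y → x ≈ y
    ≡⇒≈ {x} refl = by (+ 0) (lemma x m)
      where
      lemma : ∀ x m → x ≡ x ℤ.+ + 0 ℤ.* m
      lemma = solve-∀

    ≈-refl : ∀ {x} → x ≈ x
    ≈-refl = ≡⇒≈ refl

    ≈-sym : ∀ {x y} → x ≈ y → y ≈ x
    ≈-sym {x} {y} (by q refl) = by (ℤ.- q) (lemma y q m)
      where
      lemma : ∀ y q m → y ≡ y ℤ.+ q ℤ.* m ℤ.+ ℤ.- q ℤ.* m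
      lemma = solve-∀

    ≈-trans : ∀ {x y z} → x ≈ y → y ≈ z → x ≈ z
    ≈-trans {z = z} (by q refl) (by r refl) = by (q ℤ.+ r) (lemma z q r m)
      where
      lemma : ∀ z q r m → z ℤ.+ r ℤ.* m ℤ.+ q ℤ.* m ≡ z ℤ.+ (q ℤ.+ r) ℤ.* m
      lemma = solve-∀

    +-cong : ∀ {x y u v} → x ≈ y → u ≈ v → x ℤ.+ u ≈ y ℤ.+ v
    +-cong {y = y} {v = v} (by q refl) (by r refl) = by (q ℤ.+ r) (lemma y v q r m)
      where
      lemma : ∀ y v q r m → y ℤ.+ q ℤ.* m ℤ.+ (v ℤ.+ r ℤ.* m) ≡ y ℤ.+ v ℤ.+ (q ℤ.+ r) ℤ.* m
      lemma = solve-∀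

    *-cong : ∀ {x y u v} → x ≈ y → u ≈ v → x ℤ.* u ≈ y ℤ.* v
    *-cong {y = y} {v = v} (by q refl) (by r refl) = by (q ℤ.* v ℤ.+ r ℤ.* y ℤ.+ q ℤ.* r ℤ.* m) (lemma y v q r m)
      where
      lemma : ∀ y v q r m → (y ℤ.+ q ℤ.* m) ℤ.* (v ℤ.+ r ℤ.* m) ≡ y ℤ.* v ℤ.+ (q ℤ.* v ℤ.+ r ℤ.* y ℤ.+ q ℤ.* r ℤ.* m) ℤ.* m
      lemma = solve-∀

    neg-cong : ∀ {x y} → x ≈ y → ℤ.- x ≈ ℤ.- y
    neg-cong {y = y} (by q refl) = by (ℤ.- q) (lemma y q m)
      where
      lemma : ∀ y q m → ℤ.- (y ℤ.+ q ℤ.* m) ≡ ℤ.- y ℤ.+ ℤ.- q ℤ.* m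
      lemma = solve-∀

    *-congˡ : ∀ c {x y} → x ≈ y → c ℤ.* x ≈ c ℤ.* y
    *-congˡ c = *-cong (≈-refl {c})

    *-congʳ : ∀ c {x y} → x ≈ y → x ℤ.* c ≈ y ℤ.* c
    *-congʳ c e = *-cong e (≈-refl {c})

    ^-cong : ∀ n {x y} → x ≈ y → x ℤ.^ n ≈ y ℤ.^ n
    ^-cong zero e = ≈-refl
    ^-cong (suc n) e = *-cong e (^-cong n e)

    ^-≈1 : ∀ n {x} → x ≈ + 1 → x ℤ.^ n ≈ + 1
    ^-≈1 n e = ≈-trans (^-cong n e) (≡⇒≈ (ℤP.^-zeroˡ n))

    Σ-cong≈ : ∀ n {f g} → (∀ i → i < n → f i ≈ g i) → Σ n f ≈ Σ n g
    Σ-cong≈ zero e = ≈-refl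
    Σ-cong≈ (suc n) e = +-cong (Σ-cong≈ n (λ i l → e i (ℕP.m<n⇒m<1+n l))) (e n (ℕP.n<1+n n))

    modulus≈0 : m ≈ + 0
    modulus≈0 = by (+ 1) (lemma m)
      where
      lemma : ∀ m → m ≡ + 0 ℤ.+ + 1 ℤ.* m
      lemma = solve-∀

    multiple≈0 : ∀ x → x ℤ.* m ≈ + 0
    multiple≈0 x = by x (lemma x m)
      where
      lemma : ∀ x m → x ℤ.* m ≡ + 0 ℤ.+ x ℤ.* m
      lemma = solve-∀

    -≈0⇒≈ : ∀ {x y} → x ℤ.- y ≈ + 0 → x ≈ y
    -≈0⇒≈ {x} {y} (by q e) = by q (trans (lemma x y) (trans (cong (λ w → y ℤ.+ w) e) (cong (λ w → y ℤ.+ w) (ℤP.+-identityˡ _))))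
      where
      lemma : ∀ x y → x ≡ y ℤ.+ (x ℤ.- y)
      lemma = solve-∀

    ≈⇒-≈0 : ∀ {x y} → x ≈ y → x ℤ.- y ≈ + 0
    ≈⇒-≈0 {x} {y} e = ≈-trans (+-cong e ≈-refl) (≡⇒≈ (ℤP.+-inverseʳ y))

    ≈0⇒∣ : ∀ {x} → x ≈ + 0 → m ∣ℤ x
    ≈0⇒∣ (by q e) = divides q (trans e (ℤP.+-identityˡ _))

    ∣⇒≈0 : ∀ {x} → m ∣ℤ x → x ≈ + 0
    ∣⇒≈0 (divides q e) = by q (trans e (sym (ℤP.+-identityˡ _)))

    setoid : Setoid _ _
    setoid = record
      { Carrier = ℤ ; _≈_ = _≈_
      ; isEquivalence = record { refl = ≈-refl ; sym = ≈-sym ; trans = ≈-trans }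
      }

  bin : ℕ → ℕ → ℕ
  bin n zero = 1
  bin zero (suc k) = 0
  bin (suc n) (suc k) = bin n k ℕ.+ bin n (suc k)

  -- For n + 1 = p this shows the factor p in k + 1 times a binomial coefficient; `bin-prime` then
  -- cancels the unit k + 1.
  bin-absorb : ∀ n k → suc k ℕ.* bin (suc n) (suc k) ≡ suc n ℕ.* bin n k
  bin-absorb zero zero = refl
  bin-absorb zero (suc k) = ℕP.*-zeroʳ (suc (suc k))
  bin-absorb (suc n) zero = begin
    1 ℕ.* (1 ℕ.+ bin (suc n) 1) ≡⟨ lemma (bin (suc n) 1) ⟩
    1 ℕ.+ 1 ℕ.* bin (suc n) 1 ≡⟨ cong (1 ℕ.+_) (bin-absorb n zero) ⟩
    1 ℕ.+ suc n ℕ.* 1 ∎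
    where
    open ≡-Reasoning
    lemma : ∀ x → 1 ℕ.* (1 ℕ.+ x) ≡ 1 ℕ.+ 1 ℕ.* x
    lemma = solveℕ-∀
  bin-absorb (suc n) (suc k) = begin
    suc (suc k) ℕ.* (bin (suc n) (suc k) ℕ.+ bin (suc n) (suc (suc k)))
      ≡⟨ l₁ k (bin (suc n) (suc k)) (bin (suc n) (suc (suc k))) ⟩
    suc k ℕ.* bin (suc n) (suc k) ℕ.+ bin (suc n) (suc k) ℕ.+ suc (suc k) ℕ.* bin (suc n) (suc (suc k))
      ≡⟨ cong₂ (λ x y → x ℕ.+ bin (suc n) (suc k) ℕ.+ y) (bin-absorb n k) (bin-absorb n (suc k)) ⟩
    suc n ℕ.* bin n k ℕ.+ (bin n k ℕ.+ bin n (suc k)) ℕ.+ suc n ℕ.* bin n (suc k)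
      ≡⟨ l₂ n (bin n k) (bin n (suc k)) ⟩
    suc (suc n) ℕ.* (bin n k ℕ.+ bin n (suc k)) ∎
    where
    open ≡-Reasoning
    l₁ : ∀ k x y → suc (suc k) ℕ.* (x ℕ.+ y) ≡ suc k ℕ.* x ℕ.+ x ℕ.+ suc (suc k) ℕ.* y
    l₁ = solveℕ-∀
    l₂ : ∀ n x y → suc n ℕ.* x ℕ.+ (x ℕ.+ y) ℕ.+ suc n ℕ.* y ≡ suc (suc n) ℕ.* (x ℕ.+ y)
    l₂ = solveℕ-∀

  bin-above : ∀ n d → bin n (suc (n ℕ.+ d)) ≡ 0
  bin-above zero d = refl
  bin-above (suc n) d = cong₂ ℕ._+_ (bin-above n d) (trans (cong (bin n) (cong suc (sym (ℕP.+-suc n d)))) (bin-above n (suc d)))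

  bin-diagonal : ∀ n → bin n n ≡ 1
  bin-diagonal zero = refl
  bin-diagonal (suc n) = cong₂ ℕ._+_ (bin-diagonal n) (trans (cong (λ z → bin n (suc z)) (sym (ℕP.+-identityʳ n))) (bin-above n 0))

  binomial : ∀ n x M → n < M → (+ 1 ℤ.+ x) ℤ.^ n ≡ Σ M (λ k → + bin n k ℤ.* x ℤ.^ k)
  binomial zero x (suc M) _ = sym (trans (ℤ-Alg.Σ-front M (λ k → + bin 0 k ℤ.* x ℤ.^ k))
    (trans (cong (λ z → + 1 ℤ.* + 1 ℤ.+ z) (ℤ-Alg.Σ-zero M (λ k _ → ℤP.*-zeroˡ (x ℤ.^ suc k)))) refl))
  binomial (suc n) x (suc M) (s≤s n<M) = begin
    (+ 1 ℤ.+ x) ℤ.* (+ 1 ℤ.+ x) ℤ.^ n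
      ≡⟨ ℤP.*-distribʳ-+ ((+ 1 ℤ.+ x) ℤ.^ n) (+ 1) x ⟩
    + 1 ℤ.* (+ 1 ℤ.+ x) ℤ.^ n ℤ.+ x ℤ.* (+ 1 ℤ.+ x) ℤ.^ n
      ≡⟨ cong₂ (λ a b → a ℤ.+ x ℤ.* b) (trans (ℤP.*-identityˡ _) (binomial n x (suc M) (ℕP.m<n⇒m<1+n n<M))) (binomial n x M n<M) ⟩
    Σ (suc M) t ℤ.+ x ℤ.* Σ M t
      ≡⟨ cong₂ ℤ._+_ (ℤ-Alg.Σ-front M t) (ℤ-Alg.Σ-*ˡ M x t) ⟩
    t 0 ℤ.+ Σ M (t ∘ suc) ℤ.+ Σ M (λ k → x ℤ.* t k)
      ≡⟨ trans (ℤP.+-assoc (t 0) (Σ M (t ∘ suc)) (Σ M (λ k → x ℤ.* t k))) (cong (λ z → t 0 ℤ.+ z) (sym (ℤ-Alg.Σ-+ M (t ∘ suc) (λ k → x ℤ.* t k)))) ⟩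
    t 0 ℤ.+ Σ M (λ k → t (suc k) ℤ.+ x ℤ.* t k)
      ≡⟨ cong (λ z → t 0 ℤ.+ z) (ℤ-Alg.Σ-cong M (λ k → trans (lemma (+ bin n k) (+ bin n (suc k)) x (x ℤ.^ k)) (cong (ℤ._* x ℤ.^ suc k) (sym (ℤP.pos-+ (bin n k) (bin n (suc k))))))) ⟩
    t 0 ℤ.+ Σ M (λ k → + bin (suc n) (suc k) ℤ.* x ℤ.^ suc k)
      ≡⟨ sym (ℤ-Alg.Σ-front M (λ k → + bin (suc n) k ℤ.* x ℤ.^ k)) ⟩
    Σ (suc M) (λ k → + bin (suc n) k ℤ.* x ℤ.^ k) ∎
    where
    open ≡-Reasoning
    t : ℕ → ℤ
    t k = + bin n k ℤ.* x ℤ.^ k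
    lemma : ∀ b b′ x y → b′ ℤ.* (x ℤ.* y) ℤ.+ x ℤ.* (b ℤ.* y) ≡ (b ℤ.+ b′) ℤ.* (x ℤ.* y)
    lemma = solve-∀

  -- Throughout, p = suc e is a prime with e = h + h ≥ 4.
  record OddPrime (e h : ℕ) : Set where
    field
      prime : Prime (suc e)
      e≡h+h : e ≡ h ℕ.+ h
      4≤e : 4 ≤ e

  module PrimeModulus {e h : ℕ} (P : OddPrime e h) where

    open OddPrime P public

    p : ℕ
    p = suc e

    open Congruence (+ p) public

    ∣ℕ⇒≈0 : ∀ {n} → p ℕD.∣ n → + n ≈ + 0
    ∣ℕ⇒≈0 {n} d = ∣⇒≈0 (∣ᵤ⇒∣ d)

    ≈0⇒∣ℕ : ∀ {x} → x ≈ + 0 → p ℕD.∣ ∣ x ∣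
    ≈0⇒∣ℕ e = ∣⇒∣ᵤ (≈0⇒∣ e)

    Unit : ℤ → Set
    Unit x = ¬ (x ≈ + 0)

    ≈0? : ∀ x → Dec (x ≈ + 0)
    ≈0? x with p ℕD.∣? ∣ x ∣
    ... | yes d = yes (∣⇒≈0 (∣ᵤ⇒∣ d))
    ... | no n = no (λ e → n (≈0⇒∣ℕ e))

    integral : ∀ x y → x ℤ.* y ≈ + 0 → x ≈ + 0 ⊎ y ≈ + 0
    integral x y e with euclidsLemma ∣ x ∣ ∣ y ∣ prime (subst (p ℕD.∣_) (ℤP.abs-* x y) (≈0⇒∣ℕ e))
    ... | inj₁ d = inj₁ (∣⇒≈0 (∣ᵤ⇒∣ d))
    ... | inj₂ d = inj₂ (∣⇒≈0 (∣ᵤ⇒∣ d))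

    Unit-* : ∀ {x y} → Unit x → Unit y → Unit (x ℤ.* y)
    Unit-* {x} {y} ux uy e = [ ux , uy ]′ (integral x y e)

    Unit-*ˡ : ∀ {x} y → Unit (x ℤ.* y) → Unit x
    Unit-*ˡ y u e = u (≈-trans (*-congʳ y e) (≡⇒≈ (ℤP.*-zeroˡ y)))

    Unit-cong : ∀ {x y} → x ≈ y → Unit x → Unit y
    Unit-cong e u f = u (≈-trans e f)

    Unit-small : ∀ n → 0 < n → n < p → Unit (+ n)
    Unit-small (suc n) _ n<p e = ℕD.>⇒∤ n<p (≈0⇒∣ℕ e)

    Unit-1 : Unit (+ 1)
    Unit-1 = Unit-small 1 (s≤s z≤n) (s≤s (ℕP.≤-trans (s≤s z≤n) 4≤e))

    Unit-^ : ∀ n {x} → Unit x → Unit (x ℤ.^ n)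
    Unit-^ zero u = Unit-1
    Unit-^ (suc n) u = Unit-* u (Unit-^ n u)

    Unit-neg : ∀ {x} → Unit x → Unit (ℤ.- x)
    Unit-neg {x} u e = u (≈-trans (≡⇒≈ (sym (ℤP.neg-involutive x))) (neg-cong e))

    cancelˡ : ∀ c {x y} → Unit c → c ℤ.* x ≈ c ℤ.* y → x ≈ y
    cancelˡ c {x} {y} u e = [ ⊥-elim ∘ u , -≈0⇒≈ ]′ (integral c (x ℤ.- y) (≈-trans (≡⇒≈ (lemma c x y)) (≈⇒-≈0 e)))
      where
      lemma : ∀ c x y → c ℤ.* (x ℤ.- y) ≡ c ℤ.* x ℤ.- c ℤ.* y
      lemma = solve-∀

    bin-prime : ∀ k → k < e → + bin p (suc k) ≈ + 0
    bin-prime k k<e = cancelˡ (+ suc k) (Unit-small (suc k) (s≤s z≤n) (s≤s k<e))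
      (≈-trans (≡⇒≈ (trans (sym (ℤP.pos-* (suc k) (bin p (suc k)))) (cong +_ (bin-absorb e k))))
      (≈-trans (≡⇒≈ (trans (cong +_ (ℕP.*-comm p (bin e k))) (ℤP.pos-* (bin e k) p)))
      (≈-trans (multiple≈0 (+ bin e k)) (≡⇒≈ (sym (ℤP.*-zeroʳ (+ suc k)))))))

    frobenius : ∀ x → (+ 1 ℤ.+ x) ℤ.^ p ≈ + 1 ℤ.+ x ℤ.^ p
    frobenius x = begin
      (+ 1 ℤ.+ x) ℤ.^ p ≡⟨ binomial p x (suc p) ℕP.≤-refl ⟩
      Σ (suc p) t ≡⟨ ℤ-Alg.Σ-front p t ⟩
      + 1 ℤ.+ (Σ e (t ∘ suc) ℤ.+ t p)
        ≈⟨ +-cong (≈-refl {+ 1}) (+-cong (≈-trans (Σ-cong≈ e (λ k l → ≈-trans (*-congʳ (x ℤ.^ suc k) (bin-prime k l)) (≡⇒≈ (ℤP.*-zeroˡ (x ℤ.^ suc k))))) (≡⇒≈ (ℤ-Alg.Σ-zero e {λ _ → + 0} (λ _ _ → refl)))) (≡⇒≈ (trans (cong (λ z → + z ℤ.* x ℤ.^ p) (bin-diagonal p)) (ℤP.*-identityˡ (x ℤ.^ p))))) ⟩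
      + 1 ℤ.+ (+ 0 ℤ.+ x ℤ.^ p) ≡⟨ cong (λ z → + 1 ℤ.+ z) (ℤP.+-identityˡ (x ℤ.^ p)) ⟩
      + 1 ℤ.+ x ℤ.^ p ∎
      where
      open import Relation.Binary.Reasoning.Setoid setoid
      t : ℕ → ℤ
      t k = + bin p k ℤ.* x ℤ.^ k

    fermatℕ : ∀ n → (+ n) ℤ.^ p ≈ + n
    fermatℕ zero = ≡⇒≈ refl
    fermatℕ (suc n) = ≈-trans (frobenius (+ n)) (+-cong (≈-refl {+ 1}) (fermatℕ n))

    residue : ∀ x → ∃[ n ] (n < p × x ≈ + n)
    residue x = x %ℕ p , n%ℕd<d x p , by (x /ℕ p) (a≡a%ℕn+[a/ℕn]*n x p)
      where open import Data.Integer.DivMod using (_%ℕ_; _/ℕ_; a≡a%ℕn+[a/ℕn]*n; n%ℕd<d)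

    fermat : ∀ x → x ℤ.^ p ≈ x
    fermat x with residue x
    ... | n , _ , r = ≈-trans (^-cong p r) (≈-trans (fermatℕ n) (≈-sym r))

    fermat-unit : ∀ x → Unit x → x ℤ.^ e ≈ + 1
    fermat-unit x u = cancelˡ x u (≈-trans (fermat x) (≡⇒≈ (sym (ℤP.*-identityʳ x))))

    distinct : ∀ {x y} → x < p → y < p → + x ≈ + y → x ≡ y
    distinct {x} {y} lx ly r = case ℕP.≤-total x y of λ
      { (inj₁ x≤y) → sym (go x≤y ly (≈-sym r)) ; (inj₂ y≤x) → go y≤x lx r }
      where
      go : ∀ {x y} → y ≤ x → x < p → + x ≈ + y → x ≡ y
      go {x} {y} y≤x lx r with x ℕ.∸ y in eq
      ... | zero = ℕP.≤-antisym (ℕP.m∸n≡0⇒m≤n eq) y≤x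
      ... | suc d = ⊥-elim (Unit-small (x ℕ.∸ y) (subst (0 <_) (sym eq) (s≤s z≤n)) (ℕP.≤-<-trans (ℕP.m∸n≤m x y) lx)
            (≈-trans (≡⇒≈ (trans (sym (ℤP.⊖-≥ y≤x)) (sym (ℤP.m-n≡m⊖n x y)))) (≈⇒-≈0 r)))

    -- The n-th difference at k sees only the values on [k, k + n]. In the applications Fermat's
    -- theorem controls f exactly on 0, ..., p - 1.
    Δ^-cong≈ : ∀ n k {f g} → (∀ j → j ≤ k ℕ.+ n → f j ≈ g j) → Δ^ n f k ≈ Δ^ n g k
    Δ^-cong≈ zero k h = h k (ℕP.≤-reflexive (sym (ℕP.+-identityʳ k)))
    Δ^-cong≈ (suc n) k {f} {g} h = Δ^-cong≈ n k (λ j l → +-cong (h (suc j) (subst (suc j ≤_) (sym (ℕP.+-suc k n)) (s≤s l)))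
      (neg-cong (h j (ℕP.≤-trans l (ℕP.+-monoʳ-≤ k (ℕP.n≤1+n n))))))

    private
      indicator : ℕ → ℤ
      indicator zero = + 1
      indicator (suc _) = + 0

      nonzero : ℕ → ℤ
      nonzero zero = + 0
      nonzero (suc _) = + 1

      Δ-nonzero : ∀ k → Δ nonzero k ≡ indicator k
      Δ-nonzero zero = refl
      Δ-nonzero (suc k) = refl

      Δ-indicator : ∀ k → Δ indicator k ≡ ℤ.- (+ 1) ℤ.* indicator k
      Δ-indicator zero = refl
      Δ-indicator (suc k) = refl

      Δ^-indicator : ∀ n → Δ^ n indicator 0 ≡ (ℤ.- (+ 1)) ℤ.^ n
      Δ^-indicator zero = refl
      Δ^-indicator (suc n) = trans (ℤ-Alg.Δ^-cong n Δ-indicator 0) (trans (ℤ-Alg.Δ^-* n (ℤ.- (+ 1)) indicator 0) (cong (ℤ.- (+ 1) ℤ.*_) (Δ^-indicator n)))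

      -- A power function that is 0, 1, 1, … on residues has top difference (-1)ᵖ⁻².
      top-difference : ∀ f → f 0 ≈ + 0 → (∀ j → j < e → f (suc j) ≈ + 1) → ∀ m → e ≡ suc m → Δ^ e f 0 ≈ (ℤ.- (+ 1)) ℤ.^ m
      top-difference f z o m refl = ≈-trans (Δ^-cong≈ e 0 {f} {nonzero} agree) (≡⇒≈ (trans (ℤ-Alg.Δ^-cong m Δ-nonzero 0) (Δ^-indicator m)))
        where
        agree : ∀ j → j ≤ e → f j ≈ nonzero j
        agree zero _ = z
        agree (suc j) l = o j l

    -1^2n : ∀ n → (ℤ.- (+ 1)) ℤ.^ (n ℕ.+ n) ≡ + 1
    -1^2n zero = refl
    -1^2n (suc n) = trans (cong (λ z → (ℤ.- (+ 1)) ℤ.^ suc z) (ℕP.+-suc n n)) (trans (sym (ℤP.*-assoc (ℤ.- (+ 1)) (ℤ.- (+ 1)) ((ℤ.- (+ 1)) ℤ.^ (n ℕ.+ n)))) (trans (ℤP.*-identityˡ _) (-1^2n n)))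

    -- The e-th difference of jᵉ at 0 is e!. Modulo p the values are 0, 1, ..., 1 by Fermat, and the
    -- e-th difference of that sequence is (-1)^(e-1), which is -1 since e is even.
    wilson : ℤ-Alg.n! e ≈ ℤ.- (+ 1)
    wilson = go e refl
      where
      fe : ∀ j → j < e → (+ suc j) ℤ-Alg.^ e ≈ + 1
      fe j l = ≈-trans (≡⇒≈ (^≡ (+ suc j) e)) (fermat-unit (+ suc j) (Unit-small (suc j) (s≤s z≤n) (s≤s l)))
      0^ : ∀ m → (+ 0) ℤ-Alg.^ suc m ≡ + 0
      0^ m = ℤP.*-zeroˡ ((+ 0) ℤ-Alg.^ m)
      go : ∀ n → e ≡ n → ℤ-Alg.n! e ≈ ℤ.- (+ 1)
      go zero e≡0 = case subst (4 ≤_) e≡0 4≤e of λ ()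
      go (suc m) e≡ = begin
        ℤ-Alg.n! e ≡⟨ sym (ℤ-Alg.Δ^-pow-top e 0) ⟩
        Δ^ e (λ j → (+ j) ℤ-Alg.^ e) 0 ≈⟨ top-difference _ (≡⇒≈ (trans (cong ((+ 0) ℤ-Alg.^_) e≡) (0^ m))) fe m e≡ ⟩
        (ℤ.- (+ 1)) ℤ.^ m ≡⟨ lemma ((ℤ.- (+ 1)) ℤ.^ m) ⟩
        ℤ.- (ℤ.- (+ 1) ℤ.* (ℤ.- (+ 1)) ℤ.^ m) ≡⟨ cong ℤ.-_ (trans (cong ((ℤ.- (+ 1)) ℤ.^_) (trans (sym e≡) e≡h+h)) (-1^2n h)) ⟩
        ℤ.- (+ 1) ∎
        where
        open import Relation.Binary.Reasoning.Setoid setoid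
        lemma : ∀ x → x ≡ ℤ.- (ℤ.- (+ 1) ℤ.* x)
        lemma = solve-∀

    -- If every nonzero residue had c-th power 1, the e-th difference of jᶜ at 0 would be ±1 modulo
    -- p, yet it is 0 because c < e. This takes the place of a primitive root in the orthogonality
    -- of characters.
    non-root : ∀ c → 0 < c → c < e → ∃[ u ] (0 < u × u < p × ¬ ((+ u) ℤ.^ c ≈ + 1))
    non-root c 0<c c<e with search e
      where
      search : ∀ n → (∃[ j ] (j < n × ¬ ((+ suc j) ℤ.^ c ≈ + 1))) ⊎ (∀ j → j < n → (+ suc j) ℤ.^ c ≈ + 1)
      search zero = inj₂ (λ _ ())
      search (suc n) with search n
      ... | inj₁ (j , l , r) = inj₁ (j , ℕP.m<n⇒m<1+n l , r)
      ... | inj₂ all with ≈0? ((+ suc n) ℤ.^ c ℤ.- + 1)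
      ...   | no ¬z = inj₁ (n , ℕP.n<1+n n , λ r → ¬z (≈⇒-≈0 r))
      ...   | yes z = inj₂ (λ j l → case j ℕ.≟ n of λ
                { (yes refl) → -≈0⇒≈ z
                ; (no j≢n) → all j (ℕP.≤∧≢⇒< (ℕP.≤-pred l) j≢n) })
    ... | inj₁ (j , l , r) = suc j , s≤s z≤n , s≤s l , r
    ... | inj₂ all = ⊥-elim (absurd e refl)
      where
      c′ : ∃[ d ] e ≡ suc (c ℕ.+ d)
      c′ = e ℕ.∸ suc c , sym (ℕP.m+[n∸m]≡n c<e)
      vanish : Δ^ e (λ j → (+ j) ℤ-Alg.^ c) 0 ≡ + 0
      vanish = subst (λ n → Δ^ n (λ j → (+ j) ℤ-Alg.^ c) 0 ≡ + 0) (sym (proj₂ c′)) (ℤ-Alg.Δ^-pow-vanish c (proj₁ c′) 0)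
      0^c : ∀ c → 0 < c → (+ 0) ℤ-Alg.^ c ≡ + 0
      0^c (suc c) _ = ℤP.*-zeroˡ ((+ 0) ℤ-Alg.^ c)
      absurd : ∀ n → e ≡ n → ⊥
      absurd zero e≡0 = case subst (4 ≤_) e≡0 4≤e of λ ()
      absurd (suc m) e≡ = Unit-^ m (Unit-neg Unit-1) (≈-trans (≈-sym (top-difference _ (≡⇒≈ (0^c c 0<c)) (λ j l → ≈-trans (≡⇒≈ (^≡ (+ suc j) c)) (all j l)) m e≡)) (≡⇒≈ vanish))

-- Valuations, Morita's gamma function, and the size of Dwork's coefficients.

module PadicGamma where

  open FiniteSums
  open ExponentialSequences
  open Congruences

  module Valuation (F : ℚ-Algebra) {e h : ℕ} (P : OddPrime e h) where

    open Rational F public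
    open Solver
    module M = PrimeModulus P
    open M using (p; Unit)
    open ≡-Reasoning

    -- Valuations are measured by σ = -p, with inverse ρ, because ϖᵖ⁻¹ = -p: powers of ϖ then reduce
    -- to powers of σ without signs.
    π σ ρ : Carrier
    π = n̂ p
    σ = - π
    ρ = - recip e

    σρ : σ * ρ ≡ 1#
    σρ = trans (solve 2 (λ a b → :- a :* :- b := a :* b) refl π (recip e)) (recip-inverse e)

    σ^ρ^ : ∀ n → σ ^ n * ρ ^ n ≡ 1#
    σ^ρ^ n = trans (sym (*-^ σ ρ n)) (trans (cong (_^ n) σρ) (1^ n))

    ι-^ : ∀ x n → ι (x ℤ.^ n) ≡ ι x ^ n
    ι-^ x zero = ι-1
    ι-^ x (suc n) = trans (ι-* x (x ℤ.^ n)) (cong (ι x *_) (ι-^ x n))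

    ι-n! : ∀ n → n! n ≡ ι (ℤ-Alg.n! n)
    ι-n! zero = sym ι-1
    ι-n! (suc n) = trans (cong (n̂ (suc n) *_) (ι-n! n)) (sym (ι-* (pos (suc n)) (ℤ-Alg.n! n)))

    -- V k x: the p-adic valuation of x is at least k.
    record V (k : ℕ) (x : Carrier) : Set where
      constructor val
      field
        den : ℤ
        unit : Unit den
        num : ℤ
        eq : ι den * x ≡ σ ^ k * ι num

    V-ι : ∀ z → V 0 (ι z)
    V-ι z = val (pos 1) M.Unit-1 z (cong (_* ι z) ι-1)

    V-0 : ∀ {k} → V k 0#
    V-0 {k} = val (pos 1) M.Unit-1 (pos 0) (trans (zeroʳ _) (sym (trans (cong (σ ^ k *_) ι-0) (zeroʳ _))))

    V-1 : V 0 1#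
    V-1 = subst (V 0) ι-1 (V-ι (pos 1))

    V-+ : ∀ {k x y} → V k x → V k y → V k (x + y)
    V-+ {k} {x} {y} (val d u n eq) (val d′ u′ n′ eq′) = val (d ℤ.* d′) (M.Unit-* u u′) (d′ ℤ.* n ℤ.+ d ℤ.* n′) (begin
      ι (d ℤ.* d′) * (x + y) ≡⟨ cong (_* (x + y)) (ι-* d d′) ⟩
      ι d * ι d′ * (x + y) ≡⟨ solve 4 (λ d d′ x y → d :* d′ :* (x :+ y) := d′ :* (d :* x) :+ d :* (d′ :* y)) refl _ _ _ _ ⟩
      ι d′ * (ι d * x) + ι d * (ι d′ * y) ≡⟨ cong₂ (λ a b → ι d′ * a + ι d * b) eq eq′ ⟩
      ι d′ * (σ ^ k * ι n) + ι d * (σ ^ k * ι n′) ≡⟨ solve 5 (λ d d′ s n n′ → d′ :* (s :* n) :+ d :* (s :* n′) := s :* (d′ :* n :+ d :* n′)) refl _ _ _ _ _ ⟩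
      σ ^ k * (ι d′ * ι n + ι d * ι n′) ≡⟨ cong (σ ^ k *_) (sym (trans (ι-+ _ _) (cong₂ _+_ (ι-* _ _) (ι-* _ _)))) ⟩
      σ ^ k * ι (d′ ℤ.* n ℤ.+ d ℤ.* n′) ∎)

    V-* : ∀ {j k x y} → V j x → V k y → V (j ℕ.+ k) (x * y)
    V-* {j} {k} {x} {y} (val d u n eq) (val d′ u′ n′ eq′) = val (d ℤ.* d′) (M.Unit-* u u′) (n ℤ.* n′) (begin
      ι (d ℤ.* d′) * (x * y) ≡⟨ cong (_* (x * y)) (ι-* d d′) ⟩
      ι d * ι d′ * (x * y) ≡⟨ solve 4 (λ d d′ x y → d :* d′ :* (x :* y) := (d :* x) :* (d′ :* y)) refl _ _ _ _ ⟩
      (ι d * x) * (ι d′ * y) ≡⟨ cong₂ _*_ eq eq′ ⟩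
      (σ ^ j * ι n) * (σ ^ k * ι n′) ≡⟨ solve 4 (λ s t n n′ → (s :* n) :* (t :* n′) := (s :* t) :* (n :* n′)) refl _ _ _ _ ⟩
      (σ ^ j * σ ^ k) * (ι n * ι n′) ≡⟨ cong₂ _*_ (sym (^-+ σ j k)) (sym (ι-* n n′)) ⟩
      σ ^ (j ℕ.+ k) * ι (n ℤ.* n′) ∎)

    V-neg : ∀ {k x} → V k x → V k (- x)
    V-neg {k} {x} (val d u n eq) = val d u (ℤ.- n) (trans (solve 2 (λ d x → d :* :- x := :- (d :* x)) refl _ _)
      (trans (cong -_ eq) (trans (solve 2 (λ d x → :- (d :* x) := d :* :- x) refl _ _) (cong (σ ^ k *_) (sym (ι-neg n))))))

    V-- : ∀ {k x y} → V k x → V k y → V k (x - y)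
    V-- a b = V-+ a (V-neg b)

    σ≡ι : σ ≡ ι (ℤ.- pos p)
    σ≡ι = sym (ι-neg (pos p))

    V-drop : ∀ j {k x} → V (j ℕ.+ k) x → V k x
    V-drop j {k} {x} (val d u n eq) = val d u ((ℤ.- pos p) ℤ.^ j ℤ.* n) (begin
      ι d * x ≡⟨ eq ⟩
      σ ^ (j ℕ.+ k) * ι n ≡⟨ cong (_* ι n) (trans (^-+ σ j k) (*-comm _ _)) ⟩
      σ ^ k * σ ^ j * ι n ≡⟨ *-assoc _ _ _ ⟩
      σ ^ k * (σ ^ j * ι n) ≡⟨ cong (λ z → σ ^ k * (z * ι n)) (trans (cong (_^ j) σ≡ι) (sym (ι-^ _ j))) ⟩
      σ ^ k * (ι ((ℤ.- pos p) ℤ.^ j) * ι n) ≡⟨ cong (σ ^ k *_) (sym (ι-* _ n)) ⟩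
      σ ^ k * ι ((ℤ.- pos p) ℤ.^ j ℤ.* n) ∎)

    V-mono : ∀ {j k x} → k ≤ j → V j x → V k x
    V-mono {j} {k} {x} k≤j v = V-drop (j ℕ.∸ k) (subst (λ i → V i x) (sym (ℕP.m∸n+n≡m k≤j)) v)

    V-*ˡ : ∀ {k x y} → V 0 x → V k y → V k (x * y)
    V-*ˡ = V-*

    V-*ʳ : ∀ {k x y} → V k x → V 0 y → V k (x * y)
    V-*ʳ {k} {x} {y} a b = subst (V k) (*-comm y x) (V-* b a)

    V-σ^ : ∀ k {x} → V 0 x → V k (σ ^ k * x)
    V-σ^ k {x} (val d u n eq) = val d u n (trans (solve 3 (λ d s x → d :* (s :* x) := s :* (d :* x)) refl _ _ _) (cong (σ ^ k *_) (trans eq (*-identityˡ _))))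

    V-σ^+ : ∀ j {k x} → V k x → V (j ℕ.+ k) (σ ^ j * x)
    V-σ^+ j {k} {x} v = subst (V (j ℕ.+ k)) (cong (_* x) (*-identityʳ _)) (V-* (V-σ^ j V-1) v)

    V-ι∣ : ∀ k z → V k (ι (pos (p ℕ.^ k) ℤ.* z))
    V-ι∣ k z = subst (V k) e₁ (V-σ^ k (V-ι ((ℤ.- pos 1) ℤ.^ k ℤ.* z)))
      where
      lemma : ∀ k → (ℤ.- pos p) ℤ.^ k ℤ.* (ℤ.- pos 1) ℤ.^ k ≡ pos (p ℕ.^ k)
      lemma zero = refl
      lemma (suc k) = trans (l (pos p) ((ℤ.- pos p) ℤ.^ k) ((ℤ.- pos 1) ℤ.^ k)) (trans (cong (pos p ℤ.*_) (lemma k)) (sym (ℤP.pos-* p (p ℕ.^ k))))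
        where
        l : ∀ q a b → ℤ.- q ℤ.* a ℤ.* (ℤ.- pos 1 ℤ.* b) ≡ q ℤ.* (a ℤ.* b)
        l = solve-∀
      e₁ : σ ^ k * ι ((ℤ.- pos 1) ℤ.^ k ℤ.* z) ≡ ι (pos (p ℕ.^ k) ℤ.* z)
      e₁ = trans (cong (_* _) (trans (cong (_^ k) σ≡ι) (sym (ι-^ _ k)))) (trans (sym (ι-* _ _)) (cong ι (trans (sym (ℤP.*-assoc ((ℤ.- pos p) ℤ.^ k) ((ℤ.- pos 1) ℤ.^ k) z)) (cong (ℤ._* z) (lemma k)))))

    V-cancel-unit : ∀ {k} d {x} → Unit d → V k (ι d * x) → V k x
    V-cancel-unit {k} d {x} ud (val d′ u n eq) = val (d′ ℤ.* d) (M.Unit-* u ud) n (trans (cong (_* x) (ι-* d′ d)) (trans (*-assoc _ _ _) eq))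

    V-cancel-σ^ : ∀ j {k x} → V (j ℕ.+ k) (σ ^ j * x) → V k x
    V-cancel-σ^ j {k} {x} (val d u n eq) = val d u n (begin
      ι d * x ≡⟨ sym (trans (cong (λ z → ι d * x * z) (σ^ρ^ j)) (*-identityʳ _)) ⟩
      ι d * x * (σ ^ j * ρ ^ j) ≡⟨ solve 4 (λ d x s r → d :* x :* (s :* r) := r :* (d :* (s :* x))) refl _ _ _ _ ⟩
      ρ ^ j * (ι d * (σ ^ j * x)) ≡⟨ cong (ρ ^ j *_) (trans eq (cong (_* ι n) (^-+ σ j k))) ⟩
      ρ ^ j * (σ ^ j * σ ^ k * ι n) ≡⟨ solve 4 (λ r s t n → r :* (s :* t :* n) := (s :* r) :* (t :* n)) refl _ _ _ _ ⟩
      (σ ^ j * ρ ^ j) * (σ ^ k * ι n) ≡⟨ trans (cong (_* (σ ^ k * ι n)) (σ^ρ^ j)) (*-identityˡ _) ⟩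
      σ ^ k * ι n ∎)

    -- By injectivity of `ι` the witness is an integer equation d z = (-p)ᵏ n with d prime to p, and
    -- Euclid's lemma strips one factor p from z at a time. This leads from the algebra back to
    -- congruences in ℤ.
    V-recover : ∀ k z → V k (ι z) → Congruence._≈_ (pos (p ℕ.^ k)) z (pos 0)
    V-recover k z (val d u n eq) = go k z n (ι-injective (trans (ι-* d z) (trans eq (trans (cong (_* ι n) (trans (cong (_^ k) σ≡ι) (sym (ι-^ _ k)))) (sym (ι-* _ n))))))
      where
      go : ∀ k z n → d ℤ.* z ≡ (ℤ.- pos p) ℤ.^ k ℤ.* n → Congruence._≈_ (pos (p ℕ.^ k)) z (pos 0)
      go zero z n _ = Congruence.by z (l z)
        where
        l : ∀ z → z ≡ pos 0 ℤ.+ z ℤ.* pos 1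
        l = solve-∀
      go (suc k) z n eq with M.integral d z (M.by (ℤ.- ((ℤ.- pos p) ℤ.^ k ℤ.* n)) (trans eq (l (pos p) ((ℤ.- pos p) ℤ.^ k) n)))
        where
        l : ∀ q a n → ℤ.- q ℤ.* a ℤ.* n ≡ pos 0 ℤ.+ ℤ.- (a ℤ.* n) ℤ.* q
        l = solve-∀
      ... | inj₁ d≈0 = ⊥-elim (u d≈0)
      ... | inj₂ (M.by z′ refl) with go k z′ (ℤ.- n) (ℤP.*-cancelˡ-≡ (pos p) _ _ (trans (l₁ (pos p) d z′) (trans eq (l₂ (pos p) ((ℤ.- pos p) ℤ.^ k) n))))
        where
        l₁ : ∀ q d z → q ℤ.* (d ℤ.* z) ≡ d ℤ.* (pos 0 ℤ.+ z ℤ.* q)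
        l₁ = solve-∀
        l₂ : ∀ q a n → ℤ.- q ℤ.* a ℤ.* n ≡ q ℤ.* (a ℤ.* ℤ.- n)
        l₂ = solve-∀
      ...   | Congruence.by r refl = Congruence.by r (trans (l (pos p) r (pos (p ℕ.^ k))) (cong (λ w → pos 0 ℤ.+ r ℤ.* w) (sym (ℤP.pos-* p (p ℕ.^ k)))))
        where
        l : ∀ q r a → pos 0 ℤ.+ (pos 0 ℤ.+ r ℤ.* a) ℤ.* q ≡ pos 0 ℤ.+ r ℤ.* (q ℤ.* a)
        l = solve-∀

    Σ-V : ∀ {k} n {f} → (∀ i → i < n → V k (f i)) → V k (Σ n f)
    Σ-V {k} = Σ-closed (V k) V-0 V-+

    -- For every i ≤ n the i-th difference of f is divisible by p^⌈(i+ε)/2⌉.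
    Smooth : ℕ → ℕ → (ℕ → Carrier) → Set
    Smooth zero ε f = ∀ k → V ⌈ ε /2⌉ (f k)
    Smooth (suc n) ε f = (∀ k → V ⌈ ε /2⌉ (f k)) × Smooth n (suc ε) (Δ f)

    Smooth-cong : ∀ n {ε f g} → (∀ k → f k ≡ g k) → Smooth n ε f → Smooth n ε g
    Smooth-cong zero {ε} eq s k = subst (V ⌈ ε /2⌉) (eq k) (s k)
    Smooth-cong (suc n) {ε} eq (s , t) = (λ k → subst (V ⌈ ε /2⌉) (eq k) (s k)) , Smooth-cong n (λ k → cong₂ _-_ (eq (suc k)) (eq k)) t

    Smooth-pred : ∀ n {ε f} → Smooth (suc n) ε f → Smooth n ε f
    Smooth-pred zero (s , _) = s
    Smooth-pred (suc n) (s , t) = s , Smooth-pred n t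

    Smooth-shift : ∀ n {ε f} → Smooth n ε f → Smooth n ε (f ∘ suc)
    Smooth-shift zero s k = s (suc k)
    Smooth-shift (suc n) (s , t) = (λ k → s (suc k)) , Smooth-shift n t

    Smooth-+ : ∀ n {ε f g} → Smooth n ε f → Smooth n ε g → Smooth n ε (λ k → f k + g k)
    Smooth-+ zero s t k = V-+ (s k) (t k)
    Smooth-+ (suc n) (s , s′) (t , t′) = (λ k → V-+ (s k) (t k)) ,
      Smooth-cong n (λ k → solve 4 (λ a b c d → (a :+ :- b) :+ (c :+ :- d) := a :+ c :+ :- (b :+ d)) refl _ _ _ _) (Smooth-+ n s′ t′)

    ⌈+/2⌉ : ∀ a b → ⌈ a ℕ.+ b /2⌉ ≤ ⌈ a /2⌉ ℕ.+ ⌈ b /2⌉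
    ⌈+/2⌉ zero b = ℕP.≤-refl
    ⌈+/2⌉ (suc zero) b = s≤s (ℕP.⌊n/2⌋≤⌈n/2⌉ b)
    ⌈+/2⌉ (suc (suc a)) b = s≤s (⌈+/2⌉ a b)

    -- From Δ(f g) = Δf · g + f(· + 1) · Δg and the subadditivity of ⌈·/2⌉; the shifted factor is
    -- the reason for `Smooth-shift`.
    Smooth-* : ∀ n {ε η f g} → Smooth n ε f → Smooth n η g → Smooth n (ε ℕ.+ η) (λ k → f k * g k)
    Smooth-* zero {ε} {η} s t k = V-mono (⌈+/2⌉ ε η) (V-* (s k) (t k))
    Smooth-* (suc n) {ε} {η} {f} {g} (s , s′) (t , t′) = (λ k → V-mono (⌈+/2⌉ ε η) (V-* (s k) (t k))) ,
      Smooth-cong n (λ k → solve 4 (λ f f′ g g′ → (f′ :+ :- f) :* g :+ f′ :* (g′ :+ :- g) := f′ :* g′ :+ :- (f :* g)) refl (f k) (f (suc k)) (g k) (g (suc k)))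
        (Smooth-+ n (Smooth-* n s′ (Smooth-pred n (t , t′)))
          (subst (λ z → Smooth n z (λ k → f (suc k) * Δ g k)) (ℕP.+-suc ε η) (Smooth-* n (Smooth-shift n (Smooth-pred n (s , s′))) t′)))

    Smooth-const : ∀ n {ε c} → V ⌈ ε /2⌉ c → Smooth n ε (λ _ → c)
    Smooth-const zero v _ = v
    Smooth-const (suc n) {ε} {c} v = (λ _ → v) , Smooth-cong n (λ _ → sym (-‿inverseʳ c)) (Smooth-const n {suc ε} V-0)

    V-π : V 1 π
    V-π = val (pos 1) M.Unit-1 (ℤ.- pos 1) (trans (cong₂ _*_ ι-1 refl) (trans (*-identityˡ π) (sym (trans (cong₂ _*_ (*-identityʳ σ) (trans (ι-neg _) (cong -_ ι-1)))
      (trans (solve 2 (λ a o → :- a :* :- o := a :* o) refl π 1#) (*-identityʳ π))))))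

    -- This sequence dictates the rate one half: kp and its first difference p are guaranteed one
    -- factor p each, matching ⌈1/2⌉ = ⌈2/2⌉ = 1, and all higher differences vanish.
    Smooth-πk : ∀ n → Smooth n 1 (λ k → n̂ k * π)
    Smooth-πk zero k = V-*ˡ (V-ι (pos k)) V-π
    Smooth-πk (suc n) = (λ k → V-*ˡ (V-ι (pos k)) V-π) ,
      Smooth-cong n (λ k → sym (trans (cong (λ z → z * π - n̂ k * π) (n̂-suc k)) (trans (solve 3 (λ o k π → (o :+ k) :* π :+ :- (k :* π) := o :* π) refl 1# (n̂ k) π) (*-identityˡ π))))
        (Smooth-const n {2} V-π)

    V-half : ∀ n {ε f} k → Smooth n ε f → V ⌈ n ℕ.+ ε /2⌉ (Δ^ n f k)
    V-half zero k s = s k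
    V-half (suc n) {ε} {f} k (_ , t) = subst (λ z → V ⌈ z /2⌉ (Δ^ n (Δ f) k)) (ℕP.+-suc n ε) (V-half n k t)

    -- Morita's gamma function at the negative integers: Γ⁻ n = Γₚ(-n).
    Γ⁻ : ℕ → Carrier
    Γ⁻ zero = 1#
    Γ⁻ (suc n) with M.≈0? (pos (suc n))
    ... | yes _ = - Γ⁻ n
    ... | no _ = recip n * Γ⁻ n

    Γ⁻-unit : ∀ n → Unit (pos (suc n)) → n̂ (suc n) * Γ⁻ (suc n) ≡ Γ⁻ n
    Γ⁻-unit n u with M.≈0? (pos (suc n))
    ... | yes z = ⊥-elim (u z)
    ... | no _ = trans (sym (*-assoc _ _ _)) (trans (cong (_* Γ⁻ n) (recip-inverse n)) (*-identityˡ _))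

    Γ⁻-multiple : ∀ n → M._≈_ (pos (suc n)) (pos 0) → Γ⁻ (suc n) ≡ - Γ⁻ n
    Γ⁻-multiple n z with M.≈0? (pos (suc n))
    ... | yes _ = refl
    ... | no u = ⊥-elim (u z)

    V-Γ⁻ : ∀ n → V 0 (Γ⁻ n)
    V-Γ⁻ zero = V-1
    V-Γ⁻ (suc n) with M.≈0? (pos (suc n))
    ... | yes _ = V-neg (V-Γ⁻ n)
    ... | no u = V-cancel-unit (pos (suc n)) u (subst (V 0) (sym (trans (sym (*-assoc _ _ _)) (trans (cong (_* Γ⁻ n) (recip-inverse n)) (*-identityˡ _)))) (V-Γ⁻ n))

    -- Sorting the arguments by residue class r makes the functional equation uniform in k:
    -- consecutive classes differ by the unit r + 1 + kp (`H-step`), and passing from class p - 1 to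
    -- class 0 costs a sign (`H-wrap`).
    H : ℕ → ℕ → Carrier
    H r k = Γ⁻ (r ℕ.+ k ℕ.* p)

    unit-offset : ∀ r k → suc r < p → Unit (pos (suc r ℕ.+ k ℕ.* p))
    unit-offset r k l = M.Unit-cong {pos (suc r)} (M.by (ℤ.- pos k) eq) (M.Unit-small (suc r) (s≤s z≤n) l)
      where
      lemma : ∀ r k q → r ≡ r ℤ.+ k ℤ.* q ℤ.+ ℤ.- k ℤ.* q
      lemma = solve-∀
      eq : pos (suc r) ≡ pos (suc r ℕ.+ k ℕ.* p) ℤ.+ ℤ.- pos k ℤ.* pos p
      eq = trans (lemma (pos (suc r)) (pos k) (pos p)) (cong (ℤ._+ ℤ.- pos k ℤ.* pos p) (sym (trans (ℤP.pos-+ (suc r) (k ℕ.* p)) (cong (λ w → pos (suc r) ℤ.+ w) (ℤP.pos-* k p)))))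

    multiple-offset : ∀ k → M._≈_ (pos (suc (e ℕ.+ k ℕ.* p))) (pos 0)
    multiple-offset k = M.by (pos (suc k)) (trans (ℤP.pos-* (suc k) p) (sym (ℤP.+-identityˡ _)))

    n̂-offset : ∀ r k → n̂ (r ℕ.+ k ℕ.* p) ≡ n̂ r + n̂ k * π
    n̂-offset r k = trans (n̂-+ r (k ℕ.* p)) (cong (_+_ (n̂ r)) (n̂-* k p))

    H-step : ∀ r k → suc r < p → H r k ≡ (n̂ (suc r) + n̂ k * π) * H (suc r) k
    H-step r k l = sym (trans (cong (_* H (suc r) k) (sym (n̂-offset (suc r) k))) (Γ⁻-unit (r ℕ.+ k ℕ.* p) (unit-offset r k l)))

    H-wrap : ∀ k → H 0 (suc k) ≡ - H e k
    H-wrap k = Γ⁻-multiple (e ℕ.+ k ℕ.* p) (multiple-offset k)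

    rising : ℕ → ℕ → Carrier
    rising zero k = 1#
    rising (suc r) k = rising r k * (n̂ (suc r) + n̂ k * π)

    H-rising : ∀ r k → r < p → H 0 k ≡ rising r k * H r k
    H-rising zero k _ = sym (*-identityˡ _)
    H-rising (suc r) k l = trans (H-rising r k (ℕP.<-trans (ℕP.n<1+n r) l)) (trans (cong (rising r k *_) (H-step r k l)) (sym (*-assoc _ _ _)))

    Smooth-linear : ∀ n r → Smooth n 0 (λ k → n̂ r + n̂ k * π)
    Smooth-linear n r = Smooth-+ n (Smooth-const n {0} (V-ι (pos r))) (weaken n (Smooth-πk n))
      where
      weaken : ∀ n {ε f} → Smooth n (suc ε) f → Smooth n ε f
      weaken zero {ε} s k = V-mono (ℕP.⌈n/2⌉-mono (ℕP.n≤1+n ε)) (s k)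
      weaken (suc n) {ε} (s , t) = (λ k → V-mono (ℕP.⌈n/2⌉-mono (ℕP.n≤1+n ε)) (s k)) , weaken n t

    V-n! : ∀ n → V 0 (n! n)
    V-n! n = subst (V 0) (sym (ι-n! n)) (V-ι _)

    Smooth-rising : ∀ n r → Smooth n 1 (λ k → rising r k - n! r)
    Smooth-rising n zero = Smooth-cong n (λ _ → sym (-‿inverseʳ 1#)) (Smooth-const n {1} V-0)
    Smooth-rising n (suc r) = Smooth-cong n
      (λ k → solve 4 (λ w f r t → (w :+ :- f) :* (r :+ t) :+ f :* t := w :* (r :+ t) :+ :- (r :* f)) refl (rising r k) (n! r) (n̂ (suc r)) (n̂ k * π))
      (Smooth-+ n (Smooth-* n {1} {0} (Smooth-rising n r) (Smooth-linear n (suc r))) (Smooth-* n {0} {1} (Smooth-const n {0} (V-n! r)) (Smooth-πk n)))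

    V-wilson : V 1 (n! e + 1#)
    V-wilson = subst (V 1) (trans (cong ι eq) (trans (ι-+ _ _) (cong₂ _+_ (sym (ι-n! e)) ι-1))) (V-ι∣ 1 quot)
      where
      quot = M._≈_.quotient M.wilson
      lemma : ∀ q w → q ℤ.* pos 1 ℤ.* w ≡ ℤ.- pos 1 ℤ.+ w ℤ.* q ℤ.+ pos 1
      lemma = solve-∀
      eq : pos (p ℕ.^ 1) ℤ.* quot ≡ ℤ-Alg.n! e ℤ.+ pos 1
      eq = trans (cong (ℤ._* quot) (ℤP.pos-* p 1)) (trans (lemma (pos p) quot) (cong (ℤ._+ pos 1) (sym (M._≈_.equation M.wilson))))

    Smooth-ratio : ∀ n → Smooth n 1 (λ k → 1# + rising e k)
    Smooth-ratio n = Smooth-cong n (λ k → solve 3 (λ w f o → (w :+ :- f) :+ (f :+ o) := o :+ w) refl (rising e k) (n! e) 1#)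
      (Smooth-+ n (Smooth-rising n e) (Smooth-const n {1} V-wilson))

    -- Since H 0 (k + 1) = - H e k, the difference of `H e` at k is (1 + `rising e (k + 1)`) times
    -- `H e (k + 1)`. Wilson's theorem makes the first factor divisible by p, smoothly in k, so by
    -- induction each further difference gains half a factor p.
    Smooth-He : ∀ n → Smooth n 0 (H e)
    Smooth-He zero k = V-Γ⁻ (e ℕ.+ k ℕ.* p)
    Smooth-He (suc n) = (λ k → V-Γ⁻ (e ℕ.+ k ℕ.* p)) , Smooth-cong n eq (Smooth-* n {1} {0} (Smooth-shift n (Smooth-ratio n)) (Smooth-shift n (Smooth-He n)))
      where
      eq : ∀ k → (1# + rising e (suc k)) * H e (suc k) ≡ H e (suc k) - H e k
      eq k = begin
        (1# + rising e (suc k)) * H e (suc k) ≡⟨ trans (distribʳ _ _ _) (cong (_+ rising e (suc k) * H e (suc k)) (*-identityˡ _)) ⟩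
        H e (suc k) + rising e (suc k) * H e (suc k) ≡⟨ cong (_+_ (H e (suc k))) (sym (H-rising e (suc k) ℕP.≤-refl)) ⟩
        H e (suc k) + H 0 (suc k) ≡⟨ cong (_+_ (H e (suc k))) (H-wrap k) ⟩
        H e (suc k) - H e k ∎

    -- Descent from class e: each of the d steps multiplies by r + 1 + kp, which is smooth.
    Smooth-H : ∀ n d r → r ℕ.+ d ≡ e → Smooth n 0 (H r)
    Smooth-H n zero r eq = subst (λ z → Smooth n 0 (H z)) (trans (sym eq) (ℕP.+-identityʳ r)) (Smooth-He n)
    Smooth-H n (suc d) r eq = Smooth-cong n (λ k → sym (H-step r k l)) (Smooth-* n {0} {0} (Smooth-linear n (suc r)) (Smooth-H n d (suc r) (trans (sym (ℕP.+-suc r d)) eq)))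
      where
      l : suc r < p
      l = s≤s (subst (suc r ≤_) eq (subst (suc r ≤_) (sym (ℕP.+-suc r d)) (s≤s (ℕP.m≤m+n r d))))

    V-ΔH : ∀ i r → r < p → V ⌈ i /2⌉ (Δ^ i (H r) 0)
    V-ΔH i r (s≤s r≤e) = subst (λ z → V ⌈ z /2⌉ (Δ^ i (H r) 0)) (ℕP.+-identityʳ i) (V-half i {0} 0 (Smooth-H i (e ℕ.∸ r) r (ℕP.m+[n∸m]≡n r≤e)))

    n!-offset : ∀ j r → r < p → ∃[ u ] (Unit u × n! (r ℕ.+ j ℕ.* p) ≡ ι u * (σ ^ j * n! j))
    n!-offset zero zero _ = pos 1 , M.Unit-1 , sym (trans (cong₂ _*_ ι-1 (*-identityˡ 1#)) (*-identityˡ 1#))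
    n!-offset (suc j) zero _ with n!-offset j e ℕP.≤-refl
    ... | u , uu , eq = ℤ.- u , M.Unit-neg uu , (begin
      n̂ (suc j ℕ.* p) * n! (e ℕ.+ j ℕ.* p) ≡⟨ cong₂ _*_ (n̂-* (suc j) p) eq ⟩
      n̂ (suc j) * π * (ι u * (σ ^ j * n! j)) ≡⟨ solve 5 (λ j π u s f → j :* π :* (u :* (s :* f)) := :- u :* (:- π :* s :* (j :* f))) refl _ _ _ _ _ ⟩
      - ι u * (σ ^ suc j * n! (suc j)) ≡⟨ cong (_* (σ ^ suc j * n! (suc j))) (sym (ι-neg u)) ⟩
      ι (ℤ.- u) * (σ ^ suc j * n! (suc j)) ∎)
    n!-offset j (suc r) l with n!-offset j r (ℕP.<-trans (ℕP.n<1+n r) l)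
    ... | u , uu , eq = pos (suc r ℕ.+ j ℕ.* p) ℤ.* u , M.Unit-* (unit-offset r j l) uu ,
      trans (cong (n̂ (suc r ℕ.+ j ℕ.* p) *_) eq) (trans (sym (*-assoc _ _ _)) (cong (_* (σ ^ j * n! j)) (sym (ι-* _ u))))

    -- Legendre's recursion v(n) = ⌊n/p⌋ + v(⌊n/p⌋). With j = ⌊n/p⌋ the bound follows from 4j + j ≤
    -- pj ≤ n, which is where p ≥ 5 enters the estimates.
    n!-valuation-rec : ∀ n → ∃[ v ] ∃[ u ] (Unit u × 4 ℕ.* v ≤ n × n! n ≡ ι u * σ ^ v)
    n!-valuation-rec = <-rec _ go
      where
      go : ∀ n → (∀ {m} → m < n → ∃[ v ] ∃[ u ] (Unit u × 4 ℕ.* v ≤ m × n! m ≡ ι u * σ ^ v)) → ∃[ v ] ∃[ u ] (Unit u × 4 ℕ.* v ≤ n × n! n ≡ ι u * σ ^ v)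
      go zero _ = 0 , pos 1 , M.Unit-1 , z≤n , sym (trans (*-identityʳ _) ι-1)
      go n@(suc n′) ih with ih (ℕM.m/n<m n p (s≤s (ℕP.≤-trans (s≤s z≤n) M.4≤e))) | n!-offset (n ℕM./ p) (n ℕM.% p) (ℕM.m%n<n n p)
      ... | v , u , uu , b , eq | u′ , uu′ , eq′ = n ℕM./ p ℕ.+ v , u′ ℤ.* u , M.Unit-* uu′ uu , bound , (begin
          n! n ≡⟨ cong n! (ℕM.m≡m%n+[m/n]*n n p) ⟩
          n! (n ℕM.% p ℕ.+ n ℕM./ p ℕ.* p) ≡⟨ eq′ ⟩
          ι u′ * (σ ^ (n ℕM./ p) * n! (n ℕM./ p)) ≡⟨ cong (λ z → ι u′ * (σ ^ (n ℕM./ p) * z)) eq ⟩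
          ι u′ * (σ ^ (n ℕM./ p) * (ι u * σ ^ v)) ≡⟨ solve 4 (λ a b c d → a :* (b :* (c :* d)) := (a :* c) :* (b :* d)) refl _ _ _ _ ⟩
          (ι u′ * ι u) * (σ ^ (n ℕM./ p) * σ ^ v) ≡⟨ cong₂ _*_ (sym (ι-* u′ u)) (sym (^-+ σ (n ℕM./ p) v)) ⟩
          ι (u′ ℤ.* u) * σ ^ (n ℕM./ p ℕ.+ v) ∎)
        where
        j = n ℕM./ p
        bound : 4 ℕ.* (j ℕ.+ v) ≤ n
        bound = ℕP.≤-trans (ℕP.≤-reflexive (ℕP.*-distribˡ-+ 4 j v))
          (ℕP.≤-trans (ℕP.+-monoʳ-≤ (4 ℕ.* j) b)
          (ℕP.≤-trans (ℕP.≤-reflexive (l j))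
          (ℕP.≤-trans (ℕP.*-monoʳ-≤ j (s≤s M.4≤e)) (ℕM.m/n*n≤m n p))))
          where
          l : ∀ j → 4 ℕ.* j ℕ.+ j ≡ j ℕ.* 5
          l = solveℕ-∀

    abstract
      n!-valuation : ∀ n → ∃[ v ] ∃[ u ] (Unit u × 4 ℕ.* v ≤ n × n! n ≡ ι u * σ ^ v)
      n!-valuation = n!-valuation-rec

    H̃ : ℕ → ℕ → Carrier
    H̃ r = newtonCoeff (H r)

    -- The i-th difference has ⌈i/2⌉ factors p and i! at most i/4 of them, so about i/4 are left.
    -- The summand 3 is the gain from rounding: one factor p is already present at i = 1, as
    -- `Γ⁻-period` requires.
    V-H̃ : ∀ κ i r → r < p → 4 ℕ.* κ ≤ 3 ℕ.+ i → V κ (H̃ r i)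
    V-H̃ κ i r l κ≤ with n!-valuation i
    ... | v , u , uu , v≤ , eq = V-cancel-unit u uu (V-cancel-σ^ v (V-mono bound (subst (V ⌈ i /2⌉) eq′ (V-ΔH i r l))))
      where
      eq′ : Δ^ i (H r) 0 ≡ σ ^ v * (ι u * H̃ r i)
      eq′ = begin
        Δ^ i (H r) 0 ≡⟨ sym (trans (cong (Δ^ i (H r) 0 *_) (n!-recip! i)) (*-identityʳ _)) ⟩
        Δ^ i (H r) 0 * (n! i * recip! i) ≡⟨ cong (λ z → Δ^ i (H r) 0 * (z * recip! i)) eq ⟩
        Δ^ i (H r) 0 * (ι u * σ ^ v * recip! i) ≡⟨ solve 4 (λ d u s r → d :* (u :* s :* r) := s :* (u :* (d :* r))) refl _ _ _ _ ⟩
        σ ^ v * (ι u * H̃ r i) ∎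
      l₁ : ∀ v κ → 4 ℕ.* v ℕ.+ 4 ℕ.* κ ≡ (v ℕ.+ κ) ℕ.+ (v ℕ.+ κ) ℕ.+ ((v ℕ.+ κ) ℕ.+ (v ℕ.+ κ))
      l₁ = solveℕ-∀
      l₂ : ∀ i → i ℕ.+ (3 ℕ.+ i) ≡ suc ((suc i) ℕ.+ (suc i))
      l₂ = solveℕ-∀
      halve : ∀ a b → a ℕ.+ a ≤ suc (b ℕ.+ b) → a ≤ b
      halve a b q with a ℕP.≤? b
      ... | yes a≤b = a≤b
      ... | no a≰b = ⊥-elim (ℕP.<-irrefl refl (ℕP.≤-trans (ℕP.≤-trans (ℕP.≤-reflexive (cong suc (sym (ℕP.+-suc b b)))) (ℕP.+-mono-≤ (ℕP.≰⇒> a≰b) (ℕP.≰⇒> a≰b))) q))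
      bound : v ℕ.+ κ ≤ ⌈ i /2⌉
      bound = subst (_≤ ⌈ i /2⌉) (sym (ℕP.n≡⌊n+n/2⌋ (v ℕ.+ κ))) (ℕP.⌊n/2⌋-mono (halve _ _ (subst₂ _≤_ (l₁ v κ) (l₂ i) (ℕP.+-mono-≤ v≤ κ≤))))

    -- The coefficients of Dwork's series exp(t + tᵖ/p).
    dwork : ℕ → Carrier
    dwork n = ρ ^ (n ℕM./ p) * H̃ (n ℕM.% p) (n ℕM./ p)

    dwork-offset : ∀ r i → r < p → dwork (r ℕ.+ i ℕ.* p) ≡ ρ ^ i * H̃ r i
    dwork-offset r i l = cong₂ (λ a b → ρ ^ a * H̃ b a) quot rem
      where
      rem : (r ℕ.+ i ℕ.* p) ℕM.% p ≡ r
      rem = trans (ℕM.[m+kn]%n≡m%n r i p) (ℕM.m<n⇒m%n≡m l)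
      quot : (r ℕ.+ i ℕ.* p) ℕM./ p ≡ i
      quot = trans (ℕM.+-distrib-/-∣ʳ r (ℕD.n∣m*n i)) (cong₂ ℕ._+_ (ℕM.m<n⇒m/n≡0 l) (ℕM.m*n/n≡m i p))

    -- Take the (i + 1)-st difference of H r k = (r + 1) f k + p · k f k with f = `H (r + 1)`, by
    -- the Leibniz rule at 0, and divide by (i + 1)!. In terms of `dwork` this is n cₙ = cₙ₋₁ + cₙ₋ₚ
    -- at n = r + 1 + (i + 1)p.
    H̃-step : ∀ r i → suc r < p → H̃ r (suc i) ≡ (n̂ (suc r) + n̂ (suc i) * π) * H̃ (suc r) (suc i) + π * H̃ (suc r) i
    H̃-step r i l = begin
      Δ^ (suc i) (H r) 0 * recip! (suc i)
        ≡⟨ cong (_* recip! (suc i)) (trans (Δ^-cong (suc i) (λ k → trans (H-step r k l) (solve 4 (λ a b c d → (a :+ b :* c) :* d := a :* d :+ c :* (b :* d)) refl (n̂ (suc r)) (n̂ k) π (f k))) 0)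
            (trans (Δ^-+ (suc i) _ _ 0) (cong₂ _+_ (Δ^-* (suc i) _ f 0) (trans (Δ^-* (suc i) π (λ k → n̂ k * f k) 0) (cong (π *_) (Δ^-leibniz i f 0)))))) ⟩
      (n̂ (suc r) * a + π * (n̂ 0 * a + n̂ (suc i) * Δ^ i f 1)) * recip! (suc i)
        ≡⟨ cong₂ (λ x y → (n̂ (suc r) * a + π * (x * a + n̂ (suc i) * y)) * recip! (suc i)) ι-0 (trans (solve 2 (λ x y → x := x :+ :- y :+ y) refl (Δ^ i f 1) b) (cong (_+ b) (sym (Δ^-suc i f 0)))) ⟩
      (n̂ (suc r) * a + π * (0# * a + n̂ (suc i) * (a + b))) * recip! (suc i)
        ≡⟨ cong (λ z → (n̂ (suc r) * a + π * (z + n̂ (suc i) * (a + b))) * recip! (suc i)) (zeroˡ a) ⟩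
      (n̂ (suc r) * a + π * (0# + n̂ (suc i) * (a + b))) * recip! (suc i)
        ≡⟨ cong (λ z → (n̂ (suc r) * a + π * z) * recip! (suc i)) (+-identityˡ _) ⟩
      (n̂ (suc r) * a + π * (n̂ (suc i) * (a + b))) * recip! (suc i)
        ≡⟨ solve 6 (λ r π i a b q → (r :* a :+ π :* (i :* (a :+ b))) :* q := (r :+ i :* π) :* (a :* q) :+ π :* (b :* (i :* q))) refl (n̂ (suc r)) π (n̂ (suc i)) a b (recip! (suc i)) ⟩
      (n̂ (suc r) + n̂ (suc i) * π) * (a * recip! (suc i)) + π * (b * (n̂ (suc i) * recip! (suc i)))
        ≡⟨ cong (λ z → (n̂ (suc r) + n̂ (suc i) * π) * (a * recip! (suc i)) + π * (b * z)) (suc-recip! i) ⟩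
      (n̂ (suc r) + n̂ (suc i) * π) * H̃ (suc r) (suc i) + π * H̃ (suc r) i ∎
      where
      f = H (suc r)
      a = Δ^ (suc i) f 0
      b = Δ^ i f 0

    H̃-zero : ∀ r → suc r < p → H̃ r 0 ≡ n̂ (suc r) * H̃ (suc r) 0
    H̃-zero r l = trans (cong (_* 1#) (trans (H-step r 0 l) (cong (_* H (suc r) 0) (trans (cong (_+_ (n̂ (suc r))) (trans (cong (_* π) ι-0) (zeroˡ π))) (+-identityʳ _))))) (*-assoc _ _ _)

    -- The same recursion at the multiples n = (i + 1)p, coming from Δ (H 0) = -(H e + H 0).
    H̃-wrap : ∀ i → n̂ (suc i) * H̃ 0 (suc i) ≡ - (H̃ e i + H̃ 0 i)
    H̃-wrap i = begin
      n̂ (suc i) * H̃ 0 (suc i) ≡⟨ sym (newtonCoeff-Δ (H 0) i) ⟩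
      Δ^ i (Δ (H 0)) 0 * recip! i ≡⟨ cong (_* recip! i) (trans (Δ^-cong i eq 0) (trans (Δ^-* i (- 1#) _ 0) (cong (- 1# *_) (Δ^-+ i (H e) (H 0) 0)))) ⟩
      - 1# * (Δ^ i (H e) 0 + Δ^ i (H 0) 0) * recip! i ≡⟨ solve 4 (λ o a b r → :- o :* (a :+ b) :* r := o :* :- (a :* r :+ b :* r)) refl 1# _ _ _ ⟩
      1# * - (H̃ e i + H̃ 0 i) ≡⟨ *-identityˡ _ ⟩
      - (H̃ e i + H̃ 0 i) ∎
      where
      eq : ∀ k → Δ (H 0) k ≡ - 1# * (H e k + H 0 k)
      eq k = trans (cong (_- H 0 k) (H-wrap k)) (trans (sym (*-identityˡ _)) (solve 3 (λ o a b → o :* (:- a :+ :- b) := :- o :* (a :+ b)) refl 1# _ _))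

    sh^-below : ∀ k f n → n < k → sh^ k f n ≡ 0#
    sh^-below (suc k) f zero _ = refl
    sh^-below (suc k) f (suc n) (s≤s l) = sh^-below k f n l

    sh^-above : ∀ k f n → sh^ k f (k ℕ.+ n) ≡ f n
    sh^-above zero f n = refl
    sh^-above (suc k) f n = sh^-above k f n

    sh^-offset : ∀ r i f → sh^ p f (r ℕ.+ suc i ℕ.* p) ≡ f (r ℕ.+ i ℕ.* p)
    sh^-offset r i f = trans (cong (sh^ p f) (l r i p)) (sh^-above p f (r ℕ.+ i ℕ.* p))
      where
      l : ∀ r i p → r ℕ.+ (p ℕ.+ i ℕ.* p) ≡ p ℕ.+ (r ℕ.+ i ℕ.* p)
      l = solveℕ-∀

    offset-induction : ∀ {ℓ} (Q : ℕ → Set ℓ) → (∀ r i → r < p → Q (r ℕ.+ i ℕ.* p)) → ∀ n → Q n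
    offset-induction Q q n = subst Q (sym (ℕM.m≡m%n+[m/n]*n n p)) (q (n ℕM.% p) (n ℕM./ p) (ℕM.m%n<n n p))

    -- The powers of ρ in `dwork` do the bookkeeping: at a multiple of p the factor p of n cancels
    -- one ρ, elsewhere the term p · `H̃ (r + 1) i` becomes cₙ₋ₚ, and below p the second shift is
    -- zero.
    dwork-isExp : IsExp p 1# 1# dwork
    dwork-isExp = record { start = trans (*-identityˡ _) (*-identityʳ _) ; step = offset-induction _ go }
      where
      π≡ : π * ρ ≡ - 1#
      π≡ = trans (solve 2 (λ a b → a :* b := :- (:- a :* b)) refl π ρ) (cong -_ σρ)
      1*1* : ∀ x y → x + y ≡ 1# * x + 1# * y
      1*1* x y = sym (cong₂ _+_ (*-identityˡ x) (*-identityˡ y))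
      go : ∀ r i → r < p → θ dwork (r ℕ.+ i ℕ.* p) ≡ 1# * sh dwork (r ℕ.+ i ℕ.* p) + 1# * sh^ p dwork (r ℕ.+ i ℕ.* p)
      go zero zero l = trans (trans (cong (_* dwork 0) ι-0) (zeroˡ _)) (sym (trans (cong₂ _+_ (*-identityˡ _) (*-identityˡ _)) (+-identityˡ _)))
      go zero (suc i) l = trans (begin
        n̂ (suc i ℕ.* p) * dwork (suc i ℕ.* p)
          ≡⟨ cong₂ _*_ (n̂-* (suc i) p) (dwork-offset 0 (suc i) l) ⟩
        n̂ (suc i) * π * (ρ * ρ ^ i * H̃ 0 (suc i))
          ≡⟨ solve 5 (λ i π ρ s h → i :* π :* (ρ :* s :* h) := (π :* ρ) :* s :* (i :* h)) refl _ _ _ _ _ ⟩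
        (π * ρ) * ρ ^ i * (n̂ (suc i) * H̃ 0 (suc i))
          ≡⟨ cong₂ (λ a b → a * ρ ^ i * b) π≡ (H̃-wrap i) ⟩
        - 1# * ρ ^ i * - (H̃ e i + H̃ 0 i)
          ≡⟨ solve 4 (λ o s a b → :- o :* s :* :- (a :+ b) := o :* (s :* a :+ s :* b)) refl 1# _ _ _ ⟩
        1# * (ρ ^ i * H̃ e i + ρ ^ i * H̃ 0 i)
          ≡⟨ *-identityˡ _ ⟩
        ρ ^ i * H̃ e i + ρ ^ i * H̃ 0 i
          ≡⟨ cong₂ _+_ (sym (dwork-offset e i ℕP.≤-refl)) (trans (sym (dwork-offset 0 i l)) (sym (sh^-offset 0 i dwork))) ⟩
        dwork (e ℕ.+ i ℕ.* p) + sh^ p dwork (suc i ℕ.* p) ∎) (1*1* _ _)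
      go (suc r) zero l = trans (begin
        n̂ (suc r ℕ.+ 0) * dwork (suc r ℕ.+ 0) ≡⟨ cong₂ _*_ (cong n̂ (ℕP.+-identityʳ (suc r))) (dwork-offset (suc r) 0 l) ⟩
        n̂ (suc r) * (1# * H̃ (suc r) 0) ≡⟨ solve 3 (λ a o b → a :* (o :* b) := o :* (a :* b)) refl _ _ _ ⟩
        1# * (n̂ (suc r) * H̃ (suc r) 0) ≡⟨ cong (1# *_) (sym (H̃-zero r l)) ⟩
        1# * H̃ r 0 ≡⟨ sym (dwork-offset r 0 (ℕP.<-trans (ℕP.n<1+n r) l)) ⟩
        dwork (r ℕ.+ 0) ≡⟨ sym (+-identityʳ _) ⟩
        dwork (r ℕ.+ 0) + 0# ≡⟨ cong (_+_ (dwork (r ℕ.+ 0))) (sym (sh^-below p dwork (suc r ℕ.+ 0) (subst (_< p) (sym (ℕP.+-identityʳ (suc r))) l))) ⟩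
        dwork (r ℕ.+ 0) + sh^ p dwork (suc r ℕ.+ 0) ∎) (1*1* _ _)
      go (suc r) (suc i) l = trans (begin
        n̂ (suc r ℕ.+ suc i ℕ.* p) * dwork (suc r ℕ.+ suc i ℕ.* p)
          ≡⟨ cong₂ _*_ (n̂-offset (suc r) (suc i)) (dwork-offset (suc r) (suc i) l) ⟩
        N * (ρ * ρ ^ i * H̃ (suc r) (suc i))
          ≡⟨ solve 6 (λ N ρ s a π b → N :* (ρ :* s :* a) := ρ :* s :* (N :* a :+ π :* b) :+ :- (π :* ρ) :* (s :* b)) refl _ _ _ _ π (H̃ (suc r) i) ⟩
        ρ ^ suc i * (N * H̃ (suc r) (suc i) + π * H̃ (suc r) i) + - (π * ρ) * (ρ ^ i * H̃ (suc r) i)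
          ≡⟨ cong₂ (λ a b → ρ ^ suc i * a + b * (ρ ^ i * H̃ (suc r) i)) (sym (H̃-step r i l)) (trans (cong -_ π≡) (trans (solve 1 (λ o → :- (:- o) := o) refl 1#) refl)) ⟩
        ρ ^ suc i * H̃ r (suc i) + 1# * (ρ ^ i * H̃ (suc r) i)
          ≡⟨ cong₂ _+_ (sym (dwork-offset r (suc i) (ℕP.<-trans (ℕP.n<1+n r) l))) (trans (*-identityˡ _) (trans (sym (dwork-offset (suc r) i l)) (sym (sh^-offset (suc r) i dwork)))) ⟩
        dwork (r ℕ.+ suc i ℕ.* p) + sh^ p dwork (suc r ℕ.+ suc i ℕ.* p) ∎) (1*1* _ _)
        where N = n̂ (suc r) + n̂ (suc i) * π

    -- The power σʲ first cancels the ⌊n/p⌋ factors ρ of `dwork`; the surplus is added to the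
    -- valuation of the Newton coefficient.
    V-dwork : ∀ κ j n → n ℕM./ p ≤ j → 4 ℕ.* κ ≤ 3 ℕ.+ n ℕM./ p → V (j ℕ.∸ n ℕM./ p ℕ.+ κ) (σ ^ j * dwork n)
    V-dwork κ j n i≤j κ≤ = subst (V (j ℕ.∸ i ℕ.+ κ)) eq (V-σ^+ (j ℕ.∸ i) (V-H̃ κ i r (ℕM.m%n<n n p) κ≤))
      where
      i = n ℕM./ p
      r = n ℕM.% p
      eq : σ ^ (j ℕ.∸ i) * H̃ r i ≡ σ ^ j * dwork n
      eq = sym (begin
        σ ^ j * (ρ ^ i * H̃ r i) ≡⟨ cong (λ z → σ ^ z * (ρ ^ i * H̃ r i)) (sym (ℕP.m∸n+n≡m i≤j)) ⟩
        σ ^ (j ℕ.∸ i ℕ.+ i) * (ρ ^ i * H̃ r i) ≡⟨ cong (_* (ρ ^ i * H̃ r i)) (^-+ σ (j ℕ.∸ i) i) ⟩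
        σ ^ (j ℕ.∸ i) * σ ^ i * (ρ ^ i * H̃ r i) ≡⟨ solve 4 (λ a b c d → a :* b :* (c :* d) := (b :* c) :* (a :* d)) refl _ _ _ _ ⟩
        (σ ^ i * ρ ^ i) * (σ ^ (j ℕ.∸ i) * H̃ r i) ≡⟨ trans (cong (_* (σ ^ (j ℕ.∸ i) * H̃ r i)) (σ^ρ^ i)) (*-identityˡ _) ⟩
        σ ^ (j ℕ.∸ i) * H̃ r i ∎)

-- Diagonal sums of Dwork's coefficients as gamma values.

module DworkSums where

  open FiniteSums
  open ExponentialSequences
  open Congruences
  open PadicGamma

  module GammaSums (F : ℚ-Algebra) {e h : ℕ} (P : OddPrime e h) (K : ℕ) where

    open Valuation F P public
    open Solver
    open M using (p; Unit)

    instance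
      nonZero-e : NonZero e
      nonZero-e = ℕ.>-nonZero (ℕP.≤-trans (s≤s z≤n) M.4≤e)

    infix 4 _≋_
    record _≋_ (x y : Carrier) : Set where
      constructor ≋[_]
      field difference : V K (x - y)
    open _≋_

    ≋-refl : ∀ {x} → x ≋ x
    ≋-refl {x} = ≋[ subst (V K) (sym (-‿inverseʳ x)) V-0 ]

    ≋-reflexive : ∀ {x y} → x ≡ y → x ≋ y
    ≋-reflexive refl = ≋-refl

    ≋-sym : ∀ {x y} → x ≋ y → y ≋ x
    ≋-sym {x} {y} ≋[ v ] = ≋[ subst (V K) (solve 2 (λ x y → :- (x :+ :- y) := y :+ :- x) refl x y) (V-neg v) ]

    ≋-trans : ∀ {x y z} → x ≋ y → y ≋ z → x ≋ z
    ≋-trans {x} {y} {z} ≋[ v ] ≋[ w ] = ≋[ subst (V K) (solve 3 (λ x y z → (x :+ :- y) :+ (y :+ :- z) := x :+ :- z) refl x y z) (V-+ v w) ]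

    ≋-+ : ∀ {x y u v} → x ≋ y → u ≋ v → x + u ≋ y + v
    ≋-+ {x} {y} {u} {v} ≋[ a ] ≋[ b ] = ≋[ subst (V K) (solve 4 (λ x y u v → (x :+ :- y) :+ (u :+ :- v) := x :+ u :+ :- (y :+ v)) refl x y u v) (V-+ a b) ]

    ≋-*ˡ : ∀ {c x y} → V 0 c → x ≋ y → c * x ≋ c * y
    ≋-*ˡ {c} {x} {y} v ≋[ a ] = ≋[ subst (V K) (solve 3 (λ c x y → c :* (x :+ :- y) := c :* x :+ :- (c :* y)) refl c x y) (V-*ˡ v a) ]

    ≋-*ʳ : ∀ {c x y} → V 0 c → x ≋ y → x * c ≋ y * c
    ≋-*ʳ {c} {x} {y} v a = subst₂ _≋_ (*-comm c x) (*-comm c y) (≋-*ˡ v a)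

    ≋-drop : ∀ {x y} → V K y → x + y ≋ x
    ≋-drop {x} {y} v = ≋[ subst (V K) (solve 2 (λ x y → y := x :+ y :+ :- x) refl x y) v ]

    Σ-≋ : ∀ n {f g} → (∀ i → i < n → f i ≋ g i) → Σ n f ≋ Σ n g
    Σ-≋ zero q = ≋-refl
    Σ-≋ (suc n) q = ≋-+ (Σ-≋ n (λ i l → q i (ℕP.m<n⇒m<1+n l))) (q n (ℕP.n<1+n n))

    Σ-tail : ∀ {L M} f → L ≤ M → (∀ i → L ≤ i → V K (f i)) → Σ M f ≋ Σ L f
    Σ-tail {L} {M} f L≤M v = ≋-trans (≋-reflexive (trans (cong (λ z → Σ z f) (sym (ℕP.m+[n∸m]≡n L≤M))) (Σ-split L (M ℕ.∸ L) f)))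
      (≋-drop (Σ-V (M ℕ.∸ L) (λ i _ → v (L ℕ.+ i) (ℕP.m≤m+n L i))))

    ≋-setoid : Setoid 0ℓ 0ℓ
    ≋-setoid = record { Carrier = Carrier ; _≈_ = _≋_ ; isEquivalence = record { refl = ≋-refl ; sym = ≋-sym ; trans = ≋-trans } }

    module ≋-Reasoning where
      open import Relation.Binary.Reasoning.Setoid ≋-setoid public

    V-dwork-0 : ∀ j n → n ℕM./ p ≤ j → V 0 (σ ^ j * dwork n)
    V-dwork-0 j n l = V-mono z≤n (V-dwork 0 j n l z≤n)

    -- Either ⌊n/p⌋ ≥ 4K, and the Newton coefficient alone is divisible by p^K, or at least 5K - 4K
    -- = K of the powers of σ survive. Hence the truncation length 5K.
    V-dwork-K : ∀ j n → n ℕM./ p ≤ j → 5 ℕ.* K ≤ j → V K (σ ^ j * dwork n)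
    V-dwork-K j n l b with 4 ℕ.* K ℕP.≤? n ℕM./ p
    ... | yes q = V-mono (ℕP.m≤n+m K _) (V-dwork K j n l (ℕP.≤-trans q (ℕP.m≤n+m _ 3)))
    ... | no q = V-mono (ℕP.≤-trans (ℕP.m+n≤o⇒m≤o∸n K bound) (ℕP.m≤m+n _ 0)) (V-dwork 0 j n l z≤n)
      where
      bound : K ℕ.+ n ℕM./ p ≤ j
      bound = ℕP.≤-trans (ℕP.+-monoʳ-≤ K (ℕP.<⇒≤ (ℕP.≰⇒> q))) b

    -- For a < p - 1, the ϖᵃ-coordinate of Dwork's series at t = ϖ: the indices a + n(p - 1) are
    -- those whose power of ϖ is σⁿ times ϖᵃ.
    T : ℕ → Carrier
    T a = Σ (5 ℕ.* K) (λ n → σ ^ n * dwork (a ℕ.+ n ℕ.* e))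

    index-bound : ∀ a s n → a < p → (s ℕ.* p ℕ.+ (a ℕ.+ n ℕ.* e)) ℕM./ p ≤ s ℕ.+ n
    index-bound a s n a<p = ℕP.≤-pred (ℕM.m<n*o⇒m/o<n {n = suc (s ℕ.+ n)} (ℕP.≤-trans
      (ℕP.≤-trans (ℕP.≤-reflexive (sym (ℕP.+-suc (s ℕ.* p) (a ℕ.+ n ℕ.* e)))) (ℕP.+-monoʳ-≤ (s ℕ.* p) (ℕP.+-mono-≤ a<p (ℕP.*-monoʳ-≤ n (ℕP.n≤1+n e)))))
      (ℕP.≤-reflexive (l s n p))))
      where
      l : ∀ s n p → s ℕ.* p ℕ.+ (p ℕ.+ n ℕ.* p) ≡ suc (s ℕ.+ n) ℕ.* p
      l = solveℕ-∀

    V-T : ∀ a → a < p → V 0 (T a)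
    V-T a a<p = Σ-V (5 ℕ.* K) (λ n _ → V-dwork-0 n (a ℕ.+ n ℕ.* e) (index-bound a 0 n a<p))

    T-extend : ∀ L a → a < p → 5 ℕ.* K ≤ L → Σ L (λ n → σ ^ n * dwork (a ℕ.+ n ℕ.* e)) ≋ T a
    T-extend L a a<p l = Σ-tail _ l (λ n q → V-dwork-K n (a ℕ.+ n ℕ.* e) (index-bound a 0 n a<p) q)

    -- Summation by parts against the weights (k₀ - n)(k₀ - n - 1)… turns the
    -- diagonal sum T a into the Newton expansion of Γ⁻ at a + p k₀.
    module Telescope (a : ℕ) (a<p : a < p) (k₀ : ℕ) (k₀-cong : V K (n̂ a + n̂ e * n̂ k₀)) where

      -- A two-dimensional array whose row s = 0 consists of the terms of `T a` and whose column n =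
      -- 0 consists of the Newton coefficients `H̃ a s`. The argument moves the sum from the row to
      -- the column.
      R : ℕ → ℕ → Carrier
      R s n = σ ^ (s ℕ.+ n) * dwork (s ℕ.* p ℕ.+ (a ℕ.+ n ℕ.* e))

      V-R : ∀ s n → V 0 (R s n)
      V-R s n = V-dwork-0 (s ℕ.+ n) (s ℕ.* p ℕ.+ (a ℕ.+ n ℕ.* e)) (index-bound a s n a<p)

      V-R-K : ∀ s n → 5 ℕ.* K ≤ s ℕ.+ n → V K (R s n)
      V-R-K s n = V-dwork-K (s ℕ.+ n) (s ℕ.* p ℕ.+ (a ℕ.+ n ℕ.* e)) (index-bound a s n a<p)

      N : ℕ → ℕ → ℕ
      N s n = suc s ℕ.* p ℕ.+ (a ℕ.+ n ℕ.* e)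

      -- Dwork's recursion at the index N = `N s n`: here N - 1 and N - p are the indices of
      -- `R s (n + 1)` and `R s n`.
      R-step : ∀ s n → R s (suc n) ≡ π * R s n + n̂ (N s n) * R (suc s) n
      R-step s n = begin
        σ ^ (s ℕ.+ suc n) * dwork m
          ≡⟨ cong₂ (λ x y → σ ^ x * y) (ℕP.+-suc s n) eq ⟩
        σ ^ suc (s ℕ.+ n) * (n̂ (N s n) * dwork (N s n) + - dwork m₀)
          ≡⟨ solve 5 (λ π t N d d₀ → :- π :* t :* (N :* d :+ :- d₀) := π :* (t :* d₀) :+ N :* (:- π :* t :* d)) refl π (σ ^ (s ℕ.+ n)) (n̂ (N s n)) (dwork (N s n)) (dwork m₀) ⟩
        π * R s n + n̂ (N s n) * R (suc s) n ∎
        where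
        open ≡-Reasoning
        m = s ℕ.* p ℕ.+ (a ℕ.+ suc n ℕ.* e)
        m₀ = s ℕ.* p ℕ.+ (a ℕ.+ n ℕ.* e)
        e₁ : N s n ≡ suc m
        e₁ = l s a n e
          where
          l : ∀ s a n e → suc s ℕ.* suc e ℕ.+ (a ℕ.+ n ℕ.* e) ≡ suc (s ℕ.* suc e ℕ.+ (a ℕ.+ suc n ℕ.* e))
          l = solveℕ-∀
        eq : dwork m ≡ n̂ (N s n) * dwork (N s n) + - dwork m₀
        eq = sym (begin
          n̂ (N s n) * dwork (N s n) + - dwork m₀
            ≡⟨ cong (_+ - dwork m₀) (step dwork-isExp (N s n)) ⟩
          1# * sh dwork (N s n) + 1# * sh^ p dwork (N s n) + - dwork m₀
            ≡⟨ cong₂ (λ x y → x + y + - dwork m₀) (trans (*-identityˡ _) (cong (sh dwork) e₁)) (trans (*-identityˡ _) (trans (cong (sh^ p dwork) (ℕP.+-assoc p (s ℕ.* p) _)) (sh^-above p dwork m₀))) ⟩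
          dwork m + dwork m₀ + - dwork m₀
            ≡⟨ solve 2 (λ x y → x :+ y :+ :- y := x) refl _ _ ⟩
          dwork m ∎)

      v w : ℕ → ℕ → ℤ
      v s n = fall (pos k₀ ℤ.- pos n) s
      w s n = v s n ℤ.- pos p ℤ.* v s (suc n)

      -- Here the choice of k₀ acts: a + (p - 1)k₀ ≡ 0, so the last factor is `N s n` modulo p^K,
      -- precisely the coefficient that `R-step` brings in.
      w-suc : ∀ s n → w (suc s) n ≡ v s (suc n) ℤ.* (pos (N s n) ℤ.- (pos a ℤ.+ pos e ℤ.* pos k₀))
      w-suc s n = begin
        v (suc s) n ℤ.- pos p ℤ.* v (suc s) (suc n)
          ≡⟨ cong (λ z → z ℤ.- pos p ℤ.* v (suc s) (suc n)) (trans (fall-front (pos k₀ ℤ.- pos n) s) (cong (λ z → (pos k₀ ℤ.- pos n) ℤ.* fall z s) (l₀ (pos k₀) (pos n)))) ⟩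
        (pos k₀ ℤ.- pos n) ℤ.* x ℤ.- pos p ℤ.* (x ℤ.* (pos k₀ ℤ.- pos (suc n) ℤ.- pos s))
          ≡⟨ l₁ (pos k₀) (pos n) x (pos e) (pos s) (pos a) ⟩
        x ℤ.* ((pos 1 ℤ.+ pos s) ℤ.* (pos 1 ℤ.+ pos e) ℤ.+ (pos a ℤ.+ pos n ℤ.* pos e) ℤ.- (pos a ℤ.+ pos e ℤ.* pos k₀))
          ≡⟨ cong (λ z → x ℤ.* (z ℤ.- (pos a ℤ.+ pos e ℤ.* pos k₀))) (sym eq) ⟩
        x ℤ.* (pos (N s n) ℤ.- (pos a ℤ.+ pos e ℤ.* pos k₀)) ∎
        where
        open ≡-Reasoning
        x = v s (suc n)
        l₀ : ∀ k n → k ℤ.- n ℤ.- pos 1 ≡ k ℤ.- (pos 1 ℤ.+ n)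
        l₀ = solve-∀
        l₁ : ∀ k n x e s a → (k ℤ.- n) ℤ.* x ℤ.- (pos 1 ℤ.+ e) ℤ.* (x ℤ.* (k ℤ.- (pos 1 ℤ.+ n) ℤ.- s)) ≡ x ℤ.* ((pos 1 ℤ.+ s) ℤ.* (pos 1 ℤ.+ e) ℤ.+ (a ℤ.+ n ℤ.* e) ℤ.- (a ℤ.+ e ℤ.* k))
        l₁ = solve-∀
        eq : pos (N s n) ≡ (pos 1 ℤ.+ pos s) ℤ.* (pos 1 ℤ.+ pos e) ℤ.+ (pos a ℤ.+ pos n ℤ.* pos e)
        eq = trans (ℤP.pos-+ (suc s ℕ.* p) (a ℕ.+ n ℕ.* e)) (cong₂ ℤ._+_ (ℤP.pos-* (suc s) p) (trans (ℤP.pos-+ a (n ℕ.* e)) (cong (λ z → pos a ℤ.+ z) (ℤP.pos-* n e))))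

      L : ℕ
      L = 5 ℕ.* K

      weighted : ℕ → Carrier
      weighted s = Σ L (λ n → ι (w s n) * R s n)

      -- Replacing p · `R s n` by means of `R-step` splits each weighted term into a telescoping
      -- difference of v s n · R s n and a term of level s + 1. The far boundary term vanishes
      -- modulo p^K since it sits at n = 5K.
      parts : ∀ s → weighted s ≋ ι (v s 0) * R s 0 + weighted (suc s)
      parts s = begin
        weighted s
          ≡⟨ Σ-cong L (λ n → trans (cong (_* R s n) (trans (ι-+ (v s n) (ℤ.- (pos p ℤ.* v s (suc n)))) (cong (_+_ (ι (v s n))) (trans (ι-neg (pos p ℤ.* v s (suc n))) (cong -_ (ι-* (pos p) (v s (suc n)))))))) (l₁ n)) ⟩
        Σ L (λ n → x n + (- x (suc n) + y n))
          ≡⟨ trans (Σ-+ L _ _) (cong (_+_ (Σ L x)) (Σ-+ L _ y)) ⟩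
        Σ L x + (Σ L (λ n → - x (suc n)) + Σ L y)
          ≡⟨ cong (λ z → Σ L x + (z + Σ L y)) (Σ-neg L (x ∘ suc)) ⟩
        Σ L x + (- Σ L (x ∘ suc) + Σ L y)
          ≡⟨ solve 5 (λ S T Y a b → S :+ (:- T :+ Y) := a :+ Y :+ ((S :+ b) :+ :- (a :+ T) :+ :- b)) refl (Σ L x) (Σ L (x ∘ suc)) (Σ L y) (x 0) (x L) ⟩
        x 0 + Σ L y + (Σ (suc L) x + - (x 0 + Σ L (x ∘ suc)) + - x L)
          ≡⟨ cong (λ z → x 0 + Σ L y + (z + - (x 0 + Σ L (x ∘ suc)) + - x L)) (Σ-front L x) ⟩
        x 0 + Σ L y + ((x 0 + Σ L (x ∘ suc)) + - (x 0 + Σ L (x ∘ suc)) + - x L)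
          ≡⟨ cong (_+_ (x 0 + Σ L y)) (trans (cong (_+ - x L) (-‿inverseʳ _)) (+-identityˡ _)) ⟩
        x 0 + Σ L y + - x L
          ≈⟨ ≋-drop (V-neg (V-*ˡ (V-ι (v s L)) (V-R-K s L (ℕP.m≤n+m L s)))) ⟩
        x 0 + Σ L y
          ≈⟨ ≋-+ ≋-refl (Σ-≋ L (λ n _ → l₂ n)) ⟩
        x 0 + weighted (suc s) ∎
        where
        open ≋-Reasoning
        x y : ℕ → Carrier
        x n = ι (v s n) * R s n
        y n = ι (v s (suc n)) * (n̂ (N s n) * R (suc s) n)
        l₁ : ∀ n → (ι (v s n) + - (π * ι (v s (suc n)))) * R s n ≡ x n + (- x (suc n) + y n)
        l₁ n = trans (solve 6 (λ a b π r N r′ → (a :+ :- (π :* b)) :* r := a :* r :+ (:- (b :* (π :* r :+ N :* r′)) :+ b :* (N :* r′))) refl (ι (v s n)) (ι (v s (suc n))) π (R s n) (n̂ (N s n)) (R (suc s) n))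
          (cong (λ z → x n + (- (ι (v s (suc n)) * z) + y n)) (sym (R-step s n)))
        l₂ : ∀ n → y n ≋ ι (w (suc s) n) * R (suc s) n
        l₂ n = ≋[ subst (V K) eq (V-*ʳ (V-*ˡ (V-ι (v s (suc n))) k₀-cong) (V-R (suc s) n)) ]
          where
          eq : ι (v s (suc n)) * (n̂ a + n̂ e * n̂ k₀) * R (suc s) n ≡ y n - ι (w (suc s) n) * R (suc s) n
          eq = trans (solve 4 (λ v c N r → v :* c :* r := v :* (N :* r) :+ :- (v :* (N :+ :- c) :* r)) refl (ι (v s (suc n))) (n̂ a + n̂ e * n̂ k₀) (n̂ (N s n)) (R (suc s) n))
            (cong (λ z → y n - z * R (suc s) n) (sym (trans (cong ι (w-suc s n)) (trans (ι-* (v s (suc n)) _) (cong (ι (v s (suc n)) *_) (trans (ι-+ (pos (N s n)) _) (cong (_+_ (n̂ (N s n))) (trans (ι-neg (pos a ℤ.+ pos e ℤ.* pos k₀)) (cong -_ (trans (ι-+ (pos a) _) (cong (_+_ (n̂ a)) (ι-* (pos e) (pos k₀)))))))))))))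

      iterate : ∀ S → weighted 0 ≋ Σ S (λ s → ι (v s 0) * R s 0) + weighted S
      iterate zero = ≋-reflexive (sym (+-identityˡ _))
      iterate (suc S) = ≋-trans (iterate S) (≋-trans (≋-+ ≋-refl (parts S)) (≋-reflexive (sym (+-assoc _ _ _))))

      R-0 : ∀ s → R s 0 ≡ H̃ a s
      R-0 s = begin
        σ ^ (s ℕ.+ 0) * dwork (s ℕ.* p ℕ.+ (a ℕ.+ 0))
          ≡⟨ cong₂ (λ x y → σ ^ x * dwork y) (ℕP.+-identityʳ s) (trans (cong (s ℕ.* p ℕ.+_) (ℕP.+-identityʳ a)) (ℕP.+-comm (s ℕ.* p) a)) ⟩
        σ ^ s * dwork (a ℕ.+ s ℕ.* p) ≡⟨ cong (σ ^ s *_) (dwork-offset a s a<p) ⟩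
        σ ^ s * (ρ ^ s * H̃ a s) ≡⟨ sym (*-assoc _ _ _) ⟩
        σ ^ s * ρ ^ s * H̃ a s ≡⟨ trans (cong (_* H̃ a s) (σ^ρ^ s)) (*-identityˡ _) ⟩
        H̃ a s ∎
        where open ≡-Reasoning

      -- On level 0 the weight is constantly 1 - p, which explains the factor. What the iteration
      -- leaves in column 0 is the Newton expansion of `H a` at k₀.
      T-Γ⁻ : (1# - π) * T a ≋ Γ⁻ (a ℕ.+ k₀ ℕ.* p)
      T-Γ⁻ = begin
        (1# - π) * T a ≡⟨ trans (Σ-*ˡ L (1# - π) _) (Σ-cong L (λ n → cong (_* R 0 n) w0)) ⟩
        weighted 0 ≈⟨ iterate L ⟩
        Σ L (λ s → ι (v s 0) * R s 0) + weighted L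
          ≈⟨ ≋-drop (Σ-V L (λ n _ → V-*ˡ (V-ι (w L n)) (V-R-K L n (ℕP.m≤m+n L n)))) ⟩
        Σ L (λ s → ι (v s 0) * R s 0)
          ≡⟨ Σ-cong L (λ s → cong₂ (λ x y → ι (fall x s) * y) (ℤP.+-identityʳ (pos k₀)) (R-0 s)) ⟩
        Σ L (λ s → ι (fall (pos k₀) s) * H̃ a s)
          ≈⟨ ≋-sym (Σ-tail _ (ℕP.m≤m+n L (suc k₀)) (λ s l → V-*ˡ (V-ι (fall (pos k₀) s)) (V-H̃ K s a a<p (ℕP.≤-trans (ℕP.*-monoˡ-≤ K {4} {5} (s≤s (s≤s (s≤s (s≤s z≤n))))) (ℕP.≤-trans l (ℕP.m≤n+m s 3)))))) ⟩
        Σ (L ℕ.+ suc k₀) (λ s → ι (fall (pos k₀) s) * H̃ a s)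
          ≡⟨ sym (newton k₀ (H a) (L ℕ.+ suc k₀) (ℕP.m≤n+m (suc k₀) L)) ⟩
        Γ⁻ (a ℕ.+ k₀ ℕ.* p) ∎
        where
        open ≋-Reasoning
        w0 : 1# - π ≡ ι (pos 1 ℤ.- pos p ℤ.* pos 1)
        w0 = sym (trans (ι-+ (pos 1) _) (cong₂ _+_ ι-1 (trans (ι-neg (pos p ℤ.* pos 1)) (cong (λ z → - ι z) (ℤP.*-identityʳ (pos p))))))

    -- In the Newton expansion at k₀ = j p^K′ each term with s ≥ 1 has the factor k₀ from the
    -- falling factorial and one more factor p from the coefficient.
    Γ⁻-period : ∀ K′ j → K ≡ suc K′ → Γ⁻ (j ℕ.* p ℕ.^ K′ ℕ.* p) ≋ 1#
    Γ⁻-period K′ j refl = begin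
      H 0 k₀ ≡⟨ newton k₀ (H 0) (suc k₀) ℕP.≤-refl ⟩
      Σ (suc k₀) t ≡⟨ Σ-front k₀ t ⟩
      t 0 + Σ k₀ (t ∘ suc) ≈⟨ ≋-drop (Σ-V k₀ (λ s _ → small s)) ⟩
      t 0 ≡⟨ trans (cong₂ _*_ ι-1 (*-identityʳ 1#)) (*-identityˡ 1#) ⟩
      1# ∎
      where
      open ≋-Reasoning
      k₀ = j ℕ.* p ℕ.^ K′
      t : ℕ → Carrier
      t s = ι (fall (pos k₀) s) * H̃ 0 s
      small : ∀ s → V (suc K′) (t (suc s))
      small s = subst (λ z → V z (t (suc s))) (ℕP.+-comm K′ 1) (V-* (subst (V K′) (cong ι eq) (V-ι∣ K′ (pos j ℤ.* fall (pos k₀ ℤ.- pos 1) s))) (V-H̃ 1 (suc s) 0 (s≤s z≤n) (s≤s (s≤s (s≤s (s≤s z≤n))))))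
        where
        l : ∀ a b c → a ℤ.* (b ℤ.* c) ≡ b ℤ.* a ℤ.* c
        l = solve-∀
        eq : pos (p ℕ.^ K′) ℤ.* (pos j ℤ.* fall (pos k₀ ℤ.- pos 1) s) ≡ fall (pos k₀) (suc s)
        eq = trans (l (pos (p ℕ.^ K′)) (pos j) (fall (pos k₀ ℤ.- pos 1) s)) (trans (cong (ℤ._* fall (pos k₀ ℤ.- pos 1) s) (sym (ℤP.pos-* j (p ℕ.^ K′)))) (sym (fall-front (pos k₀) s)))

-- The addition law of the additive character, coordinate by coordinate.

module AdditiveCharacters where

  open FiniteSums
  open ExponentialSequences
  open Congruences
  open PadicGamma
  open DworkSums

  module AdditiveCharacter (F : ℚ-Algebra) {e h : ℕ} (P : OddPrime e h) (K : ℕ) where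

    open GammaSums F P K public
    open Solver
    open M using (p; Unit)

    μ : ℕ → ℕ
    μ n = n ℕM./ e

    μ-lower : ∀ k n → k ℕ.* e ≤ n → k ≤ μ n
    μ-lower k n l = subst (_≤ μ n) (ℕM.m*n/n≡m k e) (ℕM./-monoˡ-≤ e l)

    μ-+ : ∀ m n → μ m ℕ.+ μ n ≤ μ (m ℕ.+ n)
    μ-+ m n = μ-lower (μ m ℕ.+ μ n) (m ℕ.+ n) (subst (_≤ m ℕ.+ n) (sym (ℕP.*-distribʳ-+ e (μ m) (μ n))) (ℕP.+-mono-≤ (ℕM.m/n*n≤m m e) (ℕM.m/n*n≤m n e)))

    -- χ c N is the coefficient of ϖᶜ in ϖᴺ, where ϖᵉ = -p and c < e.
    χ : ℕ → ℕ → Carrier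
    χ c N with N ℕM.% e ℕ.≟ c
    ... | yes _ = σ ^ μ N
    ... | no _ = 0#

    χ-yes : ∀ c N → N ℕM.% e ≡ c → χ c N ≡ σ ^ μ N
    χ-yes c N q with N ℕM.% e ℕ.≟ c
    ... | yes _ = refl
    ... | no n = ⊥-elim (n q)

    χ-no : ∀ c N → N ℕM.% e ≢ c → χ c N ≡ 0#
    χ-no c N q with N ℕM.% e ℕ.≟ c
    ... | yes y = ⊥-elim (q y)
    ... | no _ = refl

    χ-shift : ∀ c k N → χ c (N ℕ.+ k ℕ.* e) ≡ σ ^ k * χ c N
    χ-shift c k N with N ℕM.% e ℕ.≟ c
    ... | yes y = trans (χ-yes c (N ℕ.+ k ℕ.* e) (trans (ℕM.[m+kn]%n≡m%n N k e) y))
        (trans (cong (σ ^_) (trans (ℕM.+-distrib-/-∣ʳ N (ℕD.n∣m*n k)) (trans (cong (μ N ℕ.+_) (ℕM.m*n/n≡m k e)) (ℕP.+-comm (μ N) k)))) (^-+ σ k (μ N)))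
    ... | no n = trans (χ-no c (N ℕ.+ k ℕ.* e) (λ y → n (trans (sym (ℕM.[m+kn]%n≡m%n N k e)) y))) (sym (zeroʳ _))

    -- The divisibility that coordinates of the powers of ϖ have; it is stable under the shifts that
    -- appear when one variable is summed at a time.
    Kernel : (ℕ → Carrier) → Set
    Kernel X = ∀ N → V (μ N) (X N)

    χ-kernel : ∀ c → Kernel (χ c)
    χ-kernel c N with N ℕM.% e ℕ.≟ c
    ... | yes _ = subst (V (μ N)) (*-identityʳ _) (V-σ^ (μ N) V-1)
    ... | no _ = V-0

    -- Control of the value at ϖ: the entries f n may have denominators, but their product with ϖⁿ,
    -- rounded down to a power of σ, is integral and is negligible from b on.
    record Bounded (b : ℕ) (f : ℕ → Carrier) : Set where
      constructor bounded
      field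
        integral : ∀ n → V 0 (σ ^ μ n * f n)
        vanish : ∀ n → b ≤ n → V K (σ ^ μ n * f n)
    open Bounded

    σ^ρ^-cancel : ∀ j x → σ ^ j * (ρ ^ j * x) ≡ x
    σ^ρ^-cancel j x = trans (sym (*-assoc _ _ _)) (trans (cong (_* x) (σ^ρ^ j)) (*-identityˡ x))

    V-over : ∀ j {k x} → V (j ℕ.+ k) x → V k (ρ ^ j * x)
    V-over j {k} {x} v = V-cancel-σ^ j (subst (V (j ℕ.+ k)) (sym (σ^ρ^-cancel j x)) v)

    regroup : ∀ j y x → (σ ^ j * y) * (ρ ^ j * x) ≡ y * x
    regroup j y x = trans (solve 4 (λ s y r x → (s :* y) :* (r :* x) := (s :* r) :* (y :* x)) refl (σ ^ j) y (ρ ^ j) x) (trans (cong (_* (y * x)) (σ^ρ^ j)) (*-identityˡ _))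

    kernel-shift : ∀ {X} → Kernel X → ∀ n {k y} → V k (σ ^ μ n * y) → ∀ m → V (k ℕ.+ μ m) (y * X (n ℕ.+ m))
    kernel-shift {X} kx n {k} {y} v m = subst (V (k ℕ.+ μ m)) (regroup (μ n) y (X (n ℕ.+ m))) (V-* v (V-over (μ n) (V-mono (μ-+ n m) (kx (n ℕ.+ m)))))

    kernel-* : ∀ {j X g k} m → V (j ℕ.+ μ m) X → V k (σ ^ μ m * g) → V (j ℕ.+ k) (X * g)
    kernel-* {j} {X} {g} {k} m vx vg = subst (V (j ℕ.+ k)) (trans (*-comm _ _) (trans (regroup (μ m) g X) (*-comm _ _)))
      (V-* (V-over (μ m) (subst (λ z → V z X) (ℕP.+-comm j (μ m)) vx)) vg)

    conv-closed : (Q : Carrier → Set) → (∀ {x y} → Q x → Q y → Q (x + y)) → ∀ N {f g} → (∀ n m → n ℕ.+ m ≡ N → Q (f n * g m)) → Q (conv f g N)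
    conv-closed Q _⊕_ zero q = q 0 0 refl
    conv-closed Q _⊕_ (suc N) q = q 0 (suc N) refl ⊕ conv-closed Q _⊕_ N (λ n m s → q (suc n) m (cong suc s))

    split-≤ : ∀ {a b n m} → a ℕ.+ b ≤ n ℕ.+ m → a ≤ n ⊎ b ≤ m
    split-≤ {a} {b} {n} {m} l with a ℕP.≤? n
    ... | yes q = inj₁ q
    ... | no q = inj₂ (ℕP.≮⇒≥ (λ m<b → ℕP.<-irrefl refl (ℕP.≤-trans (ℕP.+-mono-<-≤ (ℕP.≰⇒> q) (ℕP.<⇒≤ m<b)) l)))

    Bounded-conv : ∀ {b b′ f g} → Bounded b f → Bounded b′ g → Bounded (b ℕ.+ b′) (conv f g)
    Bounded-conv {b} {b′} {f} {g} F₁ G₁ = bounded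
      (λ N → conv-closed (λ x → V 0 (σ ^ μ N * x)) add N (λ n m q → term q (integral F₁ n) (integral G₁ m)))
      (λ N l → conv-closed (λ x → V K (σ ^ μ N * x)) add N (λ n m q → case split-≤ {b} {b′} {n} {m} (subst (b ℕ.+ b′ ≤_) (sym q) l) of λ
        { (inj₁ l₁) → subst (λ z → V z _) (ℕP.+-identityʳ K) (term q (vanish F₁ n l₁) (integral G₁ m))
        ; (inj₂ l₂) → term q (integral F₁ n) (vanish G₁ m l₂) }))
      where
      add : ∀ {k N x y} → V k (σ ^ μ N * x) → V k (σ ^ μ N * y) → V k (σ ^ μ N * (x + y))
      add {k} v w = subst (V k) (sym (distribˡ _ _ _)) (V-+ v w)
      term : ∀ {j k n m N} → n ℕ.+ m ≡ N → V j (σ ^ μ n * f n) → V k (σ ^ μ m * g m) → V (j ℕ.+ k) (σ ^ μ N * (f n * g m))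
      term {j} {k} {n} {m} refl v w = subst (V (j ℕ.+ k)) eq (V-drop d (V-σ^+ d (V-* v w)))
        where
        d = μ (n ℕ.+ m) ℕ.∸ (μ n ℕ.+ μ m)
        eq : σ ^ d * ((σ ^ μ n * f n) * (σ ^ μ m * g m)) ≡ σ ^ μ (n ℕ.+ m) * (f n * g m)
        eq = trans (solve 5 (λ d a f b g → d :* ((a :* f) :* (b :* g)) := d :* (a :* b) :* (f :* g)) refl _ _ _ _ _)
          (cong (_* (f n * g m)) (trans (cong (σ ^ d *_) (sym (^-+ σ (μ n) (μ m)))) (trans (sym (^-+ σ d (μ n ℕ.+ μ m))) (cong (σ ^_) (ℕP.m∸n+n≡m (μ-+ n m))))))

    -- By `Σ-conv` the left side runs over the triangle n + m < B. In the rest of the square n + m ≥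
    -- b + b′, so n ≥ b or m ≥ b′ and one factor is negligible. On a square each index can be
    -- collapsed by itself.
    box : ∀ {b b′ f g X} B → Kernel X → Bounded b f → Bounded b′ g → b ℕ.+ b′ ≤ B →
      Σ B (λ N → X N * conv f g N) ≋ Σ B (λ n → Σ B (λ m → f n * X (n ℕ.+ m) * g m))
    box {b} {b′} {f} {g} {X} B kx F₁ G₁ l = ≋-trans (≋-reflexive (Σ-conv B X f g)) (Σ-≋ B (λ n n<B →
        ≋-sym (Σ-tail _ (ℕP.m∸n≤m B n) (λ m q → far n m (ℕP.≤-trans l (ℕP.≤-trans (ℕP.≤-reflexive (sym (ℕP.m+[n∸m]≡n (ℕP.<⇒≤ n<B)))) (ℕP.+-monoʳ-≤ n q)))))))
      where
      far : ∀ n m → b ℕ.+ b′ ≤ n ℕ.+ m → V K (f n * X (n ℕ.+ m) * g m)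
      far n m q with split-≤ {b} {b′} {n} {m} q
      ... | inj₁ l₁ = subst (λ z → V z (f n * X (n ℕ.+ m) * g m)) (ℕP.+-identityʳ K) (kernel-* {K} m (kernel-shift kx n (vanish F₁ n l₁) m) (integral G₁ m))
      ... | inj₂ l₂ = kernel-* {0} m (kernel-shift kx n (integral F₁ n) m) (vanish G₁ m l₂)

    box₃ : ∀ {b b′ b″ f g k X} B → Kernel X → Bounded b f → Bounded b′ g → Bounded b″ k → b ℕ.+ (b′ ℕ.+ b″) ≤ B →
      Σ B (λ N → X N * conv f (conv g k) N) ≋ Σ B (λ n → Σ B (λ m → Σ B (λ l → g m * (f n * X (n ℕ.+ (m ℕ.+ l))) * k l)))
    box₃ {b} B kx F₁ G₁ K₁ l = ≋-trans (box B kx F₁ (Bounded-conv G₁ K₁) l)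
      (Σ-≋ B (λ n _ → box B (kernel-shift kx n (integral F₁ n)) G₁ K₁ (ℕP.≤-trans (ℕP.m≤n+m _ b) l)))

    -- Of the n factors p in σⁿ the factorial removes at most n/4, so at least half remain.
    V-div! : ∀ κ n → κ ℕ.+ κ ≤ n → V κ (σ ^ n * recip! n)
    V-div! κ n l with n!-valuation n
    ... | v , u , uu , 4v≤n , eq = V-cancel-unit u uu (subst (V κ) eq′ (V-mono bound (subst (V (n ℕ.∸ v)) (*-identityʳ _) (V-σ^ (n ℕ.∸ v) V-1))))
      where
      v≤n : v ≤ n
      v≤n = ℕP.≤-trans (ℕP.m≤n*m v 4) 4v≤n
      l₁ : ∀ κ v → 4 ℕ.* (κ ℕ.+ v) ≡ (κ ℕ.+ κ) ℕ.+ (κ ℕ.+ κ) ℕ.+ 4 ℕ.* v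
      l₁ = solveℕ-∀
      l₂ : ∀ n → n ℕ.+ n ℕ.+ n ℕ.+ n ≡ 4 ℕ.* n
      l₂ = solveℕ-∀
      bound : κ ≤ n ℕ.∸ v
      bound = ℕP.m+n≤o⇒m≤o∸n κ (ℕP.*-cancelˡ-≤ 4 (subst (_≤ 4 ℕ.* n) (sym (l₁ κ v)) (ℕP.≤-trans (ℕP.+-mono-≤ (ℕP.+-mono-≤ l l) 4v≤n) (ℕP.≤-trans (ℕP.m≤m+n _ n) (ℕP.≤-reflexive (l₂ n))))))
      open ≡-Reasoning
      eq′ : σ ^ (n ℕ.∸ v) ≡ ι u * (σ ^ n * recip! n)
      eq′ = begin
        σ ^ (n ℕ.∸ v) ≡⟨ sym (trans (cong (σ ^ (n ℕ.∸ v) *_) (n!-recip! n)) (*-identityʳ _)) ⟩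
        σ ^ (n ℕ.∸ v) * (n! n * recip! n) ≡⟨ cong (λ z → σ ^ (n ℕ.∸ v) * (z * recip! n)) eq ⟩
        σ ^ (n ℕ.∸ v) * (ι u * σ ^ v * recip! n) ≡⟨ solve 4 (λ a u b r → a :* (u :* b :* r) := u :* ((a :* b) :* r)) refl _ _ _ _ ⟩
        ι u * ((σ ^ (n ℕ.∸ v) * σ ^ v) * recip! n) ≡⟨ cong (λ z → ι u * (z * recip! n)) (trans (sym (^-+ σ (n ℕ.∸ v) v)) (cong (σ ^_) (ℕP.m∸n+n≡m v≤n))) ⟩
        ι u * (σ ^ n * recip! n) ∎

    V-^ : ∀ n {x} → V 0 x → V 0 (x ^ n)
    V-^ zero v = V-1
    V-^ (suc n) v = V-*ˡ v (V-^ n v)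

    sh^-pow : ∀ k f x n → sh^ k f n * x ^ n ≡ x ^ k * sh^ k (λ i → f i * x ^ i) n
    sh^-pow zero f x n = sym (*-identityˡ _)
    sh^-pow (suc k) f x zero = trans (zeroˡ _) (sym (zeroʳ _))
    sh^-pow (suc k) f x (suc n) = trans (solve 3 (λ s x y → s :* (x :* y) := x :* (s :* y)) refl _ _ _) (trans (cong (x *_) (sh^-pow k f x n)) (sym (*-assoc _ _ _)))

    dwork^ : Carrier → ℕ → Carrier
    dwork^ x n = dwork n * x ^ n

    dwork^-isExp : ∀ x → IsExp p x (x ^ p) (dwork^ x)
    dwork^-isExp x = record
      { start = trans (*-identityʳ _) (start dwork-isExp)
      ; step = λ n → begin
          n̂ n * (dwork n * x ^ n) ≡⟨ sym (*-assoc _ _ _) ⟩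
          n̂ n * dwork n * x ^ n ≡⟨ cong (_* x ^ n) (trans (step dwork-isExp n) (cong₂ _+_ (*-identityˡ _) (*-identityˡ _))) ⟩
          (sh dwork n + sh^ p dwork n) * x ^ n ≡⟨ distribʳ _ _ _ ⟩
          sh dwork n * x ^ n + sh^ p dwork n * x ^ n ≡⟨ cong₂ _+_ (trans (sh^-pow 1 dwork x n) (cong (_* sh (dwork^ x) n) (*-identityʳ x))) (sh^-pow p dwork x n) ⟩
          x * sh (dwork^ x) n + x ^ p * sh^ p (dwork^ x) n ∎
      }
      where open ≡-Reasoning

    p/≤μ : ∀ n → n ℕM./ p ≤ μ n
    p/≤μ n = ℕM./-monoʳ-≤ n (ℕP.n≤1+n e)

    dwork^-bounded : ∀ {x} → V 0 x → Bounded (4 ℕ.* K ℕ.* p) (dwork^ x)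
    dwork^-bounded {x} vx = bounded
      (λ n → subst (V 0) (*-assoc _ _ _) (V-*ʳ (V-dwork-0 (μ n) n (p/≤μ n)) (V-^ n vx)))
      (λ n l → subst (V K) (*-assoc _ _ _) (V-*ʳ (V-mono (ℕP.m≤n+m K _) (V-dwork K (μ n) n (p/≤μ n) (ℕP.≤-trans (lower n l) (ℕP.m≤n+m _ 3)))) (V-^ n vx)))
      where
      lower : ∀ n → 4 ℕ.* K ℕ.* p ≤ n → 4 ℕ.* K ≤ n ℕM./ p
      lower n l = subst (_≤ n ℕM./ p) (ℕM.m*n/n≡m (4 ℕ.* K) p) (ℕM./-monoˡ-≤ p l)

    expSeq : Carrier → ℕ → Carrier
    expSeq s n = s ^ n * recip! n

    expSeq-isExp : ∀ s → IsExp p s 0# (expSeq s)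
    expSeq-isExp s = record { start = *-identityˡ _ ; step = go }
      where
      go : ∀ n → θ (expSeq s) n ≡ s * sh (expSeq s) n + 0# * sh^ p (expSeq s) n
      go zero = trans (trans (cong (_* expSeq s 0) ι-0) (zeroˡ _)) (sym (trans (cong₂ _+_ (zeroʳ _) (zeroˡ _)) (+-identityˡ _)))
      go (suc n) = trans (solve 4 (λ n s t r → n :* (s :* t :* r) := s :* (t :* (n :* r))) refl (n̂ (suc n)) s (s ^ n) (recip! (suc n)))
        (trans (cong (λ z → s * (s ^ n * z)) (suc-recip! n)) (sym (trans (cong (_+_ (s * expSeq s n)) (zeroˡ _)) (+-identityʳ _))))

    V-expSeq : ∀ κ n {x} → V 0 x → κ ℕ.+ κ ≤ n → V κ (expSeq (σ * x) n)
    V-expSeq κ n {x} vx l = subst (V κ) (trans (solve 3 (λ a r b → a :* r :* b := (a :* b) :* r) refl _ _ _) (cong (_* recip! n) (sym (*-^ σ x n)))) (V-*ʳ (V-div! κ n l) (V-^ n vx))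

    expSeq-bounded : ∀ {x} → V 0 x → Bounded (K ℕ.+ K) (expSeq (σ * x))
    expSeq-bounded vx = bounded
      (λ n → V-drop (μ n) (V-σ^+ (μ n) (V-expSeq 0 n vx z≤n)))
      (λ n l → V-drop (μ n) (V-σ^+ (μ n) (V-expSeq K n vx l)))

    -- The coefficients of exp(- x tᵖ).
    expSeqᵖ : Carrier → ℕ → Carrier
    expSeqᵖ x n with n ℕM.% p ℕ.≟ 0
    ... | yes _ = expSeq (- x) (n ℕM./ p)
    ... | no _ = 0#

    expSeqᵖ-multiple : ∀ x m → expSeqᵖ x (m ℕ.* p) ≡ expSeq (- x) m
    expSeqᵖ-multiple x m with (m ℕ.* p) ℕM.% p ℕ.≟ 0
    ... | yes _ = cong (expSeq (- x)) (ℕM.m*n/n≡m m p)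
    ... | no n = ⊥-elim (n (ℕM.m*n%n≡0 m p))

    expSeqᵖ-other : ∀ x r m → suc r < p → expSeqᵖ x (suc r ℕ.+ m ℕ.* p) ≡ 0#
    expSeqᵖ-other x r m l with (suc r ℕ.+ m ℕ.* p) ℕM.% p ℕ.≟ 0
    ... | yes y = case trans (sym y) (trans (ℕM.[m+kn]%n≡m%n (suc r) m p) (ℕM.m<n⇒m%n≡m l)) of λ ()
    ... | no _ = refl

    expSeqᵖ-isExp : ∀ x → IsExp p 0# (σ * x) (expSeqᵖ x)
    expSeqᵖ-isExp x = record { start = trans (expSeqᵖ-multiple x 0) (*-identityˡ _) ; step = offset-induction _ go }
      where
      f = expSeqᵖ x
      drop0 : ∀ {a b} c → a ≡ b → a ≡ 0# * c + b
      drop0 c q = trans q (sym (trans (cong (_+ _) (zeroˡ c)) (+-identityˡ _)))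
      go : ∀ r i → r < p → θ f (r ℕ.+ i ℕ.* p) ≡ 0# * sh f (r ℕ.+ i ℕ.* p) + σ * x * sh^ p f (r ℕ.+ i ℕ.* p)
      go zero zero l = drop0 _ (trans (trans (cong (_* f 0) ι-0) (zeroˡ _)) (sym (zeroʳ _)))
      go zero (suc i) l = drop0 _ (begin
        n̂ (suc i ℕ.* p) * f (suc i ℕ.* p) ≡⟨ cong₂ _*_ (n̂-* (suc i) p) (expSeqᵖ-multiple x (suc i)) ⟩
        n̂ (suc i) * π * (- x * (- x) ^ i * recip! (suc i)) ≡⟨ solve 5 (λ n π x t r → n :* π :* (:- x :* t :* r) := :- π :* x :* (t :* (n :* r))) refl (n̂ (suc i)) π x ((- x) ^ i) (recip! (suc i)) ⟩
        σ * x * ((- x) ^ i * (n̂ (suc i) * recip! (suc i))) ≡⟨ cong (λ z → σ * x * ((- x) ^ i * z)) (suc-recip! i) ⟩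
        σ * x * expSeq (- x) i ≡⟨ cong (σ * x *_) (trans (sym (expSeqᵖ-multiple x i)) (sym (sh^-offset 0 i f))) ⟩
        σ * x * sh^ p f (suc i ℕ.* p) ∎)
        where open ≡-Reasoning
      go (suc r) zero l = drop0 _ (trans (trans (cong (n̂ (suc r ℕ.+ 0) *_) (expSeqᵖ-other x r 0 l)) (zeroʳ _))
        (sym (trans (cong (σ * x *_) (sh^-below p f (suc r ℕ.+ 0) (subst (_< p) (sym (ℕP.+-identityʳ (suc r))) l))) (zeroʳ _))))
      go (suc r) (suc i) l = drop0 _ (trans (trans (cong (n̂ (suc r ℕ.+ suc i ℕ.* p) *_) (expSeqᵖ-other x r (suc i) l)) (zeroʳ _))
        (sym (trans (cong (σ * x *_) (trans (sh^-offset (suc r) i f) (expSeqᵖ-other x r i l))) (zeroʳ _))))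

    σ^-expSeq : ∀ m x → σ ^ m * expSeq (- x) m ≡ expSeq (σ * - x) m
    σ^-expSeq m x = trans (sym (*-assoc _ _ _)) (cong (_* recip! m) (sym (*-^ σ (- x) m)))

    expSeqᵖ-bounded : ∀ {x} → V 0 x → Bounded ((K ℕ.+ K) ℕ.* p) (expSeqᵖ x)
    expSeqᵖ-bounded {x} vx = bounded (offset-induction _ (λ r i l → go 0 r i l z≤n)) (offset-induction _ (λ r i l b → go K r i l (bound r i l b)))
      where
      bound : ∀ r i → r < p → (K ℕ.+ K) ℕ.* p ≤ r ℕ.+ i ℕ.* p → K ℕ.+ K ≤ i
      bound r i l b = ℕP.≤-pred (ℕP.*-cancelʳ-< p (K ℕ.+ K) (suc i) (ℕP.≤-trans (s≤s b) (ℕP.+-monoˡ-≤ (i ℕ.* p) l)))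
      go : ∀ κ r i → r < p → κ ℕ.+ κ ≤ i → V κ (σ ^ μ (r ℕ.+ i ℕ.* p) * expSeqᵖ x (r ℕ.+ i ℕ.* p))
      go κ (suc r) i l b = subst (V κ) (sym (trans (cong (σ ^ μ (suc r ℕ.+ i ℕ.* p) *_) (expSeqᵖ-other x r i l)) (zeroʳ _))) V-0
      go κ zero i l b = subst (V κ) (sym eq) (V-drop d (V-σ^+ d (V-expSeq κ i (V-neg vx) b)))
        where
        i≤ : i ≤ μ (i ℕ.* p)
        i≤ = μ-lower i (i ℕ.* p) (ℕP.*-monoʳ-≤ i (ℕP.n≤1+n e))
        d = μ (i ℕ.* p) ℕ.∸ i
        eq : σ ^ μ (i ℕ.* p) * expSeqᵖ x (i ℕ.* p) ≡ σ ^ d * expSeq (σ * - x) i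
        eq = trans (cong₂ _*_ (trans (cong (σ ^_) (sym (ℕP.m∸n+n≡m i≤))) (^-+ σ d i)) (expSeqᵖ-multiple x i)) (trans (*-assoc _ _ _) (cong (σ ^ d *_) (σ^-expSeq i x)))

    -- One factor σx supplies all K powers; the other l factors σ outweigh (l + 1)!, since 4v ≤ l +
    -- 1 implies v ≤ l.
    V-expSeq-small : ∀ {x} → V K (σ * x) → V 0 x → ∀ l → V K (expSeq (σ * x) (suc l))
    V-expSeq-small {x} vK v0 l with n!-valuation (suc l)
    ... | v , u , uu , 4v≤ , eq = V-cancel-unit u uu (V-cancel-σ^ v (subst₂ V refl eq′ (V-mono bound (V-* vK (V-* (subst (V l) (*-identityʳ _) (V-σ^ l V-1)) (V-^ l v0))))))
      where
      open ≡-Reasoning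
      below : ∀ v → 4 ℕ.* v ≤ suc l → v ≤ l
      below zero _ = z≤n
      below (suc v′) q = ℕP.≤-pred (ℕP.≤-trans (s≤s (ℕP.m≤n*m (suc v′) 3)) (ℕP.≤-trans (s≤s (ℕP.m≤n+m (3 ℕ.* suc v′) v′)) q))
      bound : v ℕ.+ K ≤ K ℕ.+ (l ℕ.+ 0)
      bound = ℕP.≤-trans (ℕP.≤-reflexive (ℕP.+-comm v K)) (ℕP.+-monoʳ-≤ K (ℕP.≤-trans (below v 4v≤) (ℕP.m≤m+n l 0)))
      eq′ : σ * x * (σ ^ l * x ^ l) ≡ σ ^ v * (ι u * expSeq (σ * x) (suc l))
      eq′ = begin
        σ * x * (σ ^ l * x ^ l) ≡⟨ cong (σ * x *_) (sym (*-^ σ x l)) ⟩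
        (σ * x) ^ suc l ≡⟨ sym (trans (cong ((σ * x) ^ suc l *_) (n!-recip! (suc l))) (*-identityʳ _)) ⟩
        (σ * x) ^ suc l * (n! (suc l) * recip! (suc l)) ≡⟨ cong (λ z → (σ * x) ^ suc l * (z * recip! (suc l))) eq ⟩
        (σ * x) ^ suc l * (ι u * σ ^ v * recip! (suc l)) ≡⟨ solve 4 (λ a u b r → a :* (u :* b :* r) := b :* (u :* (a :* r))) refl _ _ _ _ ⟩
        σ ^ v * (ι u * expSeq (σ * x) (suc l)) ∎

    Periodic : (ℕ → Carrier) → Set
    Periodic G = ∀ k i → G (k ℕ.* e ℕ.+ i) ≡ σ ^ k * G i

    -- Write n = ke + i: the periodicity of G yields σᵏ, the power of x depends on i alone, and the
    -- sum over k becomes `T i`. The alternative G i = 0 serves an x divisible by p, for which x⁰ =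
    -- 1 and xᵉ disagree.
    collapse : ∀ L x G → 5 ℕ.* K ≤ L → V 0 x → Periodic G → (∀ i → i < e → V 0 (G i)) →
      (∀ k i → i < e → G i ≡ 0# ⊎ x ^ (k ℕ.* e ℕ.+ i) ≋ x ^ i) →
      Σ (L ℕ.* e) (λ n → dwork^ x n * G n) ≋ Σ e (λ i → T i * (x ^ i * G i))
    collapse L x G 5K≤L vx per vG pow = begin
      Σ (L ℕ.* e) (λ n → dwork^ x n * G n)
        ≡⟨ Σ-blocks L e _ ⟩
      Σ L (λ k → Σ e (λ i → dwork^ x (k ℕ.* e ℕ.+ i) * G (k ℕ.* e ℕ.+ i)))
        ≈⟨ Σ-≋ L (λ k _ → Σ-≋ e (λ i i<e → term k i i<e)) ⟩
      Σ L (λ k → Σ e (λ i → σ ^ k * dwork (i ℕ.+ k ℕ.* e) * (x ^ i * G i)))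
        ≡⟨ Σ-swap L e _ ⟩
      Σ e (λ i → Σ L (λ k → σ ^ k * dwork (i ℕ.+ k ℕ.* e) * (x ^ i * G i)))
        ≡⟨ Σ-cong e (λ i → sym (Σ-*ʳ L (x ^ i * G i) _)) ⟩
      Σ e (λ i → Σ L (λ k → σ ^ k * dwork (i ℕ.+ k ℕ.* e)) * (x ^ i * G i))
        ≈⟨ Σ-≋ e (λ i i<e → ≋-*ʳ (V-*ˡ (V-^ i vx) (vG i i<e)) (T-extend L i (ℕP.m<n⇒m<1+n i<e) 5K≤L)) ⟩
      Σ e (λ i → T i * (x ^ i * G i)) ∎
      where
      open ≋-Reasoning
      term : ∀ k i → i < e → dwork^ x (k ℕ.* e ℕ.+ i) * G (k ℕ.* e ℕ.+ i) ≋ σ ^ k * dwork (i ℕ.+ k ℕ.* e) * (x ^ i * G i)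
      term k i i<e = begin
        dwork (k ℕ.* e ℕ.+ i) * x ^ (k ℕ.* e ℕ.+ i) * G (k ℕ.* e ℕ.+ i)
          ≡⟨ trans (cong₂ (λ a b → dwork a * x ^ (k ℕ.* e ℕ.+ i) * b) (ℕP.+-comm (k ℕ.* e) i) (per k i)) (solve 4 (λ d x s g → d :* x :* (s :* g) := (s :* d) :* (x :* g)) refl _ _ _ _) ⟩
        σ ^ k * dwork (i ℕ.+ k ℕ.* e) * (x ^ (k ℕ.* e ℕ.+ i) * G i)
          ≈⟨ ≋-*ˡ (V-dwork-0 k (i ℕ.+ k ℕ.* e) (index-bound i 0 k (ℕP.m<n⇒m<1+n i<e))) (case pow k i i<e of λ
               { (inj₁ z) → ≋-reflexive (trans (cong (x ^ (k ℕ.* e ℕ.+ i) *_) z) (trans (zeroʳ _) (sym (trans (cong (x ^ i *_) z) (zeroʳ _)))))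
               ; (inj₂ q) → ≋-*ʳ (vG i i<e) q }) ⟩
        σ ^ k * dwork (i ℕ.+ k ℕ.* e) * (x ^ i * G i) ∎

    -- 12K leaves room for three series of length 4Kp. B is a multiple of e for `collapse` and of p
    -- for separating the series in tᵖ.
    C L B : ℕ
    C = 12 ℕ.* K
    L = C ℕ.* p
    B = L ℕ.* e

    -- The factor exp(σ x t - x′ tᵖ) evaluates to 1 at t = ϖ when x ≡ x′, since ϖᵖ = σ ϖ.
    correction : ∀ {b f} c x x′ → Bounded b f → b ℕ.+ ((K ℕ.+ K) ℕ.+ (K ℕ.+ K) ℕ.* p) ≤ B → V 0 x → V 0 x′ → V K (σ * (x - x′)) →
      Σ B (λ N → χ c N * conv f (conv (expSeq (σ * x)) (expSeqᵖ x′)) N) ≋ Σ B (λ n → f n * χ c n)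
    correction {b} {f} c x x′ Fb bound vx vx′ close = begin
      Σ B (λ N → χ c N * conv f (conv (expSeq (σ * x)) (expSeqᵖ x′)) N)
        ≈⟨ box₃ B (χ-kernel c) Fb (expSeq-bounded vx) (expSeqᵖ-bounded vx′) bound ⟩
      Σ B (λ n → Σ B (λ j → Σ B (λ m → E j * (f n * χ c (n ℕ.+ (j ℕ.+ m))) * expSeqᵖ x′ m)))
        ≈⟨ Σ-≋ B (λ n _ → Σ-≋ B (λ j _ → unfold n j)) ⟩
      Σ B (λ n → Σ B (λ j → Σ B (λ m → E j * (f n * χ c (n ℕ.+ (j ℕ.+ m))) * E′ m)))
        ≈⟨ Σ-≋ B (λ n _ → ≋-sym (box B (Y-kernel n) (expSeq-bounded vx) (expSeq-bounded (V-neg vx′)) 4K≤B)) ⟩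
      Σ B (λ n → Σ B (λ l → f n * χ c (n ℕ.+ l) * conv E E′ l))
        ≈⟨ Σ-≋ B (λ n n<B → unit n (ℕP.≤-trans (s≤s z≤n) n<B)) ⟩
      Σ B (λ n → f n * χ c n) ∎
      where
      open ≋-Reasoning
      E E′ : ℕ → Carrier
      E = expSeq (σ * x)
      E′ = expSeq (σ * - x′)
      Y-kernel : ∀ n → Kernel (λ m → f n * χ c (n ℕ.+ m))
      Y-kernel n = kernel-shift (χ-kernel c) n (integral Fb n)
      V-Y : ∀ n j m → V 0 (E j * (f n * χ c (n ℕ.+ (j ℕ.+ m))))
      V-Y n j m = V-mono z≤n (kernel-shift (Y-kernel n) j (integral (expSeq-bounded vx) j) m)
      2K≤Ce : K ℕ.+ K ≤ C ℕ.* e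
      2K≤Ce = ℕP.≤-trans (ℕP.≤-trans (ℕP.+-monoʳ-≤ K (ℕP.m≤m+n K (10 ℕ.* K))) ℕP.≤-refl) (ℕP.m≤m*n C e)
      Ce≤B : C ℕ.* e ≤ B
      Ce≤B = ℕP.*-monoˡ-≤ e (ℕP.m≤m*n C p)
      4K≤B : (K ℕ.+ K) ℕ.+ (K ℕ.+ K) ≤ B
      4K≤B = ℕP.≤-trans (ℕP.≤-trans (subst₂ _≤_ (l₁ K) refl (ℕP.*-monoˡ-≤ K {4} {12} (s≤s (s≤s (s≤s (s≤s z≤n)))))) (ℕP.m≤m*n C e)) Ce≤B
        where
        l₁ : ∀ K → 4 ℕ.* K ≡ (K ℕ.+ K) ℕ.+ (K ℕ.+ K)
        l₁ = solveℕ-∀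
      -- Only multiples m = kp contribute, and ϖᵖ = σϖ: `χ-shift` extracts σᵏ, which turns the
      -- coefficient of exp(-x′tᵖ) at kp into that of exp(-σx′t) at k.
      unfold : ∀ n j → Σ B (λ m → E j * (f n * χ c (n ℕ.+ (j ℕ.+ m))) * expSeqᵖ x′ m) ≋ Σ B (λ m → E j * (f n * χ c (n ℕ.+ (j ℕ.+ m))) * E′ m)
      unfold n j = begin
        Σ B g ≡⟨ trans (cong (λ z → Σ z g) (l₁ C e p)) (Σ-blocks (C ℕ.* e) p g) ⟩
        Σ (C ℕ.* e) (λ k → Σ p (λ r → g (k ℕ.* p ℕ.+ r)))
          ≡⟨ Σ-cong (C ℕ.* e) (λ k → trans (Σ-single p 0 _ (s≤s z≤n) (λ r r<p r≢0 → zero-term k r r<p r≢0)) (main-term k)) ⟩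
        Σ (C ℕ.* e) g′
          ≈⟨ ≋-sym (Σ-tail g′ Ce≤B (λ m l → V-*ˡ (V-Y n j m) (V-expSeq K m (V-neg vx′) (ℕP.≤-trans 2K≤Ce l)))) ⟩
        Σ B g′ ∎
        where
        g g′ : ℕ → Carrier
        g m = E j * (f n * χ c (n ℕ.+ (j ℕ.+ m))) * expSeqᵖ x′ m
        g′ m = E j * (f n * χ c (n ℕ.+ (j ℕ.+ m))) * E′ m
        l₁ : ∀ C e p → C ℕ.* p ℕ.* e ≡ C ℕ.* e ℕ.* p
        l₁ = solveℕ-∀
        zero-term : ∀ k r → r < p → r ≢ 0 → g (k ℕ.* p ℕ.+ r) ≡ 0#
        zero-term k zero _ r≢0 = ⊥-elim (r≢0 refl)
        zero-term k (suc r) r<p _ = trans (cong (E j * (f n * χ c (n ℕ.+ (j ℕ.+ (k ℕ.* p ℕ.+ suc r)))) *_) (trans (cong (expSeqᵖ x′) (ℕP.+-comm (k ℕ.* p) (suc r))) (expSeqᵖ-other x′ r k r<p))) (zeroʳ _)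
        l₂ : ∀ n j k e → n ℕ.+ (j ℕ.+ (k ℕ.* suc e ℕ.+ 0)) ≡ n ℕ.+ (j ℕ.+ k) ℕ.+ k ℕ.* e
        l₂ = solveℕ-∀
        main-term : ∀ k → g (k ℕ.* p ℕ.+ 0) ≡ g′ k
        main-term k = trans (cong₂ (λ a b → E j * (f n * a) * b) (trans (cong (χ c) (l₂ n j k e)) (χ-shift c k _)) (trans (cong (expSeqᵖ x′) (ℕP.+-identityʳ (k ℕ.* p))) (expSeqᵖ-multiple x′ k)))
          (trans (solve 5 (λ a f s g b → a :* (f :* (s :* g)) :* b := a :* (f :* g) :* (s :* b)) refl _ _ _ _ _) (cong (E j * (f n * χ c (n ℕ.+ (j ℕ.+ k))) *_) (σ^-expSeq k x′)))
      -- Both exponentials are now series in t itself, and the difference of their exponents is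
      -- negligible, so that only the constant term of the product counts.
      E*E′ : ∀ l → conv E E′ l ≡ expSeq (σ * (x - x′)) l
      E*E′ = IsExp-unique (subst₂ (λ a b → IsExp p a b (conv E E′)) (sym (distribˡ σ x (- x′))) (+-identityˡ 0#) (IsExp-conv (expSeq-isExp (σ * x)) (expSeq-isExp (σ * - x′)))) (expSeq-isExp (σ * (x - x′)))
      unit : ∀ n → 0 < B → Σ B (λ l → f n * χ c (n ℕ.+ l) * conv E E′ l) ≋ f n * χ c n
      unit n 0<B = begin
        Σ B (λ l → f n * χ c (n ℕ.+ l) * conv E E′ l)
          ≡⟨ Σ-cong B (λ l → cong (f n * χ c (n ℕ.+ l) *_) (E*E′ l)) ⟩
        Σ B t ≈⟨ Σ-tail t 0<B small ⟩
        0# + t 0 ≡⟨ +-identityˡ _ ⟩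
        f n * χ c (n ℕ.+ 0) * (1# * 1#) ≡⟨ cong₂ (λ a b → f n * χ c a * b) (ℕP.+-identityʳ n) (*-identityˡ 1#) ⟩
        f n * χ c n * 1# ≡⟨ *-identityʳ _ ⟩
        f n * χ c n ∎
        where
        t : ℕ → Carrier
        t l = f n * χ c (n ℕ.+ l) * expSeq (σ * (x - x′)) l
        small : ∀ l → 1 ≤ l → V K (t l)
        small (suc l) _ = V-*ˡ (V-mono z≤n (Y-kernel n (suc l))) (V-expSeq-small close (V-- vx vx′) l)

    -- Periodicity already at i = 0 means xᵉ ≡ 1, which excludes zero. The sum z in `additive` may
    -- be zero, so for z the periodicity is assumed for positive exponents.
    record Teichmüller (x : Carrier) : Set where
      field
        integral-x : V 0 x
        power : ∀ k i → x ^ (k ℕ.* e ℕ.+ i) ≋ x ^ i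
    open Teichmüller

    -- The ϖᶜ-component of ψ(u)ψ(v)ψ(w) = ψ(u+v+w) for the additive character
    -- ψ(u) = Σᵢ T i (ϖ u)ⁱ.
    additive : ∀ c {u v w z x x′} → 0 < c → c < e →
      Teichmüller u → Teichmüller v → Teichmüller w → V 0 z →
      (∀ k i → 0 < i → z ^ (k ℕ.* e ℕ.+ i) ≋ z ^ i) →
      u + (v + w) ≡ z + σ * x → u ^ p + (v ^ p + w ^ p) ≡ z ^ p + σ * x′ → V 0 x → V 0 x′ → V K (σ * (x - x′)) →
      Σ e (λ i → T i * (u ^ i * Σ e (λ j → T j * (v ^ j * Σ e (λ k → T k * (w ^ k * χ c (i ℕ.+ (j ℕ.+ k)))))))) ≋ T c * z ^ c
    additive c {u} {v} {w} {z} {x} {x′} 0<c c<e tu tv tw vz zpow sum₁ sumₚ vx vx′ close = ≋-sym (begin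
      T c * z ^ c
        ≡⟨ sym (trans (Σ-single e c _ c<e (λ i i<e i≢c → trans (cong (λ a → T i * (z ^ i * a)) (χ-no c i (λ q → i≢c (trans (sym (ℕM.m<n⇒m%n≡m i<e)) q)))) (trans (cong (T i *_) (zeroʳ _)) (zeroʳ _))))
            (cong (λ a → T c * a) (trans (cong (z ^ c *_) (trans (χ-yes c c (ℕM.m<n⇒m%n≡m c<e)) (cong (σ ^_) (ℕM.m<n⇒m/n≡0 c<e)))) (*-identityʳ _)))) ⟩
      Σ e (λ i → T i * (z ^ i * χ c i))
        ≈⟨ ≋-sym (collapse L z (χ c) 5K≤L vz (λ k i → trans (cong (χ c) (ℕP.+-comm (k ℕ.* e) i)) (χ-shift c k i)) (λ i _ → V-mono z≤n (χ-kernel c i)) zpow′) ⟩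
      Σ B (λ n → dwork^ z n * χ c n)
        ≈⟨ ≋-sym (correction c x x′ (dwork^-bounded vz) bound₁ vx vx′ close) ⟩
      -- The addition law itself: by the two sum hypotheses both products have the same exponents in
      -- t and in tᵖ, so `IsExp-unique` identifies them.
      Σ B (λ N → χ c N * conv (dwork^ z) (conv (expSeq (σ * x)) (expSeqᵖ x′)) N)
        ≡⟨ Σ-cong B (λ N → cong (χ c N *_) (IsExp-unique (subst₂ (λ a b → IsExp p a b (conv (dwork^ z) (conv (expSeq (σ * x)) (expSeqᵖ x′)))) (cong (_+_ z) (+-identityʳ _)) (cong (_+_ (z ^ p)) (+-identityˡ _)) (IsExp-conv (dwork^-isExp z) (IsExp-conv (expSeq-isExp (σ * x)) (expSeqᵖ-isExp x′))))
             (subst₂ (λ a b → IsExp p a b (conv (dwork^ u) (conv (dwork^ v) (dwork^ w)))) sum₁ sumₚ (IsExp-conv (dwork^-isExp u) (IsExp-conv (dwork^-isExp v) (dwork^-isExp w)))) N)) ⟩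
      Σ B (λ N → χ c N * conv (dwork^ u) (conv (dwork^ v) (dwork^ w)) N)
        ≈⟨ box₃ B (χ-kernel c) bu bv bw bound₂ ⟩
      -- The three indices are collapsed from the inside out, the remaining ones being absorbed into
      -- the periodic factor each time.
      Σ B (λ n → Σ B (λ m → Σ B (λ l → dwork^ v m * (dwork^ u n * χ c (n ℕ.+ (m ℕ.+ l))) * dwork^ w l)))
        ≈⟨ Σ-≋ B (λ n _ → Σ-≋ B (λ m _ → ≋-trans (≋-reflexive (Σ-cong B (λ l → *-comm _ _)))
             (collapse L w (λ l → dwork^ v m * (dwork^ u n * χ c (n ℕ.+ (m ℕ.+ l)))) 5K≤L (integral-x tw)
               (λ k i → trans (cong (λ a → dwork^ v m * (dwork^ u n * χ c a)) (l₁ n m (k ℕ.* e) i)) (trans (cong (λ a → dwork^ v m * (dwork^ u n * a)) (χ-shift c k _)) (solve 4 (λ a b s d → a :* (b :* (s :* d)) := s :* (a :* (b :* d))) refl _ _ _ _)))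
               (λ i _ → V-mono z≤n (kernel-shift (kernel-shift (χ-kernel c) n (integral bu n)) m (integral bv m) i))
               (λ k i _ → inj₂ (power tw k i))))) ⟩
      Σ B (λ n → Σ B (λ m → Σ e (λ k → T k * (w ^ k * (dwork^ v m * (dwork^ u n * χ c (n ℕ.+ (m ℕ.+ k))))))))
        ≡⟨ Σ-cong B (λ n → Σ-cong B (λ m → trans (Σ-cong e (λ k → solve 5 (λ t w v u x → t :* (w :* (v :* (u :* x))) := (v :* u) :* (t :* (w :* x))) refl (T k) (w ^ k) (dwork^ v m) (dwork^ u n) (χ c (n ℕ.+ (m ℕ.+ k))))) (trans (sym (Σ-*ˡ e _ _)) (*-assoc _ _ _)))) ⟩
      Σ B (λ n → Σ B (λ m → dwork^ v m * (dwork^ u n * S n m)))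
        ≈⟨ Σ-≋ B (λ n _ → collapse L v (λ m → dwork^ u n * S n m) 5K≤L (integral-x tv)
             (λ k i → trans (cong (dwork^ u n *_) (S-shift₂ n k i)) (solve 3 (λ a s b → a :* (s :* b) := s :* (a :* b)) refl _ _ _))
             (λ j _ → subst (V 0) (sym (trans (Σ-*ˡ e _ _) (Σ-cong e (λ k → solve 4 (λ u t w x → u :* (t :* (w :* x)) := t :* (w :* (u :* x))) refl (dwork^ u n) (T k) (w ^ k) (χ c (n ℕ.+ (j ℕ.+ k))))))) (Σ-V e (λ k k<e → V-*ˡ (V-T k (ℕP.m<n⇒m<1+n k<e)) (V-*ˡ (V-^ k (integral-x tw)) (V-mono z≤n (kernel-shift (χ-kernel c) n (integral bu n) (j ℕ.+ k)))))))
             (λ k i _ → inj₂ (power tv k i))) ⟩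
      Σ B (λ n → Σ e (λ j → T j * (v ^ j * (dwork^ u n * S n j))))
        ≡⟨ Σ-cong B (λ n → trans (Σ-cong e (λ j → solve 4 (λ t v u s → t :* (v :* (u :* s)) := u :* (t :* (v :* s))) refl (T j) (v ^ j) (dwork^ u n) (S n j))) (sym (Σ-*ˡ e _ _))) ⟩
      Σ B (λ n → dwork^ u n * S₂ n)
        ≈⟨ collapse L u S₂ 5K≤L (integral-x tu)
             (λ k i → trans (Σ-cong e (λ j → trans (cong (λ a → T j * (v ^ j * a)) (S-shift₁ k i j)) (solve 4 (λ t v s x → t :* (v :* (s :* x)) := s :* (t :* (v :* x))) refl _ _ _ _))) (sym (Σ-*ˡ e _ _)))
             (λ i _ → Σ-V e (λ j j<e → V-*ˡ (V-T j (ℕP.m<n⇒m<1+n j<e)) (V-*ˡ (V-^ j (integral-x tv)) (Σ-V e (λ k k<e → V-*ˡ (V-T k (ℕP.m<n⇒m<1+n k<e)) (V-*ˡ (V-^ k (integral-x tw)) (V-mono z≤n (χ-kernel c (i ℕ.+ (j ℕ.+ k))))))))))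
             (λ k i _ → inj₂ (power tu k i)) ⟩
      Σ e (λ i → T i * (u ^ i * S₂ i)) ∎)
      where
      open ≋-Reasoning
      S : ℕ → ℕ → Carrier
      S n m = Σ e (λ k → T k * (w ^ k * χ c (n ℕ.+ (m ℕ.+ k))))
      S₂ : ℕ → Carrier
      S₂ n = Σ e (λ j → T j * (v ^ j * S n j))
      bu = dwork^-bounded (integral-x tu)
      bv = dwork^-bounded (integral-x tv)
      bw = dwork^-bounded (integral-x tw)
      l₁ : ∀ n m k i → n ℕ.+ (m ℕ.+ (k ℕ.+ i)) ≡ n ℕ.+ (m ℕ.+ i) ℕ.+ k
      l₁ = solveℕ-∀
      shift-out : ∀ k n m (g : ℕ → ℕ) → (∀ i → g i ≡ n ℕ.+ (m ℕ.+ i) ℕ.+ k ℕ.* e) → Σ e (λ i → T i * (w ^ i * χ c (g i))) ≡ σ ^ k * S n m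
      shift-out k n m g q = trans (Σ-cong e (λ i → trans (cong (λ a → T i * (w ^ i * a)) (trans (cong (χ c) (q i)) (χ-shift c k _))) (solve 4 (λ t v s x → t :* (v :* (s :* x)) := s :* (t :* (v :* x))) refl _ _ _ _))) (sym (Σ-*ˡ e _ _))
      S-shift₂ : ∀ n k m → S n (k ℕ.* e ℕ.+ m) ≡ σ ^ k * S n m
      S-shift₂ n k m = shift-out k n m _ (λ i → l n (k ℕ.* e) m i)
        where
        l : ∀ n k m i → n ℕ.+ (k ℕ.+ m ℕ.+ i) ≡ n ℕ.+ (m ℕ.+ i) ℕ.+ k
        l = solveℕ-∀
      S-shift₁ : ∀ k n m → S (k ℕ.* e ℕ.+ n) m ≡ σ ^ k * S n m
      S-shift₁ k n m = shift-out k n m _ (λ i → l (k ℕ.* e) n m i)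
        where
        l : ∀ k n m i → k ℕ.+ n ℕ.+ (m ℕ.+ i) ≡ n ℕ.+ (m ℕ.+ i) ℕ.+ k
        l = solveℕ-∀
      5K≤L : 5 ℕ.* K ≤ L
      5K≤L = ℕP.≤-trans (ℕP.*-monoˡ-≤ K {5} {12} (s≤s (s≤s (s≤s (s≤s (s≤s z≤n)))))) (ℕP.m≤m*n C p)
      bound₁ : 4 ℕ.* K ℕ.* p ℕ.+ ((K ℕ.+ K) ℕ.+ (K ℕ.+ K) ℕ.* p) ≤ B
      bound₁ = ℕP.≤-trans (ℕP.+-monoʳ-≤ (4 ℕ.* K ℕ.* p) (ℕP.+-monoˡ-≤ ((K ℕ.+ K) ℕ.* p) (ℕP.m≤m*n (K ℕ.+ K) p)))
        (ℕP.≤-trans (ℕP.≤-trans (ℕP.≤-reflexive (l K p)) (ℕP.*-monoˡ-≤ p (ℕP.*-monoˡ-≤ K {8} {12} (ℕP.m≤m+n 8 4)))) (ℕP.m≤m*n L e))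
        where
        l : ∀ K p → 4 ℕ.* K ℕ.* p ℕ.+ ((K ℕ.+ K) ℕ.* p ℕ.+ (K ℕ.+ K) ℕ.* p) ≡ 8 ℕ.* K ℕ.* p
        l = solveℕ-∀
      bound₂ : 4 ℕ.* K ℕ.* p ℕ.+ (4 ℕ.* K ℕ.* p ℕ.+ 4 ℕ.* K ℕ.* p) ≤ B
      bound₂ = ℕP.≤-trans (ℕP.≤-reflexive (l K p)) (ℕP.m≤m*n L e)
        where
        l : ∀ K p → 4 ℕ.* K ℕ.* p ℕ.+ (4 ℕ.* K ℕ.* p ℕ.+ 4 ℕ.* K ℕ.* p) ≡ 12 ℕ.* K ℕ.* p
        l = solveℕ-∀
      -- The exponent i = 0, where z = 0 would break periodicity, carries the coefficient χ c 0 = 0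
      -- because c is positive.
      zpow′ : ∀ k i → i < e → χ c i ≡ 0# ⊎ z ^ (k ℕ.* e ℕ.+ i) ≋ z ^ i
      zpow′ k zero _ = inj₁ (χ-no c 0 (λ q → ℕP.<-irrefl (trans (sym (ℕM.m<n⇒m%n≡m (ℕP.≤-trans (s≤s z≤n) M.4≤e))) q) 0<c))
      zpow′ k (suc i) _ = inj₂ (zpow k (suc i) (s≤s z≤n))

-- The rational numbers as the algebra of the p-adic estimates.

module RationalNumbers where

  open FiniteSums
  open ExponentialSequences

  private
    toℚᵘ-/ : ∀ x n → toℚᵘ (x ℚ./ suc n) ≃ mkℚᵘ x n
    toℚᵘ-/ x n = ℚP.toℚᵘ-fromℚᵘ (mkℚᵘ x n)

  rationals : ℚ-Algebra
  rationals = record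
    { algebra = record
      { isCommutativeRing = ℚP.+-*-isCommutativeRing
      ; ι = λ x → x ℚ./ 1
      ; ι-+ = λ x y → ℚP.toℚᵘ-injective (ℚᵘP.≃-trans (toℚᵘ-/ (x ℤ.+ y) 0) (ℚᵘP.≃-trans (*≡* (l₁ x y))
          (ℚᵘP.≃-sym (ℚᵘP.≃-trans (ℚP.toℚᵘ-homo-+ (x ℚ./ 1) (y ℚ./ 1)) (ℚᵘP.+-cong (toℚᵘ-/ x 0) (toℚᵘ-/ y 0))))))
      ; ι-* = λ x y → ℚP.toℚᵘ-injective (ℚᵘP.≃-trans (toℚᵘ-/ (x ℤ.* y) 0) (ℚᵘP.≃-trans (*≡* refl)
          (ℚᵘP.≃-sym (ℚᵘP.≃-trans (ℚP.toℚᵘ-homo-* (x ℚ./ 1) (y ℚ./ 1)) (ℚᵘP.*-cong (toℚᵘ-/ x 0) (toℚᵘ-/ y 0))))))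
      ; ι-neg = λ x → ℚP.toℚᵘ-injective (ℚᵘP.≃-trans (toℚᵘ-/ (ℤ.- x) 0) (ℚᵘP.≃-trans (*≡* refl)
          (ℚᵘP.≃-sym (ℚᵘP.≃-trans (ℚP.toℚᵘ-homo‿- (x ℚ./ 1)) (ℚᵘP.-‿cong (toℚᵘ-/ x 0))))))
      ; ι-0 = refl
      ; ι-1 = refl
      }
    ; recip = λ n → + 1 ℚ./ suc n
    ; recip-inverse = λ n → ℚP.toℚᵘ-injective (ℚᵘP.≃-trans (ℚP.toℚᵘ-homo-* (+ suc n ℚ./ 1) (+ 1 ℚ./ suc n))
        (ℚᵘP.≃-trans (ℚᵘP.*-cong (toℚᵘ-/ (+ suc n) 0) (toℚᵘ-/ (+ 1) n)) (*≡* (l₂ n))))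
    ; ι-injective = λ {x} {y} q → l₃ (ℚᵘP.≃-trans (ℚᵘP.≃-sym (toℚᵘ-/ x 0)) (ℚᵘP.≃-trans (ℚᵘP.≃-reflexive (cong toℚᵘ q)) (toℚᵘ-/ y 0)))
    }
    where
    l₁ : ∀ x y → (x ℤ.+ y) ℤ.* + 1 ≡ (x ℤ.* + 1 ℤ.+ y ℤ.* + 1) ℤ.* + 1
    l₁ = solve-∀
    l₂ : ∀ n → (+ suc n ℤ.* + 1) ℤ.* + 1 ≡ + 1 ℤ.* + (1 ℕ.* suc n)
    l₂ n = trans (ℤP.*-identityʳ _) (trans (ℤP.*-identityʳ _) (sym (trans (ℤP.*-identityˡ _) (cong +_ (ℕP.*-identityˡ (suc n))))))
    l₃ : ∀ {x y} → mkℚᵘ x 0 ≃ mkℚᵘ y 0 → x ≡ y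
    l₃ {x} {y} (*≡* q) = trans (sym (ℤP.*-identityʳ x)) (trans q (ℤP.*-identityʳ y))

-- Transfer to integers modulo q = p^(k′+1).

module GrossKoblitz where

  open FiniteSums
  open ExponentialSequences
  open Congruences
  open AdditiveCharacters

  -- The sum 1 + p + ... + p^(k-1), which represents -1/(p-1) modulo p^k by `geometric-sum`.
  geometric : ℕ → ℕ → ℕ
  geometric p zero = 0
  geometric p (suc k) = 1 ℕ.+ p ℕ.* geometric p k

  geometric-sum : ∀ e k → suc (e ℕ.* geometric (suc e) k) ≡ suc e ℕ.^ k
  geometric-sum e zero = cong suc (ℕP.*-zeroʳ e)
  geometric-sum e (suc k) = trans (l e (geometric (suc e) k)) (cong (suc e ℕ.*_) (geometric-sum e k))
    where
    l : ∀ e g → suc (e ℕ.* (1 ℕ.+ suc e ℕ.* g)) ≡ suc e ℕ.* suc (e ℕ.* g)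
    l = solveℕ-∀

  module MoritaGamma {e h : ℕ} (P : OddPrime e h) where

    open PrimeModulus P using (p; ≈0?)

    γ : ℕ → ℤ
    γ n with ≈0? (pos n)
    ... | yes _ = ℤ.- pos 1
    ... | no _ = ℤ.- pos n

    -- Morita's function in the form of its functional equation, on which all inductions run;
    -- `Γₚℕ≡Γ` compares it with the product.
    Γ : ℕ → ℤ
    Γ zero = pos 1
    Γ (suc n) = γ n ℤ.* Γ n

    χℤ : .{{NonZero e}} → ℕ → ℕ → ℤ
    χℤ c N with N ℕM.% e ℕ.≟ c
    ... | yes _ = (ℤ.- pos p) ℤ.^ (N ℕM./ e)
    ... | no _ = pos 0

  module Transfer (F : ℚ-Algebra) {e h : ℕ} (P : OddPrime e h) (k′ : ℕ) where

    open AdditiveCharacter F P (suc k′)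
    open Solver
    open M using (p; Unit)
    open MoritaGamma P

    q : ℕ
    q = p ℕ.^ suc k′

    module Z = Congruence (pos q)
    open Z using () renaming (_≈_ to _≈q_)

    ≈q⇒≋ : ∀ {x y} → x ≈q y → ι x ≋ ι y
    ≈q⇒≋ {x} {y} (Z.by r refl) = ≋[ subst (V (suc k′)) (trans (cong ι (l y r (pos q))) (trans (ι-+ (y ℤ.+ r ℤ.* pos q) (ℤ.- y)) (cong (_+_ (ι (y ℤ.+ r ℤ.* pos q))) (ι-neg y)))) (V-ι∣ (suc k′) r) ]
      where
      l : ∀ y r q → q ℤ.* r ≡ y ℤ.+ r ℤ.* q ℤ.+ ℤ.- y
      l = solve-∀

    ≋⇒≈q : ∀ {x y} → ι x ≋ ι y → x ≈q y
    ≋⇒≈q {x} {y} ≋[ v ] = Z.-≈0⇒≈ (V-recover (suc k′) (x ℤ.- y) (subst (V (suc k′)) (sym (trans (ι-+ x (ℤ.- y)) (cong (_+_ (ι x)) (ι-neg y)))) v))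

    cancel-unit : ∀ c {x} → Unit c → c ℤ.* x ≈q pos 0 → x ≈q pos 0
    cancel-unit c {x} u z = V-recover (suc k′) x (V-cancel-unit c u (subst (V (suc k′)) (trans eq (ι-* c x)) (_≋_.difference (≈q⇒≋ z))))
      where
      eq : ι (c ℤ.* x) - ι (pos 0) ≡ ι (c ℤ.* x)
      eq = trans (cong (λ z → ι (c ℤ.* x) - z) ι-0) (trans (cong (_+_ (ι (c ℤ.* x))) (trans (sym (+-identityʳ _)) (-‿inverseˡ 0#))) (+-identityʳ _))

    q-multiple-offset : ∀ N → N ℕ.* q ≡ N ℕ.* p ℕ.^ k′ ℕ.* p
    q-multiple-offset N = l N p (p ℕ.^ k′)
      where
      l : ∀ N p r → N ℕ.* (p ℕ.* r) ≡ N ℕ.* r ℕ.* p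
      l = solveℕ-∀

    V-A : V 0 (1# - π)
    V-A = V-- V-1 (V-ι (pos p))

    -- The reflection Γₚ(m) = Γₚ(-(Nq - m)), by induction on m from the periodicity of Γ⁻.
    Γ-Γ⁻ : ∀ N m → m ≤ N ℕ.* q → ι (Γ m) ≋ Γ⁻ (N ℕ.* q ℕ.∸ m)
    Γ-Γ⁻ N zero _ = ≋-sym (≋-trans (≋-trans (≋-reflexive (cong Γ⁻ (q-multiple-offset N))) (Γ⁻-period k′ N refl)) (≋-reflexive (sym ι-1)))
    Γ-Γ⁻ N (suc m) l = ≋-trans (≋-reflexive (ι-* (γ m) (Γ m))) (≋-trans (≋-*ˡ (V-ι (γ m)) (≋-trans (Γ-Γ⁻ N m (ℕP.<⇒≤ l)) (≋-reflexive (cong Γ⁻ n≡)))) step′)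
      where
      n′ = N ℕ.* q ℕ.∸ suc m
      n≡ : N ℕ.* q ℕ.∸ m ≡ suc n′
      n≡ = ℕP.+-∸-assoc 1 l
      total : suc n′ ℕ.+ m ≡ N ℕ.* q
      total = trans (cong (ℕ._+ m) (sym n≡)) (ℕP.m∸n+n≡m (ℕP.<⇒≤ l))
      totalℤ : pos (suc n′) ≡ ℤ.- pos m ℤ.+ pos N ℤ.* pos q
      totalℤ = trans (l₁ (pos (suc n′)) (pos m)) (cong (λ z → ℤ.- pos m ℤ.+ z) (trans (sym (ℤP.pos-+ (suc n′) m)) (trans (cong pos total) (ℤP.pos-* N q))))
        where
        l₁ : ∀ n m → n ≡ ℤ.- m ℤ.+ (n ℤ.+ m)
        l₁ = solve-∀
      mod-p : pos (suc n′) M.≈ ℤ.- pos m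
      mod-p = M.by (pos N ℤ.* pos (p ℕ.^ k′)) (trans totalℤ (cong (λ z → ℤ.- pos m ℤ.+ z) (trans (cong (pos N ℤ.*_) (ℤP.pos-* p (p ℕ.^ k′))) (l₁ (pos N) (pos p) (pos (p ℕ.^ k′))))))
        where
        l₁ : ∀ N p r → N ℤ.* (p ℤ.* r) ≡ N ℤ.* r ℤ.* p
        l₁ = solve-∀
      step′ : ι (γ m) * Γ⁻ (suc n′) ≋ Γ⁻ n′
      step′ with M.≈0? (pos m)
      ... | yes z = ≋-reflexive (trans (cong₂ _*_ (trans (ι-neg (pos 1)) (cong -_ ι-1)) (Γ⁻-multiple n′ (M.≈-trans mod-p (M.neg-cong z)))) (trans (solve 2 (λ o x → :- o :* :- x := o :* x) refl 1# (Γ⁻ n′)) (*-identityˡ _)))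
      ... | no u = ≋-trans (≋-*ʳ (V-Γ⁻ (suc n′)) (≈q⇒≋ (Z.≈-sym (Z.by (pos N) totalℤ)))) (≋-reflexive (Γ⁻-unit n′ (M.Unit-cong (M.≈-sym mod-p) (M.Unit-neg u))))

    -- This is the continuity of Γₚ. For m = n + tq one has (m + t)q - m = mq - n, so both sides
    -- reflect to the same value of `Γ⁻`; the multipliers m + t and m are large enough for the
    -- subtractions in ℕ.
    Γ-periodic-≤ : ∀ m n → n ≤ m → pos m ≈q pos n → Γ m ≈q Γ n
    Γ-periodic-≤ m n n≤m (Z.by r eq) = ≋⇒≈q (≋-trans (Γ-Γ⁻ (m ℕ.+ t) m m≤) (≋-trans (≋-reflexive (cong Γ⁻ index)) (≋-sym (Γ-Γ⁻ m n n≤))))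
      where
      l : ∀ m x → m ℤ.+ x ℤ.- m ≡ pos 0 ℤ.+ x
      l = solve-∀
      q∣m∸n : q ℕD.∣ m ℕ.∸ n
      q∣m∸n = ∣⇒∣ᵤ (Z.≈0⇒∣ {pos (m ℕ.∸ n)} (Z.by r (trans (sym (ℤP.⊖-≥ n≤m)) (trans (sym (ℤP.m-n≡m⊖n m n)) (trans (cong (ℤ._- pos n) eq) (l (pos n) (r ℤ.* pos q)))))))
      t = ℕD.quotient q∣m∸n
      instance
        q≢0 : NonZero q
        q≢0 = ℕ.>-nonZero (ℕP.m^n>0 p (suc k′))
      m≤ : m ≤ (m ℕ.+ t) ℕ.* q
      m≤ = ℕP.≤-trans (ℕP.m≤m+n m t) (ℕP.m≤m*n (m ℕ.+ t) q)
      n≤ : n ≤ m ℕ.* q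
      n≤ = ℕP.≤-trans n≤m (ℕP.m≤m*n m q)
      index : (m ℕ.+ t) ℕ.* q ℕ.∸ m ≡ m ℕ.* q ℕ.∸ n
      index = trans (cong₂ ℕ._∸_ (trans (ℕP.*-distribʳ-+ q m t) (cong (m ℕ.* q ℕ.+_) (sym (ℕD._∣_.equality q∣m∸n)))) (sym (ℕP.m∸n+n≡m n≤m)))
        (trans (cong (ℕ._∸ (m ℕ.∸ n ℕ.+ n)) (ℕP.+-comm (m ℕ.* q) (m ℕ.∸ n))) (ℕP.[m+n]∸[m+o]≡n∸o (m ℕ.∸ n) (m ℕ.* q) n))

    Γ-periodic : ∀ {m n} → pos m ≈q pos n → Γ m ≈q Γ n
    Γ-periodic {m} {n} m≈n with ℕP.≤-total n m
    ... | inj₁ n≤m = Γ-periodic-≤ m n n≤m m≈n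
    ... | inj₂ m≤n = Z.≈-sym (Γ-periodic-≤ n m m≤n (Z.≈-sym m≈n))

    Unit-e : Unit (pos e)
    Unit-e = M.Unit-small e (ℕP.≤-trans (s≤s z≤n) M.4≤e) ℕP.≤-refl

    -- Since (p - 1)s = q - 1, the choice k₀ = a s gives a + (p - 1)k₀ = q a, as `Telescope`
    -- demands. Then m = a + p k₀ represents -a/(p-1), so n + m ≡ 0 and `Γ-Γ⁻` turns `Γ⁻ m` into
    -- `Γ n`.
    T-Γ : ∀ a n → a < p → pos e ℤ.* pos n ≈q pos a → (1# - π) * T a ≋ ι (Γ n)
    T-Γ a n a<p en≈a = ≋-trans (Telescope.T-Γ⁻ a a<p k₀ k₀-cong) (≋-sym (≋-trans (Γ-Γ⁻ N n n≤) (≋-reflexive (cong Γ⁻ index))))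
      where
      s = geometric p (suc k′)
      k₀ = a ℕ.* s
      es : pos e ℤ.* pos s ≡ pos q ℤ.- pos 1
      es = trans (l (pos e ℤ.* pos s)) (cong (ℤ._- pos 1) (trans (cong (λ z → pos 1 ℤ.+ z) (sym (ℤP.pos-* e s))) (cong pos (geometric-sum e (suc k′)))))
        where
        l : ∀ x → x ≡ pos 1 ℤ.+ x ℤ.- pos 1
        l = solve-∀
      ek₀ : pos a ℤ.+ pos e ℤ.* pos k₀ ≡ pos q ℤ.* pos a
      ek₀ = trans (cong (λ z → pos a ℤ.+ pos e ℤ.* z) (ℤP.pos-* a s)) (trans (l₁ (pos a) (pos e) (pos s)) (trans (cong (λ z → pos a ℤ.+ pos a ℤ.* z) es) (l₂ (pos a) (pos q))))
        where
        l₁ : ∀ a e s → a ℤ.+ e ℤ.* (a ℤ.* s) ≡ a ℤ.+ a ℤ.* (e ℤ.* s)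
        l₁ = solve-∀
        l₂ : ∀ a q → a ℤ.+ a ℤ.* (q ℤ.- pos 1) ≡ q ℤ.* a
        l₂ = solve-∀
      k₀-cong : V (suc k′) (n̂ a + n̂ e * n̂ k₀)
      k₀-cong = subst (V (suc k′)) (trans (cong ι (sym ek₀)) (trans (ι-+ (pos a) (pos e ℤ.* pos k₀)) (cong (_+_ (n̂ a)) (ι-* (pos e) (pos k₀))))) (V-ι∣ (suc k′) (pos a))
      m = a ℕ.+ k₀ ℕ.* p
      mℤ : pos m ≡ pos a ℤ.+ pos k₀ ℤ.* (pos 1 ℤ.+ pos e)
      mℤ = trans (ℤP.pos-+ a (k₀ ℕ.* p)) (cong (λ z → pos a ℤ.+ z) (ℤP.pos-* k₀ p))
      n+m : pos n ℤ.+ pos m ≈q pos 0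
      n+m = cancel-unit (pos e) Unit-e (begin
        pos e ℤ.* (pos n ℤ.+ pos m) ≡⟨ trans (cong (λ z → pos e ℤ.* (pos n ℤ.+ z)) mℤ) (l₁ (pos e) (pos n) (pos a) (pos k₀)) ⟩
        pos e ℤ.* pos n ℤ.+ (ℤ.- pos a ℤ.+ (pos 1 ℤ.+ pos e) ℤ.* (pos a ℤ.+ pos e ℤ.* pos k₀)) ≈⟨ Z.+-cong en≈a (Z.≡⇒≈ (cong (λ z → ℤ.- pos a ℤ.+ (pos 1 ℤ.+ pos e) ℤ.* z) ek₀)) ⟩
        pos a ℤ.+ (ℤ.- pos a ℤ.+ (pos 1 ℤ.+ pos e) ℤ.* (pos q ℤ.* pos a)) ≡⟨ l₂ (pos a) (pos e) (pos q) ⟩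
        (pos 1 ℤ.+ pos e) ℤ.* pos a ℤ.* pos q ≈⟨ Z.multiple≈0 ((pos 1 ℤ.+ pos e) ℤ.* pos a) ⟩
        pos 0 ∎)
        where
        open import Relation.Binary.Reasoning.Setoid Z.setoid
        l₁ : ∀ e n a k → e ℤ.* (n ℤ.+ (a ℤ.+ k ℤ.* (pos 1 ℤ.+ e))) ≡ e ℤ.* n ℤ.+ (ℤ.- a ℤ.+ (pos 1 ℤ.+ e) ℤ.* (a ℤ.+ e ℤ.* k))
        l₁ = solve-∀
        l₂ : ∀ a e q → a ℤ.+ (ℤ.- a ℤ.+ (pos 1 ℤ.+ e) ℤ.* (q ℤ.* a)) ≡ (pos 1 ℤ.+ e) ℤ.* a ℤ.* q
        l₂ = solve-∀
      q∣ : q ℕD.∣ n ℕ.+ m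
      q∣ = ∣⇒∣ᵤ (Z.≈0⇒∣ {pos (n ℕ.+ m)} (Z.≈-trans (Z.≡⇒≈ (ℤP.pos-+ n m)) n+m))
      N = ℕD.quotient q∣
      Nq : n ℕ.+ m ≡ N ℕ.* q
      Nq = ℕD._∣_.equality q∣
      n≤ : n ≤ N ℕ.* q
      n≤ = subst (n ≤_) Nq (ℕP.m≤m+n n m)
      index : N ℕ.* q ℕ.∸ n ≡ m
      index = trans (cong (ℕ._∸ n) (sym Nq)) (ℕP.m+n∸m≡n n m)

    ι-Σ : ∀ n f → ι (ℤ-Alg.Σ n f) ≡ Σ n (ι ∘ f)
    ι-Σ zero f = ι-0
    ι-Σ (suc n) f = trans (ι-+ (ℤ-Alg.Σ n f) (f n)) (cong (_+ ι (f n)) (ι-Σ n f))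

    ι-χ : ∀ c N → ι (χℤ c N) ≡ χ c N
    ι-χ c N with N ℕM.% e ℕ.≟ c
    ... | yes _ = trans (ι-^ (ℤ.- pos p) (N ℕM./ e)) (cong (_^ (N ℕM./ e)) (sym σ≡ι))
    ... | no _ = ι-0

    -- Multiplying `additive` by (1 - p)³ converts the three sums T on the left into gamma values;
    -- the right side has one T, so (1 - p)² is left over. The integer x records by which multiple
    -- of p the sum u + v + w misses z.
    additiveℤ : ∀ (G : ℕ → ℤ) → (∀ i → i < e → ∃[ n ] (pos e ℤ.* pos n ≈q pos i × G i ≡ Γ n)) →
      ∀ c {u v w z} x → 0 < c → c < e → u ℤ.^ e ≈q pos 1 → v ℤ.^ e ≈q pos 1 → w ℤ.^ e ≈q pos 1 → z ℤ.^ p ≈q z →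
      u ℤ.+ (v ℤ.+ w) ≡ z ℤ.+ ℤ.- pos p ℤ.* x →
      ℤ-Alg.Σ e (λ i → G i ℤ.* (u ℤ.^ i ℤ.* ℤ-Alg.Σ e (λ j → G j ℤ.* (v ℤ.^ j ℤ.* ℤ-Alg.Σ e (λ k → G k ℤ.* (w ℤ.^ k ℤ.* χℤ c (i ℕ.+ (j ℕ.+ k))))))))
        ≈q (pos 1 ℤ.- pos p) ℤ.* ((pos 1 ℤ.- pos p) ℤ.* (G c ℤ.* z ℤ.^ c))
    additiveℤ G isΓ c {u} {v} {w} {z} x 0<c c<e ue ve we zp sum≡ = ≋⇒≈q (≋-trans (≋-sym lhs) (≋-trans (≋-*ˡ (V-*ˡ V-A (V-*ˡ V-A V-A))
        (additive c 0<c c<e (teich ue) (teich ve) (teich we) (V-ι z) zpow sum₁ sumₚ (V-ι x) (V-ι x′) close)) rhs))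
      where
      A = 1# - π
      A≡ : A ≡ ι (pos 1 ℤ.- pos p)
      A≡ = sym (trans (ι-+ (pos 1) (ℤ.- pos p)) (cong₂ _+_ ι-1 (ι-neg (pos p))))
      TG : ∀ i → i < e → A * T i ≋ ι (G i)
      TG i l with isΓ i l
      ... | n , en , eq = ≋-trans (T-Γ i n (ℕP.m<n⇒m<1+n l) en) (≋-reflexive (cong ι (sym eq)))
      teich : ∀ {u} → u ℤ.^ e ≈q pos 1 → Teichmüller (ι u)
      teich {u} ue = record { integral-x = V-ι u ; power = λ k i → subst₂ _≋_ (ι-^ u (k ℕ.* e ℕ.+ i)) (ι-^ u i)
        (≈q⇒≋ (Z.≈-trans (Z.≡⇒≈ (trans (ℤP.^-distribˡ-+-* u (k ℕ.* e) i) (cong (λ t → u ℤ.^ t ℤ.* u ℤ.^ i) (ℕP.*-comm k e)) ))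
          (Z.≈-trans (Z.*-congʳ (u ℤ.^ i) (Z.≈-trans (Z.≡⇒≈ (sym (ℤP.^-*-assoc u e k))) (Z.^-≈1 k ue))) (Z.≡⇒≈ (ℤP.*-identityˡ (u ℤ.^ i)))))) }
      zpowℤ : ∀ k i → z ℤ.^ (k ℕ.* e ℕ.+ suc i) ≈q z ℤ.^ suc i
      zpowℤ zero i = Z.≈-refl
      zpowℤ (suc k) i = begin
        z ℤ.^ (e ℕ.+ k ℕ.* e ℕ.+ suc i) ≡⟨ cong (z ℤ.^_) (l e (k ℕ.* e) i) ⟩
        z ℤ.^ (p ℕ.+ (k ℕ.* e ℕ.+ i)) ≡⟨ ℤP.^-distribˡ-+-* z p (k ℕ.* e ℕ.+ i) ⟩
        z ℤ.^ p ℤ.* z ℤ.^ (k ℕ.* e ℕ.+ i) ≈⟨ Z.*-congʳ (z ℤ.^ (k ℕ.* e ℕ.+ i)) zp ⟩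
        z ℤ.* z ℤ.^ (k ℕ.* e ℕ.+ i) ≡⟨ cong (z ℤ.^_) (sym (ℕP.+-suc (k ℕ.* e) i)) ⟩
        z ℤ.^ (k ℕ.* e ℕ.+ suc i) ≈⟨ zpowℤ k i ⟩
        z ℤ.^ suc i ∎
        where
        open import Relation.Binary.Reasoning.Setoid Z.setoid
        l : ∀ e k i → e ℕ.+ k ℕ.+ suc i ≡ suc e ℕ.+ (k ℕ.+ i)
        l = solveℕ-∀
      zpow : ∀ k i → 0 < i → ι z ^ (k ℕ.* e ℕ.+ i) ≋ ι z ^ i
      zpow k (suc i) _ = subst₂ _≋_ (ι-^ z (k ℕ.* e ℕ.+ suc i)) (ι-^ z (suc i)) (≈q⇒≋ (zpowℤ k i))
      pth : ∀ {u} → u ℤ.^ e ≈q pos 1 → u ℤ.^ p ≈q u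
      pth {u} ue = Z.≈-trans (Z.*-congˡ u ue) (Z.≡⇒≈ (ℤP.*-identityʳ u))
      qu = Z._≈_.quotient (pth ue)
      qv = Z._≈_.quotient (pth ve)
      qw = Z._≈_.quotient (pth we)
      qz = Z._≈_.quotient zp
      r = pos (p ℕ.^ k′)
      -- Read off from the quotients of uᵖ ≡ u and its analogues for v, w and z. It differs from x
      -- by a multiple of q/p, so p(x - x′) is divisible by q, which is what `correction` asks for.
      x′ : ℤ
      x′ = x ℤ.- r ℤ.* (qu ℤ.+ qv ℤ.+ qw ℤ.- qz)
      q≡ : pos q ≡ pos p ℤ.* r
      q≡ = ℤP.pos-* p (p ℕ.^ k′)
      sum₁ : ι u + (ι v + ι w) ≡ ι z + σ * ι x
      sum₁ = trans (sym (trans (ι-+ u (v ℤ.+ w)) (cong (_+_ (ι u)) (ι-+ v w)))) (trans (cong ι sum≡) (trans (ι-+ z _) (cong (_+_ (ι z)) (trans (ι-* (ℤ.- pos p) x) (cong (_* ι x) (sym σ≡ι))))))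
      sumₚℤ : u ℤ.^ p ℤ.+ (v ℤ.^ p ℤ.+ w ℤ.^ p) ≡ z ℤ.^ p ℤ.+ ℤ.- pos p ℤ.* x′
      sumₚℤ = trans (cong₂ ℤ._+_ (Z._≈_.equation (pth ue)) (cong₂ ℤ._+_ (Z._≈_.equation (pth ve)) (Z._≈_.equation (pth we))))
        (trans (l₁ u v w qu qv qw (pos q)) (trans (cong₂ (λ a b → a ℤ.+ (qu ℤ.+ qv ℤ.+ qw) ℤ.* b) sum≡ q≡)
        (trans (l₂ z (pos p) x r (qu ℤ.+ qv ℤ.+ qw) qz) (cong (λ a → a ℤ.+ ℤ.- pos p ℤ.* x′) (trans (cong (λ b → z ℤ.+ qz ℤ.* b) (sym q≡)) (sym (Z._≈_.equation zp)))))))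
        where
        l₁ : ∀ u v w a b c q → u ℤ.+ a ℤ.* q ℤ.+ (v ℤ.+ b ℤ.* q ℤ.+ (w ℤ.+ c ℤ.* q)) ≡ u ℤ.+ (v ℤ.+ w) ℤ.+ (a ℤ.+ b ℤ.+ c) ℤ.* q
        l₁ = solve-∀
        l₂ : ∀ z p x r s d → z ℤ.+ ℤ.- p ℤ.* x ℤ.+ s ℤ.* (p ℤ.* r) ≡ z ℤ.+ d ℤ.* (p ℤ.* r) ℤ.+ ℤ.- p ℤ.* (x ℤ.- r ℤ.* (s ℤ.- d))
        l₂ = solve-∀
      sumₚ : ι u ^ p + (ι v ^ p + ι w ^ p) ≡ ι z ^ p + σ * ι x′
      sumₚ = trans (cong₂ _+_ (sym (ι-^ u p)) (cong₂ _+_ (sym (ι-^ v p)) (sym (ι-^ w p))))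
        (trans (sym (trans (ι-+ (u ℤ.^ p) _) (cong (_+_ (ι (u ℤ.^ p))) (ι-+ (v ℤ.^ p) (w ℤ.^ p)))))
        (trans (cong ι sumₚℤ) (trans (ι-+ (z ℤ.^ p) _) (cong₂ _+_ (ι-^ z p) (trans (ι-* (ℤ.- pos p) x′) (cong (_* ι x′) (sym σ≡ι)))))))
      close : V (suc k′) (σ * (ι x - ι x′))
      close = subst (V (suc k′)) (trans (cong ι eq) (trans (ι-* (ℤ.- pos p) (x ℤ.- x′)) (cong₂ _*_ (sym σ≡ι) (trans (ι-+ x (ℤ.- x′)) (cong (_+_ (ι x)) (ι-neg x′)))))) (V-ι∣ (suc k′) (ℤ.- (qu ℤ.+ qv ℤ.+ qw ℤ.- qz)))
        where
        l : ∀ p x r s → p ℤ.* r ℤ.* ℤ.- s ≡ ℤ.- p ℤ.* (x ℤ.- (x ℤ.- r ℤ.* s))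
        l = solve-∀
        eq : pos q ℤ.* ℤ.- (qu ℤ.+ qv ℤ.+ qw ℤ.- qz) ≡ ℤ.- pos p ℤ.* (x ℤ.- x′)
        eq = trans (cong (ℤ._* ℤ.- (qu ℤ.+ qv ℤ.+ qw ℤ.- qz)) q≡) (l (pos p) x r (qu ℤ.+ qv ℤ.+ qw ℤ.- qz))
      -- D is the power of 1 - p already spent on the inner sums; one more factor converts the
      -- current T.
      lift : ∀ u D (X : ℕ → Carrier) (Y : ℕ → ℤ) → (∀ i → i < e → D * X i ≋ ι (Y i)) → (∀ i → V 0 (D * X i)) →
        (A * D) * Σ e (λ i → T i * (ι u ^ i * X i)) ≋ ι (ℤ-Alg.Σ e (λ i → G i ℤ.* (u ℤ.^ i ℤ.* Y i)))
      lift u D X Y XY vX = ≋-trans (≋-reflexive (Σ-*ˡ e (A * D) _)) (≋-trans (Σ-≋ e (λ i l → begin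
          (A * D) * (T i * (ι u ^ i * X i)) ≡⟨ solve 5 (λ a d t u x → (a :* d) :* (t :* (u :* x)) := (a :* t) :* (u :* (d :* x))) refl A D (T i) (ι u ^ i) (X i) ⟩
          (A * T i) * (ι u ^ i * (D * X i)) ≈⟨ ≋-*ʳ (V-*ˡ (V-^ i (V-ι u)) (vX i)) (TG i l) ⟩
          ι (G i) * (ι u ^ i * (D * X i)) ≈⟨ ≋-*ˡ (V-ι (G i)) (≋-*ˡ (V-^ i (V-ι u)) (XY i l)) ⟩
          ι (G i) * (ι u ^ i * ι (Y i)) ≡⟨ cong (ι (G i) *_) (trans (cong (_* ι (Y i)) (sym (ι-^ u i))) (sym (ι-* (u ℤ.^ i) (Y i)))) ⟩
          ι (G i) * ι (u ℤ.^ i ℤ.* Y i) ≡⟨ sym (ι-* (G i) (u ℤ.^ i ℤ.* Y i)) ⟩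
          ι (G i ℤ.* (u ℤ.^ i ℤ.* Y i)) ∎)) (≋-reflexive (sym (ι-Σ e (λ i → G i ℤ.* (u ℤ.^ i ℤ.* Y i))))))
        where open ≋-Reasoning
      V-ΣT : ∀ u (X : ℕ → Carrier) → (∀ i → V 0 (X i)) → V 0 (Σ e (λ i → T i * (ι u ^ i * X i)))
      V-ΣT u X vX = Σ-V e (λ i l → V-*ˡ (V-T i (ℕP.m<n⇒m<1+n l)) (V-*ˡ (V-^ i (V-ι u)) (vX i)))
      V-χ : ∀ N → V 0 (χ c N)
      V-χ N = V-mono z≤n (χ-kernel c N)
      S₃ : ℕ → ℕ → Carrier
      S₃ i j = Σ e (λ k → T k * (ι w ^ k * χ c (i ℕ.+ (j ℕ.+ k))))
      S₂ : ℕ → Carrier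
      S₂ i = Σ e (λ j → T j * (ι v ^ j * S₃ i j))
      s₃ : ℕ → ℕ → ℤ
      s₃ i j = ℤ-Alg.Σ e (λ k → G k ℤ.* (w ℤ.^ k ℤ.* χℤ c (i ℕ.+ (j ℕ.+ k))))
      s₂ : ℕ → ℤ
      s₂ i = ℤ-Alg.Σ e (λ j → G j ℤ.* (v ℤ.^ j ℤ.* s₃ i j))
      V-S₃ : ∀ i j → V 0 (S₃ i j)
      V-S₃ i j = V-ΣT w (λ k → χ c (i ℕ.+ (j ℕ.+ k))) (λ k → V-χ (i ℕ.+ (j ℕ.+ k)))
      lift₃ : ∀ i j → A * S₃ i j ≋ ι (s₃ i j)
      lift₃ i j = ≋-trans (≋-reflexive (cong (_* S₃ i j) (sym (*-identityʳ A))))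
        (lift w 1# (λ k → χ c (i ℕ.+ (j ℕ.+ k))) (λ k → χℤ c (i ℕ.+ (j ℕ.+ k))) (λ k _ → ≋-reflexive (trans (*-identityˡ _) (sym (ι-χ c (i ℕ.+ (j ℕ.+ k)))))) (λ k → V-*ˡ V-1 (V-χ (i ℕ.+ (j ℕ.+ k)))))
      lift₂ : ∀ i → A * A * S₂ i ≋ ι (s₂ i)
      lift₂ i = lift v A (S₃ i) (s₃ i) (λ j _ → lift₃ i j) (λ j → V-*ˡ V-A (V-S₃ i j))
      lhs : A * (A * A) * Σ e (λ i → T i * (ι u ^ i * S₂ i)) ≋ ι (ℤ-Alg.Σ e (λ i → G i ℤ.* (u ℤ.^ i ℤ.* s₂ i)))
      lhs = lift u (A * A) S₂ s₂ (λ i _ → lift₂ i) (λ i → V-*ˡ (V-*ˡ V-A V-A) (V-ΣT v (S₃ i) (V-S₃ i)))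
      rhs : A * (A * A) * (T c * ι z ^ c) ≋ ι ((pos 1 ℤ.- pos p) ℤ.* ((pos 1 ℤ.- pos p) ℤ.* (G c ℤ.* z ℤ.^ c)))
      rhs = begin
        A * (A * A) * (T c * ι z ^ c) ≡⟨ solve 3 (λ a t z → a :* (a :* a) :* (t :* z) := a :* (a :* ((a :* t) :* z))) refl A (T c) (ι z ^ c) ⟩
        A * (A * ((A * T c) * ι z ^ c)) ≈⟨ ≋-*ˡ V-A (≋-*ˡ V-A (≋-*ʳ (V-^ c (V-ι z)) (TG c c<e))) ⟩
        A * (A * (ι (G c) * ι z ^ c)) ≡⟨ cong₂ (λ a b → a * (a * b)) A≡ (trans (cong (ι (G c) *_) (sym (ι-^ z c))) (sym (ι-* (G c) (z ℤ.^ c)))) ⟩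
        ι (pos 1 ℤ.- pos p) * (ι (pos 1 ℤ.- pos p) * ι (G c ℤ.* z ℤ.^ c)) ≡⟨ sym (trans (ι-* (pos 1 ℤ.- pos p) _) (cong (ι (pos 1 ℤ.- pos p) *_) (ι-* (pos 1 ℤ.- pos p) (G c ℤ.* z ℤ.^ c)))) ⟩
        ι ((pos 1 ℤ.- pos p) ℤ.* ((pos 1 ℤ.- pos p) ℤ.* (G c ℤ.* z ℤ.^ c))) ∎
        where open ≋-Reasoning

-- Teichmüller representatives modulo q.

module Teichmuller where

  open FiniteSums
  open Congruences
  open RationalNumbers
  open GrossKoblitz

  open ℤ-Alg using (Σ)

  geo : ℤ → ℤ → ℕ → ℤ
  geo x y zero = + 0
  geo x y (suc n) = x ℤ.^ n ℤ.+ y ℤ.* geo x y n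

  geo-factor : ∀ x y n → x ℤ.^ n ℤ.- y ℤ.^ n ≡ (x ℤ.- y) ℤ.* geo x y n
  geo-factor x y zero = sym (ℤP.*-zeroʳ (x ℤ.- y))
  geo-factor x y (suc n) = trans (l₁ x y (x ℤ.^ n) (y ℤ.^ n)) (trans (cong (λ z → (x ℤ.- y) ℤ.* x ℤ.^ n ℤ.+ y ℤ.* z) (geo-factor x y n)) (l₂ x y (x ℤ.^ n) (geo x y n)))
    where
    l₁ : ∀ x y a b → x ℤ.* a ℤ.- y ℤ.* b ≡ (x ℤ.- y) ℤ.* a ℤ.+ y ℤ.* (a ℤ.- b)
    l₁ = solve-∀
    l₂ : ∀ x y a g → (x ℤ.- y) ℤ.* a ℤ.+ y ℤ.* ((x ℤ.- y) ℤ.* g) ≡ (x ℤ.- y) ℤ.* (a ℤ.+ y ℤ.* g)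
    l₂ = solve-∀

  Σ-geometric : ∀ z n → (z ℤ.- + 1) ℤ.* Σ n (z ℤ.^_) ≡ z ℤ.^ n ℤ.- + 1
  Σ-geometric z zero = ℤP.*-zeroʳ (z ℤ.- + 1)
  Σ-geometric z (suc n) = trans (ℤP.*-distribˡ-+ (z ℤ.- + 1) (Σ n (z ℤ.^_)) (z ℤ.^ n)) (trans (cong (λ a → a ℤ.+ (z ℤ.- + 1) ℤ.* z ℤ.^ n) (Σ-geometric z n)) (l z (z ℤ.^ n)))
    where
    l : ∀ z a → a ℤ.- + 1 ℤ.+ (z ℤ.- + 1) ℤ.* a ≡ z ℤ.* a ℤ.- + 1
    l = solve-∀

  Σ-const : ∀ n c → Σ n (λ _ → c) ≡ + n ℤ.* c
  Σ-const zero c = sym (ℤP.*-zeroˡ c)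
  Σ-const (suc n) c = trans (cong (ℤ._+ c) (Σ-const n c)) (l (+ n) c)
    where
    l : ∀ n c → n ℤ.* c ℤ.+ c ≡ (+ 1 ℤ.+ n) ℤ.* c
    l = solve-∀

  module PrimePower {e h : ℕ} (P : OddPrime e h) (k′ : ℕ) where

    module M = PrimeModulus P
    open M using (p; Unit; 4≤e; e≡h+h)
    open MoritaGamma P public
    open Transfer rationals P k′ public using (q; Γ-periodic; cancel-unit; additiveℤ; Unit-e)
    module Z = Congruence (+ q)
    open Z public
    open import Relation.Binary.Reasoning.Setoid Z.setoid

    instance
      nonZero-e : NonZero e
      nonZero-e = ℕ.>-nonZero (ℕP.≤-trans (s≤s z≤n) 4≤e)

    cancel : ∀ c {x y} → Unit c → c ℤ.* x ≈ c ℤ.* y → x ≈ y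
    cancel c {x} {y} u r = -≈0⇒≈ (cancel-unit c u (≈-trans (≡⇒≈ (l c x y)) (≈⇒-≈0 r)))
      where
      l : ∀ c x y → c ℤ.* (x ℤ.- y) ≡ c ℤ.* x ℤ.- c ℤ.* y
      l = solve-∀

    q≡ : + q ≡ + p ℤ.* + (p ℕ.^ k′)
    q≡ = ℤP.pos-* p (p ℕ.^ k′)

    ≈⇒≈p : ∀ {x y} → x ≈ y → x M.≈ y
    ≈⇒≈p {x} {y} (by r eq) = M.by (r ℤ.* + (p ℕ.^ k′)) (trans eq (cong (λ z → y ℤ.+ z) (trans (cong (r ℤ.*_) q≡) (l r (+ p) (+ (p ℕ.^ k′))))))
      where
      l : ∀ r p s → r ℤ.* (p ℤ.* s) ≡ r ℤ.* s ℤ.* p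
      l = solve-∀

    -- The Teichmüller representative of x modulo q. As a plain power it is multiplicative as an
    -- equation of integers; its dependence on x modulo p alone is the congruence `Ω-cong`.
    Ω : ℤ → ℤ
    Ω x = x ℤ.^ (p ℕ.^ k′)

    geo-p : ∀ x y → x M.≈ y → ∀ n → geo x y (suc n) M.≈ + suc n ℤ.* y ℤ.^ n
    geo-p x y r zero = M.≡⇒≈ (cong (λ z → + 1 ℤ.+ z) (ℤP.*-zeroʳ y))
    geo-p x y r (suc n) = M.≈-trans (M.+-cong (M.^-cong (suc n) r) (M.*-congˡ y (geo-p x y r n))) (M.≡⇒≈ (l (+ n) y (y ℤ.^ n)))
      where
      l : ∀ n y a → y ℤ.* a ℤ.+ y ℤ.* ((+ 1 ℤ.+ n) ℤ.* a) ≡ (+ 1 ℤ.+ (+ 1 ℤ.+ n)) ℤ.* (y ℤ.* a)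
      l = solve-∀

    -- Each p-th power gains a factor p: in Xᵖ - Yᵖ = (X - Y) · geo X Y p the cofactor is ≡ p Yᵖ⁻¹ ≡
    -- 0 modulo p.
    lift-power : ∀ j {x y} → x M.≈ y → ∃[ t ] (x ℤ.^ (p ℕ.^ j) ℤ.- y ℤ.^ (p ℕ.^ j) ≡ t ℤ.* + (p ℕ.^ suc j))
    lift-power zero {x} {y} (M.by r refl) = r , trans (l y r (+ p)) (cong (r ℤ.*_) (sym (ℤP.pos-* p 1)))
      where
      l : ∀ y r p → (y ℤ.+ r ℤ.* p) ℤ.* + 1 ℤ.- y ℤ.* + 1 ≡ r ℤ.* (p ℤ.* + 1)
      l = solve-∀
    lift-power (suc j) {x} {y} r with lift-power j r
    ... | t , eq = t ℤ.* s ,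
      trans (cong₂ ℤ._-_ (pow x) (pow y)) (trans (geo-factor X Y p)
      (trans (cong₂ ℤ._*_ eq (trans (M._≈_.equation g≈0) (ℤP.+-identityˡ _)))
      (trans (l t (+ (p ℕ.^ suc j)) s (+ p)) (cong (λ z → t ℤ.* s ℤ.* z) (sym (ℤP.pos-* p (p ℕ.^ suc j)))))))
      where
      X = x ℤ.^ (p ℕ.^ j)
      Y = y ℤ.^ (p ℕ.^ j)
      pow : ∀ x → x ℤ.^ (p ℕ.* p ℕ.^ j) ≡ (x ℤ.^ (p ℕ.^ j)) ℤ.^ p
      pow x = trans (cong (x ℤ.^_) (ℕP.*-comm p (p ℕ.^ j))) (sym (ℤP.^-*-assoc x (p ℕ.^ j) p))
      g≈0 : geo X Y p M.≈ + 0
      g≈0 = M.≈-trans (geo-p X Y (M.^-cong (p ℕ.^ j) r) e) (M.≈-trans (M.*-congʳ (Y ℤ.^ e) M.modulus≈0) (M.≡⇒≈ (ℤP.*-zeroˡ (Y ℤ.^ e))))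
      s = M._≈_.quotient g≈0
      l : ∀ t a s p → t ℤ.* a ℤ.* (s ℤ.* p) ≡ t ℤ.* s ℤ.* (p ℤ.* a)
      l = solve-∀

    Ω-cong : ∀ {x y} → x M.≈ y → Ω x ≈ Ω y
    Ω-cong r with lift-power k′ r
    ... | t , eq = -≈0⇒≈ (≈-trans (≡⇒≈ eq) (multiple≈0 t))

    Ω≈p : ∀ x → Ω x M.≈ x
    Ω≈p x = go k′
      where
      go : ∀ j → x ℤ.^ (p ℕ.^ j) M.≈ x
      go zero = M.≡⇒≈ (ℤP.*-identityʳ x)
      go (suc j) = M.≈-trans (M.≡⇒≈ (sym (ℤP.^-*-assoc x p (p ℕ.^ j)))) (M.≈-trans (M.^-cong (p ℕ.^ j) (M.fermat x)) (go j))

    Ω-* : ∀ x y → Ω (x ℤ.* y) ≡ Ω x ℤ.* Ω y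
    Ω-* x y = go (p ℕ.^ k′)
      where
      l : ∀ x y a b → x ℤ.* y ℤ.* (a ℤ.* b) ≡ x ℤ.* a ℤ.* (y ℤ.* b)
      l = solve-∀
      go : ∀ n → (x ℤ.* y) ℤ.^ n ≡ x ℤ.^ n ℤ.* y ℤ.^ n
      go zero = refl
      go (suc n) = trans (cong (x ℤ.* y ℤ.*_) (go n)) (l x y (x ℤ.^ n) (y ℤ.^ n))

    Ω-^ : ∀ x n → Ω (x ℤ.^ n) ≡ Ω x ℤ.^ n
    Ω-^ x n = trans (ℤP.^-*-assoc x n (p ℕ.^ k′)) (trans (cong (x ℤ.^_) (ℕP.*-comm n (p ℕ.^ k′))) (sym (ℤP.^-*-assoc x (p ℕ.^ k′) n)))

    Ω-1 : Ω (+ 1) ≡ + 1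
    Ω-1 = ℤP.^-zeroˡ (p ℕ.^ k′)

    Ω-e : ∀ {x} → Unit x → Ω x ℤ.^ e ≈ + 1
    Ω-e {x} u = ≈-trans (≡⇒≈ (sym (Ω-^ x e))) (≈-trans (Ω-cong (M.fermat-unit x u)) (≡⇒≈ Ω-1))

    Ω-p : ∀ x → Ω x ℤ.^ p ≈ Ω x
    Ω-p x = ≈-trans (≡⇒≈ (sym (Ω-^ x p))) (Ω-cong (M.fermat x))

    Unit-Ω : ∀ {x} → Unit x → Unit (Ω x)
    Unit-Ω u = M.Unit-^ (p ℕ.^ k′) u

    Ω-≈0 : ∀ {x} → x M.≈ + 0 → Ω x ≈ + 0
    Ω-≈0 z = ≈-trans (Ω-cong z) (≡⇒≈ (0^ (p ℕ.^ k′) (ℕP.m^n>0 p k′)))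
      where
      0^ : ∀ n → 0 < n → (+ 0) ℤ.^ n ≡ + 0
      0^ (suc n) _ = ℤP.*-zeroˡ ((+ 0) ℤ.^ n)

    power-mod : ∀ {x} → x ℤ.^ e ≈ + 1 → ∀ m n → m ℕM.% e ≡ n ℕM.% e → x ℤ.^ m ≈ x ℤ.^ n
    power-mod {x} xe m n r = ≈-trans (red m) (≈-trans (≡⇒≈ (cong (x ℤ.^_) r)) (≈-sym (red n)))
      where
      red : ∀ m → x ℤ.^ m ≈ x ℤ.^ (m ℕM.% e)
      red m = begin
        x ℤ.^ m ≡⟨ cong (x ℤ.^_) (trans (ℕM.m≡m%n+[m/n]*n m e) (cong (m ℕM.% e ℕ.+_) (ℕP.*-comm (m ℕM./ e) e))) ⟩
        x ℤ.^ (m ℕM.% e ℕ.+ e ℕ.* (m ℕM./ e)) ≡⟨ trans (ℤP.^-distribˡ-+-* x (m ℕM.% e) (e ℕ.* (m ℕM./ e))) (cong (x ℤ.^ (m ℕM.% e) ℤ.*_) (sym (ℤP.^-*-assoc x e (m ℕM./ e)))) ⟩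
        x ℤ.^ (m ℕM.% e) ℤ.* (x ℤ.^ e) ℤ.^ (m ℕM./ e) ≈⟨ *-congˡ (x ℤ.^ (m ℕM.% e)) (^-≈1 (m ℕM./ e) xe) ⟩
        x ℤ.^ (m ℕM.% e) ℤ.* + 1 ≡⟨ ℤP.*-identityʳ _ ⟩
        x ℤ.^ (m ℕM.% e) ∎

    periodic : ∀ (f : ℕ → ℤ) → (∀ m → f (m ℕ.+ q) ≈ f m) → ∀ {m n} → + m ≈ + n → f m ≈ f n
    periodic f step {m} {n} m≈n = case ℕP.≤-total n m of λ
      { (inj₁ n≤m) → down m n n≤m m≈n
      ; (inj₂ m≤n) → ≈-sym (down n m m≤n (≈-sym m≈n)) }
      where
      shifts : ∀ n t → f (n ℕ.+ t ℕ.* q) ≈ f n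
      shifts n zero = ≡⇒≈ (cong f (ℕP.+-identityʳ n))
      shifts n (suc t) = ≈-trans (≡⇒≈ (cong f (l n q (t ℕ.* q)))) (≈-trans (step (n ℕ.+ t ℕ.* q)) (shifts n t))
        where
        l : ∀ n q t → n ℕ.+ (q ℕ.+ t) ≡ n ℕ.+ t ℕ.+ q
        l = solveℕ-∀
      down : ∀ m n → n ≤ m → + m ≈ + n → f m ≈ f n
      down m n n≤m (by r eq) = ≈-trans (≡⇒≈ (cong f (trans (sym (ℕP.m+[n∸m]≡n n≤m)) (cong (n ℕ.+_) (ℕD._∣_.equality q∣))))) (shifts n (ℕD.quotient q∣))
        where
        l : ∀ m x → m ℤ.+ x ℤ.- m ≡ + 0 ℤ.+ x
        l = solve-∀
        q∣ : q ℕD.∣ m ℕ.∸ n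
        q∣ = ∣⇒∣ᵤ (≈0⇒∣ {+ (m ℕ.∸ n)} (by r (trans (sym (ℤP.⊖-≥ n≤m)) (trans (sym (ℤP.m-n≡m⊖n m n)) (trans (cong (ℤ._- + n) eq) (l (+ n) (r ℤ.* + q)))))))

-- Reflection, duplication and triplication for Morita's gamma function.

module GammaFormulas where

  open FiniteSums
  open Congruences
  open GrossKoblitz
  open Teichmuller

  module GammaIdentities {e h : ℕ} (P : OddPrime e h) (k′ : ℕ) where

    open PrimePower P k′
    open M using (p; Unit; 4≤e; e≡h+h)
    open import Relation.Binary.Reasoning.Setoid Z.setoid

    -- E b n is b to the number of j < n prime to p.
    ε : ℤ → ℕ → ℤ
    ε b n with M.≈0? (+ n)
    ... | yes _ = + 1
    ... | no _ = b

    E : ℤ → ℕ → ℤ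
    E b zero = + 1
    E b (suc n) = ε b n ℤ.* E b n

    ε-multiple : ∀ b n → + n M.≈ + 0 → ε b n ≡ + 1
    ε-multiple b n z with M.≈0? (+ n)
    ... | yes _ = refl
    ... | no u = ⊥-elim (u z)

    ε-unit : ∀ b n → Unit (+ n) → ε b n ≡ b
    ε-unit b n u with M.≈0? (+ n)
    ... | yes z = ⊥-elim (u z)
    ... | no _ = refl

    γ-multiple : ∀ n → + n M.≈ + 0 → γ n ≡ ℤ.- (+ 1)
    γ-multiple n z with M.≈0? (+ n)
    ... | yes _ = refl
    ... | no u = ⊥-elim (u z)

    γ-unit : ∀ n → Unit (+ n) → γ n ≡ ℤ.- (+ n)
    γ-unit n u with M.≈0? (+ n)
    ... | yes z = ⊥-elim (u z)
    ... | no _ = refl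

    ε-cong : ∀ b {m n} → + m M.≈ + n → ε b m ≡ ε b n
    ε-cong b {m} {n} r = case M.≈0? (+ m) of λ
      { (yes z) → trans (ε-multiple b m z) (sym (ε-multiple b n (M.≈-trans (M.≈-sym r) z)))
      ; (no u) → trans (ε-unit b m u) (sym (ε-unit b n (M.Unit-cong r u))) }

    offset-p : ∀ i n → + (i ℕ.+ n ℕ.* p) M.≈ + i
    offset-p i n = M.by (+ n) (trans (ℤP.pos-+ i (n ℕ.* p)) (cong (λ z → + i ℤ.+ z) (ℤP.pos-* n p)))

    E-block : ∀ b n i → i < p → E b (suc (i ℕ.+ n ℕ.* p)) ≡ b ℤ.^ (i ℕ.+ n ℕ.* e)
    E-block b zero zero _ = cong (ℤ._* + 1) (ε-multiple b 0 M.≈-refl)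
    E-block b (suc n) zero _ = trans (cong₂ ℤ._*_ (ε-multiple b (suc n ℕ.* p) (offset-p 0 (suc n))) (E-block b n e ℕP.≤-refl)) (ℤP.*-identityˡ (b ℤ.^ (e ℕ.+ n ℕ.* e)))
    E-block b n (suc i) l = cong₂ ℤ._*_ (ε-unit b (suc i ℕ.+ n ℕ.* p) (M.Unit-cong (M.≈-sym (offset-p (suc i) n)) (M.Unit-small (suc i) (s≤s z≤n) l))) (E-block b n i (ℕP.<-trans (ℕP.n<1+n i) l))

    -- Below q there are p^k′(p - 1) integers prime to p, so this is Euler's theorem.
    E-period : ∀ b → Unit b → E b q ≈ + 1
    E-period b u = go (p ℕ.^ k′) refl
      where
      l : ∀ p t → p ℕ.* suc t ≡ p ℕ.+ t ℕ.* p
      l = solveℕ-∀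
      go : ∀ n → p ℕ.^ k′ ≡ n → E b q ≈ + 1
      go zero eq = case subst (0 <_) eq (ℕP.m^n>0 p k′) of λ ()
      go (suc t) eq = begin
        E b q ≡⟨ cong (E b) (trans (cong (p ℕ.*_) eq) (l p t)) ⟩
        E b (suc (e ℕ.+ t ℕ.* p)) ≡⟨ E-block b t e ℕP.≤-refl ⟩
        b ℤ.^ (suc t ℕ.* e) ≡⟨ cong (λ z → b ℤ.^ (z ℕ.* e)) (sym eq) ⟩
        b ℤ.^ (p ℕ.^ k′ ℕ.* e) ≡⟨ sym (ℤP.^-*-assoc b (p ℕ.^ k′) e) ⟩
        Ω b ℤ.^ e ≈⟨ Ω-e u ⟩
        + 1 ∎

    mod-q : ∀ m → + (m ℕ.+ q) ≈ + m
    mod-q m = by (+ 1) (trans (ℤP.pos-+ m q) (cong (λ z → + m ℤ.+ z) (sym (ℤP.*-identityˡ (+ q)))))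

    E-periodic : ∀ b → Unit b → ∀ {m n} → + m ≈ + n → E b m ≈ E b n
    E-periodic b u = periodic (E b) go
      where
      go : ∀ m → E b (m ℕ.+ q) ≈ E b m
      go zero = E-period b u
      go (suc m) = *-cong (≡⇒≈ (ε-cong b (≈⇒≈p (mod-q m)))) (go m)

    -- nr a represents a/(p-1) modulo q.
    nr : ℕ → ℕ
    nr a = suc ((e ℕ.∸ a) ℕ.* geometric p (suc k′))

    nr-spec : ∀ a → a ≤ e → + e ℤ.* + nr a ≈ + a
    nr-spec a a≤e = by (+ (e ℕ.∸ a)) (
      trans (cong (+ e ℤ.*_) (trans (ℤP.pos-+ 1 (r ℕ.* s)) (cong (λ z → + 1 ℤ.+ z) (ℤP.pos-* r s)))) (trans (l₁ (+ e) (+ r) (+ s))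
      (trans (cong (λ z → + e ℤ.+ + r ℤ.* z) es) (trans (l₂ (+ e) (+ r) (+ q)) (cong (ℤ._+ + r ℤ.* + q) er)))))
      where
      r = e ℕ.∸ a
      s = geometric p (suc k′)
      l₁ : ∀ e r s → e ℤ.* (+ 1 ℤ.+ r ℤ.* s) ≡ e ℤ.+ r ℤ.* (e ℤ.* s)
      l₁ = solve-∀
      l₂ : ∀ e r q → e ℤ.+ r ℤ.* (q ℤ.- + 1) ≡ e ℤ.- r ℤ.+ r ℤ.* q
      l₂ = solve-∀
      l₃ : ∀ x → x ≡ + 1 ℤ.+ x ℤ.- + 1
      l₃ = solve-∀
      l₄ : ∀ a r → a ℤ.+ r ℤ.- r ≡ a
      l₄ = solve-∀
      es : + e ℤ.* + s ≡ + q ℤ.- + 1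
      es = trans (l₃ (+ e ℤ.* + s)) (cong (ℤ._- + 1) (trans (cong (λ z → + 1 ℤ.+ z) (sym (ℤP.pos-* e s))) (cong +_ (geometric-sum e (suc k′)))))
      er : + e ℤ.- + r ≡ + a
      er = trans (cong (ℤ._- + r) (trans (cong +_ (sym (ℕP.m+[n∸m]≡n a≤e))) (ℤP.pos-+ a r))) (l₄ (+ a) (+ r))

    -- Put r = e - a and s = `geometric p k′`. Below nr a = 1 + r + rsp the integers prime to p
    -- number r + rse = r p^k′, and b to the power p^k′ is `Ω b`.
    E-nr : ∀ b a → E b (nr a) ≡ Ω b ℤ.^ (e ℕ.∸ a)
    E-nr b a = trans (cong (λ z → E b (suc z)) (l₁ r p s)) (trans (E-block b (r ℕ.* s) r (s≤s (ℕP.m∸n≤m e a))) (trans (cong (b ℤ.^_) (trans (l₂ r s e) (cong (ℕ._* r) (geometric-sum e k′)))) (sym (ℤP.^-*-assoc b (p ℕ.^ k′) r))))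
      where
      r = e ℕ.∸ a
      s = geometric p k′
      l₁ : ∀ r p s → r ℕ.* (1 ℕ.+ p ℕ.* s) ≡ r ℕ.+ r ℕ.* s ℕ.* p
      l₁ = solveℕ-∀
      l₂ : ∀ r s e → r ℕ.+ r ℕ.* s ℕ.* e ≡ suc (e ℕ.* s) ℕ.* r
      l₂ = solveℕ-∀

    -- Lowering m raises n. As n ≡ -m, the factors γ m and γ n agree when p divides m and are
    -- opposite otherwise; `E` at -1 collects these signs.
    reflection : ∀ m n → + (m ℕ.+ n) ≈ + 1 → Γ m ℤ.* Γ n ≈ ℤ.- E (ℤ.- (+ 1)) m
    reflection zero n r = ≈-trans (≡⇒≈ (ℤP.*-identityˡ (Γ n))) (≈-trans (Γ-periodic r) (≡⇒≈ (cong (ℤ._* + 1) (γ-multiple 0 M.≈-refl))))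
    reflection (suc m) n r = case M.≈0? (+ m) of λ
      { (yes z) → begin
          γ m ℤ.* Γ m ℤ.* Γ n ≡⟨ trans (cong (λ a → a ℤ.* Γ m ℤ.* Γ n) (trans (γ-multiple m z) (sym (γ-multiple n (n-multiple z))))) (l₁ (γ n) (Γ m) (Γ n)) ⟩
          Γ m ℤ.* (γ n ℤ.* Γ n) ≈⟨ ih ⟩
          ℤ.- E (ℤ.- (+ 1)) m ≡⟨ cong ℤ.-_ (sym (trans (cong (ℤ._* E (ℤ.- (+ 1)) m) (ε-multiple (ℤ.- (+ 1)) m z)) (ℤP.*-identityˡ _))) ⟩
          ℤ.- (ε (ℤ.- (+ 1)) m ℤ.* E (ℤ.- (+ 1)) m) ∎
      ; (no u) → begin
          γ m ℤ.* Γ m ℤ.* Γ n ≈⟨ *-congʳ (Γ n) (*-congʳ (Γ m) (γ-opposite u)) ⟩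
          ℤ.- γ n ℤ.* Γ m ℤ.* Γ n ≡⟨ l₂ (γ n) (Γ m) (Γ n) ⟩
          ℤ.- (Γ m ℤ.* (γ n ℤ.* Γ n)) ≈⟨ neg-cong ih ⟩
          ℤ.- (ℤ.- E (ℤ.- (+ 1)) m) ≡⟨ trans (l₃ (E (ℤ.- (+ 1)) m)) (cong (λ a → ℤ.- (a ℤ.* E (ℤ.- (+ 1)) m)) (sym (ε-unit (ℤ.- (+ 1)) m u))) ⟩
          ℤ.- (ε (ℤ.- (+ 1)) m ℤ.* E (ℤ.- (+ 1)) m) ∎ }
      where
      l₁ : ∀ c a b → c ℤ.* a ℤ.* b ≡ a ℤ.* (c ℤ.* b)
      l₁ = solve-∀
      l₂ : ∀ c a b → ℤ.- c ℤ.* a ℤ.* b ≡ ℤ.- (a ℤ.* (c ℤ.* b))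
      l₂ = solve-∀
      l₃ : ∀ x → ℤ.- (ℤ.- x) ≡ ℤ.- (ℤ.- (+ 1) ℤ.* x)
      l₃ = solve-∀
      l₄ : ∀ m n → n ≡ ℤ.- m ℤ.+ (+ 1 ℤ.+ (m ℤ.+ n) ℤ.- + 1)
      l₄ = solve-∀
      ih : Γ m ℤ.* Γ (suc n) ≈ ℤ.- E (ℤ.- (+ 1)) m
      ih = reflection m (suc n) (≈-trans (≡⇒≈ (cong +_ (ℕP.+-suc m n))) r)
      n≈-m : + n ≈ ℤ.- (+ m)
      n≈-m = ≈-trans (≡⇒≈ (l₄ (+ m) (+ n))) (≈-trans (+-cong (≈-refl {ℤ.- (+ m)}) (≈⇒-≈0 {+ 1 ℤ.+ (+ m ℤ.+ + n)} r)) (≡⇒≈ (ℤP.+-identityʳ (ℤ.- (+ m)))))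
      n-multiple : + m M.≈ + 0 → + n M.≈ + 0
      n-multiple z = M.≈-trans (≈⇒≈p n≈-m) (M.neg-cong z)
      γ-opposite : Unit (+ m) → γ m ≈ ℤ.- γ n
      γ-opposite u = ≈-trans (≡⇒≈ (γ-unit m u)) (≈-trans (≈-sym n≈-m) (≡⇒≈ (trans (sym (ℤP.neg-involutive (+ n))) (cong ℤ.-_ (sym (γ-unit n (M.Unit-cong (M.≈-sym (≈⇒≈p n≈-m)) (M.Unit-neg u))))))))

    γ-ε : ∀ b x y → Unit (+ b) → + b ℤ.* + x ≈ + y → γ x ℤ.* ε (+ b) y ≈ γ y
    γ-ε b x y ub r = case M.≈0? (+ x) of λ
      { (yes z) → ≡⇒≈ (trans (cong₂ ℤ._*_ (γ-multiple x z) (ε-multiple (+ b) y (y0 z))) (sym (γ-multiple y (y0 z))))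
      ; (no u) → let uy = M.Unit-cong (≈⇒≈p r) (M.Unit-* ub u) in
          ≈-trans (≡⇒≈ (trans (cong₂ ℤ._*_ (γ-unit x u) (ε-unit (+ b) y uy)) (l (+ b) (+ x)))) (≈-trans (neg-cong r) (≡⇒≈ (sym (γ-unit y uy)))) }
      where
      l : ∀ b x → ℤ.- x ℤ.* b ≡ ℤ.- (b ℤ.* x)
      l = solve-∀
      y0 : + x M.≈ + 0 → + y M.≈ + 0
      y0 z = M.≈-trans (M.≈-sym (≈⇒≈p r)) (M.≈-trans (M.*-congˡ (+ b) z) (M.≡⇒≈ (ℤP.*-zeroʳ (+ b))))

    Unit-2 : Unit (+ 2)
    Unit-2 = M.Unit-small 2 (s≤s z≤n) (s≤s (ℕP.≤-trans (s≤s (s≤s z≤n)) 4≤e))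

    Unit-3 : Unit (+ 3)
    Unit-3 = M.Unit-small 3 (s≤s z≤n) (s≤s (ℕP.≤-trans (s≤s (s≤s (s≤s z≤n))) 4≤e))

    -- Gauss's formula by induction on m, with t for 1/2. A step brings the factors at m and m + 1/2
    -- on the left and those at 2m and 2m + 1 on the right; by `γ-ε` they differ by the powers of 2
    -- that `E` counts. At m = 0 both sides are Γ t.
    duplication-step : ∀ t → + 2 ℤ.* + t ≈ + 1 → ∀ m → Γ m ℤ.* Γ (m ℕ.+ t) ℤ.* E (+ 2) (m ℕ.+ m) ≈ Γ (m ℕ.+ m) ℤ.* Γ t
    duplication-step t 2t zero = ≡⇒≈ (l (Γ t))
      where
      l : ∀ x → + 1 ℤ.* x ℤ.* + 1 ≡ + 1 ℤ.* x
      l = solve-∀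
    duplication-step t 2t (suc m) = begin
      Γ (suc m) ℤ.* Γ (suc m ℕ.+ t) ℤ.* E (+ 2) (suc m ℕ.+ suc m)
        ≡⟨ cong (λ z → Γ (suc m) ℤ.* Γ (suc m ℕ.+ t) ℤ.* E (+ 2) (suc z)) (ℕP.+-suc m m) ⟩
      γ m ℤ.* Γ m ℤ.* (γ (m ℕ.+ t) ℤ.* Γ (m ℕ.+ t)) ℤ.* (ε (+ 2) (suc (m ℕ.+ m)) ℤ.* (ε (+ 2) (m ℕ.+ m) ℤ.* E (+ 2) (m ℕ.+ m)))
        ≡⟨ l₁ (γ m) (Γ m) (γ (m ℕ.+ t)) (Γ (m ℕ.+ t)) (ε (+ 2) (suc (m ℕ.+ m))) (ε (+ 2) (m ℕ.+ m)) (E (+ 2) (m ℕ.+ m)) ⟩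
      (γ (m ℕ.+ t) ℤ.* ε (+ 2) (suc (m ℕ.+ m))) ℤ.* ((γ m ℤ.* ε (+ 2) (m ℕ.+ m)) ℤ.* (Γ m ℤ.* Γ (m ℕ.+ t) ℤ.* E (+ 2) (m ℕ.+ m)))
        ≈⟨ *-cong (γ-ε 2 (m ℕ.+ t) (suc (m ℕ.+ m)) Unit-2 odd) (*-cong (γ-ε 2 m (m ℕ.+ m) Unit-2 (≡⇒≈ even)) (duplication-step t 2t m)) ⟩
      γ (suc (m ℕ.+ m)) ℤ.* (γ (m ℕ.+ m) ℤ.* (Γ (m ℕ.+ m) ℤ.* Γ t))
        ≡⟨ l₂ (γ (suc (m ℕ.+ m))) (γ (m ℕ.+ m)) (Γ (m ℕ.+ m)) (Γ t) ⟩
      Γ (suc (suc (m ℕ.+ m))) ℤ.* Γ t ≡⟨ cong (λ z → Γ (suc z) ℤ.* Γ t) (sym (ℕP.+-suc m m)) ⟩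
      Γ (suc m ℕ.+ suc m) ℤ.* Γ t ∎
      where
      l₁ : ∀ a b c d e f g → a ℤ.* b ℤ.* (c ℤ.* d) ℤ.* (e ℤ.* (f ℤ.* g)) ≡ (c ℤ.* e) ℤ.* ((a ℤ.* f) ℤ.* (b ℤ.* d ℤ.* g))
      l₁ = solve-∀
      l₂ : ∀ a b c d → a ℤ.* (b ℤ.* (c ℤ.* d)) ≡ a ℤ.* (b ℤ.* c) ℤ.* d
      l₂ = solve-∀
      l₃ : ∀ m → + 2 ℤ.* m ≡ m ℤ.+ m
      l₃ = solve-∀
      l₄ : ∀ m t → + 2 ℤ.* (m ℤ.+ t) ≡ + 2 ℤ.* t ℤ.+ (m ℤ.+ m)
      l₄ = solve-∀
      even : + 2 ℤ.* + m ≡ + (m ℕ.+ m)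
      even = trans (l₃ (+ m)) (sym (ℤP.pos-+ m m))
      odd : + 2 ℤ.* + (m ℕ.+ t) ≈ + suc (m ℕ.+ m)
      odd = ≈-trans (≡⇒≈ (trans (cong (+ 2 ℤ.*_) (ℤP.pos-+ m t)) (l₄ (+ m) (+ t)))) (≈-trans (+-cong 2t (≡⇒≈ (sym (ℤP.pos-+ m m)))) ≈-refl)

    -- Periodicity frees the formula from particular integers: m, m′ and n merely represent x, x +
    -- 1/2 and 2x modulo q.
    duplication : ∀ t m m′ n → + 2 ℤ.* + t ≈ + 1 → + 2 ℤ.* + m ≈ + n → + 2 ℤ.* + m′ ≈ + 1 ℤ.+ + n → Γ m ℤ.* Γ m′ ℤ.* E (+ 2) n ≈ Γ n ℤ.* Γ t
    duplication t m m′ n 2t 2m 2m′ = begin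
      Γ m ℤ.* Γ m′ ℤ.* E (+ 2) n ≈⟨ *-cong (*-congˡ (Γ m) (Γ-periodic m′≈)) (E-periodic (+ 2) Unit-2 n≈) ⟩
      Γ m ℤ.* Γ (m ℕ.+ t) ℤ.* E (+ 2) (m ℕ.+ m) ≈⟨ duplication-step t 2t m ⟩
      Γ (m ℕ.+ m) ℤ.* Γ t ≈⟨ *-congʳ (Γ t) (Γ-periodic (≈-sym n≈)) ⟩
      Γ n ℤ.* Γ t ∎
      where
      l₃ : ∀ m → + 2 ℤ.* m ≡ m ℤ.+ m
      l₃ = solve-∀
      l₄ : ∀ m t → + 2 ℤ.* t ℤ.+ + 2 ℤ.* m ≡ + 2 ℤ.* (m ℤ.+ t)
      l₄ = solve-∀
      n≈ : + n ≈ + (m ℕ.+ m)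
      n≈ = ≈-trans (≈-sym 2m) (≡⇒≈ (trans (l₃ (+ m)) (sym (ℤP.pos-+ m m))))
      m′≈ : + m′ ≈ + (m ℕ.+ t)
      m′≈ = cancel (+ 2) Unit-2 (≈-trans 2m′ (≈-trans (+-cong (≈-sym 2t) (≈-sym 2m)) (≡⇒≈ (trans (l₄ (+ m) (+ t)) (cong (+ 2 ℤ.*_) (sym (ℤP.pos-+ m t)))))))

    -- The induction of `duplication-step` with t and t′ for 1/3 and 2/3: the factors at m, m + 1/3,
    -- m + 2/3 meet those at 3m, 3m + 1, 3m + 2.
    triplication-step : ∀ t t′ → + 3 ℤ.* + t ≈ + 1 → + 3 ℤ.* + t′ ≈ + 2 → ∀ m →
      Γ m ℤ.* (Γ (m ℕ.+ t) ℤ.* Γ (m ℕ.+ t′)) ℤ.* E (+ 3) (m ℕ.+ m ℕ.+ m) ≈ Γ (m ℕ.+ m ℕ.+ m) ℤ.* (Γ t ℤ.* Γ t′)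
    triplication-step t t′ 3t 3t′ zero = ≡⇒≈ (l (Γ t ℤ.* Γ t′))
      where
      l : ∀ x → + 1 ℤ.* x ℤ.* + 1 ≡ + 1 ℤ.* x
      l = solve-∀
    triplication-step t t′ 3t 3t′ (suc m) = begin
      Γ (suc m) ℤ.* (Γ (suc m ℕ.+ t) ℤ.* Γ (suc m ℕ.+ t′)) ℤ.* E (+ 3) (suc m ℕ.+ suc m ℕ.+ suc m)
        ≡⟨ cong (λ z → Γ (suc m) ℤ.* (Γ (suc m ℕ.+ t) ℤ.* Γ (suc m ℕ.+ t′)) ℤ.* E (+ 3) z) (l₀ m) ⟩
      γ m ℤ.* Γ m ℤ.* (γ (m ℕ.+ t) ℤ.* Γ (m ℕ.+ t) ℤ.* (γ (m ℕ.+ t′) ℤ.* Γ (m ℕ.+ t′))) ℤ.* (ε (+ 3) (suc (suc s)) ℤ.* (ε (+ 3) (suc s) ℤ.* (ε (+ 3) s ℤ.* E (+ 3) s)))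
        ≡⟨ l₁ (γ m) (Γ m) (γ (m ℕ.+ t)) (Γ (m ℕ.+ t)) (γ (m ℕ.+ t′)) (Γ (m ℕ.+ t′)) (ε (+ 3) (suc (suc s))) (ε (+ 3) (suc s)) (ε (+ 3) s) (E (+ 3) s) ⟩
      (γ (m ℕ.+ t′) ℤ.* ε (+ 3) (suc (suc s))) ℤ.* ((γ (m ℕ.+ t) ℤ.* ε (+ 3) (suc s)) ℤ.* ((γ m ℤ.* ε (+ 3) s) ℤ.* (Γ m ℤ.* (Γ (m ℕ.+ t) ℤ.* Γ (m ℕ.+ t′)) ℤ.* E (+ 3) s)))
        ≈⟨ *-cong (γ-ε 3 (m ℕ.+ t′) (suc (suc s)) Unit-3 (shifted t′ 2 3t′)) (*-cong (γ-ε 3 (m ℕ.+ t) (suc s) Unit-3 (shifted t 1 3t)) (*-cong (γ-ε 3 m s Unit-3 (≡⇒≈ triple)) (triplication-step t t′ 3t 3t′ m))) ⟩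
      γ (suc (suc s)) ℤ.* (γ (suc s) ℤ.* (γ s ℤ.* (Γ s ℤ.* (Γ t ℤ.* Γ t′))))
        ≡⟨ l₂ (γ (suc (suc s))) (γ (suc s)) (γ s) (Γ s) (Γ t ℤ.* Γ t′) ⟩
      Γ (suc (suc (suc s))) ℤ.* (Γ t ℤ.* Γ t′) ≡⟨ cong (λ z → Γ z ℤ.* (Γ t ℤ.* Γ t′)) (sym (l₀ m)) ⟩
      Γ (suc m ℕ.+ suc m ℕ.+ suc m) ℤ.* (Γ t ℤ.* Γ t′) ∎
      where
      s = m ℕ.+ m ℕ.+ m
      l₀ : ∀ m → suc m ℕ.+ suc m ℕ.+ suc m ≡ suc (suc (suc (m ℕ.+ m ℕ.+ m)))
      l₀ = solveℕ-∀
      l₁ : ∀ a b c d e f g h i j → a ℤ.* b ℤ.* (c ℤ.* d ℤ.* (e ℤ.* f)) ℤ.* (g ℤ.* (h ℤ.* (i ℤ.* j))) ≡ (e ℤ.* g) ℤ.* ((c ℤ.* h) ℤ.* ((a ℤ.* i) ℤ.* (b ℤ.* (d ℤ.* f) ℤ.* j)))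
      l₁ = solve-∀
      l₂ : ∀ a b c d e → a ℤ.* (b ℤ.* (c ℤ.* (d ℤ.* e))) ≡ a ℤ.* (b ℤ.* (c ℤ.* d)) ℤ.* e
      l₂ = solve-∀
      l₃ : ∀ m → + 3 ℤ.* m ≡ m ℤ.+ m ℤ.+ m
      l₃ = solve-∀
      triple : + 3 ℤ.* + m ≡ + s
      triple = trans (l₃ (+ m)) (sym (trans (ℤP.pos-+ (m ℕ.+ m) m) (cong (ℤ._+ + m) (ℤP.pos-+ m m))))
      l₄ : ∀ m t → + 3 ℤ.* (m ℤ.+ t) ≡ + 3 ℤ.* t ℤ.+ + 3 ℤ.* m
      l₄ = solve-∀
      shifted : ∀ t c → + 3 ℤ.* + t ≈ + c → + 3 ℤ.* + (m ℕ.+ t) ≈ + (c ℕ.+ s)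
      shifted t c r = ≈-trans (≡⇒≈ (trans (cong (+ 3 ℤ.*_) (ℤP.pos-+ m t)) (l₄ (+ m) (+ t)))) (≈-trans (+-cong r (≡⇒≈ triple)) (≡⇒≈ (sym (ℤP.pos-+ c s))))

    triplication : ∀ t t′ m m′ m″ n → + 3 ℤ.* + t ≈ + 1 → + 3 ℤ.* + t′ ≈ + 2 → + 3 ℤ.* + m ≈ + n → + 3 ℤ.* + m′ ≈ + 1 ℤ.+ + n → + 3 ℤ.* + m″ ≈ + 2 ℤ.+ + n →
      Γ m ℤ.* (Γ m′ ℤ.* Γ m″) ℤ.* E (+ 3) n ≈ Γ n ℤ.* (Γ t ℤ.* Γ t′)
    triplication t t′ m m′ m″ n 3t 3t′ 3m 3m′ 3m″ = begin
      Γ m ℤ.* (Γ m′ ℤ.* Γ m″) ℤ.* E (+ 3) n ≈⟨ *-cong (*-congˡ (Γ m) (*-cong (Γ-periodic (match t m′ (+ 1) 3t 3m′)) (Γ-periodic (match t′ m″ (+ 2) 3t′ 3m″)))) (E-periodic (+ 3) Unit-3 n≈) ⟩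
      Γ m ℤ.* (Γ (m ℕ.+ t) ℤ.* Γ (m ℕ.+ t′)) ℤ.* E (+ 3) s ≈⟨ triplication-step t t′ 3t 3t′ m ⟩
      Γ s ℤ.* (Γ t ℤ.* Γ t′) ≈⟨ *-congʳ (Γ t ℤ.* Γ t′) (Γ-periodic (≈-sym n≈)) ⟩
      Γ n ℤ.* (Γ t ℤ.* Γ t′) ∎
      where
      s = m ℕ.+ m ℕ.+ m
      l₃ : ∀ m → + 3 ℤ.* m ≡ m ℤ.+ m ℤ.+ m
      l₃ = solve-∀
      l₄ : ∀ m t → + 3 ℤ.* t ℤ.+ + 3 ℤ.* m ≡ + 3 ℤ.* (m ℤ.+ t)
      l₄ = solve-∀
      n≈ : + n ≈ + s
      n≈ = ≈-trans (≈-sym 3m) (≡⇒≈ (trans (l₃ (+ m)) (sym (trans (ℤP.pos-+ (m ℕ.+ m) m) (cong (ℤ._+ + m) (ℤP.pos-+ m m))))))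
      match : ∀ t m′ c → + 3 ℤ.* + t ≈ c → + 3 ℤ.* + m′ ≈ c ℤ.+ + n → + m′ ≈ + (m ℕ.+ t)
      match t m′ c r r′ = cancel (+ 3) Unit-3 (≈-trans r′ (≈-trans (+-cong (≈-sym r) (≈-sym 3m)) (≡⇒≈ (trans (l₄ (+ m) (+ t)) (cong (+ 3 ℤ.*_) (sym (ℤP.pos-+ m t)))))))

    Unit-Γ : ∀ n → Unit (Γ n)
    Unit-Γ zero = M.Unit-1
    Unit-Γ (suc n) = M.Unit-* (case M.≈0? (+ n) of λ
      { (yes z) → subst Unit (sym (γ-multiple n z)) (M.Unit-neg M.Unit-1)
      ; (no u) → subst Unit (sym (γ-unit n u)) (M.Unit-neg u) }) (Unit-Γ n)

-- Orthogonality of characters and the quadratic character.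

module Characters where

  open FiniteSums
  open Congruences
  open GrossKoblitz
  open Teichmuller
  open GammaFormulas

  open ℤ-Alg using (Σ; Σ-cong; Σ-cong<; Σ-front; Σ-swap; Σ-*ˡ; Σ-*ʳ; Σ-single; Σ-zero; Σ-+; Σ-split)

  *-pow : ∀ x y n → (x ℤ.* y) ℤ.^ n ≡ x ℤ.^ n ℤ.* y ℤ.^ n
  *-pow x y zero = refl
  *-pow x y (suc n) = trans (cong (x ℤ.* y ℤ.*_) (*-pow x y n)) (l x y (x ℤ.^ n) (y ℤ.^ n))
    where
    l : ∀ x y a b → x ℤ.* y ℤ.* (a ℤ.* b) ≡ x ℤ.* a ℤ.* (y ℤ.* b)
    l = solve-∀

  module _ (e : ℕ) .{{_ : NonZero e}} where

    %-cancel : ∀ s {j j′} → j < e → j′ < e → (s ℕ.+ j) ℕM.% e ≡ (s ℕ.+ j′) ℕM.% e → j ≡ j′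
    %-cancel s {j} {j′} l l′ r = trans (sym (red j l)) (trans (ℕM.%-distribˡ-+ t (s ℕ.+ j) e) (trans (cong (λ z → (t ℕM.% e ℕ.+ z) ℕM.% e) r) (trans (sym (ℕM.%-distribˡ-+ t (s ℕ.+ j′) e)) (red j′ l′))))
      where
      t = e ℕ.∸ s ℕM.% e
      t+s : t ℕ.+ s ≡ suc (s ℕM./ e) ℕ.* e
      t+s = trans (cong (t ℕ.+_) (ℕM.m≡m%n+[m/n]*n s e)) (trans (sym (ℕP.+-assoc t (s ℕM.% e) _)) (cong (ℕ._+ s ℕM./ e ℕ.* e) (ℕP.m∸n+n≡m (ℕP.<⇒≤ (ℕM.m%n<n s e)))))
      red : ∀ j → j < e → (t ℕ.+ (s ℕ.+ j)) ℕM.% e ≡ j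
      red j l = trans (cong (ℕM._% e) (trans (sym (ℕP.+-assoc t s j)) (trans (cong (ℕ._+ j) t+s) (ℕP.+-comm (suc (s ℕM./ e) ℕ.* e) j)))) (trans (ℕM.[m+kn]%n≡m%n j (suc (s ℕM./ e)) e) (ℕM.m<n⇒m%n≡m l))

  module CharacterSums {e h : ℕ} (P : OddPrime e h) (k′ : ℕ) where

    open PrimePower P k′ public
    open GammaIdentities P k′ public
    open M using (p; Unit; 4≤e; e≡h+h; distinct)
    open import Relation.Binary.Reasoning.Setoid Z.setoid

    ind : ℤ → ℤ → ℤ
    ind x y with M.≈0? (x ℤ.- y)
    ... | yes _ = + 1
    ... | no _ = + 0

    ind-yes : ∀ {x y} → x M.≈ y → ind x y ≡ + 1
    ind-yes {x} {y} r with M.≈0? (x ℤ.- y)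
    ... | yes _ = refl
    ... | no n = ⊥-elim (n (M.≈⇒-≈0 r))

    ind-no : ∀ {x y} → ¬ (x M.≈ y) → ind x y ≡ + 0
    ind-no {x} {y} r with M.≈0? (x ℤ.- y)
    ... | yes z = ⊥-elim (r (M.-≈0⇒≈ z))
    ... | no _ = refl

    inverse : ∀ {x} → Unit x → x ℤ.* x ℤ.^ (e ℕ.∸ 1) M.≈ + 1
    inverse {x} u = M.≈-trans (M.≡⇒≈ (cong (x ℤ.^_) (ℕP.m+[n∸m]≡n {1} {e} (ℕP.≤-trans (s≤s z≤n) 4≤e)))) (M.fermat-unit x u)

    Σ-ind : ∀ (f : ℕ → ℤ) {n} → n < p → ∀ {x} → x M.≈ + n → Σ p (λ y → ind x (+ y) ℤ.* f y) ≡ f n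
    Σ-ind f {n} n<p {x} r = trans (Σ-single p n (λ y → ind x (+ y) ℤ.* f y) n<p (λ i l i≢n → trans (cong (ℤ._* f i) (ind-no (λ r′ → i≢n (distinct l n<p (M.≈-trans (M.≈-sym r′) r))))) (ℤP.*-zeroˡ (f i))))
      (trans (cong (ℤ._* f n) (ind-yes r)) (ℤP.*-identityˡ (f n)))

    -- Each term is spread over the indicators of ux ≡ y. After exchanging the sums every y is met
    -- by the single x = y/u, so no permutation of the residues has to be formed.
    reindex : ∀ u c → Unit u → Σ p (λ x → Ω (u ℤ.* + x) ℤ.^ c) ≈ Σ p (λ y → Ω (+ y) ℤ.^ c)
    reindex u c uu = begin
      Σ p (λ x → Ω (u ℤ.* + x) ℤ.^ c) ≈⟨ Σ-cong≈ p (λ x _ → expand x) ⟩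
      Σ p (λ x → Σ p (λ y → ind (u ℤ.* + x) (+ y) ℤ.* f y)) ≡⟨ Σ-swap p p (λ x y → ind (u ℤ.* + x) (+ y) ℤ.* f y) ⟩
      Σ p (λ y → Σ p (λ x → ind (u ℤ.* + x) (+ y) ℤ.* f y)) ≡⟨ Σ-cong p (λ y → trans (sym (Σ-*ʳ p (f y) (λ x → ind (u ℤ.* + x) (+ y)))) (trans (cong (ℤ._* f y) (one y)) (ℤP.*-identityˡ (f y)))) ⟩
      Σ p f ∎
      where
      f : ℕ → ℤ
      f y = Ω (+ y) ℤ.^ c
      expand : ∀ x → Ω (u ℤ.* + x) ℤ.^ c ≈ Σ p (λ y → ind (u ℤ.* + x) (+ y) ℤ.* f y)
      expand x with M.residue (u ℤ.* + x)
      ... | n , n<p , r = ≈-trans (^-cong c (Ω-cong r)) (≡⇒≈ (sym (Σ-ind f n<p r)))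
      l : ∀ u v y → u ℤ.* (v ℤ.* y) ≡ u ℤ.* v ℤ.* y
      l = solve-∀
      one : ∀ y → Σ p (λ x → ind (u ℤ.* + x) (+ y)) ≡ + 1
      one y with M.residue (u ℤ.^ (e ℕ.∸ 1) ℤ.* + y)
      ... | n , n<p , r = trans (Σ-single p n (λ x → ind (u ℤ.* + x) (+ y)) n<p (λ i l i≢n → ind-no (λ r′ → i≢n (distinct l n<p (M.cancelˡ u uu (M.≈-trans r′ (M.≈-sym un)))))))
          (ind-yes un)
        where
        un : u ℤ.* + n M.≈ + y
        un = M.≈-trans (M.*-congˡ u (M.≈-sym r)) (M.≈-trans (M.≡⇒≈ (l u (u ℤ.^ (e ℕ.∸ 1)) (+ y))) (M.≈-trans (M.*-congʳ (+ y) (inverse uu)) (M.≡⇒≈ (ℤP.*-identityˡ (+ y)))))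

    orthogonal-trivial : ∀ c → c ℕM.% e ≡ 0 → Σ e (λ x → Ω (+ suc x) ℤ.^ c) ≈ + e
    orthogonal-trivial c r = ≈-trans (Σ-cong≈ e (λ x l → power-mod (Ω-e (M.Unit-small (suc x) (s≤s z≤n) (s≤s l))) c 0 (trans r (sym (ℕM.m<n⇒m%n≡m (ℕP.≤-trans (s≤s z≤n) 4≤e)))))) (≡⇒≈ (trans (Σ-const e (+ 1)) (ℤP.*-identityʳ (+ e))))

    0^ : ∀ c → c ≢ 0 → Ω (+ 0) ℤ.^ c ≈ + 0
    0^ zero c≢0 = ⊥-elim (c≢0 refl)
    0^ (suc c) _ = ≈-trans (*-congʳ (Ω (+ 0) ℤ.^ c) (Ω-≈0 M.≈-refl)) (≡⇒≈ (ℤP.*-zeroˡ (Ω (+ 0) ℤ.^ c)))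

    -- With u from `non-root`, multiplication by ω(u)ᶜ permutes the terms of S, so (ω(u)ᶜ - 1)S ≡ 0.
    -- That factor is nonzero modulo p, hence S vanishes modulo the full q.
    orthogonal : ∀ c → c ℕM.% e ≢ 0 → Σ e (λ x → Ω (+ suc x) ℤ.^ c) ≈ + 0
    orthogonal c r with M.non-root (c ℕM.% e) (ℕP.n≢0⇒n>0 r) (ℕM.m%n<n c e)
    ... | u , 0<u , u<p , ¬1 = ≈-trans (≈-sym drop-zero) (cancel-unit (Ω (+ u) ℤ.^ c ℤ.- + 1) unit (begin
        (Ω (+ u) ℤ.^ c ℤ.- + 1) ℤ.* S ≡⟨ l (Ω (+ u) ℤ.^ c) S ⟩
        Ω (+ u) ℤ.^ c ℤ.* S ℤ.- S ≈⟨ +-cong (≈-trans (≡⇒≈ (trans (Σ-*ˡ p (Ω (+ u) ℤ.^ c) f) (Σ-cong p (λ x → trans (sym (*-pow (Ω (+ u)) (Ω (+ x)) c)) (cong (ℤ._^ c) (sym (Ω-* (+ u) (+ x)))))))) (reindex (+ u) c uu)) (≈-refl {ℤ.- S}) ⟩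
        S ℤ.- S ≡⟨ ℤP.+-inverseʳ S ⟩
        + 0 ∎))
      where
      f : ℕ → ℤ
      f x = Ω (+ x) ℤ.^ c
      S = Σ p f
      uu : Unit (+ u)
      uu = M.Unit-small u 0<u u<p
      l : ∀ a s → (a ℤ.- + 1) ℤ.* s ≡ a ℤ.* s ℤ.- s
      l = solve-∀
      unit : Unit (Ω (+ u) ℤ.^ c ℤ.- + 1)
      unit z = ¬1 (M.≈-trans (M.≈-sym (M.^-cong (c ℕM.% e) (Ω≈p (+ u)))) (M.≈-trans (≈⇒≈p (power-mod (Ω-e uu) (c ℕM.% e) c (ℕM.m%n%n≡m%n c e))) (M.-≈0⇒≈ z)))
      c≢0 : c ≢ 0
      c≢0 refl = r (ℕM.m<n⇒m%n≡m (ℕP.≤-trans (s≤s z≤n) 4≤e))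
      drop-zero : S ≈ Σ e (λ x → Ω (+ suc x) ℤ.^ c)
      drop-zero = ≈-trans (≡⇒≈ (Σ-front e f)) (≈-trans (+-cong (0^ c c≢0) ≈-refl) (≡⇒≈ (ℤP.+-identityˡ _)))

    0<h : 0 < h
    0<h = ℕP.n≢0⇒n>0 (λ { refl → case subst (4 ≤_) e≡h+h 4≤e of λ () })

    h<e : h < e
    h<e = subst (h <_) (sym e≡h+h) (ℕP.m<m+n h 0<h)

    φ : ℤ → ℤ
    φ w = Ω w ℤ.^ h

    φ-0 : ∀ {w} → w M.≈ + 0 → φ w ≈ + 0
    φ-0 {w} z = ≈-trans (^-cong h (Ω-cong z)) (0^ h (λ q → ℕP.<-irrefl (sym q) 0<h))

    φ² : ∀ {w} → Unit w → φ w ℤ.* φ w ≈ + 1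
    φ² {w} u = ≈-trans (≡⇒≈ (trans (sym (ℤP.^-distribˡ-+-* (Ω w) h h)) (cong (Ω w ℤ.^_) (sym e≡h+h)))) (Ω-e u)

    roots : ℤ → ℤ
    roots w = Σ p (λ y → ind (+ y ℤ.* + y) w)

    -- If z - 1 is a unit, the geometric sum vanishes. Otherwise z ≡ 1 modulo p, and since zᵖ ≡ z
    -- makes z its own Teichmüller representative, z ≡ 1 modulo q.
    Σ-powers : ∀ {z} → z ℤ.^ e ≈ + 1 → Σ e (z ℤ.^_) ≈ + e ℤ.* ind z (+ 1)
    Σ-powers {z} ze = case M.≈0? (z ℤ.- + 1) of λ
      { (no u) → ≈-trans (cancel-unit (z ℤ.- + 1) u (≈-trans (≡⇒≈ (Σ-geometric z e)) (≈⇒-≈0 ze))) (≡⇒≈ (sym (trans (cong (+ e ℤ.*_) (ind-no (λ r → u (M.≈⇒-≈0 r)))) (ℤP.*-zeroʳ (+ e)))))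
      ; (yes r) → ≈-trans (Σ-cong≈ e (λ c _ → ^-≈1 c (one (M.-≈0⇒≈ r)))) (≡⇒≈ (trans (Σ-const e (+ 1)) (cong (+ e ℤ.*_) (sym (ind-yes (M.-≈0⇒≈ r)))))) }
      where
      one : z M.≈ + 1 → z ≈ + 1
      one r = ≈-trans (teich k′) (≈-trans (Ω-cong r) (≡⇒≈ Ω-1))
        where
        zp : z ℤ.^ p ≈ z
        zp = ≈-trans (*-congˡ z ze) (≡⇒≈ (ℤP.*-identityʳ z))
        teich : ∀ j → z ≈ z ℤ.^ (p ℕ.^ j)
        teich zero = ≡⇒≈ (sym (ℤP.*-identityʳ z))
        teich (suc j) = ≈-trans (≈-trans (teich j) (^-cong (p ℕ.^ j) (≈-sym zp))) (≡⇒≈ (ℤP.^-*-assoc z p (p ℕ.^ j)))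

    -- For a unit w, e times the indicator of y² ≡ w is the sum over c < e of ω(y²/w)ᶜ. Summing over
    -- y ≠ 0 keeps the c with 2c ≡ 0 modulo e, namely c = 0 and c = h, which contribute 1 and φ(1/w)
    -- = φ(w).
    roots-φ : ∀ w → roots w ≈ + 1 ℤ.+ φ w
    roots-φ w = case M.≈0? w of λ { (yes z) → zero-case z ; (no u) → unit-case u }
      where
      zero-case : w M.≈ + 0 → roots w ≈ + 1 ℤ.+ φ w
      zero-case z = ≈-trans (≡⇒≈ (trans (Σ-single p 0 (λ y → ind (+ y ℤ.* + y) w) (s≤s z≤n) (λ i l i≢0 → ind-no (λ r → M.Unit-* (ui i l i≢0) (ui i l i≢0) (M.≈-trans r z)))) (ind-yes (M.≈-sym z))))
        (≈-trans (≡⇒≈ refl) (+-cong (≈-refl {+ 1}) (≈-sym (φ-0 z))))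
        where
        ui : ∀ i → i < p → i ≢ 0 → Unit (+ i)
        ui i l i≢0 = M.Unit-small i (ℕP.n≢0⇒n>0 i≢0) l
      unit-case : Unit w → roots w ≈ + 1 ℤ.+ φ w
      unit-case u = cancel (+ e) Unit-e (begin
        + e ℤ.* roots w
          ≡⟨ cong (+ e ℤ.*_) (trans (Σ-front e (λ y → ind (+ y ℤ.* + y) w)) (trans (cong (ℤ._+ Σ e (λ y → ind (+ suc y ℤ.* + suc y) w)) (ind-no (λ r → u (M.≈-sym r)))) (ℤP.+-identityˡ _))) ⟩
        + e ℤ.* Σ e (λ y → ind (+ suc y ℤ.* + suc y) w)
          ≡⟨ Σ-*ˡ e (+ e) (λ y → ind (+ suc y ℤ.* + suc y) w) ⟩
        Σ e (λ y → + e ℤ.* ind (+ suc y ℤ.* + suc y) w)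
          ≈⟨ Σ-cong≈ e (λ y l → expand y l) ⟩
        Σ e (λ y → Σ e (λ c → Ω w̄ ℤ.^ c ℤ.* Ω (+ suc y) ℤ.^ (c ℕ.+ c)))
          ≡⟨ trans (Σ-swap e e (λ y c → Ω w̄ ℤ.^ c ℤ.* Ω (+ suc y) ℤ.^ (c ℕ.+ c))) (Σ-cong e (λ c → sym (Σ-*ˡ e (Ω w̄ ℤ.^ c) (λ y → Ω (+ suc y) ℤ.^ (c ℕ.+ c))))) ⟩
        Σ e t
          ≡⟨ trans (cong (λ n → Σ n t) e≡h+h) (Σ-split h h t) ⟩
        Σ h t ℤ.+ Σ h (λ i → t (h ℕ.+ i))
          ≈⟨ +-cong (single t (λ c → c) (λ c l → refl) (λ _ → refl)) (single (λ i → t (h ℕ.+ i)) (h ℕ.+_) (λ i l → trans (cong (ℕM._% e) (l₁ h i)) (trans (cong (λ z → (i ℕ.+ i ℕ.+ z) ℕM.% e) (trans (sym e≡h+h) (sym (ℕP.*-identityˡ e)))) (ℕM.[m+kn]%n≡m%n (i ℕ.+ i) 1 e))) (λ _ → refl)) ⟩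
        Ω w̄ ℤ.^ 0 ℤ.* + e ℤ.+ Ω w̄ ℤ.^ (h ℕ.+ 0) ℤ.* + e
          ≡⟨ trans (cong (λ z → + 1 ℤ.* + e ℤ.+ Ω w̄ ℤ.^ z ℤ.* + e) (ℕP.+-identityʳ h)) (l₂ (+ e) (φ w̄)) ⟩
        + e ℤ.* (+ 1 ℤ.+ φ w̄)
          ≈⟨ *-congˡ (+ e) (+-cong (≈-refl {+ 1}) φ-inverse) ⟩
        + e ℤ.* (+ 1 ℤ.+ φ w) ∎)
        where
        w̄ = w ℤ.^ (e ℕ.∸ 1)
        uw̄ : Unit w̄
        uw̄ = M.Unit-^ (e ℕ.∸ 1) u
        t : ℕ → ℤ
        t c = Ω w̄ ℤ.^ c ℤ.* Σ e (λ y → Ω (+ suc y) ℤ.^ (c ℕ.+ c))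
        l₁ : ∀ h i → h ℕ.+ i ℕ.+ (h ℕ.+ i) ≡ i ℕ.+ i ℕ.+ (h ℕ.+ h)
        l₁ = solveℕ-∀
        l₂ : ∀ e f → + 1 ℤ.* e ℤ.+ f ℤ.* e ≡ e ℤ.* (+ 1 ℤ.+ f)
        l₂ = solve-∀
        -- In both halves of the range of c the exponents 2c reduce to 2i with i < h, which is
        -- nonzero modulo e except at i = 0.
        single : ∀ (s : ℕ → ℤ) (g : ℕ → ℕ) → (∀ i → i < h → (g i ℕ.+ g i) ℕM.% e ≡ (i ℕ.+ i) ℕM.% e) →
          (∀ i → s i ≡ t (g i)) → Σ h s ≈ Ω w̄ ℤ.^ g 0 ℤ.* + e
        single s g r eq = begin
          Σ h s ≈⟨ Σ-cong≈ h (λ i l → ≈-trans (≡⇒≈ (eq i)) (*-congˡ (Ω w̄ ℤ.^ g i) (case i ℕ.≟ 0 of λ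
              { (yes refl) → ≈-trans (orthogonal-trivial (g 0 ℕ.+ g 0) (trans (r 0 l) (ℕM.m<n⇒m%n≡m (ℕP.≤-trans (s≤s z≤n) 4≤e)))) (≡⇒≈ (sym (δ-yes refl)))
              ; (no i≢0) → ≈-trans (orthogonal (g i ℕ.+ g i) (λ z → i≢0 (i+i≡0 i (trans (sym (ℕM.m<n⇒m%n≡m (subst (i ℕ.+ i <_) (sym e≡h+h) (ℕP.+-mono-< l l)))) (trans (sym (r i l)) z))))) (≡⇒≈ (sym (δ-no i≢0))) }))) ⟩
          Σ h (λ i → Ω w̄ ℤ.^ g i ℤ.* δ i) ≡⟨ Σ-single h 0 (λ i → Ω w̄ ℤ.^ g i ℤ.* δ i) 0<h (λ i l i≢0 → trans (cong (Ω w̄ ℤ.^ g i ℤ.*_) (δ-no i≢0)) (ℤP.*-zeroʳ (Ω w̄ ℤ.^ g i))) ⟩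
          Ω w̄ ℤ.^ g 0 ℤ.* + e ∎
          where
          δ : ℕ → ℤ
          δ zero = + e
          δ (suc _) = + 0
          δ-yes : ∀ {i} → i ≡ 0 → δ i ≡ + e
          δ-yes refl = refl
          δ-no : ∀ {i} → i ≢ 0 → δ i ≡ + 0
          δ-no {zero} n = ⊥-elim (n refl)
          δ-no {suc i} n = refl
          i+i≡0 : ∀ i → i ℕ.+ i ≡ 0 → i ≡ 0
          i+i≡0 zero _ = refl
        expand : ∀ y → y < e → + e ℤ.* ind (+ suc y ℤ.* + suc y) w ≈ Σ e (λ c → Ω w̄ ℤ.^ c ℤ.* Ω (+ suc y) ℤ.^ (c ℕ.+ c))
        expand y l = ≈-sym (begin
          Σ e (λ c → Ω w̄ ℤ.^ c ℤ.* Ω Y ℤ.^ (c ℕ.+ c)) ≡⟨ Σ-cong e (λ c → trans (cong (Ω w̄ ℤ.^ c ℤ.*_) (ℤP.^-distribˡ-+-* (Ω Y) c c)) (sym (trans (cong (ℤ._^ c) (trans (Ω-* (Y ℤ.* Y) w̄) (cong (ℤ._* Ω w̄) (Ω-* Y Y)))) (pow₃ (Ω Y) (Ω w̄) c)))) ⟩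
          Σ e (Ω (Y ℤ.* Y ℤ.* w̄) ℤ.^_) ≈⟨ Σ-powers (Ω-e (M.Unit-* (M.Unit-* uY uY) uw̄)) ⟩
          + e ℤ.* ind (Ω (Y ℤ.* Y ℤ.* w̄)) (+ 1) ≡⟨ cong (+ e ℤ.*_) same ⟩
          + e ℤ.* ind (Y ℤ.* Y) w ∎)
          where
          Y = + suc y
          uY : Unit Y
          uY = M.Unit-small (suc y) (s≤s z≤n) (s≤s l)
          l₃ : ∀ a b x y → a ℤ.* a ℤ.* b ℤ.* (y ℤ.* (x ℤ.* x)) ≡ b ℤ.* y ℤ.* (a ℤ.* x ℤ.* (a ℤ.* x))
          l₃ = solve-∀
          pow₃ : ∀ a b c → (a ℤ.* a ℤ.* b) ℤ.^ c ≡ b ℤ.^ c ℤ.* (a ℤ.^ c ℤ.* a ℤ.^ c)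
          pow₃ a b zero = refl
          pow₃ a b (suc c) = trans (cong (a ℤ.* a ℤ.* b ℤ.*_) (pow₃ a b c)) (l₃ a b (a ℤ.^ c) (b ℤ.^ c))
          l₅ : ∀ a w v → w ℤ.* (a ℤ.* v) ≡ a ℤ.* (w ℤ.* v)
          l₅ = solve-∀
          same : ind (Ω (Y ℤ.* Y ℤ.* w̄)) (+ 1) ≡ ind (Y ℤ.* Y) w
          same = case M.≈0? (Y ℤ.* Y ℤ.- w) of λ
            { (yes z) → trans (ind-yes (M.≈-trans (Ω≈p (Y ℤ.* Y ℤ.* w̄)) (M.≈-trans (M.*-congʳ w̄ (M.-≈0⇒≈ {Y ℤ.* Y} {w} z)) (inverse u)))) (sym (ind-yes (M.-≈0⇒≈ {Y ℤ.* Y} {w} z)))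
            ; (no n) → trans (ind-no (λ r → n (M.≈⇒-≈0 (M.≈-trans (M.≈-trans (M.≡⇒≈ (sym (ℤP.*-identityʳ (Y ℤ.* Y)))) (M.≈-trans (M.*-congˡ (Y ℤ.* Y) (M.≈-sym (inverse u))) (M.≡⇒≈ (sym (l₅ (Y ℤ.* Y) w w̄)))))
                (M.≈-trans (M.*-congˡ w (M.≈-trans (M.≈-sym (Ω≈p (Y ℤ.* Y ℤ.* w̄))) r)) (M.≡⇒≈ (ℤP.*-identityʳ w))))))) (sym (ind-no (λ r → n (M.≈⇒-≈0 r)))) }
        φ-inverse : φ w̄ ≈ φ w
        φ-inverse = begin
          φ w̄ ≡⟨ sym (ℤP.*-identityˡ (φ w̄)) ⟩
          + 1 ℤ.* φ w̄ ≈⟨ *-congʳ (φ w̄) (≈-sym (φ² u)) ⟩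
          φ w ℤ.* φ w ℤ.* φ w̄ ≡⟨ trans (ℤP.*-assoc (φ w) (φ w) (φ w̄)) (cong (φ w ℤ.*_) (sym (trans (cong (ℤ._^ h) (Ω-* w w̄)) (*-pow (Ω w) (Ω w̄) h)))) ⟩
          φ w ℤ.* Ω (w ℤ.* w̄) ℤ.^ h ≈⟨ *-congˡ (φ w) (^-≈1 h (≈-trans (Ω-cong (inverse u)) (≡⇒≈ Ω-1))) ⟩
          φ w ℤ.* + 1 ≡⟨ ℤP.*-identityʳ (φ w) ⟩
          φ w ∎

-- The addition law summed over the x-coordinates of the curve.

module CurveSums where

  open FiniteSums
  open Congruences
  open GrossKoblitz
  open Teichmuller
  open GammaFormulas
  open Characters

  open ℤ-Alg using (Σ; Σ-cong; Σ-cong<; Σ-front; Σ-swap; Σ-*ˡ; Σ-*ʳ; Σ-single; Σ-zero; Σ-+; Σ-split)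

  module CurveSum {e h : ℕ} (P : OddPrime e h) (k′ : ℕ) (a b : ℤ)
    (Unit-a : PrimeModulus.Unit P a) (Unit-b : PrimeModulus.Unit P b) where

    open CharacterSums P k′ public
    open M using (p; Unit; 4≤e; e≡h+h)
    open import Relation.Binary.Reasoning.Setoid Z.setoid

    cubic : ℤ → ℤ
    cubic x = x ℤ.* x ℤ.* x ℤ.+ (a ℤ.* x ℤ.+ b)

    G : ℕ → ℤ
    G i = Γ (nr i)

    χ-no : ∀ c N → N ℕM.% e ≢ c → χℤ c N ≡ + 0
    χ-no c N r with N ℕM.% e ℕ.≟ c
    ... | yes q = ⊥-elim (r q)
    ... | no _ = refl

    χ-yes : ∀ c N → N ℕM.% e ≡ c → χℤ c N ≡ (ℤ.- (+ p)) ℤ.^ (N ℕM./ e)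
    χ-yes c N r with N ℕM.% e ℕ.≟ c
    ... | yes q = refl
    ... | no n = ⊥-elim (n r)

    inner : ℕ → ℕ → ℤ
    inner i j = Σ e (λ k → G k ℤ.* (Ω b ℤ.^ k ℤ.* χℤ h (i ℕ.+ (j ℕ.+ k))))

    -- `additiveℤ` at ω(x³), ω(ax), ω(b) with c = h, because the h-th power of ω is the quadratic
    -- character; (1 - p)² is e². The point x = 0 is absent since ω(0) is not an e-th root of unity.
    pointwise : ∀ x → x < e →
      Σ e (λ i → Σ e (λ j → G i ℤ.* (G j ℤ.* (Ω a ℤ.^ j ℤ.* inner i j)) ℤ.* Ω (+ suc x) ℤ.^ (i ℕ.* 3 ℕ.+ j)))
        ≈ + e ℤ.* (+ e ℤ.* (G h ℤ.* φ (cubic (+ suc x))))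
    pointwise x l = begin
      Σ e (λ i → Σ e (λ j → G i ℤ.* (G j ℤ.* (Ω a ℤ.^ j ℤ.* inner i j)) ℤ.* Ω X ℤ.^ (i ℕ.* 3 ℕ.+ j)))
        ≡⟨ Σ-cong e (λ i → trans (Σ-cong e (λ j → trans (cong (G i ℤ.* (G j ℤ.* (Ω a ℤ.^ j ℤ.* inner i j)) ℤ.*_) (trans (ℤP.^-distribˡ-+-* (Ω X) (i ℕ.* 3) j) (cong (ℤ._* Ω X ℤ.^ j) (trans (cong (Ω X ℤ.^_) (ℕP.*-comm i 3)) (sym (ℤP.^-*-assoc (Ω X) 3 i))))))
             (trans (l₁ (G i) (G j) (Ω a ℤ.^ j) (inner i j) ((Ω X ℤ.^ 3) ℤ.^ i) (Ω X ℤ.^ j)) (cong₂ (λ r s → G i ℤ.* (r ℤ.^ i ℤ.* (G j ℤ.* (s ℤ.* inner i j)))) (sym cube) (sym (trans (cong (ℤ._^ j) (Ω-* a X)) (*-pow (Ω a) (Ω X) j)))))))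
             (trans (sym (Σ-*ˡ e (G i) (λ j → Ω (X ℤ.* X ℤ.* X) ℤ.^ i ℤ.* (G j ℤ.* (Ω (a ℤ.* X) ℤ.^ j ℤ.* inner i j))))) (cong (G i ℤ.*_) (sym (Σ-*ˡ e (Ω (X ℤ.* X ℤ.* X) ℤ.^ i) (λ j → G j ℤ.* (Ω (a ℤ.* X) ℤ.^ j ℤ.* inner i j))))))) ⟩
      Σ e (λ i → G i ℤ.* (Ω (X ℤ.* X ℤ.* X) ℤ.^ i ℤ.* Σ e (λ j → G j ℤ.* (Ω (a ℤ.* X) ℤ.^ j ℤ.* inner i j))))
        ≈⟨ additiveℤ G (λ i i<e → nr i , nr-spec i (ℕP.<⇒≤ i<e) , refl) h (ℤ.- t) 0<h h<e (Ω-e (M.Unit-* (M.Unit-* uX uX) uX)) (Ω-e (M.Unit-* Unit-a uX)) (Ω-e Unit-b) (Ω-p (cubic X)) sum≡ ⟩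
      (+ 1 ℤ.- + p) ℤ.* ((+ 1 ℤ.- + p) ℤ.* (G h ℤ.* φ (cubic X)))
        ≡⟨ l₂ (+ e) (G h ℤ.* φ (cubic X)) ⟩
      + e ℤ.* (+ e ℤ.* (G h ℤ.* φ (cubic X))) ∎
      where
      X = + suc x
      uX : Unit X
      uX = M.Unit-small (suc x) (s≤s z≤n) (s≤s l)
      l₁ : ∀ g g′ w n c y → g ℤ.* (g′ ℤ.* (w ℤ.* n)) ℤ.* (c ℤ.* y) ≡ g ℤ.* (c ℤ.* (g′ ℤ.* (w ℤ.* y ℤ.* n)))
      l₁ = solve-∀
      l₂ : ∀ e y → (+ 1 ℤ.- (+ 1 ℤ.+ e)) ℤ.* ((+ 1 ℤ.- (+ 1 ℤ.+ e)) ℤ.* y) ≡ e ℤ.* (e ℤ.* y)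
      l₂ = solve-∀
      l₃ : ∀ x → x ℤ.* x ℤ.* x ≡ x ℤ.* (x ℤ.* (x ℤ.* + 1))
      l₃ = solve-∀
      cube : Ω (X ℤ.* X ℤ.* X) ≡ Ω X ℤ.^ 3
      cube = trans (cong Ω (l₃ X)) (Ω-^ X 3)
      congruent : Ω (X ℤ.* X ℤ.* X) ℤ.+ (Ω (a ℤ.* X) ℤ.+ Ω b) M.≈ Ω (cubic X)
      congruent = M.≈-trans (M.+-cong (Ω≈p (X ℤ.* X ℤ.* X)) (M.+-cong (Ω≈p (a ℤ.* X)) (Ω≈p b))) (M.≈-sym (Ω≈p (cubic X)))
      t = M._≈_.quotient congruent
      l₄ : ∀ z t p → z ℤ.+ t ℤ.* p ≡ z ℤ.+ ℤ.- p ℤ.* ℤ.- t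
      l₄ = solve-∀
      sum≡ : Ω (X ℤ.* X ℤ.* X) ℤ.+ (Ω (a ℤ.* X) ℤ.+ Ω b) ≡ Ω (cubic X) ℤ.+ ℤ.- (+ p) ℤ.* ℤ.- t
      sum≡ = trans (M._≈_.equation congruent) (l₄ (Ω (cubic X)) t (+ p))

    -- The indices that i determines: 3i + j ≡ 0 modulo e by orthogonality in x, then i + j + k ≡ h
    -- because the coordinate of ϖʰ is taken.
    jj kk : ℕ → ℕ
    jj i = (3 ℕ.* (e ℕ.∸ i)) ℕM.% e
    kk i = (h ℕ.+ 2 ℕ.* i) ℕM.% e

    total : ℕ → ℕ
    total i = i ℕ.+ (jj i ℕ.+ kk i)

    %-+ʳ : ∀ m n → (m ℕ.+ n ℕM.% e) ℕM.% e ≡ (m ℕ.+ n) ℕM.% e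
    %-+ʳ m n = trans (ℕM.%-distribˡ-+ m (n ℕM.% e) e) (trans (cong (λ z → (m ℕM.% e ℕ.+ z) ℕM.% e) (ℕM.m%n%n≡m%n n e)) (sym (ℕM.%-distribˡ-+ m n e)))

    jj-spec : ∀ i → i ≤ e → (i ℕ.* 3 ℕ.+ jj i) ℕM.% e ≡ 0
    jj-spec i i≤e = trans (%-+ʳ (i ℕ.* 3) (3 ℕ.* (e ℕ.∸ i))) (trans (cong (ℕM._% e) (trans (l i (e ℕ.∸ i)) (cong (3 ℕ.*_) (ℕP.m+[n∸m]≡n i≤e)))) (ℕM.m*n%n≡0 3 e))
      where
      l : ∀ i r → i ℕ.* 3 ℕ.+ 3 ℕ.* r ≡ 3 ℕ.* (i ℕ.+ r)
      l = solveℕ-∀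

    total-spec : ∀ i → i ≤ e → total i ℕM.% e ≡ h
    total-spec i i≤e = trans (cong (ℕM._% e) (sym (ℕP.+-assoc i (jj i) (kk i)))) (trans (%-+ʳ (i ℕ.+ jj i) (h ℕ.+ 2 ℕ.* i))
      (trans (cong (ℕM._% e) (l i (jj i) h)) (trans (cong (λ z → (h ℕ.+ z) ℕM.% e) (trans (ℕM.m≡m%n+[m/n]*n (i ℕ.* 3 ℕ.+ jj i) e) (cong (ℕ._+ (i ℕ.* 3 ℕ.+ jj i) ℕM./ e ℕ.* e) (jj-spec i i≤e)))) (trans (ℕM.[m+kn]%n≡m%n h ((i ℕ.* 3 ℕ.+ jj i) ℕM./ e) e) (ℕM.m<n⇒m%n≡m h<e)))))
      where
      l : ∀ i j h → i ℕ.+ j ℕ.+ (h ℕ.+ 2 ℕ.* i) ≡ h ℕ.+ (i ℕ.* 3 ℕ.+ j)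
      l = solveℕ-∀

    Z-term : ℕ → ℤ
    Z-term i = G i ℤ.* (G (jj i) ℤ.* (Ω a ℤ.^ jj i ℤ.* (G (kk i) ℤ.* (Ω b ℤ.^ kk i ℤ.* (ℤ.- (+ p)) ℤ.^ (total i ℕM./ e)))))

    Φ : ℤ
    Φ = Σ e (λ x → φ (cubic (+ suc x)))

    -- After exchanging the sums, orthogonality in x leaves j = `jj i` with a factor e, which
    -- cancels one of the two factors e in `pointwise`.
    curve-sum : Σ e Z-term ≈ + e ℤ.* (G h ℤ.* Φ)
    curve-sum = cancel (+ e) Unit-e (begin
      + e ℤ.* Σ e Z-term
        ≡⟨ trans (Σ-*ˡ e (+ e) Z-term) (Σ-cong e (λ i → ℤP.*-comm (+ e) (Z-term i))) ⟩
      Σ e (λ i → Z-term i ℤ.* + e)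
        ≈⟨ Σ-cong≈ e (λ i l → ≈-sym (collapse-j i l)) ⟩
      Σ e (λ i → Σ e (λ j → c i j ℤ.* Σ e (λ x → Ω (+ suc x) ℤ.^ (i ℕ.* 3 ℕ.+ j))))
        ≡⟨ Σ-cong e (λ i → trans (Σ-cong e (λ j → Σ-*ˡ e (c i j) (λ x → Ω (+ suc x) ℤ.^ (i ℕ.* 3 ℕ.+ j)))) (Σ-swap e e (λ j x → c i j ℤ.* Ω (+ suc x) ℤ.^ (i ℕ.* 3 ℕ.+ j)))) ⟩
      Σ e (λ i → Σ e (λ x → Σ e (λ j → c i j ℤ.* Ω (+ suc x) ℤ.^ (i ℕ.* 3 ℕ.+ j))))
        ≡⟨ Σ-swap e e (λ i x → Σ e (λ j → c i j ℤ.* Ω (+ suc x) ℤ.^ (i ℕ.* 3 ℕ.+ j))) ⟩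
      Σ e (λ x → Σ e (λ i → Σ e (λ j → c i j ℤ.* Ω (+ suc x) ℤ.^ (i ℕ.* 3 ℕ.+ j))))
        ≈⟨ Σ-cong≈ e pointwise ⟩
      Σ e (λ x → + e ℤ.* (+ e ℤ.* (G h ℤ.* φ (cubic (+ suc x)))))
        ≡⟨ sym (trans (cong (λ z → + e ℤ.* (+ e ℤ.* z)) (Σ-*ˡ e (G h) g)) (trans (cong (+ e ℤ.*_) (Σ-*ˡ e (+ e) (λ x → G h ℤ.* g x))) (Σ-*ˡ e (+ e) (λ x → + e ℤ.* (G h ℤ.* g x))))) ⟩
      + e ℤ.* (+ e ℤ.* (G h ℤ.* Φ)) ∎)
      where
      g : ℕ → ℤ
      g x = φ (cubic (+ suc x))
      c : ℕ → ℕ → ℤ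
      c i j = G i ℤ.* (G j ℤ.* (Ω a ℤ.^ j ℤ.* inner i j))
      δ : ℕ → ℕ → ℤ
      δ i j with j ℕ.≟ jj i
      ... | yes _ = + e
      ... | no _ = + 0
      δ-yes : ∀ i → δ i (jj i) ≡ + e
      δ-yes i with jj i ℕ.≟ jj i
      ... | yes _ = refl
      ... | no n = ⊥-elim (n refl)
      δ-no : ∀ i j → j ≢ jj i → δ i j ≡ + 0
      δ-no i j n with j ℕ.≟ jj i
      ... | yes y = ⊥-elim (n y)
      ... | no _ = refl
      δ-sum : ∀ i → i < e → ∀ j → j < e → Σ e (λ x → Ω (+ suc x) ℤ.^ (i ℕ.* 3 ℕ.+ j)) ≈ δ i j
      δ-sum i i<e j j<e with j ℕ.≟ jj i
      ... | yes refl = orthogonal-trivial (i ℕ.* 3 ℕ.+ jj i) (jj-spec i (ℕP.<⇒≤ i<e))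
      ... | no n = orthogonal (i ℕ.* 3 ℕ.+ j) (λ z → n (%-cancel e (i ℕ.* 3) j<e (ℕM.m%n<n (3 ℕ.* (e ℕ.∸ i)) e) (trans z (sym (jj-spec i (ℕP.<⇒≤ i<e))))))
      inner-jj : ∀ i → i < e → inner i (jj i) ≡ G (kk i) ℤ.* (Ω b ℤ.^ kk i ℤ.* (ℤ.- (+ p)) ℤ.^ (total i ℕM./ e))
      inner-jj i l = trans (Σ-single e (kk i) (λ k → G k ℤ.* (Ω b ℤ.^ k ℤ.* χℤ h (i ℕ.+ (jj i ℕ.+ k)))) (ℕM.m%n<n (h ℕ.+ 2 ℕ.* i) e)
          (λ k k<e k≢ → trans (cong (λ z → G k ℤ.* (Ω b ℤ.^ k ℤ.* z)) (χ-no h (i ℕ.+ (jj i ℕ.+ k)) (λ r → k≢ (%-cancel e (i ℕ.+ jj i) k<e (ℕM.m%n<n (h ℕ.+ 2 ℕ.* i) e)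
            (trans (cong (ℕM._% e) (ℕP.+-assoc i (jj i) k)) (trans r (trans (sym (total-spec i (ℕP.<⇒≤ l))) (cong (ℕM._% e) (sym (ℕP.+-assoc i (jj i) (kk i))))))))))) (trans (cong (G k ℤ.*_) (ℤP.*-zeroʳ (Ω b ℤ.^ k))) (ℤP.*-zeroʳ (G k)))))
        (cong (λ z → G (kk i) ℤ.* (Ω b ℤ.^ kk i ℤ.* z)) (χ-yes h (total i) (total-spec i (ℕP.<⇒≤ l))))
      collapse-j : ∀ i → i < e → Σ e (λ j → c i j ℤ.* Σ e (λ x → Ω (+ suc x) ℤ.^ (i ℕ.* 3 ℕ.+ j))) ≈ Z-term i ℤ.* + e
      collapse-j i l = begin
        Σ e (λ j → c i j ℤ.* Σ e (λ x → Ω (+ suc x) ℤ.^ (i ℕ.* 3 ℕ.+ j))) ≈⟨ Σ-cong≈ e (λ j j<e → *-congˡ (c i j) (δ-sum i l j j<e)) ⟩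
        Σ e (λ j → c i j ℤ.* δ i j) ≡⟨ Σ-single e (jj i) (λ j → c i j ℤ.* δ i j) (ℕM.m%n<n (3 ℕ.* (e ℕ.∸ i)) e) (λ j _ n → trans (cong (c i j ℤ.*_) (δ-no i j n)) (ℤP.*-zeroʳ (c i j))) ⟩
        c i (jj i) ℤ.* δ i (jj i) ≡⟨ cong₂ (λ y z → G i ℤ.* (G (jj i) ℤ.* (Ω a ℤ.^ jj i ℤ.* y)) ℤ.* z) (inner-jj i l) (δ-yes i) ⟩
        Z-term i ℤ.* + e ∎

-- One summand of the curve sum against one term of the hypergeometric function.

module Terms where

  open FiniteSums
  open Congruences
  open GrossKoblitz
  open Teichmuller
  open GammaFormulas
  open Characters
  open CurveSums

  module TermIdentity {e h : ℕ} (P : OddPrime e h) (k′ : ℕ) (a b : ℤ)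
    (Unit-a : PrimeModulus.Unit P a) (Unit-b : PrimeModulus.Unit P b) where

    open CurveSum P k′ a b Unit-a Unit-b public
    open M using (p; Unit; 4≤e; e≡h+h)
    open import Relation.Binary.Reasoning.Setoid Z.setoid

    2h : + 2 ℤ.* + h ≡ + e
    2h = trans (l (+ h)) (trans (sym (ℤP.pos-+ h h)) (cong +_ (sym e≡h+h)))
      where
      l : ∀ h → + 2 ℤ.* h ≡ h ℤ.+ h
      l = solve-∀

    nr-half : + 2 ℤ.* + nr h ≈ + 1
    nr-half = cancel (+ e) Unit-e (≈-trans (≡⇒≈ (l (+ e) (+ nr h))) (≈-trans (*-congˡ (+ 2) (nr-spec h (ℕP.<⇒≤ h<e))) (≡⇒≈ (trans 2h (sym (ℤP.*-identityʳ (+ e)))))))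
      where
      l : ∀ e n → e ℤ.* (+ 2 ℤ.* n) ≡ + 2 ℤ.* (e ℤ.* n)
      l = solve-∀

    -- The arguments are fractions with denominator c(p - 1). Cancelling p - 1 brings them into the
    -- form c m ≡ r + n expected by `duplication` and `triplication`.
    scaled : ∀ c {m x} {n} d → Unit (+ c) → + c ℤ.* + e ℤ.* + m ≈ x → + e ℤ.* + n ≈ d → ∀ r →
      x ≈ d ℤ.+ r ℤ.* + e → + c ℤ.* + m ≈ r ℤ.+ + n
    scaled c {m} {x} {n} d uc cm en r xr = cancel (+ e) Unit-e (begin
      + e ℤ.* (+ c ℤ.* + m) ≡⟨ l₁ (+ e) (+ c) (+ m) ⟩
      + c ℤ.* + e ℤ.* + m ≈⟨ ≈-trans cm xr ⟩
      d ℤ.+ r ℤ.* + e ≈⟨ +-cong (≈-sym en) ≈-refl ⟩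
      + e ℤ.* + n ℤ.+ r ℤ.* + e ≡⟨ l₂ (+ e) (+ n) r ⟩
      + e ℤ.* (r ℤ.+ + n) ∎)
      where
      l₁ : ∀ e c m → e ℤ.* (c ℤ.* m) ≡ c ℤ.* e ℤ.* m
      l₁ = solve-∀
      l₂ : ∀ e n r → e ℤ.* n ℤ.+ r ℤ.* e ≡ e ℤ.* (r ℤ.+ n)
      l₂ = solve-∀

    halve : ∀ m x r → + 4 ℤ.* + e ℤ.* + m ≈ + 2 ℤ.* x ℤ.+ r ℤ.* (+ 2 ℤ.* + e) → + 2 ℤ.* + e ℤ.* + m ≈ x ℤ.+ r ℤ.* + e
    halve m x r y = cancel (+ 2) Unit-2 (≈-trans (≡⇒≈ (l₁ (+ e) (+ m))) (≈-trans y (≡⇒≈ (l₂ (+ e) x r))))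
      where
      l₁ : ∀ e m → + 2 ℤ.* (+ 2 ℤ.* e ℤ.* m) ≡ + 4 ℤ.* e ℤ.* m
      l₁ = solve-∀
      l₂ : ∀ e x r → + 2 ℤ.* x ℤ.+ r ℤ.* (+ 2 ℤ.* e) ≡ + 2 ℤ.* (x ℤ.+ r ℤ.* e)
      l₂ = solve-∀

    -- Duplication at x = k/(2(p-1)), with m for x and m′ for x + 1/2. The fourfold hypotheses are
    -- those that the arguments 1/4 - j/(p-1) and 3/4 - j/(p-1) satisfy.
    quarter : ∀ k m m′ → k ≤ e → + 4 ℤ.* + e ℤ.* + m ≈ + 2 ℤ.* + k ℤ.+ + 0 ℤ.* (+ 2 ℤ.* + e) → + 4 ℤ.* + e ℤ.* + m′ ≈ + 2 ℤ.* + k ℤ.+ + 1 ℤ.* (+ 2 ℤ.* + e) →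
      Γ m ℤ.* Γ m′ ℤ.* Ω (+ 2) ℤ.^ (e ℕ.∸ k) ≈ G k ℤ.* G h
    quarter k m m′ k≤e r r′ = ≈-trans (*-congˡ (Γ m ℤ.* Γ m′) (≡⇒≈ (sym (E-nr (+ 2) k))))
      (duplication (nr h) m m′ (nr k) nr-half
        (≈-trans (scaled 2 {m} (+ k) Unit-2 (halve m (+ k) (+ 0) r) (nr-spec k k≤e) (+ 0) ≈-refl) (≡⇒≈ (ℤP.+-identityˡ (+ nr k))))
        (scaled 2 {m′} (+ k) Unit-2 (halve m′ (+ k) (+ 1) r′) (nr-spec k k≤e) (+ 1) ≈-refl))

    -- Triplication at l/(3(p-1)). The constants c₂ and c₁ stand for ⟨-2/3⟩ = 1/3 and ⟨-1/3⟩ = 2/3,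
    -- hence their order.
    third : ∀ l m m′ m″ c₁ c₂ → l ≤ e → + 3 ℤ.* + c₂ ≈ + 1 → + 3 ℤ.* + c₁ ≈ + 2 →
      + 3 ℤ.* + e ℤ.* + m ≈ + l ℤ.+ + 0 ℤ.* + e → + 3 ℤ.* + e ℤ.* + m′ ≈ + l ℤ.+ + 1 ℤ.* + e → + 3 ℤ.* + e ℤ.* + m″ ≈ + l ℤ.+ + 2 ℤ.* + e →
      Γ m ℤ.* (Γ m′ ℤ.* Γ m″) ℤ.* Ω (+ 3) ℤ.^ (e ℕ.∸ l) ≈ G l ℤ.* (Γ c₂ ℤ.* Γ c₁)
    third l m m′ m″ c₁ c₂ l≤e 3c₂ 3c₁ r r′ r″ = ≈-trans (*-congˡ (Γ m ℤ.* (Γ m′ ℤ.* Γ m″)) (≡⇒≈ (sym (E-nr (+ 3) l))))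
      (triplication c₂ c₁ m m′ m″ (nr l) 3c₂ 3c₁
        (≈-trans (scaled 3 {m} (+ l) Unit-3 r (nr-spec l l≤e) (+ 0) ≈-refl) (≡⇒≈ (ℤP.+-identityˡ (+ nr l))))
        (scaled 3 {m′} (+ l) Unit-3 r′ (nr-spec l l≤e) (+ 1) ≈-refl)
        (scaled 3 {m″} (+ l) Unit-3 r″ (nr-spec l l≤e) (+ 2) ≈-refl))

    reflect : ∀ j → j ≤ e → G j ℤ.* G (e ℕ.∸ j) ≈ ℤ.- Ω (ℤ.- (+ 1)) ℤ.^ (e ℕ.∸ j)
    reflect j j≤e = ≈-trans (reflection (nr j) (nr (e ℕ.∸ j)) (cancel (+ e) Unit-e (begin
        + e ℤ.* + (nr j ℕ.+ nr (e ℕ.∸ j)) ≡⟨ trans (cong (+ e ℤ.*_) (ℤP.pos-+ (nr j) (nr (e ℕ.∸ j)))) (ℤP.*-distribˡ-+ (+ e) (+ nr j) (+ nr (e ℕ.∸ j))) ⟩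
        + e ℤ.* + nr j ℤ.+ + e ℤ.* + nr (e ℕ.∸ j) ≈⟨ +-cong (nr-spec j j≤e) (nr-spec (e ℕ.∸ j) (ℕP.m∸n≤m e j)) ⟩
        + j ℤ.+ + (e ℕ.∸ j) ≡⟨ trans (sym (ℤP.pos-+ j (e ℕ.∸ j))) (trans (cong +_ (ℕP.m+[n∸m]≡n j≤e)) (sym (ℤP.*-identityʳ (+ e)))) ⟩
        + e ℤ.* + 1 ∎))) (neg-cong (≡⇒≈ (E-nr (ℤ.- (+ 1)) j)))

    -- In the application s is the value of ω̄ at t = -27b²/(4a³), given here by the equation that
    -- clears the denominator.
    module _ (s : ℤ) (s-spec : s ℤ.* Ω (+ 27 ℤ.* (b ℤ.* b)) ≈ Ω (ℤ.- (+ 1) ℤ.* (+ 4 ℤ.* (a ℤ.* (a ℤ.* a))))) where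

      Ω₋ Ω₂ Ω₃ Ωa Ωb : ℤ
      Ω₋ = Ω (ℤ.- (+ 1))
      Ω₂ = Ω (+ 2)
      Ω₃ = Ω (+ 3)
      Ωa = Ω a
      Ωb = Ω b

      Ω₋-e : Ω₋ ℤ.^ e ≈ + 1
      Ω₋-e = Ω-e (M.Unit-neg M.Unit-1)

      -- The j-th power of s · ω(27 b²) = ω(-4 a³).
      monomial : ∀ j → j ≤ e → s ℤ.^ j ℤ.* (Ωb ℤ.^ (j ℕ.+ j) ℤ.* Ω₃ ℤ.^ (j ℕ.* 3)) ≈ Ω₋ ℤ.^ (e ℕ.∸ j) ℤ.* (Ωa ℤ.^ (j ℕ.* 3) ℤ.* Ω₂ ℤ.^ (j ℕ.+ j))
      monomial j j≤e = begin
        s ℤ.^ j ℤ.* (Ωb ℤ.^ (j ℕ.+ j) ℤ.* Ω₃ ℤ.^ (j ℕ.* 3))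
          ≡⟨ cong (s ℤ.^ j ℤ.*_) (trans (cong₂ ℤ._*_ (double Ωb j) (treble Ω₃ j)) (sym (*-pow (Ωb ℤ.* Ωb) (Ω₃ ℤ.* (Ω₃ ℤ.* Ω₃)) j))) ⟩
        s ℤ.^ j ℤ.* (Ωb ℤ.* Ωb ℤ.* (Ω₃ ℤ.* (Ω₃ ℤ.* Ω₃))) ℤ.^ j
          ≡⟨ sym (*-pow s (Ωb ℤ.* Ωb ℤ.* (Ω₃ ℤ.* (Ω₃ ℤ.* Ω₃))) j) ⟩
        (s ℤ.* (Ωb ℤ.* Ωb ℤ.* (Ω₃ ℤ.* (Ω₃ ℤ.* Ω₃)))) ℤ.^ j
          ≡⟨ cong (λ z → (s ℤ.* z) ℤ.^ j) (sym (trans (Ω-* (+ 27) (b ℤ.* b)) (trans (cong₂ ℤ._*_ (trans (Ω-* (+ 3) (+ 9)) (cong (Ω₃ ℤ.*_) (Ω-* (+ 3) (+ 3)))) (Ω-* b b)) (ℤP.*-comm (Ω₃ ℤ.* (Ω₃ ℤ.* Ω₃)) (Ωb ℤ.* Ωb))))) ⟩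
        (s ℤ.* Ω (+ 27 ℤ.* (b ℤ.* b))) ℤ.^ j
          ≈⟨ ^-cong j s-spec ⟩
        Ω (ℤ.- (+ 1) ℤ.* (+ 4 ℤ.* (a ℤ.* (a ℤ.* a)))) ℤ.^ j
          ≡⟨ cong (ℤ._^ j) (trans (Ω-* (ℤ.- (+ 1)) (+ 4 ℤ.* (a ℤ.* (a ℤ.* a)))) (cong (Ω₋ ℤ.*_) (trans (Ω-* (+ 4) (a ℤ.* (a ℤ.* a))) (cong₂ ℤ._*_ (Ω-* (+ 2) (+ 2)) (trans (Ω-* a (a ℤ.* a)) (cong (Ωa ℤ.*_) (Ω-* a a))))))) ⟩
        (Ω₋ ℤ.* (Ω₂ ℤ.* Ω₂ ℤ.* (Ωa ℤ.* (Ωa ℤ.* Ωa)))) ℤ.^ j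
          ≡⟨ trans (*-pow Ω₋ (Ω₂ ℤ.* Ω₂ ℤ.* (Ωa ℤ.* (Ωa ℤ.* Ωa))) j) (cong (Ω₋ ℤ.^ j ℤ.*_) (trans (*-pow (Ω₂ ℤ.* Ω₂) (Ωa ℤ.* (Ωa ℤ.* Ωa)) j) (trans (ℤP.*-comm ((Ω₂ ℤ.* Ω₂) ℤ.^ j) _) (cong₂ ℤ._*_ (sym (treble Ωa j)) (sym (double Ω₂ j)))))) ⟩
        Ω₋ ℤ.^ j ℤ.* (Ωa ℤ.^ (j ℕ.* 3) ℤ.* Ω₂ ℤ.^ (j ℕ.+ j))
          ≈⟨ *-congʳ (Ωa ℤ.^ (j ℕ.* 3) ℤ.* Ω₂ ℤ.^ (j ℕ.+ j)) sign ⟩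
        Ω₋ ℤ.^ (e ℕ.∸ j) ℤ.* (Ωa ℤ.^ (j ℕ.* 3) ℤ.* Ω₂ ℤ.^ (j ℕ.+ j)) ∎
        where
        double : ∀ x j → x ℤ.^ (j ℕ.+ j) ≡ (x ℤ.* x) ℤ.^ j
        double x j = trans (ℤP.^-distribˡ-+-* x j j) (sym (*-pow x x j))
        treble : ∀ x j → x ℤ.^ (j ℕ.* 3) ≡ (x ℤ.* (x ℤ.* x)) ℤ.^ j
        treble x j = trans (cong (x ℤ.^_) (ℕP.*-comm j 3)) (trans (sym (ℤP.^-*-assoc x 3 j)) (cong (λ z → (x ℤ.* (x ℤ.* z)) ℤ.^ j) (ℤP.*-identityʳ x)))
        sign : Ω₋ ℤ.^ j ≈ Ω₋ ℤ.^ (e ℕ.∸ j)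
        sign = begin
          Ω₋ ℤ.^ j ≡⟨ sym (ℤP.*-identityʳ (Ω₋ ℤ.^ j)) ⟩
          Ω₋ ℤ.^ j ℤ.* + 1 ≈⟨ *-congˡ (Ω₋ ℤ.^ j) (≈-sym Ω₋-e) ⟩
          Ω₋ ℤ.^ j ℤ.* Ω₋ ℤ.^ e ≡⟨ cong (Ω₋ ℤ.^ j ℤ.*_) (trans (cong (Ω₋ ℤ.^_) (sym (ℕP.m+[n∸m]≡n j≤e))) (ℤP.^-distribˡ-+-* Ω₋ j (e ℕ.∸ j))) ⟩
          Ω₋ ℤ.^ j ℤ.* (Ω₋ ℤ.^ j ℤ.* Ω₋ ℤ.^ (e ℕ.∸ j)) ≡⟨ trans (sym (ℤP.*-assoc (Ω₋ ℤ.^ j) (Ω₋ ℤ.^ j) (Ω₋ ℤ.^ (e ℕ.∸ j)))) (cong (ℤ._* Ω₋ ℤ.^ (e ℕ.∸ j)) (trans (sym (*-pow Ω₋ Ω₋ j)) (trans (cong (ℤ._^ j) (trans (sym (Ω-* (ℤ.- (+ 1)) (ℤ.- (+ 1)))) Ω-1)) (ℤP.^-zeroˡ j)))) ⟩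
          + 1 ℤ.* Ω₋ ℤ.^ (e ℕ.∸ j) ≡⟨ ℤP.*-identityˡ (Ω₋ ℤ.^ (e ℕ.∸ j)) ⟩
          Ω₋ ℤ.^ (e ℕ.∸ j) ∎

      module _ (j l k : ℕ) (j≤e : j ≤ e) (l≤e : l ≤ e) (k≤e : k ≤ e)
        (l-mod : l ℕM.% e ≡ (j ℕ.* 3) ℕM.% e) (k-mod : (k ℕ.+ (j ℕ.+ j)) ℕM.% e ≡ h ℕM.% e) where

        complement : ∀ {x} → x ℤ.^ e ≈ + 1 → ∀ m n → m ≤ e → m ℕM.% e ≡ n ℕM.% e → x ℤ.^ (e ℕ.∸ m) ℤ.* x ℤ.^ n ≈ + 1
        complement {x} xe m n m≤e r = begin
          x ℤ.^ (e ℕ.∸ m) ℤ.* x ℤ.^ n ≈⟨ *-congˡ (x ℤ.^ (e ℕ.∸ m)) (power-mod xe n m (sym r)) ⟩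
          x ℤ.^ (e ℕ.∸ m) ℤ.* x ℤ.^ m ≡⟨ trans (sym (ℤP.^-distribˡ-+-* x (e ℕ.∸ m) m)) (cong (x ℤ.^_) (ℕP.m∸n+n≡m m≤e)) ⟩
          x ℤ.^ e ≈⟨ xe ⟩
          + 1 ∎

        -- Inverse characters are written as powers with exponent e - m. Multiplication by the unit
        -- F completes them to e-th powers, and what is left is `monomial` together with the
        -- congruences for l and k.
        characters : Ωb ℤ.^ h ℤ.* (s ℤ.^ j ℤ.* Ω₂ ℤ.^ (e ℕ.∸ h)) ≈ Ω₋ ℤ.^ (e ℕ.∸ j) ℤ.* (Ωa ℤ.^ l ℤ.* (Ωb ℤ.^ k ℤ.* (Ω₂ ℤ.^ (e ℕ.∸ k) ℤ.* Ω₃ ℤ.^ (e ℕ.∸ l))))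
        characters = cancel F uF (begin
          F ℤ.* (B ℤ.* (S ℤ.* Ω₂ ℤ.^ (e ℕ.∸ h))) ≡⟨ l₁ c3 c2k c22 b2 B S (Ω₂ ℤ.^ (e ℕ.∸ h)) ⟩
          B ℤ.* (S ℤ.* (b2 ℤ.* c3)) ℤ.* (Ω₂ ℤ.^ (e ℕ.∸ h) ℤ.* (c2k ℤ.* c22)) ≈⟨ *-cong (*-congˡ B (monomial j j≤e)) (≈-trans (*-congˡ (Ω₂ ℤ.^ (e ℕ.∸ h)) (≡⇒≈ (sym (ℤP.^-distribˡ-+-* Ω₂ k (j ℕ.+ j))))) (complement (Ω-e Unit-2) h (k ℕ.+ (j ℕ.+ j)) (ℕP.<⇒≤ h<e) (sym k-mod))) ⟩
          B ℤ.* (N ℤ.* (Ωa ℤ.^ (j ℕ.* 3) ℤ.* c22)) ℤ.* + 1 ≈⟨ *-cong (*-cong (≈-trans (power-mod (Ω-e Unit-b) h (k ℕ.+ (j ℕ.+ j)) (sym k-mod)) (≡⇒≈ (ℤP.^-distribˡ-+-* Ωb k (j ℕ.+ j)))) (*-congˡ N (*-congʳ c22 (power-mod (Ω-e Unit-a) (j ℕ.* 3) l (sym l-mod))))) (≈-sym (*-cong (complement (Ω-e Unit-2) k k k≤e refl) (complement (Ω-e Unit-3) l (j ℕ.* 3) l≤e l-mod))) ⟩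
          (Ωb ℤ.^ k ℤ.* b2) ℤ.* (N ℤ.* (Ωa ℤ.^ l ℤ.* c22)) ℤ.* ((Ω₂ ℤ.^ (e ℕ.∸ k) ℤ.* c2k) ℤ.* (Ω₃ ℤ.^ (e ℕ.∸ l) ℤ.* c3)) ≡⟨ l₂ c3 c2k c22 b2 (Ωb ℤ.^ k) N (Ωa ℤ.^ l) (Ω₂ ℤ.^ (e ℕ.∸ k)) (Ω₃ ℤ.^ (e ℕ.∸ l)) ⟩
          F ℤ.* (N ℤ.* (Ωa ℤ.^ l ℤ.* (Ωb ℤ.^ k ℤ.* (Ω₂ ℤ.^ (e ℕ.∸ k) ℤ.* Ω₃ ℤ.^ (e ℕ.∸ l))))) ∎)
          where
          c3 = Ω₃ ℤ.^ (j ℕ.* 3)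
          c2k = Ω₂ ℤ.^ k
          c22 = Ω₂ ℤ.^ (j ℕ.+ j)
          b2 = Ωb ℤ.^ (j ℕ.+ j)
          B = Ωb ℤ.^ h
          S = s ℤ.^ j
          N = Ω₋ ℤ.^ (e ℕ.∸ j)
          F = c3 ℤ.* (c2k ℤ.* (c22 ℤ.* b2))
          uF : Unit F
          uF = M.Unit-* (M.Unit-^ (j ℕ.* 3) (Unit-Ω Unit-3)) (M.Unit-* (M.Unit-^ k (Unit-Ω Unit-2)) (M.Unit-* (M.Unit-^ (j ℕ.+ j) (Unit-Ω Unit-2)) (M.Unit-^ (j ℕ.+ j) (Unit-Ω Unit-b))))
          l₁ : ∀ c d f b B S E → c ℤ.* (d ℤ.* (f ℤ.* b)) ℤ.* (B ℤ.* (S ℤ.* E)) ≡ B ℤ.* (S ℤ.* (b ℤ.* c)) ℤ.* (E ℤ.* (d ℤ.* f))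
          l₁ = solve-∀
          l₂ : ∀ c d f b k N a x y → (k ℤ.* b) ℤ.* (N ℤ.* (a ℤ.* f)) ℤ.* ((x ℤ.* d) ℤ.* (y ℤ.* c)) ≡ c ℤ.* (d ℤ.* (f ℤ.* b)) ℤ.* (N ℤ.* (a ℤ.* (k ℤ.* (x ℤ.* y))))
          l₂ = solve-∀

        -- Both sides agree after multiplication by the Γ-values and characters that
        -- complete the duplication, triplication and reflection formulas.
        term-identity : ∀ {n₁ n₃ m₁ m₂ d₁ d₃ c₁ c₂} I₁ I₃ J₁ J₂ →
          Γ d₁ ℤ.* I₁ ≈ + 1 → Γ d₃ ℤ.* I₃ ≈ + 1 → Γ c₁ ℤ.* J₁ ≈ + 1 → Γ c₂ ℤ.* J₂ ≈ + 1 →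
          Γ d₁ ℤ.* Γ d₃ ℤ.* Ω₂ ℤ.^ (e ℕ.∸ h) ≈ G h ℤ.* G h →
          Γ n₁ ℤ.* Γ n₃ ℤ.* Ω₂ ℤ.^ (e ℕ.∸ k) ≈ G k ℤ.* G h →
          G j ℤ.* (Γ m₁ ℤ.* Γ m₂) ℤ.* Ω₃ ℤ.^ (e ℕ.∸ l) ≈ G l ℤ.* (Γ c₂ ℤ.* Γ c₁) →
          G h ℤ.* (φ b ℤ.* (s ℤ.^ j ℤ.* ((Γ n₁ ℤ.* I₁ ℤ.* (Γ m₁ ℤ.* J₁)) ℤ.* (Γ n₃ ℤ.* I₃ ℤ.* (Γ m₂ ℤ.* J₂)))))
            ≈ ℤ.- (G (e ℕ.∸ j) ℤ.* (G l ℤ.* (Ωa ℤ.^ l ℤ.* (G k ℤ.* Ωb ℤ.^ k))))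
        term-identity {n₁} {n₃} {m₁} {m₂} {d₁} {d₃} {c₁} {c₂} I₁ I₃ J₁ J₂ i₁ i₃ k₁ k₂ dd nn mm = cancel W uW (begin
          W ℤ.* (G h ℤ.* (φ b ℤ.* (S ℤ.* ((Γ n₁ ℤ.* I₁ ℤ.* (Γ m₁ ℤ.* J₁)) ℤ.* (Γ n₃ ℤ.* I₃ ℤ.* (Γ m₂ ℤ.* J₂))))))
            ≡⟨ rearrange ⟩
          ((Γ d₁ ℤ.* I₁) ℤ.* (Γ d₃ ℤ.* I₃) ℤ.* ((Γ c₁ ℤ.* J₁) ℤ.* (Γ c₂ ℤ.* J₂))) ℤ.* ((φ b ℤ.* (S ℤ.* x)) ℤ.* (G h ℤ.* ((Γ n₁ ℤ.* Γ n₃ ℤ.* y) ℤ.* (G j ℤ.* (Γ m₁ ℤ.* Γ m₂) ℤ.* z))))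
            ≈⟨ *-cong (*-cong (*-cong i₁ i₃) (*-cong k₁ k₂)) (*-cong characters (*-congˡ (G h) (*-cong nn mm))) ⟩
          (+ 1 ℤ.* + 1 ℤ.* (+ 1 ℤ.* + 1)) ℤ.* ((N ℤ.* (Ωa ℤ.^ l ℤ.* (Ωb ℤ.^ k ℤ.* (y ℤ.* z)))) ℤ.* (G h ℤ.* ((G k ℤ.* G h) ℤ.* (G l ℤ.* (Γ c₂ ℤ.* Γ c₁)))))
            ≡⟨ l₂ N (Ωa ℤ.^ l) (Ωb ℤ.^ k) y z (G h) (G k) (G l) (Γ c₂) (Γ c₁) ⟩
          ℤ.- (ℤ.- N ℤ.* ((G h ℤ.* G h) ℤ.* (Γ c₁ ℤ.* (Γ c₂ ℤ.* (y ℤ.* (z ℤ.* (G l ℤ.* (Ωa ℤ.^ l ℤ.* (G k ℤ.* Ωb ℤ.^ k)))))))))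
            ≈⟨ neg-cong (*-cong (≈-sym (reflect j j≤e)) (*-congʳ (Γ c₁ ℤ.* (Γ c₂ ℤ.* (y ℤ.* (z ℤ.* (G l ℤ.* (Ωa ℤ.^ l ℤ.* (G k ℤ.* Ωb ℤ.^ k))))))) (≈-sym dd))) ⟩
          ℤ.- ((G j ℤ.* G (e ℕ.∸ j)) ℤ.* ((Γ d₁ ℤ.* Γ d₃ ℤ.* x) ℤ.* (Γ c₁ ℤ.* (Γ c₂ ℤ.* (y ℤ.* (z ℤ.* (G l ℤ.* (Ωa ℤ.^ l ℤ.* (G k ℤ.* Ωb ℤ.^ k)))))))))
            ≡⟨ l₃ (G j) (G (e ℕ.∸ j)) (Γ d₁) (Γ d₃) x (Γ c₁) (Γ c₂) y z (G l ℤ.* (Ωa ℤ.^ l ℤ.* (G k ℤ.* Ωb ℤ.^ k))) ⟩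
          W ℤ.* ℤ.- (G (e ℕ.∸ j) ℤ.* (G l ℤ.* (Ωa ℤ.^ l ℤ.* (G k ℤ.* Ωb ℤ.^ k)))) ∎)
          where
          x = Ω₂ ℤ.^ (e ℕ.∸ h)
          y = Ω₂ ℤ.^ (e ℕ.∸ k)
          z = Ω₃ ℤ.^ (e ℕ.∸ l)
          S = s ℤ.^ j
          N = Ω₋ ℤ.^ (e ℕ.∸ j)
          -- The gamma values inverted by I₁, I₃, J₁, J₂, the powers of 2 and 3 from the
          -- multiplication formulas, and `G j`, which completes the triplication on the left and
          -- pairs with `G (e - j)` by reflection on the right.
          W = Γ d₁ ℤ.* Γ d₃ ℤ.* (Γ c₁ ℤ.* Γ c₂) ℤ.* (x ℤ.* (y ℤ.* (z ℤ.* G j)))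
          uW : Unit W
          uW = M.Unit-* (M.Unit-* (M.Unit-* (Unit-Γ d₁) (Unit-Γ d₃)) (M.Unit-* (Unit-Γ c₁) (Unit-Γ c₂)))
            (M.Unit-* (M.Unit-^ (e ℕ.∸ h) (Unit-Ω Unit-2)) (M.Unit-* (M.Unit-^ (e ℕ.∸ k) (Unit-Ω Unit-2)) (M.Unit-* (M.Unit-^ (e ℕ.∸ l) (Unit-Ω Unit-3)) (Unit-Γ (nr j)))))
          r₁ : ∀ a b c d f g h i → (a ℤ.* b ℤ.* (c ℤ.* d)) ℤ.* (f ℤ.* g ℤ.* (h ℤ.* i)) ≡ (a ℤ.* f ℤ.* (c ℤ.* h)) ℤ.* (b ℤ.* g ℤ.* (d ℤ.* i))
          r₁ = solve-∀
          r₂ : ∀ K x Y H f S Q → K ℤ.* (x ℤ.* Y) ℤ.* (H ℤ.* (f ℤ.* (S ℤ.* Q))) ≡ K ℤ.* ((f ℤ.* (S ℤ.* x)) ℤ.* (H ℤ.* (Y ℤ.* Q)))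
          r₂ = solve-∀
          r₃ : ∀ y z g A B I → (y ℤ.* (z ℤ.* g)) ℤ.* (A ℤ.* B ℤ.* I) ≡ ((A ℤ.* y) ℤ.* (g ℤ.* B ℤ.* z)) ℤ.* I
          r₃ = solve-∀
          r₄ : ∀ K X H Y I → K ℤ.* (X ℤ.* (H ℤ.* (Y ℤ.* I))) ≡ (K ℤ.* I) ℤ.* (X ℤ.* (H ℤ.* Y))
          r₄ = solve-∀
          rearrange : W ℤ.* (G h ℤ.* (φ b ℤ.* (S ℤ.* ((Γ n₁ ℤ.* I₁ ℤ.* (Γ m₁ ℤ.* J₁)) ℤ.* (Γ n₃ ℤ.* I₃ ℤ.* (Γ m₂ ℤ.* J₂))))))
            ≡ ((Γ d₁ ℤ.* I₁) ℤ.* (Γ d₃ ℤ.* I₃) ℤ.* ((Γ c₁ ℤ.* J₁) ℤ.* (Γ c₂ ℤ.* J₂))) ℤ.* ((φ b ℤ.* (S ℤ.* x)) ℤ.* (G h ℤ.* ((Γ n₁ ℤ.* Γ n₃ ℤ.* y) ℤ.* (G j ℤ.* (Γ m₁ ℤ.* Γ m₂) ℤ.* z))))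
          rearrange = trans (r₂ K x (y ℤ.* (z ℤ.* G j)) (G h) (φ b) S _)
            (trans (cong (λ q → K ℤ.* ((φ b ℤ.* (S ℤ.* x)) ℤ.* (G h ℤ.* q))) (trans (cong (y ℤ.* (z ℤ.* G j) ℤ.*_) (r₁ (Γ n₁) I₁ (Γ m₁) J₁ (Γ n₃) I₃ (Γ m₂) J₂)) (r₃ y z (G j) (Γ n₁ ℤ.* Γ n₃) (Γ m₁ ℤ.* Γ m₂) (I₁ ℤ.* I₃ ℤ.* (J₁ ℤ.* J₂)))))
            (trans (r₄ K (φ b ℤ.* (S ℤ.* x)) (G h) ((Γ n₁ ℤ.* Γ n₃ ℤ.* y) ℤ.* (G j ℤ.* (Γ m₁ ℤ.* Γ m₂) ℤ.* z)) (I₁ ℤ.* I₃ ℤ.* (J₁ ℤ.* J₂)))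
            (cong (ℤ._* ((φ b ℤ.* (S ℤ.* x)) ℤ.* (G h ℤ.* ((Γ n₁ ℤ.* Γ n₃ ℤ.* y) ℤ.* (G j ℤ.* (Γ m₁ ℤ.* Γ m₂) ℤ.* z))))) (r₅ (Γ d₁) (Γ d₃) (Γ c₁) (Γ c₂) I₁ I₃ J₁ J₂))))
            where
            K = Γ d₁ ℤ.* Γ d₃ ℤ.* (Γ c₁ ℤ.* Γ c₂)
            r₅ : ∀ a b c d f g h i → (a ℤ.* b ℤ.* (c ℤ.* d)) ℤ.* (f ℤ.* g ℤ.* (h ℤ.* i)) ≡ (a ℤ.* f) ℤ.* (b ℤ.* g) ℤ.* ((c ℤ.* h) ℤ.* (d ℤ.* i))
            r₅ = solve-∀
          l₂ : ∀ N a b y z H k l c₂ c₁ → (+ 1 ℤ.* + 1 ℤ.* (+ 1 ℤ.* + 1)) ℤ.* ((N ℤ.* (a ℤ.* (b ℤ.* (y ℤ.* z)))) ℤ.* (H ℤ.* ((k ℤ.* H) ℤ.* (l ℤ.* (c₂ ℤ.* c₁)))))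
            ≡ ℤ.- (ℤ.- N ℤ.* ((H ℤ.* H) ℤ.* (c₁ ℤ.* (c₂ ℤ.* (y ℤ.* (z ℤ.* (l ℤ.* (a ℤ.* (k ℤ.* b)))))))))
          l₂ = solve-∀
          l₃ : ∀ g g′ d₁ d₃ x c₁ c₂ y z r → ℤ.- ((g ℤ.* g′) ℤ.* ((d₁ ℤ.* d₃ ℤ.* x) ℤ.* (c₁ ℤ.* (c₂ ℤ.* (y ℤ.* (z ℤ.* r)))))) ≡ d₁ ℤ.* d₃ ℤ.* (c₁ ℤ.* c₂) ℤ.* (x ℤ.* (y ℤ.* (z ℤ.* g))) ℤ.* ℤ.- (g′ ℤ.* r)
          l₃ = solve-∀

-- Rational arguments: floors, fractional parts and residues.

module Fractions where

  open Congruences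
  open Teichmuller

  -- Fractions need not be in lowest terms: A/C ± j/(p-1) has the evident denominator C(p-1),
  -- whereas the reduced one varies with j.
  record Frac (x : ℚ) (N : ℤ) (D : ℕ) : Set where
    constructor frac
    field
      d : ℕ
      D≡ : D ≡ suc d
      value : toℚᵘ x ≃ mkℚᵘ N d

  frac-/ : ∀ N d → Frac (N ℚ./ suc d) N (suc d)
  frac-/ N d = frac d refl (ℚP.toℚᵘ-fromℚᵘ (mkℚᵘ N d))

  frac-over : ∀ j e → 0 < e → Frac (j over e) (+ j) e
  frac-over j (suc e) _ = frac-/ (+ j) e

  frac-+ : ∀ {x y N N′ D D′} → Frac x N D → Frac y N′ D′ → Frac (x ℚ.+ y) (N ℤ.* + D′ ℤ.+ N′ ℤ.* + D) (D ℕ.* D′)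
  frac-+ {x} {y} (frac d refl v) (frac d′ refl v′) = frac _ refl (ℚᵘP.≃-trans (ℚP.toℚᵘ-homo-+ x y) (ℚᵘP.+-cong v v′))

  frac-neg : ∀ {x N D} → Frac x N D → Frac (ℚ.- x) (ℤ.- N) D
  frac-neg {x} (frac d refl v) = frac d refl (ℚᵘP.≃-trans (ℚP.toℚᵘ-homo‿- x) (ℚᵘP.-‿cong v))

  frac-rescale : ∀ {x N D N′ D′} → Frac x N D → 0 < D′ → N ℤ.* + D′ ≡ N′ ℤ.* + D → Frac x N′ D′
  frac-rescale {D′ = suc d′} (frac d refl v) _ eq = frac d′ refl (ℚᵘP.≃-trans v (*≡* eq))

  euclid-unique : ∀ {r r′ B} m m′ → r < B → r′ < B → + r ℤ.+ m ℤ.* + B ≡ + r′ ℤ.+ m′ ℤ.* + B → m ≡ m′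
  euclid-unique {r} {r′} {B} m m′ r<B r′<B eq = go (m ℤ.- m′) refl
    where
    l₂ : ∀ r m m′ B → r ℤ.+ m ℤ.* B ℤ.- m′ ℤ.* B ≡ r ℤ.+ (m ℤ.- m′) ℤ.* B
    l₂ = solve-∀
    l₃ : ∀ m m′ → m ≡ m′ ℤ.+ (m ℤ.- m′)
    l₃ = solve-∀
    base : + r′ ≡ + r ℤ.+ (m ℤ.- m′) ℤ.* + B
    base = trans (l₀ (+ r′) (m′ ℤ.* + B)) (trans (cong (ℤ._- m′ ℤ.* + B) (sym eq)) (l₂ (+ r) m m′ (+ B)))
      where
      l₀ : ∀ r x → r ≡ r ℤ.+ x ℤ.- x
      l₀ = solve-∀
    go : ∀ t → m ℤ.- m′ ≡ t → m ≡ m′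
    go (+ zero) t≡ = trans (l₃ m m′) (trans (cong (λ z → m′ ℤ.+ z) t≡) (ℤP.+-identityʳ m′))
    go (+ suc n) t≡ = ⊥-elim (ℕP.<⇒≱ r′<B (subst (B ≤_) (sym big) (ℕP.≤-trans (ℕP.m≤m+n B (n ℕ.* B)) (ℕP.m≤n+m (suc n ℕ.* B) r))))
      where
      big : r′ ≡ r ℕ.+ suc n ℕ.* B
      big = ℤP.+-injective (trans base (trans (cong (λ z → + r ℤ.+ z ℤ.* + B) t≡) (trans (cong (λ z → + r ℤ.+ z) (sym (ℤP.pos-* (suc n) B))) (sym (ℤP.pos-+ r (suc n ℕ.* B))))))
    go -[1+ n ] t≡ = ⊥-elim (ℕP.<⇒≱ r<B (subst (B ≤_) (sym big) (ℕP.≤-trans (ℕP.m≤m+n B (n ℕ.* B)) (ℕP.m≤n+m (suc n ℕ.* B) r′))))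
      where
      l₄ : ∀ r x → r ≡ r ℤ.+ ℤ.- x ℤ.+ x
      l₄ = solve-∀
      l₅ : ∀ s B → ℤ.- s ℤ.* B ≡ ℤ.- (s ℤ.* B)
      l₅ = solve-∀
      big : r ≡ r′ ℕ.+ suc n ℕ.* B
      big = ℤP.+-injective (trans (l₄ (+ r) (+ suc n ℤ.* + B)) (trans (cong (ℤ._+ + suc n ℤ.* + B) (sym (trans base (trans (cong (λ z → + r ℤ.+ z ℤ.* + B) t≡) (cong (λ z → + r ℤ.+ z) (l₅ (+ suc n) (+ B))))))) (trans (cong (λ z → + r′ ℤ.+ z) (sym (ℤP.pos-* (suc n) B))) (sym (ℤP.pos-+ r′ (suc n ℕ.* B))))))

  -- `floor` divides the reduced numerator. Scaling that division and the given one to a common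
  -- modulus lets `euclid-unique` compare the quotients.
  floor-frac : ∀ {x N D} m r → Frac x N D → N ≡ + r ℤ.+ m ℤ.* + D → r < D → floor x ≡ m
  floor-frac {mkℚ n d′ c} {N} {D} m r (frac d refl (*≡* v)) eq r<D = trans (ℤM.div-pos-is-/ℕ n (suc d′)) (euclid-unique {n ℤ.%ℕ suc d′ ℕ.* suc d} {r ℕ.* suc d′} {suc d′ ℕ.* suc d} (n ℤ./ℕ suc d′) m
      (ℕP.*-monoˡ-< (suc d) (ℤM.n%ℕd<d n (suc d′))) (subst (r ℕ.* suc d′ <_) (ℕP.*-comm (suc d) (suc d′)) (ℕP.*-monoˡ-< (suc d′) r<D)) main)
    where
    l₁ : ∀ r m D′ D → r ℤ.* D ℤ.+ m ℤ.* (D′ ℤ.* D) ≡ (r ℤ.+ m ℤ.* D′) ℤ.* D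
    l₁ = solve-∀
    l₂ : ∀ r m D′ D → (r ℤ.+ m ℤ.* D) ℤ.* D′ ≡ r ℤ.* D′ ℤ.+ m ℤ.* (D′ ℤ.* D)
    l₂ = solve-∀
    main : + (n ℤ.%ℕ suc d′ ℕ.* suc d) ℤ.+ n ℤ./ℕ suc d′ ℤ.* + (suc d′ ℕ.* suc d) ≡ + (r ℕ.* suc d′) ℤ.+ m ℤ.* + (suc d′ ℕ.* suc d)
    main = trans (cong₂ (λ a b → a ℤ.+ n ℤ./ℕ suc d′ ℤ.* b) (ℤP.pos-* (n ℤ.%ℕ suc d′) (suc d)) (ℤP.pos-* (suc d′) (suc d)))
      (trans (l₁ (+ (n ℤ.%ℕ suc d′)) (n ℤ./ℕ suc d′) (+ suc d′) (+ suc d)) (trans (cong (ℤ._* + suc d) (sym (ℤM.a≡a%ℕn+[a/ℕn]*n n (suc d′)))) (trans v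
      (trans (cong (ℤ._* + suc d′) eq) (trans (l₂ (+ r) m (+ suc d′) (+ suc d)) (sym (cong₂ (λ a b → a ℤ.+ m ℤ.* b) (ℤP.pos-* r (suc d′)) (ℤP.pos-* (suc d′) (suc d)))))))))

  frac-⟨⟩ : ∀ {x N D} m → floor x ≡ m → Frac x N D → Frac ⟨ x ⟩ (N ℤ.- m ℤ.* + D) D
  frac-⟨⟩ {x} {N} {D} m refl fx@(frac d refl _) = frac-rescale (frac-+ fx (frac-neg (frac-/ (floor x) 0))) (s≤s z≤n) (trans (l N (floor x) (+ D)) (cong ((N ℤ.- floor x ℤ.* + D) ℤ.*_) (sym (ℤP.pos-* D 1))))
    where
    l : ∀ N m D → (N ℤ.* + 1 ℤ.+ ℤ.- m ℤ.* D) ℤ.* D ≡ (N ℤ.- m ℤ.* D) ℤ.* (D ℤ.* + 1)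
    l = solve-∀

  modN-spec : ∀ x m → 0 < m → Congruence._≈_ (+ m) (+ modN x m) (+ x)
  modN-spec x (suc m) _ = Congruence.≈-sym (+ suc m) (Congruence.by (+ (x ℕM./ suc m)) (trans (cong +_ (ℕM.m≡m%n+[m/n]*n x (suc m))) (trans (ℤP.pos-+ (x ℕM.% suc m) _) (cong (λ z → + (x ℕM.% suc m) ℤ.+ z) (ℤP.pos-* (x ℕM./ suc m) (suc m))))))

  modZ-spec : ∀ x m → 0 < m → Congruence._≈_ (+ m) (+ modZ x m) x
  modZ-spec x (suc m) _ = Congruence.≈-sym (+ suc m) (Congruence.by (x ℤ./ℕ suc m) (ℤM.a≡a%ℕn+[a/ℕn]*n x (suc m)))

  modN-< : ∀ x m → 0 < m → modN x m < m
  modN-< x (suc m) _ = ℕM.m%n<n x (suc m)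

  module ModN {e h : ℕ} (P : OddPrime e h) where

    open PrimeModulus P

    modN-≈p : ∀ x → + modN x p ≈ + x
    modN-≈p x = modN-spec x p (s≤s z≤n)

    modN-<p : ∀ x → modN x p < p
    modN-<p x = modN-< x p (s≤s z≤n)

    modN-cong : ∀ x y → modN x p ≡ modN y p → + x ≈ + y
    modN-cong x y eq = ≈-trans (≈-sym (modN-≈p x)) (≈-trans (≡⇒≈ (cong +_ eq)) (modN-≈p y))

    cong-modN : ∀ x y → + x ≈ + y → modN x p ≡ modN y p
    cong-modN x y r = distinct (modN-<p x) (modN-<p y) (≈-trans (modN-≈p x) (≈-trans r (≈-sym (modN-≈p y))))

    modN-≈0 : ∀ x → modN x p ≡ 0 → + x ≈ + 0
    modN-≈0 x eq = ≈-trans (≈-sym (modN-≈p x)) (≡⇒≈ (cong +_ eq))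

  module Representatives {e h : ℕ} (P : OddPrime e h) (k′ : ℕ) where

    open PrimePower P k′
    open M using (p; Unit; 4≤e; e≡h+h)
    open import Relation.Binary.Reasoning.Setoid Z.setoid

    0<q : 0 < q
    0<q = ℕP.m^n>0 p (suc k′)

    0<e : 0 < e
    0<e = ℕP.≤-trans (s≤s z≤n) 4≤e

    euler : ∀ {x} → Unit x → x ℤ.* x ℤ.^ (φpk p (suc k′) ℕ.∸ 1) ≈ + 1
    euler {x} u = ≈-trans (≡⇒≈ (cong (x ℤ.^_) (ℕP.m+[n∸m]≡n {1} (ℕP.*-mono-≤ (ℕP.m^n>0 p k′) 0<e)))) (≈-trans (≡⇒≈ (sym (ℤP.^-*-assoc x (p ℕ.^ k′) e))) (Ω-e u))

    invMod-spec : ∀ u → Unit u → u ℤ.* invMod p (suc k′) u ≈ + 1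
    invMod-spec u uu = ≈-trans (*-congˡ u (modZ-spec (u ℤ.^ (φpk p (suc k′) ℕ.∸ 1)) q 0<q)) (euler uu)

    -- The reduced denominator is again prime to p: otherwise n D = N d with D a unit would force p
    -- to divide n, against coprimality. Euler's theorem then inverts it.
    ratRep-frac : ∀ {x N D} → Frac x N D → Unit (+ D) → + D ℤ.* + ratRep p (suc k′) x ≈ N
    ratRep-frac {x@(mkℚ n d′ c)} {N} {D} (frac d refl (*≡* v)) uD = cancel (+ suc d′) uden (begin
      + suc d′ ℤ.* (+ D ℤ.* + r) ≡⟨ l₁ (+ suc d′) (+ D) (+ r) ⟩
      + D ℤ.* (+ suc d′ ℤ.* + r) ≈⟨ *-congˡ (+ D) dr ⟩
      + D ℤ.* n ≡⟨ trans (ℤP.*-comm (+ D) n) (trans v (ℤP.*-comm N (+ suc d′))) ⟩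
      + suc d′ ℤ.* N ∎)
      where
      r = ratRep p (suc k′) x
      c′ : Coprime.Coprime ∣ n ∣ (suc d′)
      c′ = Coprime.recompute c
      uden : Unit (+ suc d′)
      uden z with M.integral n (+ D) (M.≈-trans (M.≡⇒≈ v) (M.≈-trans (M.*-congˡ N z) (M.≡⇒≈ (ℤP.*-zeroʳ N))))
      ... | inj₂ D≈0 = uD D≈0
      ... | inj₁ n≈0 = M.Unit-1 (M.∣ℕ⇒≈0 (subst (p ℕD.∣_) (c′ (M.≈0⇒∣ℕ n≈0 , M.≈0⇒∣ℕ z)) ℕD.∣-refl))
      i = φpk p (suc k′) ℕ.∸ 1
      l₁ : ∀ a b c → a ℤ.* (b ℤ.* c) ≡ b ℤ.* (a ℤ.* c)
      l₁ = solve-∀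
      dr : + suc d′ ℤ.* + r ≈ n
      dr = begin
        + suc d′ ℤ.* + r ≈⟨ *-congˡ (+ suc d′) (modN-spec (modZ n q ℕ.* modN (suc d′ ℕ.^ i) q) q 0<q) ⟩
        + suc d′ ℤ.* + (modZ n q ℕ.* modN (suc d′ ℕ.^ i) q) ≡⟨ cong (+ suc d′ ℤ.*_) (ℤP.pos-* (modZ n q) (modN (suc d′ ℕ.^ i) q)) ⟩
        + suc d′ ℤ.* (+ modZ n q ℤ.* + modN (suc d′ ℕ.^ i) q) ≈⟨ *-congˡ (+ suc d′) (*-cong (modZ-spec n q 0<q) (≈-trans (modN-spec (suc d′ ℕ.^ i) q 0<q) (≡⇒≈ (pos-^ (suc d′) i)))) ⟩
        + suc d′ ℤ.* (n ℤ.* (+ suc d′) ℤ.^ i) ≡⟨ l₁ (+ suc d′) n ((+ suc d′) ℤ.^ i) ⟩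
        n ℤ.* (+ suc d′ ℤ.* (+ suc d′) ℤ.^ i) ≈⟨ *-congˡ n (euler uden) ⟩
        n ℤ.* + 1 ≡⟨ ℤP.*-identityʳ n ⟩
        n ∎

    Unit-multiple : ∀ c → 0 < c → c ≤ e → Unit (+ (c ℕ.* e))
    Unit-multiple c 0<c c≤e = subst Unit (sym (ℤP.pos-* c e)) (M.Unit-* (M.Unit-small c 0<c (s≤s c≤e)) (M.Unit-small e 0<e ℕP.≤-refl))

    rr : ℚ → ℕ
    rr = ratRep p (suc k′)

    -- The two possible values of ⌊⟨a⟩ - j/(p-1)⌋ for a = A/C in (0,1), with the class of ⟨a - j/(p-1)⟩.
    lower-spec : ∀ A C a j → 0 < C → C ≤ e → A < C → Frac a (+ A) C → Frac ⟨ a ⟩ (+ A) C → j < e →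
      (C ℕ.* j ≤ A ℕ.* e × floor (⟨ a ⟩ ℚ.- (j over e)) ≡ + 0 × + C ℤ.* + e ℤ.* + rr ⟨ a ℚ.- (j over e) ⟩ ≈ + A ℤ.* + e ℤ.- + C ℤ.* + j) ⊎
      (A ℕ.* e < C ℕ.* j × floor (⟨ a ⟩ ℚ.- (j over e)) ≡ ℤ.- (+ 1) × + C ℤ.* + e ℤ.* + rr ⟨ a ℚ.- (j over e) ⟩ ≈ + A ℤ.* + e ℤ.- + C ℤ.* + j ℤ.+ + C ℤ.* + e)
    lower-spec A C a j 0<C C≤e A<C fa f⟨a⟩ j<e with C ℕ.* j ℕP.≤? A ℕ.* e
    ... | yes le = inj₁ (le , fl f⟨a⟩ , ≈-trans (≈-trans (≡⇒≈ (cong (ℤ._* + rr ⟨ a ℚ.- (j over e) ⟩) (sym (ℤP.pos-* C e)))) (ratRep-frac (frac-⟨⟩ (+ 0) (fl fa) (base fa)) (Unit-multiple C 0<C C≤e))) (≡⇒≈ (l₂ (+ A) (+ e) (+ C) (+ j) (+ (C ℕ.* e)))))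
      where
      l₂ : ∀ A e C j D → A ℤ.* e ℤ.+ ℤ.- j ℤ.* C ℤ.- + 0 ℤ.* D ≡ A ℤ.* e ℤ.- C ℤ.* j
      l₂ = solve-∀
      l₃ : ∀ A e C j D → A ℤ.* e ℤ.+ ℤ.- j ℤ.* C ≡ A ℤ.* e ℤ.- C ℤ.* j ℤ.+ + 0 ℤ.* D
      l₃ = solve-∀
      base : ∀ {x} → Frac x (+ A) C → Frac (x ℚ.- (j over e)) (+ A ℤ.* + e ℤ.+ ℤ.- (+ j) ℤ.* + C) (C ℕ.* e)
      base f = frac-+ f (frac-neg (frac-over j e 0<e))
      fl : ∀ {x} → Frac x (+ A) C → floor (x ℚ.- (j over e)) ≡ + 0
      fl f = floor-frac (+ 0) (A ℕ.* e ℕ.∸ C ℕ.* j) (base f) (trans (l₃ (+ A) (+ e) (+ C) (+ j) (+ (C ℕ.* e))) (cong (ℤ._+ + 0 ℤ.* + (C ℕ.* e)) (trans (cong₂ ℤ._-_ (sym (ℤP.pos-* A e)) (sym (ℤP.pos-* C j))) (trans (ℤP.m-n≡m⊖n (A ℕ.* e) (C ℕ.* j)) (ℤP.⊖-≥ le)))))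
        (ℕP.≤-<-trans (ℕP.m∸n≤m (A ℕ.* e) (C ℕ.* j)) (ℕP.*-monoˡ-< e A<C))
    ... | no ¬le = inj₂ (ℕP.≰⇒> ¬le , fl f⟨a⟩ , ≈-trans (≈-trans (≡⇒≈ (cong (ℤ._* + rr ⟨ a ℚ.- (j over e) ⟩) (sym (ℤP.pos-* C e)))) (ratRep-frac (frac-⟨⟩ (ℤ.- (+ 1)) (fl fa) (base fa)) (Unit-multiple C 0<C C≤e))) (≡⇒≈ (trans (l₂ (+ A) (+ e) (+ C) (+ j) (+ (C ℕ.* e))) (cong (λ z → + A ℤ.* + e ℤ.- + C ℤ.* + j ℤ.+ z) (ℤP.pos-* C e)))))
      where
      l₂ : ∀ A e C j D → A ℤ.* e ℤ.+ ℤ.- j ℤ.* C ℤ.- ℤ.- (+ 1) ℤ.* D ≡ A ℤ.* e ℤ.- C ℤ.* j ℤ.+ D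
      l₂ = solve-∀
      l₃ : ∀ A e C j D → A ℤ.* e ℤ.+ ℤ.- j ℤ.* C ≡ A ℤ.* e ℤ.+ D ℤ.- C ℤ.* j ℤ.+ ℤ.- (+ 1) ℤ.* D
      l₃ = solve-∀
      base : ∀ {x} → Frac x (+ A) C → Frac (x ℚ.- (j over e)) (+ A ℤ.* + e ℤ.+ ℤ.- (+ j) ℤ.* + C) (C ℕ.* e)
      base f = frac-+ f (frac-neg (frac-over j e 0<e))
      le : C ℕ.* j ≤ A ℕ.* e ℕ.+ C ℕ.* e
      le = ℕP.≤-trans (ℕP.*-monoʳ-≤ C (ℕP.<⇒≤ j<e)) (ℕP.m≤n+m (C ℕ.* e) (A ℕ.* e))
      small : A ℕ.* e ℕ.+ C ℕ.* e ℕ.∸ C ℕ.* j < C ℕ.* e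
      small = ℕP.+-cancelʳ-< (C ℕ.* j) _ _ (subst (_< C ℕ.* e ℕ.+ C ℕ.* j) (sym (ℕP.m∸n+n≡m le)) (subst (A ℕ.* e ℕ.+ C ℕ.* e <_) (ℕP.+-comm (C ℕ.* j) (C ℕ.* e)) (ℕP.+-monoˡ-< (C ℕ.* e) (ℕP.≰⇒> ¬le))))
      fl : ∀ {x} → Frac x (+ A) C → floor (x ℚ.- (j over e)) ≡ ℤ.- (+ 1)
      fl f = floor-frac (ℤ.- (+ 1)) (A ℕ.* e ℕ.+ C ℕ.* e ℕ.∸ C ℕ.* j) (base f) (trans (l₃ (+ A) (+ e) (+ C) (+ j) (+ (C ℕ.* e))) (cong (ℤ._+ ℤ.- (+ 1) ℤ.* + (C ℕ.* e)) (trans (cong₂ ℤ._-_ (trans (cong (ℤ._+ + (C ℕ.* e)) (sym (ℤP.pos-* A e))) (sym (ℤP.pos-+ (A ℕ.* e) (C ℕ.* e)))) (sym (ℤP.pos-* C j))) (trans (ℤP.m-n≡m⊖n (A ℕ.* e ℕ.+ C ℕ.* e) (C ℕ.* j)) (ℤP.⊖-≥ le))))) small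

    -- Likewise for ⌊⟨-b⟩ + j/(p-1)⌋, with b = B/C and C = A + B.
    upper-spec : ∀ A B C b j → 0 < C → C ≤ e → A ℕ.+ B ≡ C → 0 < B → Frac (ℚ.- b) (ℤ.- (+ B)) C → Frac ⟨ ℚ.- b ⟩ (+ A) C → j < e →
      (C ℕ.* j < B ℕ.* e × floor (⟨ ℚ.- b ⟩ ℚ.+ (j over e)) ≡ + 0 × + C ℤ.* + e ℤ.* + rr ⟨ ℚ.- b ℚ.+ (j over e) ⟩ ≈ + A ℤ.* + e ℤ.+ + C ℤ.* + j) ⊎
      (B ℕ.* e ≤ C ℕ.* j × floor (⟨ ℚ.- b ⟩ ℚ.+ (j over e)) ≡ + 1 × + C ℤ.* + e ℤ.* + rr ⟨ ℚ.- b ℚ.+ (j over e) ⟩ ≈ + C ℤ.* + j ℤ.- + B ℤ.* + e)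
    upper-spec A B C b j 0<C C≤e refl 0<B fb f⟨b⟩ j<e with B ℕ.* e ℕP.≤? C ℕ.* j
    ... | no ¬le = inj₁ (ℕP.≰⇒> ¬le , fl₁ , ≈-trans (≈-trans (≡⇒≈ (cong (ℤ._* + rr ⟨ ℚ.- b ℚ.+ (j over e) ⟩) (sym (ℤP.pos-* C e)))) (ratRep-frac (frac-⟨⟩ (ℤ.- (+ 1)) fl₂ base₂) (Unit-multiple C 0<C C≤e)))
        (≡⇒≈ (trans (cong (λ z → ℤ.- (+ B) ℤ.* + e ℤ.+ + j ℤ.* + C ℤ.- ℤ.- (+ 1) ℤ.* z) Ce) (trans (l₂ (+ A) (+ B) (+ e) (+ C) (+ j)) refl))))
      where
      Ce : + (C ℕ.* e) ≡ (+ A ℤ.+ + B) ℤ.* + e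
      Ce = trans (ℤP.pos-* C e) (cong (ℤ._* + e) (ℤP.pos-+ A B))
      base₁ = frac-+ f⟨b⟩ (frac-over j e 0<e)
      base₂ = frac-+ fb (frac-over j e 0<e)
      l₂ : ∀ A B e C j → ℤ.- B ℤ.* e ℤ.+ j ℤ.* C ℤ.- ℤ.- (+ 1) ℤ.* ((A ℤ.+ B) ℤ.* e) ≡ A ℤ.* e ℤ.+ C ℤ.* j
      l₂ = solve-∀
      l₃ : ∀ A e C j D → A ℤ.* e ℤ.+ j ℤ.* C ≡ A ℤ.* e ℤ.+ C ℤ.* j ℤ.+ + 0 ℤ.* D
      l₃ = solve-∀
      l₄ : ∀ A B e C j → ℤ.- B ℤ.* e ℤ.+ j ℤ.* C ≡ A ℤ.* e ℤ.+ C ℤ.* j ℤ.+ ℤ.- (+ 1) ℤ.* ((A ℤ.+ B) ℤ.* e)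
      l₄ = solve-∀
      r = A ℕ.* e ℕ.+ C ℕ.* j
      r≡ : + A ℤ.* + e ℤ.+ + C ℤ.* + j ≡ + r
      r≡ = sym (trans (ℤP.pos-+ (A ℕ.* e) (C ℕ.* j)) (cong₂ ℤ._+_ (ℤP.pos-* A e) (ℤP.pos-* C j)))
      r< : r < C ℕ.* e
      r< = subst (r <_) (sym (ℕP.*-distribʳ-+ e A B)) (ℕP.+-monoʳ-< (A ℕ.* e) (ℕP.≰⇒> ¬le))
      fl₁ : floor (⟨ ℚ.- b ⟩ ℚ.+ (j over e)) ≡ + 0
      fl₁ = floor-frac (+ 0) r base₁ (trans (l₃ (+ A) (+ e) (+ C) (+ j) (+ (C ℕ.* e))) (cong (ℤ._+ + 0 ℤ.* + (C ℕ.* e)) r≡)) r<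
      fl₂ : floor (ℚ.- b ℚ.+ (j over e)) ≡ ℤ.- (+ 1)
      fl₂ = floor-frac (ℤ.- (+ 1)) r base₂ (trans (l₄ (+ A) (+ B) (+ e) (+ C) (+ j)) (cong₂ (λ a b → a ℤ.+ ℤ.- (+ 1) ℤ.* b) r≡ (sym Ce))) r<
    ... | yes le = inj₂ (le , fl₁ , ≈-trans (≈-trans (≡⇒≈ (cong (ℤ._* + rr ⟨ ℚ.- b ℚ.+ (j over e) ⟩) (sym (ℤP.pos-* C e)))) (ratRep-frac (frac-⟨⟩ (+ 0) fl₂ base₂) (Unit-multiple C 0<C C≤e)))
        (≡⇒≈ (l₂ (+ B) (+ e) (+ C) (+ j) (+ (C ℕ.* e)))))
      where
      Ce : + (C ℕ.* e) ≡ (+ A ℤ.+ + B) ℤ.* + e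
      Ce = trans (ℤP.pos-* C e) (cong (ℤ._* + e) (ℤP.pos-+ A B))
      base₁ = frac-+ f⟨b⟩ (frac-over j e 0<e)
      base₂ = frac-+ fb (frac-over j e 0<e)
      l₂ : ∀ B e C j D → ℤ.- B ℤ.* e ℤ.+ j ℤ.* C ℤ.- + 0 ℤ.* D ≡ C ℤ.* j ℤ.- B ℤ.* e
      l₂ = solve-∀
      l₃ : ∀ A B e C j → A ℤ.* e ℤ.+ j ℤ.* C ≡ C ℤ.* j ℤ.- B ℤ.* e ℤ.+ + 1 ℤ.* ((A ℤ.+ B) ℤ.* e)
      l₃ = solve-∀
      l₄ : ∀ B e C j D → ℤ.- B ℤ.* e ℤ.+ j ℤ.* C ≡ C ℤ.* j ℤ.- B ℤ.* e ℤ.+ + 0 ℤ.* D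
      l₄ = solve-∀
      r = C ℕ.* j ℕ.∸ B ℕ.* e
      r≡ : + C ℤ.* + j ℤ.- + B ℤ.* + e ≡ + r
      r≡ = trans (cong₂ ℤ._-_ (sym (ℤP.pos-* C j)) (sym (ℤP.pos-* B e))) (trans (ℤP.m-n≡m⊖n (C ℕ.* j) (B ℕ.* e)) (ℤP.⊖-≥ le))
      r< : r < C ℕ.* e
      r< = ℕP.≤-<-trans (ℕP.m∸n≤m (C ℕ.* j) (B ℕ.* e)) (ℕP.*-monoʳ-< C {{ℕ.>-nonZero 0<C}} j<e)
      fl₁ : floor (⟨ ℚ.- b ⟩ ℚ.+ (j over e)) ≡ + 1
      fl₁ = floor-frac (+ 1) r base₁ (trans (l₃ (+ A) (+ B) (+ e) (+ C) (+ j)) (cong₂ (λ a b → a ℤ.+ + 1 ℤ.* b) r≡ (sym Ce))) r<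
      fl₂ : floor (ℚ.- b ℚ.+ (j over e)) ≡ + 0
      fl₂ = floor-frac (+ 0) r base₂ (trans (l₄ (+ B) (+ e) (+ C) (+ j) (+ (C ℕ.* e))) (cong (ℤ._+ + 0 ℤ.* + (C ℕ.* e)) r≡)) r<

-- The defined quantities as character sums.

module Curves where

  open Congruences
  open GrossKoblitz
  open Teichmuller
  open Characters
  open CurveSums
  open Fractions

  open ℤ-Alg using (Σ; Σ-cong; Σ-cong<; Σ-front; Σ-+; Σ-zero)

  sumℤ-applyUpTo : ∀ (f : ℕ → ℤ) g n → sumℤ (map f (applyUpTo g n)) ≡ Σ n (f ∘ g)
  sumℤ-applyUpTo f g zero = refl
  sumℤ-applyUpTo f g (suc n) = trans (cong (λ z → f (g 0) ℤ.+ z) (sumℤ-applyUpTo f (g ∘ suc) n)) (sym (Σ-front n (f ∘ g)))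

  sum-applyUpTo : ∀ (f : ℕ → ℕ) g n → + sum (map f (applyUpTo g n)) ≡ Σ n (λ i → + f (g i))
  sum-applyUpTo f g zero = refl
  sum-applyUpTo f g (suc n) = trans (ℤP.pos-+ (f (g 0)) _) (trans (cong (λ z → + f (g 0) ℤ.+ z) (sum-applyUpTo f (g ∘ suc) n)) (sym (Σ-front n (λ i → + f (g i)))))

  prodℤ-applyUpTo : ∀ (f : ℕ → ℤ) g n → prodℤ (map f (applyUpTo g (suc n))) ≡ prodℤ (map f (applyUpTo g n)) ℤ.* f (g n)
  prodℤ-applyUpTo f g zero = trans (ℤP.*-identityʳ (f (g 0))) (sym (ℤP.*-identityˡ (f (g 0))))
  prodℤ-applyUpTo f g (suc n) = trans (cong (f (g 0) ℤ.*_) (prodℤ-applyUpTo f (g ∘ suc) n)) (sym (ℤP.*-assoc (f (g 0)) (prodℤ (map f (applyUpTo (g ∘ suc) n))) (f (g (suc n)))))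

  any-applyUpTo-true : ∀ (f : ℕ → Bool) g n → any f (applyUpTo g n) ≡ true → ∃[ i ] (i < n × f (g i) ≡ true)
  any-applyUpTo-true f g (suc n) eq with f (g 0) in eq₀
  ... | true = 0 , s≤s z≤n , eq₀
  ... | false with any-applyUpTo-true f (g ∘ suc) n eq
  ...   | i , l , q = suc i , s≤s l , q

  any-applyUpTo-false : ∀ (f : ℕ → Bool) g n → any f (applyUpTo g n) ≡ false → ∀ i → i < n → f (g i) ≡ false
  any-applyUpTo-false f g (suc n) eq i l with f (g 0) in eq₀
  any-applyUpTo-false f g (suc n) () i l | true
  any-applyUpTo-false f g (suc n) eq zero l | false = eq₀
  any-applyUpTo-false f g (suc n) eq (suc i) (s≤s l) | false = any-applyUpTo-false f (g ∘ suc) n eq i l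

  ≡ᵇ-true : ∀ m n → (m ≡ᵇ n) ≡ true → m ≡ n
  ≡ᵇ-true m n eq = ℕP.≡ᵇ⇒≡ m n (subst Bool.T (sym eq) tt)

  ≡ᵇ-false : ∀ m n → (m ≡ᵇ n) ≡ false → m ≢ n
  ≡ᵇ-false m n eq m≡n = subst Bool.T eq (ℕP.≡⇒≡ᵇ m n m≡n)

  module CurveData {e h : ℕ} (P : OddPrime e h) (k′ : ℕ) (a b : ℕ)
    (Unit-a : PrimeModulus.Unit P (+ a)) (Unit-b : PrimeModulus.Unit P (+ b)) where

    open CurveSum P k′ (+ a) (+ b) Unit-a Unit-b
    open M using (p; Unit; 4≤e; e≡h+h)
    open ModN P
    open Representatives P k′
    open import Relation.Binary.Reasoning.Setoid Z.setoid

    private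
      factor : ℕ → ℤ
      factor j = if does (p ℕD.∣? j) then + 1 else + j

      γ-factor : ∀ n → γ (suc n) ≡ ℤ.- (+ 1) ℤ.* factor (suc n)
      γ-factor n = case p ℕD.∣? suc n of λ
        { (yes d) → trans (γ-multiple (suc n) (M.∣ℕ⇒≈0 d)) (cong (λ b → ℤ.- (+ 1) ℤ.* (if b then + 1 else + suc n)) (sym (dec-true (p ℕD.∣? suc n) d)))
        ; (no nd) → trans (γ-unit (suc n) (λ z → nd (M.≈0⇒∣ℕ z))) (trans (l (+ suc n)) (cong (λ b → ℤ.- (+ 1) ℤ.* (if b then + 1 else + suc n)) (sym (dec-false (p ℕD.∣? suc n) nd)))) }
        where
        l : ∀ x → ℤ.- x ≡ ℤ.- (+ 1) ℤ.* x
        l = solve-∀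

    Γₚℕ≡Γ : ∀ n → Γₚℕ p n ≡ Γ n
    Γₚℕ≡Γ zero = refl
    -- The product starts at j = 1, while the functional equation starts at 0; its first factor
    -- `γ 0` = -1 supplies just the sign.
    Γₚℕ≡Γ (suc zero) = sym (cong (ℤ._* + 1) (γ-multiple 0 M.≈-refl))
    Γₚℕ≡Γ (suc (suc n)) = trans (cong ((ℤ.- (+ 1)) ℤ.^ suc (suc n) ℤ.*_) (prodℤ-applyUpTo factor suc n))
      (trans (l ((ℤ.- (+ 1)) ℤ.^ suc n) (prodℤ (map factor (applyUpTo suc n))) (factor (suc n))) (cong₂ ℤ._*_ (sym (γ-factor n)) (Γₚℕ≡Γ (suc n))))
      where
      l : ∀ s r f → ℤ.- (+ 1) ℤ.* s ℤ.* (r ℤ.* f) ≡ ℤ.- (+ 1) ℤ.* f ℤ.* (s ℤ.* r)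
      l = solve-∀

    cubicℕ : ℕ → ℕ
    cubicℕ x = x ℕ.* x ℕ.* x ℕ.+ a ℕ.* x ℕ.+ b

    cubicℕ≡ : ∀ x → + cubicℕ x ≡ cubic (+ x)
    cubicℕ≡ x = trans (ℤP.pos-+ (x ℕ.* x ℕ.* x ℕ.+ a ℕ.* x) b) (trans (cong (ℤ._+ + b) (trans (ℤP.pos-+ (x ℕ.* x ℕ.* x) (a ℕ.* x)) (cong₂ ℤ._+_ (trans (ℤP.pos-* (x ℕ.* x) x) (cong (ℤ._* + x) (ℤP.pos-* x x))) (ℤP.pos-* a x)))) (ℤP.+-assoc (+ x ℤ.* + x ℤ.* + x) (+ a ℤ.* + x) (+ b)))

    ind-bool : ∀ x y → + (if modN x p ≡ᵇ modN y p then 1 else 0) ≡ ind (+ x) (+ y)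
    ind-bool x y with modN x p ≡ᵇ modN y p in eq
    ... | true = sym (ind-yes (modN-cong x y (≡ᵇ-true (modN x p) (modN y p) eq)))
    ... | false = sym (ind-no (λ r → ≡ᵇ-false (modN x p) (modN y p) eq (cong-modN x y r)))

    affineCount-roots : + affineCount p a b ≡ Σ p (λ x → roots (cubic (+ x)))
    affineCount-roots = trans (sum-applyUpTo _ id p) (Σ-cong p (λ x → trans (sum-applyUpTo _ id p) (Σ-cong p (λ y → trans (ind-bool (y ℕ.* y) (cubicℕ x)) (cong₂ ind (ℤP.pos-* y y) (cubicℕ≡ x))))))

    -- Each x carries 1 + φ(x³ + ax + b) affine points. The value φ(b) at x = 0 is split off because
    -- `Φ` runs over x ≠ 0.
    aₚ-Φ : Φ ≈ ℤ.- aₚ p a b ℤ.- φ (+ b)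
    aₚ-Φ = begin
      Φ ≡⟨ l₁ Φ (φ (+ b)) (+ p) ⟩
      (+ p ℤ.+ (φ (+ b) ℤ.+ Φ)) ℤ.- + p ℤ.- φ (+ b) ≈⟨ +-cong (+-cong (≈-sym count) ≈-refl) ≈-refl ⟩
      + affineCount p a b ℤ.- + p ℤ.- φ (+ b) ≡⟨ cong (ℤ._- φ (+ b)) (l₂ (+ affineCount p a b) (+ p)) ⟩
      ℤ.- aₚ p a b ℤ.- φ (+ b) ∎
      where
      l₁ : ∀ F f p → F ≡ (p ℤ.+ (f ℤ.+ F)) ℤ.- p ℤ.- f
      l₁ = solve-∀
      l₂ : ∀ N p → N ℤ.- p ≡ ℤ.- ((+ 1 ℤ.+ p) ℤ.- (+ 1 ℤ.+ N))
      l₂ = solve-∀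
      l₃ : ∀ a b → + 0 ℤ.* + 0 ℤ.* + 0 ℤ.+ (a ℤ.* + 0 ℤ.+ b) ≡ b
      l₃ = solve-∀
      count : + affineCount p a b ≈ + p ℤ.+ (φ (+ b) ℤ.+ Φ)
      count = begin
        + affineCount p a b ≡⟨ affineCount-roots ⟩
        Σ p (λ x → roots (cubic (+ x))) ≈⟨ Σ-cong≈ p (λ x _ → roots-φ (cubic (+ x))) ⟩
        Σ p (λ x → + 1 ℤ.+ φ (cubic (+ x))) ≡⟨ trans (Σ-+ p (λ _ → + 1) (λ x → φ (cubic (+ x)))) (cong₂ ℤ._+_ (trans (Σ-const p (+ 1)) (ℤP.*-identityʳ (+ p))) (trans (Σ-front e (λ x → φ (cubic (+ x)))) (cong (λ z → φ z ℤ.+ Φ) (l₃ (+ a) (+ b))))) ⟩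
        + p ℤ.+ (φ (+ b) ℤ.+ Φ) ∎

    -- If b ≡ y², then φ(b) ≡ ω(y)ᵉ ≡ 1. If the search finds no root, `roots-φ` reads 0 ≡ 1 + φ(b).
    legendre-φ : legendre p b ≈ φ (+ b)
    legendre-φ with modN b p ≡ᵇ 0 in eq₀
    ... | true = ⊥-elim (Unit-b (modN-≈0 b (≡ᵇ-true (modN b p) 0 eq₀)))
    ... | false with any (λ x → modN (x ℕ.* x) p ≡ᵇ modN b p) (upTo p) in eq₁
    ...   | true with any-applyUpTo-true (λ x → modN (x ℕ.* x) p ≡ᵇ modN b p) id p eq₁
    ...     | y , _ , eq₂ = ≈-sym (begin
          φ (+ b) ≈⟨ ^-cong h (Ω-cong (M.≈-sym y²)) ⟩
          Ω (+ y ℤ.* + y) ℤ.^ h ≡⟨ trans (cong (ℤ._^ h) (Ω-* (+ y) (+ y))) (trans (*-pow (Ω (+ y)) (Ω (+ y)) h) (trans (sym (ℤP.^-distribˡ-+-* (Ω (+ y)) h h)) (cong (Ω (+ y) ℤ.^_) (sym e≡h+h)))) ⟩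
          Ω (+ y) ℤ.^ e ≈⟨ Ω-e (M.Unit-*ˡ (+ y) (M.Unit-cong (M.≈-sym y²) Unit-b)) ⟩
          + 1 ∎)
      where
      y² : + y ℤ.* + y M.≈ + b
      y² = M.≈-trans (M.≡⇒≈ (sym (ℤP.pos-* y y))) (modN-cong (y ℕ.* y) b (≡ᵇ-true (modN (y ℕ.* y) p) (modN b p) eq₂))
    legendre-φ | false | false = ≈-trans (≡⇒≈ (l₁ (ℤ.- (+ 1)))) (≈-trans (+-cong (≈-trans (≡⇒≈ (sym none)) (roots-φ (+ b))) (≈-refl {ℤ.- (+ 1)})) (≡⇒≈ (l₂ (φ (+ b)))))
      where
      l₁ : ∀ x → x ≡ + 0 ℤ.+ x
      l₁ = solve-∀
      l₂ : ∀ x → + 1 ℤ.+ x ℤ.+ ℤ.- (+ 1) ≡ x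
      l₂ = solve-∀
      none : roots (+ b) ≡ + 0
      none = Σ-zero p (λ y l → ind-no (λ r → ≡ᵇ-false (modN (y ℕ.* y) p) (modN b p) (any-applyUpTo-false (λ x → modN (x ℕ.* x) p ≡ᵇ modN b p) id p eq₁ y l) (cong-modN (y ℕ.* y) b (M.≈-trans (M.≡⇒≈ (ℤP.pos-* y y)) r))))

    invFp-spec : ∀ x → Unit (+ x) → + x ℤ.* + invFp p x M.≈ + 1
    invFp-spec x u = M.≈-trans (M.*-congˡ (+ x) (M.≈-trans (modN-≈p (x ℕ.^ (e ℕ.∸ 1))) (M.≡⇒≈ (pos-^ x (e ℕ.∸ 1))))) (inverse u)

    private
      4a³ 27b² : ℤ
      4a³ = + 4 ℤ.* (+ a ℤ.* (+ a ℤ.* + a))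
      27b² = + 27 ℤ.* (+ b ℤ.* + b)

      Unit-4a³ : Unit 4a³
      Unit-4a³ = M.Unit-* (M.Unit-small 4 (s≤s z≤n) (s≤s 4≤e)) (M.Unit-* Unit-a (M.Unit-* Unit-a Unit-a))

      Unit-27b² : Unit 27b²
      Unit-27b² = M.Unit-* (M.Unit-* Unit-3 (M.Unit-* Unit-3 Unit-3)) (M.Unit-* Unit-b Unit-b)

      D : ℕ
      D = modN (4 ℕ.* (a ℕ.^ 3)) p

      D≈ : + D M.≈ 4a³
      D≈ = M.≈-trans (modN-≈p (4 ℕ.* (a ℕ.^ 3))) (M.≡⇒≈ (trans (ℤP.pos-* 4 (a ℕ.^ 3)) (cong (+ 4 ℤ.*_) (trans (pos-^ a 3) (l (+ a))))))
        where
        l : ∀ a → a ℤ.* (a ℤ.* (a ℤ.* + 1)) ≡ a ℤ.* (a ℤ.* a)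
        l = solve-∀

      t : ℕ
      t = tArg p a b

      t-spec : + t ℤ.* 4a³ M.≈ ℤ.- 27b²
      t-spec = M.≈-trans (M.*-cong (M.≈-trans (modN-≈p _) (M.≡⇒≈ (ℤP.pos-* (p ℕ.∸ m) (invFp p D)))) (M.≈-sym D≈))
        (M.≈-trans (M.≡⇒≈ (l₁ (+ (p ℕ.∸ m)) (+ invFp p D) (+ D))) (M.≈-trans (M.*-cong p∸m (invFp-spec D (M.Unit-cong (M.≈-sym D≈) Unit-4a³))) (M.≡⇒≈ (ℤP.*-identityʳ (ℤ.- 27b²)))))
        where
        m = modN (27 ℕ.* b ℕ.* b) p
        l₁ : ∀ x i d → x ℤ.* i ℤ.* d ≡ x ℤ.* (d ℤ.* i)
        l₁ = solve-∀
        l₂ : ∀ p m → p ℤ.- m ≡ ℤ.- m ℤ.+ + 1 ℤ.* p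
        l₂ = solve-∀
        p∸m : + (p ℕ.∸ m) M.≈ ℤ.- 27b²
        p∸m = M.≈-trans (M.≡⇒≈ (sym (trans (ℤP.m-n≡m⊖n p m) (ℤP.⊖-≥ (ℕP.<⇒≤ (modN-<p (27 ℕ.* b ℕ.* b))))))) (M.≈-trans (M.by (+ 1) (l₂ (+ p) (+ m)))
          (M.neg-cong (M.≈-trans (modN-≈p (27 ℕ.* b ℕ.* b)) (M.≡⇒≈ (trans (ℤP.pos-* (27 ℕ.* b) b) (trans (cong (ℤ._* + b) (ℤP.pos-* 27 b)) (ℤP.*-assoc (+ 27) (+ b) (+ b))))))))

      Unit-t : Unit (+ t)
      Unit-t = M.Unit-*ˡ 4a³ (M.Unit-cong (M.≈-sym t-spec) (M.Unit-neg Unit-27b²))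

    ωt : ℤ
    ωt = ωₖ p (suc k′) (invFp p (modN t p))

    ω̄-power : ∀ j → ω̄^ p (suc k′) j t ≡ ωt ℤ.^ j
    ω̄-power j with modN t p ≡ᵇ 0 in eq
    ... | true = ⊥-elim (Unit-t (modN-≈0 t (≡ᵇ-true (modN t p) 0 eq)))
    ... | false = refl

    ωt-spec : ωt ℤ.* Ω 27b² ≈ Ω (ℤ.- (+ 1) ℤ.* 4a³)
    ωt-spec = ≈-trans (*-congʳ (Ω 27b²) (≈-trans (modN-spec (s ℕ.^ (p ℕ.^ k′)) q 0<q) (≡⇒≈ (pos-^ s (p ℕ.^ k′))))) (≈-trans (≡⇒≈ (sym (Ω-* (+ s) 27b²))) (Ω-cong main))
      where
      s = invFp p (modN t p)
      ts : + t ℤ.* + s M.≈ + 1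
      ts = M.≈-trans (M.*-congʳ (+ s) (M.≈-sym (modN-≈p t))) (invFp-spec (modN t p) (M.Unit-cong (M.≈-sym (modN-≈p t)) Unit-t))
      l₁ : ∀ s x → s ℤ.* x ≡ ℤ.- (s ℤ.* ℤ.- x)
      l₁ = solve-∀
      l₂ : ∀ s t x → ℤ.- (s ℤ.* (t ℤ.* x)) ≡ t ℤ.* s ℤ.* (ℤ.- (+ 1) ℤ.* x)
      l₂ = solve-∀
      main : + s ℤ.* 27b² M.≈ ℤ.- (+ 1) ℤ.* 4a³
      main = M.≈-trans (M.≡⇒≈ (l₁ (+ s) 27b²)) (M.≈-trans (M.neg-cong (M.*-congˡ (+ s) (M.≈-sym t-spec))) (M.≈-trans (M.≡⇒≈ (l₂ (+ s) (+ t) 4a³)) (M.≈-trans (M.*-congʳ (ℤ.- (+ 1) ℤ.* 4a³) ts) (M.≡⇒≈ (ℤP.*-identityˡ (ℤ.- (+ 1) ℤ.* 4a³))))))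

-- Matching floors with powers of p, and summing up.

module Summation where

  open Congruences
  open GrossKoblitz
  open Teichmuller
  open Characters
  open CurveSums
  open Terms
  open Fractions
  open Curves

  open ℤ-Alg using (Σ; Σ-cong; Σ-cong<; Σ-front; Σ-*ˡ; Σ-reverse)

  ¼ ¾ ⅓ ⅔ : ℚ
  ¼ = + 1 ℚ./ 4
  ¾ = + 3 ℚ./ 4
  ⅓ = + 1 ℚ./ 3
  ⅔ = + 2 ℚ./ 3

  module Assembly {e h : ℕ} (P : OddPrime e h) (k′ : ℕ) (a b : ℕ)
    (Unit-a : PrimeModulus.Unit P (+ a)) (Unit-b : PrimeModulus.Unit P (+ b)) where

    open TermIdentity P k′ (+ a) (+ b) Unit-a Unit-b
    open M using (p; Unit; 4≤e; e≡h+h)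
    open Representatives P k′
    open CurveData P k′ a b Unit-a Unit-b
    open import Relation.Binary.Reasoning.Setoid Z.setoid

    3≤e : 3 ≤ e
    3≤e = ℕP.≤-trans (ℕP.n≤1+n 3) 4≤e

    low : ℚ → ℕ → ℕ
    low x j = rr ⟨ x ℚ.- (j over e) ⟩

    high : ℚ → ℕ → ℕ
    high x j = rr ⟨ ℚ.- x ℚ.+ (j over e) ⟩

    lowFloor highFloor : ℚ → ℕ → ℤ
    lowFloor x j = floor (⟨ x ⟩ ℚ.- (j over e))
    highFloor x j = floor (⟨ ℚ.- x ⟩ ℚ.+ (j over e))

    low¼ : ∀ j → j < e → _
    low¼ j = lower-spec 1 4 ¼ j (s≤s z≤n) 4≤e (s≤s (s≤s z≤n)) (frac 3 refl (*≡* refl)) (frac 3 refl (*≡* refl))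

    low¾ : ∀ j → j < e → _
    low¾ j = lower-spec 3 4 ¾ j (s≤s z≤n) 4≤e (s≤s (s≤s (s≤s (s≤s z≤n)))) (frac 3 refl (*≡* refl)) (frac 3 refl (*≡* refl))

    high⅓ : ∀ j → j < e → _
    high⅓ j = upper-spec 2 1 3 ⅓ j (s≤s z≤n) 3≤e refl (s≤s z≤n) (frac 2 refl (*≡* refl)) (frac 2 refl (*≡* refl))

    high⅔ : ∀ j → j < e → _
    high⅔ j = upper-spec 1 2 3 ⅔ j (s≤s z≤n) 3≤e refl (s≤s z≤n) (frac 2 refl (*≡* refl)) (frac 2 refl (*≡* refl))

    eℤ : + e ≡ + h ℤ.+ + h
    eℤ = trans (cong +_ e≡h+h) (ℤP.pos-+ h h)

    -- k is h - 2j reduced modulo e, and δ counts the added multiples of e. The same δ is the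
    -- exponent of -p coming from the two floors, since both change when j/e passes 1/4 and 3/4. In
    -- all cases c = 2 - δ.
    record LowerData (j : ℕ) : Set where
      field
        k δ c : ℕ
        k<e : k < e
        k-eq : k ℕ.+ (j ℕ.+ j) ≡ h ℕ.+ δ ℕ.* e
        k-mod : h ℕ.+ 2 ℕ.* (e ℕ.∸ j) ≡ k ℕ.+ c ℕ.* e
        floors : ℤ.- lowFloor ¼ j ℤ.+ ℤ.- lowFloor ¾ j ≡ + δ
        gammas : Γ (low ¼ j) ℤ.* Γ (low ¾ j) ℤ.* Ω (+ 2) ℤ.^ (e ℕ.∸ k) ≈ G k ℤ.* G h

    lowerData : ∀ j → j < e → LowerData j
    lowerData j j<e = case low¼ j j<e , low¾ j j<e of λ
      { (inj₁ (le , f₁ , r₁) , inj₁ (_ , f₃ , r₃)) →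
          let k = h ℕ.∸ (j ℕ.+ j) ; eq = ℕP.m∸n+n≡m (case₀ le) in record
          { k = k ; δ = 0 ; c = 2 ; k<e = ℕP.≤-<-trans (ℕP.m∸n≤m h (j ℕ.+ j)) h<e
          ; k-eq = trans eq (sym (ℕP.+-identityʳ h))
          ; k-mod = mods k 0 2 (trans eq (sym (ℕP.+-identityʳ h))) refl
          ; floors = cong₂ (λ x y → ℤ.- x ℤ.+ ℤ.- y) f₁ f₃
          ; gammas = quarter k (low ¼ j) (low ¾ j) (ℕP.<⇒≤ (ℕP.≤-<-trans (ℕP.m∸n≤m h (j ℕ.+ j)) h<e))
              (≈-trans r₁ (≡⇒≈ (trans (cong (λ z → + 1 ℤ.* z ℤ.- + 4 ℤ.* + j) eℤ) (trans (cong (λ z → + 1 ℤ.* (z ℤ.+ z) ℤ.- + 4 ℤ.* + j) (ints k 0 (trans eq (sym (ℕP.+-identityʳ h))))) (c₀₁ (+ k) (+ j) (+ e))))))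
              (≈-trans r₃ (≡⇒≈ (trans splitℤ (trans (cong (λ z → + 1 ℤ.* (z ℤ.+ z) ℤ.+ + 2 ℤ.* + e ℤ.- + 4 ℤ.* + j) (ints k 0 (trans eq (sym (ℕP.+-identityʳ h))))) (c₀₃ (+ k) (+ j) (+ e))))))
          }
      -- Between 1/4 and 3/4 the first argument has wrapped around: its fractional part now exceeds
      -- the other by 1/2, so the two change roles in the duplication formula.
      ; (inj₂ (lt , f₁ , r₁) , inj₁ (le , f₃ , r₃)) →
          let k = h ℕ.+ 1 ℕ.* e ℕ.∸ (j ℕ.+ j) ; eq = ℕP.m∸n+n≡m (case₁ le) ; kl = small₁ k lt eq in record
          { k = k ; δ = 1 ; c = 1 ; k<e = kl ; k-eq = eq ; k-mod = mods k 1 1 eq refl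
          ; floors = cong₂ (λ x y → ℤ.- x ℤ.+ ℤ.- y) f₁ f₃
          ; gammas = ≈-trans (≡⇒≈ (cong (ℤ._* Ω (+ 2) ℤ.^ (e ℕ.∸ k)) (ℤP.*-comm (Γ (low ¼ j)) (Γ (low ¾ j))))) (quarter k (low ¾ j) (low ¼ j) (ℕP.<⇒≤ kl)
              (≈-trans r₃ (≡⇒≈ (trans splitℤ (trans (cong (λ z → + 1 ℤ.* (z ℤ.+ z) ℤ.+ + 2 ℤ.* + e ℤ.- + 4 ℤ.* + j) (ints k 1 eq)) (c₁₃ (+ k) (+ j) (+ e))))))
              (≈-trans r₁ (≡⇒≈ (trans (cong (λ z → + 1 ℤ.* z ℤ.- + 4 ℤ.* + j ℤ.+ + 4 ℤ.* + e) eℤ) (trans (cong (λ z → + 1 ℤ.* (z ℤ.+ z) ℤ.- + 4 ℤ.* + j ℤ.+ + 4 ℤ.* + e) (ints k 1 eq)) (c₁₁ (+ k) (+ j) (+ e)))))))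
          }
      ; (inj₂ (_ , f₁ , r₁) , inj₂ (lt , f₃ , r₃)) →
          let k = h ℕ.+ 2 ℕ.* e ℕ.∸ (j ℕ.+ j) ; eq = ℕP.m∸n+n≡m case₂ ; kl = small₂ k lt eq in record
          { k = k ; δ = 2 ; c = 0 ; k<e = kl ; k-eq = eq ; k-mod = mods k 2 0 eq refl
          ; floors = cong₂ (λ x y → ℤ.- x ℤ.+ ℤ.- y) f₁ f₃
          ; gammas = quarter k (low ¼ j) (low ¾ j) (ℕP.<⇒≤ kl)
              (≈-trans r₁ (≡⇒≈ (trans (cong (λ z → + 1 ℤ.* z ℤ.- + 4 ℤ.* + j ℤ.+ + 4 ℤ.* + e) eℤ) (trans (cong (λ z → + 1 ℤ.* (z ℤ.+ z) ℤ.- + 4 ℤ.* + j ℤ.+ + 4 ℤ.* + e) (ints k 2 eq)) (c₂₁ (+ k) (+ j) (+ e))))))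
              (≈-trans r₃ (≡⇒≈ (trans (cong (ℤ._+ + 4 ℤ.* + e) splitℤ) (trans (cong (λ z → + 1 ℤ.* (z ℤ.+ z) ℤ.+ + 2 ℤ.* + e ℤ.- + 4 ℤ.* + j ℤ.+ + 4 ℤ.* + e) (ints k 2 eq)) (c₂₃ (+ k) (+ j) (+ e))))))
          }
      ; (inj₁ (le , _) , inj₂ (lt , _)) → ⊥-elim (ℕP.<-irrefl refl (ℕP.≤-trans lt (ℕP.≤-trans le (ℕP.*-monoˡ-≤ e {1} {3} (s≤s z≤n))))) }
      where
      four : ∀ j → 4 ℕ.* j ≡ 2 ℕ.* (j ℕ.+ j)
      four = solveℕ-∀
      e2 : ∀ c → c ℕ.* e ≡ 2 ℕ.* (c ℕ.* h)
      e2 c = trans (cong (c ℕ.*_) e≡h+h) (l c h)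
        where
        l : ∀ c h → c ℕ.* (h ℕ.+ h) ≡ 2 ℕ.* (c ℕ.* h)
        l = solveℕ-∀
      3h : ∀ h → 3 ℕ.* h ≡ h ℕ.+ 1 ℕ.* (h ℕ.+ h)
      3h = solveℕ-∀
      case₀ : 4 ℕ.* j ≤ 1 ℕ.* e → j ℕ.+ j ≤ h
      case₀ le = subst (j ℕ.+ j ≤_) (ℕP.*-identityˡ h) (ℕP.*-cancelˡ-≤ 2 (subst₂ _≤_ (four j) (e2 1) le))
      case₁ : 4 ℕ.* j ≤ 3 ℕ.* e → j ℕ.+ j ≤ h ℕ.+ 1 ℕ.* e
      case₁ le = subst (j ℕ.+ j ≤_) (trans (3h h) (cong (λ z → h ℕ.+ 1 ℕ.* z) (sym e≡h+h))) (ℕP.*-cancelˡ-≤ 2 (subst₂ _≤_ (four j) (e2 3) le))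
      case₂ : j ℕ.+ j ≤ h ℕ.+ 2 ℕ.* e
      case₂ = ℕP.≤-trans (ℕP.+-mono-≤ (ℕP.<⇒≤ j<e) (ℕP.<⇒≤ j<e)) (ℕP.≤-trans (ℕP.≤-reflexive (l e)) (ℕP.m≤n+m (2 ℕ.* e) h))
        where
        l : ∀ e → e ℕ.+ e ≡ 2 ℕ.* e
        l = solveℕ-∀
      small₁ : ∀ k → 1 ℕ.* e < 4 ℕ.* j → k ℕ.+ (j ℕ.+ j) ≡ h ℕ.+ 1 ℕ.* e → k < e
      small₁ k lt eq = ℕP.+-cancelʳ-< (j ℕ.+ j) k e (subst (_< e ℕ.+ (j ℕ.+ j)) (sym eq) (subst₂ _<_ (trans (ℕP.+-comm e h) (cong (h ℕ.+_) (sym (ℕP.*-identityˡ e)))) refl (ℕP.+-monoʳ-< e (subst (_< j ℕ.+ j) (ℕP.*-identityˡ h) (ℕP.*-cancelˡ-< 2 (1 ℕ.* h) (j ℕ.+ j) (subst₂ _<_ (e2 1) (four j) lt))))))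
      small₂ : ∀ k → 3 ℕ.* e < 4 ℕ.* j → k ℕ.+ (j ℕ.+ j) ≡ h ℕ.+ 2 ℕ.* e → k < e
      small₂ k lt eq = ℕP.+-cancelʳ-< (j ℕ.+ j) k e (subst (_< e ℕ.+ (j ℕ.+ j)) (sym eq) (subst₂ _<_ (trans (cong (λ z → z ℕ.+ 3 ℕ.* h) e≡h+h) (trans (l h) (cong (λ z → h ℕ.+ 2 ℕ.* z) (sym e≡h+h)))) refl (ℕP.+-monoʳ-< e (ℕP.*-cancelˡ-< 2 (3 ℕ.* h) (j ℕ.+ j) (subst₂ _<_ (e2 3) (four j) lt)))))
        where
        l : ∀ h → h ℕ.+ h ℕ.+ 3 ℕ.* h ≡ h ℕ.+ 2 ℕ.* (h ℕ.+ h)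
        l = solveℕ-∀
      mods : ∀ k δ c → k ℕ.+ (j ℕ.+ j) ≡ h ℕ.+ δ ℕ.* e → δ ℕ.+ c ≡ 2 → h ℕ.+ 2 ℕ.* (e ℕ.∸ j) ≡ k ℕ.+ c ℕ.* e
      mods k δ c eq dc = ℕP.+-cancelʳ-≡ (δ ℕ.* e ℕ.+ (j ℕ.+ j)) _ _ (
        trans (l₁ h (e ℕ.∸ j) j (δ ℕ.* e)) (trans (cong (λ z → h ℕ.+ δ ℕ.* e ℕ.+ 2 ℕ.* z) (ℕP.m∸n+n≡m (ℕP.<⇒≤ j<e))) (trans (cong₂ (λ x y → x ℕ.+ y ℕ.* e) (sym eq) (sym dc)) (l₂ k j δ c e))))
        where
        l₁ : ∀ h i j d → h ℕ.+ 2 ℕ.* i ℕ.+ (d ℕ.+ (j ℕ.+ j)) ≡ h ℕ.+ d ℕ.+ 2 ℕ.* (i ℕ.+ j)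
        l₁ = solveℕ-∀
        l₂ : ∀ k j δ c e → k ℕ.+ (j ℕ.+ j) ℕ.+ (δ ℕ.+ c) ℕ.* e ≡ k ℕ.+ c ℕ.* e ℕ.+ (δ ℕ.* e ℕ.+ (j ℕ.+ j))
        l₂ = solveℕ-∀
      ints : ∀ k δ → k ℕ.+ (j ℕ.+ j) ≡ h ℕ.+ δ ℕ.* e → + h ≡ + k ℤ.+ (+ j ℤ.+ + j) ℤ.- + δ ℤ.* + e
      ints k δ eq = trans (l (+ h) (+ δ ℤ.* + e)) (cong (ℤ._- + δ ℤ.* + e) (trans (trans (cong (λ z → + h ℤ.+ z) (sym (ℤP.pos-* δ e))) (sym (ℤP.pos-+ h (δ ℕ.* e)))) (trans (cong +_ (sym eq)) (trans (ℤP.pos-+ k (j ℕ.+ j)) (cong (λ z → + k ℤ.+ z) (ℤP.pos-+ j j))))))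
        where
        l : ∀ h d → h ≡ h ℤ.+ d ℤ.- d
        l = solve-∀
      splitℤ : + 3 ℤ.* + e ℤ.- + 4 ℤ.* + j ≡ + 1 ℤ.* (+ h ℤ.+ + h) ℤ.+ + 2 ℤ.* + e ℤ.- + 4 ℤ.* + j
      splitℤ = trans (l (+ e) (+ j)) (cong (λ z → + 1 ℤ.* z ℤ.+ + 2 ℤ.* + e ℤ.- + 4 ℤ.* + j) eℤ)
        where
        l : ∀ e j → + 3 ℤ.* e ℤ.- + 4 ℤ.* j ≡ + 1 ℤ.* e ℤ.+ + 2 ℤ.* e ℤ.- + 4 ℤ.* j
        l = solve-∀
      c₀₁ : ∀ k j e → + 1 ℤ.* ((k ℤ.+ (j ℤ.+ j) ℤ.- + 0 ℤ.* e) ℤ.+ (k ℤ.+ (j ℤ.+ j) ℤ.- + 0 ℤ.* e)) ℤ.- + 4 ℤ.* j ≡ + 2 ℤ.* k ℤ.+ + 0 ℤ.* (+ 2 ℤ.* e)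
      c₀₁ = solve-∀
      c₀₃ : ∀ k j e → + 1 ℤ.* ((k ℤ.+ (j ℤ.+ j) ℤ.- + 0 ℤ.* e) ℤ.+ (k ℤ.+ (j ℤ.+ j) ℤ.- + 0 ℤ.* e)) ℤ.+ + 2 ℤ.* e ℤ.- + 4 ℤ.* j ≡ + 2 ℤ.* k ℤ.+ + 1 ℤ.* (+ 2 ℤ.* e)
      c₀₃ = solve-∀
      c₁₃ : ∀ k j e → + 1 ℤ.* ((k ℤ.+ (j ℤ.+ j) ℤ.- + 1 ℤ.* e) ℤ.+ (k ℤ.+ (j ℤ.+ j) ℤ.- + 1 ℤ.* e)) ℤ.+ + 2 ℤ.* e ℤ.- + 4 ℤ.* j ≡ + 2 ℤ.* k ℤ.+ + 0 ℤ.* (+ 2 ℤ.* e)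
      c₁₃ = solve-∀
      c₁₁ : ∀ k j e → + 1 ℤ.* ((k ℤ.+ (j ℤ.+ j) ℤ.- + 1 ℤ.* e) ℤ.+ (k ℤ.+ (j ℤ.+ j) ℤ.- + 1 ℤ.* e)) ℤ.- + 4 ℤ.* j ℤ.+ + 4 ℤ.* e ≡ + 2 ℤ.* k ℤ.+ + 1 ℤ.* (+ 2 ℤ.* e)
      c₁₁ = solve-∀
      c₂₁ : ∀ k j e → + 1 ℤ.* ((k ℤ.+ (j ℤ.+ j) ℤ.- + 2 ℤ.* e) ℤ.+ (k ℤ.+ (j ℤ.+ j) ℤ.- + 2 ℤ.* e)) ℤ.- + 4 ℤ.* j ℤ.+ + 4 ℤ.* e ≡ + 2 ℤ.* k ℤ.+ + 0 ℤ.* (+ 2 ℤ.* e)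
      c₂₁ = solve-∀
      c₂₃ : ∀ k j e → + 1 ℤ.* ((k ℤ.+ (j ℤ.+ j) ℤ.- + 2 ℤ.* e) ℤ.+ (k ℤ.+ (j ℤ.+ j) ℤ.- + 2 ℤ.* e)) ℤ.+ + 2 ℤ.* e ℤ.- + 4 ℤ.* j ℤ.+ + 4 ℤ.* e ≡ + 2 ℤ.* k ℤ.+ + 1 ℤ.* (+ 2 ℤ.* e)
      c₂₃ = solve-∀

    c₁ c₂ d₁ d₃ : ℕ
    d₁ = rr ⟨ ¼ ⟩
    d₃ = rr ⟨ ¾ ⟩
    c₁ = rr ⟨ ℚ.- ⅓ ⟩
    c₂ = rr ⟨ ℚ.- ⅔ ⟩

    4d₁ : + 4 ℤ.* + d₁ ≈ + 1
    4d₁ = ratRep-frac {⟨ ¼ ⟩} (frac 3 refl (*≡* refl)) (M.Unit-small 4 (s≤s z≤n) (s≤s 4≤e))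

    4d₃ : + 4 ℤ.* + d₃ ≈ + 3
    4d₃ = ratRep-frac {⟨ ¾ ⟩} (frac 3 refl (*≡* refl)) (M.Unit-small 4 (s≤s z≤n) (s≤s 4≤e))

    3c₁ : + 3 ℤ.* + c₁ ≈ + 2
    3c₁ = ratRep-frac {⟨ ℚ.- ⅓ ⟩} (frac 2 refl (*≡* refl)) Unit-3

    3c₂ : + 3 ℤ.* + c₂ ≈ + 1
    3c₂ = ratRep-frac {⟨ ℚ.- ⅔ ⟩} (frac 2 refl (*≡* refl)) Unit-3

    -- l is 3j reduced modulo e, and c counts the removed multiples of e. It also equals the sum of
    -- the two floors, which jump when j/e reaches 2/3 and 1/3 respectively for -1/3 shifted to 2/3
    -- and the like, so that c is 0, 1 or 2.
    record UpperData (j : ℕ) : Set where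
      field
        l c : ℕ
        l<e : l < e
        l-eq : 3 ℕ.* j ≡ l ℕ.+ c ℕ.* e
        floors : highFloor ⅓ j ℤ.+ highFloor ⅔ j ≡ + c
        gammas : G j ℤ.* (Γ (high ⅓ j) ℤ.* Γ (high ⅔ j)) ℤ.* Ω (+ 3) ℤ.^ (e ℕ.∸ l) ≈ G l ℤ.* (Γ c₂ ℤ.* Γ c₁)

    -- Modulo 1 the numbers j/e, j/e + 1/3, j/e + 2/3 are always l/(3e) and its translates by 1/3
    -- and 2/3; c decides which of them comes first.
    upperData : ∀ j → j < e → UpperData j
    upperData j j<e = case high⅓ j j<e , high⅔ j j<e of λ
      { (inj₁ (lt , f₁ , r₁) , inj₁ (_ , f₂ , r₂)) → make (3 ℕ.* j) 0 (subst (3 ℕ.* j <_) (ℕP.*-identityˡ e) lt) (sym (ℕP.+-identityʳ (3 ℕ.* j))) (cong₂ ℤ._+_ f₁ f₂)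
          (λ l l<e i → ≈-trans (≡⇒≈ (cong (ℤ._* Ω (+ 3) ℤ.^ (e ℕ.∸ l)) (p₀ (G j) (Γ (high ⅓ j)) (Γ (high ⅔ j))))) (third l (nr j) (high ⅔ j) (high ⅓ j) c₁ c₂ (ℕP.<⇒≤ l<e) 3c₂ 3c₁
            (≈-trans 3nr (≡⇒≈ i)) (≈-trans r₂ (≡⇒≈ (trans (cong (λ z → + 1 ℤ.* + e ℤ.+ z) i) (q₁ (+ l) (+ e))))) (≈-trans r₁ (≡⇒≈ (trans (cong (λ z → + 2 ℤ.* + e ℤ.+ z) i) (q₂ (+ l) (+ e)))))))
      ; (inj₂ (le , f₁ , r₁) , inj₁ (lt , f₂ , r₂)) → make (3 ℕ.* j ℕ.∸ 1 ℕ.* e) 1 (ℕP.+-cancelʳ-< (1 ℕ.* e) _ e (subst (_< e ℕ.+ 1 ℕ.* e) (sym (ℕP.m∸n+n≡m le)) lt)) (sym (ℕP.m∸n+n≡m le)) (cong₂ ℤ._+_ f₁ f₂)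
          (λ l l<e i → ≈-trans (≡⇒≈ (cong (ℤ._* Ω (+ 3) ℤ.^ (e ℕ.∸ l)) (p₁ (G j) (Γ (high ⅓ j)) (Γ (high ⅔ j))))) (third l (high ⅓ j) (nr j) (high ⅔ j) c₁ c₂ (ℕP.<⇒≤ l<e) 3c₂ 3c₁
            (≈-trans r₁ (≡⇒≈ (trans (cong (ℤ._- + 1 ℤ.* + e) i) (q₃ (+ l) (+ e))))) (≈-trans 3nr (≡⇒≈ i)) (≈-trans r₂ (≡⇒≈ (trans (cong (λ z → + 1 ℤ.* + e ℤ.+ z) i) (q₄ (+ l) (+ e)))))))
      ; (inj₂ (_ , f₁ , r₁) , inj₂ (le , f₂ , r₂)) → make (3 ℕ.* j ℕ.∸ 2 ℕ.* e) 2 (ℕP.+-cancelʳ-< (2 ℕ.* e) _ e (subst (_< e ℕ.+ 2 ℕ.* e) (sym (ℕP.m∸n+n≡m le)) (ℕP.*-monoʳ-< 3 j<e))) (sym (ℕP.m∸n+n≡m le)) (cong₂ ℤ._+_ f₁ f₂)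
          (λ l l<e i → ≈-trans (≡⇒≈ (cong (ℤ._* Ω (+ 3) ℤ.^ (e ℕ.∸ l)) (p₂ (G j) (Γ (high ⅓ j)) (Γ (high ⅔ j))))) (third l (high ⅔ j) (high ⅓ j) (nr j) c₁ c₂ (ℕP.<⇒≤ l<e) 3c₂ 3c₁
            (≈-trans r₂ (≡⇒≈ (trans (cong (ℤ._- + 2 ℤ.* + e) i) (q₅ (+ l) (+ e))))) (≈-trans r₁ (≡⇒≈ (trans (cong (ℤ._- + 1 ℤ.* + e) i) (q₆ (+ l) (+ e))))) (≈-trans 3nr (≡⇒≈ i))))
      ; (inj₁ (lt , _) , inj₂ (le , _)) → ⊥-elim (ℕP.<-irrefl refl (ℕP.≤-trans lt (ℕP.≤-trans (ℕP.*-monoˡ-≤ e {1} {2} (s≤s z≤n)) le))) }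
      where
      3nr : + 3 ℤ.* + e ℤ.* + nr j ≈ + 3 ℤ.* + j
      3nr = ≈-trans (≡⇒≈ (ℤP.*-assoc (+ 3) (+ e) (+ nr j))) (*-congˡ (+ 3) (nr-spec j (ℕP.<⇒≤ j<e)))
      make : ∀ l c → l < e → 3 ℕ.* j ≡ l ℕ.+ c ℕ.* e → highFloor ⅓ j ℤ.+ highFloor ⅔ j ≡ + c →
        (∀ l → l < e → + 3 ℤ.* + j ≡ + l ℤ.+ + c ℤ.* + e → G j ℤ.* (Γ (high ⅓ j) ℤ.* Γ (high ⅔ j)) ℤ.* Ω (+ 3) ℤ.^ (e ℕ.∸ l) ≈ G l ℤ.* (Γ c₂ ℤ.* Γ c₁)) → UpperData j
      make l c l<e eq f g = record { l = l ; c = c ; l<e = l<e ; l-eq = eq ; floors = f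
        ; gammas = g l l<e (trans (sym (ℤP.pos-* 3 j)) (trans (cong +_ eq) (trans (ℤP.pos-+ l (c ℕ.* e)) (cong (λ z → + l ℤ.+ z) (ℤP.pos-* c e))))) }
      p₀ : ∀ x y z → x ℤ.* (y ℤ.* z) ≡ x ℤ.* (z ℤ.* y)
      p₀ = solve-∀
      p₁ : ∀ x y z → x ℤ.* (y ℤ.* z) ≡ y ℤ.* (x ℤ.* z)
      p₁ = solve-∀
      p₂ : ∀ x y z → x ℤ.* (y ℤ.* z) ≡ z ℤ.* (y ℤ.* x)
      p₂ = solve-∀
      q₁ : ∀ l e → + 1 ℤ.* e ℤ.+ (l ℤ.+ + 0 ℤ.* e) ≡ l ℤ.+ + 1 ℤ.* e
      q₁ = solve-∀
      q₂ : ∀ l e → + 2 ℤ.* e ℤ.+ (l ℤ.+ + 0 ℤ.* e) ≡ l ℤ.+ + 2 ℤ.* e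
      q₂ = solve-∀
      q₃ : ∀ l e → l ℤ.+ + 1 ℤ.* e ℤ.- + 1 ℤ.* e ≡ l ℤ.+ + 0 ℤ.* e
      q₃ = solve-∀
      q₄ : ∀ l e → + 1 ℤ.* e ℤ.+ (l ℤ.+ + 1 ℤ.* e) ≡ l ℤ.+ + 2 ℤ.* e
      q₄ = solve-∀
      q₅ : ∀ l e → l ℤ.+ + 2 ℤ.* e ℤ.- + 2 ℤ.* e ≡ l ℤ.+ + 0 ℤ.* e
      q₅ = solve-∀
      q₆ : ∀ l e → l ℤ.+ + 2 ℤ.* e ℤ.- + 1 ℤ.* e ≡ l ℤ.+ + 1 ℤ.* e
      q₆ = solve-∀

    s : ℤ
    s = ωt

    I₁ I₃ J₁ J₂ : ℤ
    I₁ = invMod p (suc k′) (Γₚ p (suc k′) ⟨ ¼ ⟩)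
    I₃ = invMod p (suc k′) (Γₚ p (suc k′) ⟨ ¾ ⟩)
    J₁ = invMod p (suc k′) (Γₚ p (suc k′) ⟨ ℚ.- ⅓ ⟩)
    J₂ = invMod p (suc k′) (Γₚ p (suc k′) ⟨ ℚ.- ⅔ ⟩)

    inverse-Γ : ∀ x → Γ (rr x) ℤ.* invMod p (suc k′) (Γₚ p (suc k′) x) ≈ + 1
    inverse-Γ x = ≈-trans (≡⇒≈ (cong (ℤ._* invMod p (suc k′) (Γₚ p (suc k′) x)) (sym (Γₚℕ≡Γ (rr x))))) (invMod-spec (Γₚ p (suc k′) x) (subst Unit (sym (Γₚℕ≡Γ (rr x))) (Unit-Γ (rr x))))

    gammaProduct : ℕ → ℤ
    gammaProduct j = (Γ (low ¼ j) ℤ.* I₁ ℤ.* (Γ (high ⅓ j) ℤ.* J₁)) ℤ.* (Γ (low ¾ j) ℤ.* I₃ ℤ.* (Γ (high ⅔ j) ℤ.* J₂))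

    term : ℕ → ℤ
    term j = (-[1+ 0 ] ℤ.^ (j ℕ.* 2)) ℤ.* ω̄^ p (suc k′) j (tArg p a b) ℤ.* prodℤ (zipWith (Gfactor p (suc k′) j) (¼ ∷ ¾ ∷ []) (⅓ ∷ ⅔ ∷ [])) ℤ.*
      ((ℤ.- (+ p)) ℤ.^ ∣ + 2 ℤ.+ sumℤ (zipWith (Gexp p j) (¼ ∷ ¾ ∷ []) (⅓ ∷ ⅔ ∷ [])) ∣)

    exponent : ℕ → ℤ
    exponent j = + 2 ℤ.+ ((ℤ.- lowFloor ¼ j ℤ.- highFloor ⅓ j) ℤ.+ ((ℤ.- lowFloor ¾ j ℤ.- highFloor ⅔ j) ℤ.+ + 0))

    term-≡ : ∀ j → term j ≡ s ℤ.^ j ℤ.* gammaProduct j ℤ.* (ℤ.- (+ p)) ℤ.^ ∣ exponent j ∣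
    term-≡ j = cong (ℤ._* (ℤ.- (+ p)) ℤ.^ ∣ exponent j ∣) (trans (cong₂ (λ x y → x ℤ.* y ℤ.* prodℤ (zipWith (Gfactor p (suc k′) j) (¼ ∷ ¾ ∷ []) (⅓ ∷ ⅔ ∷ []))) sign (ω̄-power j))
      (trans (cong (ℤ._* prodℤ (zipWith (Gfactor p (suc k′) j) (¼ ∷ ¾ ∷ []) (⅓ ∷ ⅔ ∷ []))) (ℤP.*-identityˡ (s ℤ.^ j)))
      (cong (s ℤ.^ j ℤ.*_) (cong₂ ℤ._*_ (factor ¼ ⅓) (trans (ℤP.*-identityʳ (Gfactor p (suc k′) j ¾ ⅔)) (factor ¾ ⅔))))))
      where
      sign : -[1+ 0 ] ℤ.^ (j ℕ.* 2) ≡ + 1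
      sign = trans (cong (-[1+ 0 ] ℤ.^_) (l j)) (M.-1^2n j)
        where
        l : ∀ j → j ℕ.* 2 ≡ j ℕ.+ j
        l = solveℕ-∀
      factor : ∀ x y → Gfactor p (suc k′) j x y ≡ Γ (low x j) ℤ.* invMod p (suc k′) (Γₚ p (suc k′) ⟨ x ⟩) ℤ.* (Γ (high y j) ℤ.* invMod p (suc k′) (Γₚ p (suc k′) ⟨ ℚ.- y ⟩))
      factor x y = cong₂ (λ u v → u ℤ.* invMod p (suc k′) (Γₚ p (suc k′) ⟨ x ⟩) ℤ.* (v ℤ.* invMod p (suc k′) (Γₚ p (suc k′) ⟨ ℚ.- y ⟩))) (Γₚℕ≡Γ (low x j)) (Γₚℕ≡Γ (high y j))

    %-unique : ∀ n k c → k < e → n ≡ k ℕ.+ c ℕ.* e → n ℕM.% e ≡ k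
    %-unique n k c k<e eq = trans (cong (ℕM._% e) eq) (trans (ℕM.[m+kn]%n≡m%n k c e) (ℕM.m<n⇒m%n≡m k<e))

    -- The summand i = e - j corresponds to the term j. `term-identity` settles gamma values and
    -- characters up to the sign -1, and the exponent of -p is one more than in `Z-term`; sign and
    -- extra factor together give p.
    term-positive : ∀ j → 0 < j → j < e → G h ℤ.* (φ (+ b) ℤ.* term j) ≈ + p ℤ.* Z-term (e ℕ.∸ j)
    term-positive j 0<j j<e = begin
      G h ℤ.* (φ (+ b) ℤ.* term j)
        ≡⟨ trans (cong (λ z → G h ℤ.* (φ (+ b) ℤ.* z)) (trans (term-≡ j) (cong (λ z → s ℤ.^ j ℤ.* gammaProduct j ℤ.* (ℤ.- (+ p)) ℤ.^ ∣ z ∣) exponent≡))) (l₁ (G h) (φ (+ b)) (s ℤ.^ j ℤ.* gammaProduct j) ((ℤ.- (+ p)) ℤ.^ suc ν)) ⟩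
      (G h ℤ.* (φ (+ b) ℤ.* (s ℤ.^ j ℤ.* gammaProduct j))) ℤ.* (ℤ.- (+ p)) ℤ.^ suc ν
        ≈⟨ *-congʳ ((ℤ.- (+ p)) ℤ.^ suc ν) (term-identity s ωt-spec j l k (ℕP.<⇒≤ j<e) (ℕP.<⇒≤ (U.l<e)) (ℕP.<⇒≤ L.k<e) l-mod k-mod {low ¼ j} {low ¾ j} {high ⅓ j} {high ⅔ j} {d₁} {d₃} {c₁} {c₂} I₁ I₃ J₁ J₂
             (inverse-Γ ⟨ ¼ ⟩) (inverse-Γ ⟨ ¾ ⟩) (inverse-Γ ⟨ ℚ.- ⅓ ⟩) (inverse-Γ ⟨ ℚ.- ⅔ ⟩) constants L.gammas U.gammas) ⟩
      ℤ.- (G i ℤ.* (G l ℤ.* (Ω (+ a) ℤ.^ l ℤ.* (G k ℤ.* Ω (+ b) ℤ.^ k)))) ℤ.* (ℤ.- (+ p) ℤ.* (ℤ.- (+ p)) ℤ.^ ν)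
        ≡⟨ l₂ (G i) (G l) (Ω (+ a) ℤ.^ l) (G k) (Ω (+ b) ℤ.^ k) (+ p) ((ℤ.- (+ p)) ℤ.^ ν) ⟩
      + p ℤ.* (G i ℤ.* (G l ℤ.* (Ω (+ a) ℤ.^ l ℤ.* (G k ℤ.* (Ω (+ b) ℤ.^ k ℤ.* (ℤ.- (+ p)) ℤ.^ ν)))))
        ≡⟨ cong₂ (λ x y → + p ℤ.* (G i ℤ.* (G x ℤ.* (Ω (+ a) ℤ.^ x ℤ.* (G y ℤ.* (Ω (+ b) ℤ.^ y ℤ.* (ℤ.- (+ p)) ℤ.^ ν)))))) (sym jj≡) (sym kk≡) ⟩
      + p ℤ.* Z-term i ∎
      where
      module L = LowerData (lowerData j j<e)
      module U = UpperData (upperData j j<e)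
      i = e ℕ.∸ j
      l = U.l
      k = L.k
      ν = total i ℕM./ e
      i+j : i ℕ.+ j ≡ e
      i+j = ℕP.m∸n+n≡m (ℕP.<⇒≤ j<e)
      jj≡ : jj i ≡ l
      jj≡ = trans (cong (λ z → (3 ℕ.* z) ℕM.% e) (ℕP.m∸[m∸n]≡n (ℕP.<⇒≤ j<e))) (%-unique (3 ℕ.* j) l U.c U.l<e U.l-eq)
      kk≡ : kk i ≡ k
      kk≡ = %-unique (h ℕ.+ 2 ℕ.* i) k L.c L.k<e L.k-mod
      l-mod : l ℕM.% e ≡ (j ℕ.* 3) ℕM.% e
      l-mod = sym (trans (cong (ℕM._% e) (trans (ℕP.*-comm j 3) U.l-eq)) (ℕM.[m+kn]%n≡m%n l U.c e))
      k-mod : (k ℕ.+ (j ℕ.+ j)) ℕM.% e ≡ h ℕM.% e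
      k-mod = trans (cong (ℕM._% e) L.k-eq) (ℕM.[m+kn]%n≡m%n h L.δ e)
      l₁ : ∀ g f x y → g ℤ.* (f ℤ.* (x ℤ.* y)) ≡ (g ℤ.* (f ℤ.* x)) ℤ.* y
      l₁ = solve-∀
      l₂ : ∀ g g′ x g″ y p z → ℤ.- (g ℤ.* (g′ ℤ.* (x ℤ.* (g″ ℤ.* y)))) ℤ.* (ℤ.- p ℤ.* z) ≡ p ℤ.* (g ℤ.* (g′ ℤ.* (x ℤ.* (g″ ℤ.* (y ℤ.* z)))))
      l₂ = solve-∀
      total-eq : i ℕ.+ (l ℕ.+ k) ≡ h ℕ.+ ν ℕ.* e
      total-eq = trans (cong₂ (λ x y → i ℕ.+ (x ℕ.+ y)) (sym jj≡) (sym kk≡)) (trans (ℕM.m≡m%n+[m/n]*n (total i) e) (cong (ℕ._+ ν ℕ.* e) (total-spec i (ℕP.m∸n≤m e j))))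
      -- Add i + j = e, l + ce = 3j and k + 2j = h + δe, insert i + l + k = h + νe, and compare the
      -- multiples of e.
      ν+c : ν ℕ.+ U.c ≡ 1 ℕ.+ L.δ
      ν+c = ℕP.*-cancelʳ-≡ (ν ℕ.+ U.c) (1 ℕ.+ L.δ) e (ℕP.+-cancelʳ-≡ (h ℕ.+ (j ℕ.+ j ℕ.+ j)) _ _
        (trans (m₁ ν U.c e h j) (trans (cong (λ z → z ℕ.+ U.c ℕ.* e ℕ.+ (j ℕ.+ j ℕ.+ j)) (sym total-eq)) (trans (m₂ i l k (U.c ℕ.* e) j)
        (trans (cong₂ (λ x y → x ℕ.+ y ℕ.+ (k ℕ.+ (j ℕ.+ j))) i+j (sym U.l-eq)) (trans (cong (λ z → e ℕ.+ 3 ℕ.* j ℕ.+ z) L.k-eq) (m₃ e j h L.δ)))))))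
        where
        m₁ : ∀ ν c e h j → (ν ℕ.+ c) ℕ.* e ℕ.+ (h ℕ.+ (j ℕ.+ j ℕ.+ j)) ≡ h ℕ.+ ν ℕ.* e ℕ.+ c ℕ.* e ℕ.+ (j ℕ.+ j ℕ.+ j)
        m₁ = solveℕ-∀
        m₂ : ∀ i l k c j → i ℕ.+ (l ℕ.+ k) ℕ.+ c ℕ.+ (j ℕ.+ j ℕ.+ j) ≡ (i ℕ.+ j) ℕ.+ (l ℕ.+ c) ℕ.+ (k ℕ.+ (j ℕ.+ j))
        m₂ = solveℕ-∀
        m₃ : ∀ e j h δ → e ℕ.+ 3 ℕ.* j ℕ.+ (h ℕ.+ δ ℕ.* e) ≡ (1 ℕ.+ δ) ℕ.* e ℕ.+ (h ℕ.+ (j ℕ.+ j ℕ.+ j))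
        m₃ = solveℕ-∀
      exponent≡ : exponent j ≡ + suc ν
      exponent≡ = trans (n₁ (lowFloor ¼ j) (lowFloor ¾ j) (highFloor ⅓ j) (highFloor ⅔ j)) (trans (cong₂ (λ x y → + 2 ℤ.+ x ℤ.- y) L.floors U.floors)
        (trans (n₂ (+ L.δ) (+ U.c)) (trans (cong (λ z → + 1 ℤ.+ z ℤ.- + U.c) (trans (sym (ℤP.pos-+ 1 L.δ)) (trans (cong +_ (sym ν+c)) (ℤP.pos-+ ν U.c)))) (n₃ (+ ν) (+ U.c)))))
        where
        n₁ : ∀ f f′ g g′ → + 2 ℤ.+ ((ℤ.- f ℤ.- g) ℤ.+ ((ℤ.- f′ ℤ.- g′) ℤ.+ + 0)) ≡ + 2 ℤ.+ (ℤ.- f ℤ.+ ℤ.- f′) ℤ.- (g ℤ.+ g′)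
        n₁ = solve-∀
        n₂ : ∀ d c → + 2 ℤ.+ d ℤ.- c ≡ + 1 ℤ.+ (+ 1 ℤ.+ d) ℤ.- c
        n₂ = solve-∀
        n₃ : ∀ ν c → + 1 ℤ.+ (ν ℤ.+ c) ℤ.- c ≡ + 1 ℤ.+ ν
        n₃ = solve-∀
      constants : Γ d₁ ℤ.* Γ d₃ ℤ.* Ω (+ 2) ℤ.^ (e ℕ.∸ h) ≈ G h ℤ.* G h
      constants = quarter h d₁ d₃ (ℕP.<⇒≤ h<e)
        (≈-trans (scale (+ d₁) 4d₁) (≡⇒≈ (trans (o₁ (+ e)) (cong (ℤ._+ + 0 ℤ.* (+ 2 ℤ.* + e)) (sym 2h)))))
        (≈-trans (scale (+ d₃) 4d₃) (≡⇒≈ (trans (o₂ (+ e)) (cong (ℤ._+ + 1 ℤ.* (+ 2 ℤ.* + e)) (sym 2h)))))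
        where
        o₁ : ∀ e → e ℤ.* + 1 ≡ e ℤ.+ + 0 ℤ.* (+ 2 ℤ.* e)
        o₁ = solve-∀
        o₂ : ∀ e → e ℤ.* + 3 ≡ e ℤ.+ + 1 ℤ.* (+ 2 ℤ.* e)
        o₂ = solve-∀
        o₃ : ∀ e d → + 4 ℤ.* e ℤ.* d ≡ e ℤ.* (+ 4 ℤ.* d)
        o₃ = solve-∀
        scale : ∀ d {x} → + 4 ℤ.* d ≈ x → + 4 ℤ.* + e ℤ.* d ≈ + e ℤ.* x
        scale d r = ≈-trans (≡⇒≈ (o₃ (+ e) d)) (*-congˡ (+ e) r)

    -- At j = 0 every gamma quotient and the character are 1 and the floors vanish, leaving (-p)².
    -- By `Z-zero` the pattern of `term-positive`, continued to i = 0, would give p in place of p².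
    term-zero : term 0 ≈ + p ℤ.* + p
    term-zero = ≈-trans (≡⇒≈ (term-≡ 0)) (≈-trans (*-cong (*-congˡ (+ 1) (*-cong (*-cong (unit (low ¼ 0) ⟨ ¼ ⟩ (proj₁ l¼)) (unit (high ⅓ 0) ⟨ ℚ.- ⅓ ⟩ (proj₁ h⅓))) (*-cong (unit (low ¾ 0) ⟨ ¾ ⟩ (proj₁ l¾)) (unit (high ⅔ 0) ⟨ ℚ.- ⅔ ⟩ (proj₁ h⅔)))))
        (≡⇒≈ (cong (λ z → (ℤ.- (+ p)) ℤ.^ ∣ z ∣) exponent≡))) (≡⇒≈ (l₀ (+ p))))
      where
      l₀ : ∀ p → + 1 ℤ.* (+ 1 ℤ.* + 1 ℤ.* (+ 1 ℤ.* + 1)) ℤ.* (ℤ.- p ℤ.* (ℤ.- p ℤ.* + 1)) ≡ p ℤ.* p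
      l₀ = solve-∀
      unit : ∀ n x → + n ≈ + rr x → Γ n ℤ.* invMod p (suc k′) (Γₚ p (suc k′) x) ≈ + 1
      unit n x r = ≈-trans (*-congʳ (invMod p (suc k′) (Γₚ p (suc k′) x)) (Γ-periodic r)) (inverse-Γ x)
      clear : ∀ C n d {x y} → Unit (+ C) → + C ℤ.* + e ℤ.* + n ≈ y → y ≡ + e ℤ.* x → + C ℤ.* + d ≈ x → + n ≈ + d
      clear C n d {x} uC r eq r′ = cancel (+ C) uC (cancel (+ e) Unit-e (≈-trans (≡⇒≈ (o (+ C) (+ e) (+ n))) (≈-trans r (≈-trans (≡⇒≈ eq) (*-congˡ (+ e) (≈-sym r′))))))
        where
        o : ∀ C e n → e ℤ.* (C ℤ.* n) ≡ C ℤ.* e ℤ.* n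
        o = solve-∀
      o₁ : ∀ A C e → A ℤ.* e ℤ.- C ℤ.* + 0 ≡ e ℤ.* A
      o₁ = solve-∀
      o₂ : ∀ A C e → A ℤ.* e ℤ.+ C ℤ.* + 0 ≡ e ℤ.* A
      o₂ = solve-∀
      u4 : Unit (+ 4)
      u4 = M.Unit-small 4 (s≤s z≤n) (s≤s 4≤e)
      l¼ : + low ¼ 0 ≈ + d₁ × lowFloor ¼ 0 ≡ + 0
      l¼ = case low¼ 0 0<e of λ
        { (inj₁ (_ , f , r)) → clear 4 (low ¼ 0) d₁ u4 r (o₁ (+ 1) (+ 4) (+ e)) 4d₁ , f ; (inj₂ (() , _)) }
      l¾ : + low ¾ 0 ≈ + d₃ × lowFloor ¾ 0 ≡ + 0
      l¾ = case low¾ 0 0<e of λ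
        { (inj₁ (_ , f , r)) → clear 4 (low ¾ 0) d₃ u4 r (o₁ (+ 3) (+ 4) (+ e)) 4d₃ , f ; (inj₂ (() , _)) }
      h⅓ : + high ⅓ 0 ≈ + c₁ × highFloor ⅓ 0 ≡ + 0
      h⅓ = case high⅓ 0 0<e of λ
        { (inj₁ (_ , f , r)) → clear 3 (high ⅓ 0) c₁ Unit-3 r (o₂ (+ 2) (+ 3) (+ e)) 3c₁ , f
        ; (inj₂ (le , _)) → ⊥-elim (ℕP.<⇒≱ (ℕP.≤-trans 0<e (ℕP.m≤m+n e 0)) le) }
      h⅔ : + high ⅔ 0 ≈ + c₂ × highFloor ⅔ 0 ≡ + 0
      h⅔ = case high⅔ 0 0<e of λ
        { (inj₁ (_ , f , r)) → clear 3 (high ⅔ 0) c₂ Unit-3 r (o₂ (+ 1) (+ 3) (+ e)) 3c₂ , f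
        ; (inj₂ (le , _)) → ⊥-elim (ℕP.<⇒≱ (ℕP.≤-trans 0<e (ℕP.m≤m+n e (1 ℕ.* e))) le) }
      exponent≡ : exponent 0 ≡ + 2
      exponent≡ = trans (cong₂ (λ x y → + 2 ℤ.+ ((ℤ.- x ℤ.- y) ℤ.+ ((ℤ.- lowFloor ¾ 0 ℤ.- highFloor ⅔ 0) ℤ.+ + 0))) (proj₂ l¼) (proj₂ h⅓)) (cong₂ (λ x y → + 2 ℤ.+ (+ 0 ℤ.+ ((ℤ.- x ℤ.- y) ℤ.+ + 0))) (proj₂ l¾) (proj₂ h⅔))

    Z-zero : Z-term 0 ≈ G h ℤ.* φ (+ b)
    Z-zero = ≈-trans (*-cong G0 (≈-trans (≡⇒≈ (cong₂ (λ x y → G x ℤ.* (Ω (+ a) ℤ.^ x ℤ.* (G y ℤ.* (Ω (+ b) ℤ.^ y ℤ.* (ℤ.- (+ p)) ℤ.^ (total 0 ℕM./ e))))) jj0 kk0)) (*-congʳ (Ω (+ a) ℤ.^ 0 ℤ.* (G h ℤ.* (Ω (+ b) ℤ.^ h ℤ.* (ℤ.- (+ p)) ℤ.^ (total 0 ℕM./ e)))) G0)))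
        (≡⇒≈ (trans (cong (λ z → + 1 ℤ.* (+ 1 ℤ.* (+ 1 ℤ.* (G h ℤ.* (Ω (+ b) ℤ.^ h ℤ.* (ℤ.- (+ p)) ℤ.^ z))))) total0) (l (G h) (Ω (+ b) ℤ.^ h))))
      where
      l : ∀ g f → + 1 ℤ.* (+ 1 ℤ.* (+ 1 ℤ.* (g ℤ.* (f ℤ.* + 1)))) ≡ g ℤ.* f
      l = solve-∀
      G0 : G 0 ≈ + 1
      G0 = Γ-periodic {nr 0} {0} (cancel (+ e) Unit-e (≈-trans (nr-spec 0 z≤n) (≡⇒≈ (sym (ℤP.*-zeroʳ (+ e))))))
      jj0 : jj 0 ≡ 0
      jj0 = ℕM.m*n%n≡0 3 e
      kk0 : kk 0 ≡ h
      kk0 = trans (cong (ℕM._% e) (ℕP.+-identityʳ h)) (ℕM.m<n⇒m%n≡m h<e)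
      total0 : total 0 ℕM./ e ≡ 0
      total0 = trans (cong (ℕM._/ e) (cong₂ ℕ._+_ jj0 kk0)) (ℕM.m<n⇒m/n≡0 h<e)

    -- For j from 1 to e - 1 the index i = e - j runs through the same range backwards; `Z-term 0`
    -- is taken out and the term j = 0 evaluated directly.
    terms-sum : ∀ e′ → e ≡ suc e′ → G h ℤ.* (φ (+ b) ℤ.* Σ e term) ≈ G h ℤ.* (φ (+ b) ℤ.* (+ p ℤ.* + p)) ℤ.+ + p ℤ.* (Σ e Z-term ℤ.- Z-term 0)
    terms-sum e′ e≡ = begin
      G h ℤ.* (φ (+ b) ℤ.* Σ e term)
        ≡⟨ trans (cong (λ z → G h ℤ.* (φ (+ b) ℤ.* z)) (trans (cong (λ n → Σ n term) e≡) (Σ-front e′ term))) (l₁ (G h) (φ (+ b)) (term 0) (Σ e′ (term ∘ suc))) ⟩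
      G h ℤ.* (φ (+ b) ℤ.* term 0) ℤ.+ G h ℤ.* φ (+ b) ℤ.* Σ e′ (term ∘ suc)
        ≈⟨ +-cong (*-congˡ (G h) (*-congˡ (φ (+ b)) term-zero)) (≈-trans (≡⇒≈ (Σ-*ˡ e′ (G h ℤ.* φ (+ b)) (term ∘ suc))) (Σ-cong≈ e′ (λ j l → ≈-trans (≡⇒≈ (ℤP.*-assoc (G h) (φ (+ b)) (term (suc j)))) (≈-trans (term-positive (suc j) (s≤s z≤n) (subst (suc j <_) (sym e≡) (s≤s l))) (≡⇒≈ (cong (λ z → + p ℤ.* Z-term z) (index j l))))))) ⟩
      G h ℤ.* (φ (+ b) ℤ.* (+ p ℤ.* + p)) ℤ.+ Σ e′ (λ j → + p ℤ.* Z-term (suc (e′ ℕ.∸ suc j)))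
        ≡⟨ cong (λ z → G h ℤ.* (φ (+ b) ℤ.* (+ p ℤ.* + p)) ℤ.+ z) (trans (sym (Σ-*ˡ e′ (+ p) (λ j → Z-term (suc (e′ ℕ.∸ suc j))))) (cong (+ p ℤ.*_) (trans (sym (Σ-reverse e′ (Z-term ∘ suc))) (trans (l₂ (Z-term 0) (Σ e′ (Z-term ∘ suc))) (cong (ℤ._- Z-term 0) (sym (trans (cong (λ n → Σ n Z-term) e≡) (Σ-front e′ Z-term)))))))) ⟩
      G h ℤ.* (φ (+ b) ℤ.* (+ p ℤ.* + p)) ℤ.+ + p ℤ.* (Σ e Z-term ℤ.- Z-term 0) ∎
      where
      l₁ : ∀ g f x y → g ℤ.* (f ℤ.* (x ℤ.+ y)) ≡ g ℤ.* (f ℤ.* x) ℤ.+ g ℤ.* f ℤ.* y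
      l₁ = solve-∀
      l₂ : ∀ z S → S ≡ z ℤ.+ S ℤ.- z
      l₂ = solve-∀
      index : ∀ j → j < e′ → e ℕ.∸ suc j ≡ suc (e′ ℕ.∸ suc j)
      index j l = trans (cong (ℕ._∸ suc j) e≡) (ℕP.+-∸-assoc 1 l)

    -- The boundary terms cancel: the term j = 0 exceeds the pattern by (p² - p)φ(b), while the
    -- missing x = 0 in `Φ` contributes -p(p - 1)φ(b). The common unit `G h` is cancelled at the
    -- start.
    conclusion : + (p ℕ.* e) ℤ.* aₚ p a b ℤ.+ legendre p b ℤ.* Gscaled p (suc k′) (¼ ∷ ¾ ∷ []) (⅓ ∷ ⅔ ∷ []) (tArg p a b) ≈ + 0
    conclusion = cancel-unit (G h) (Unit-Γ (nr h)) (begin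
      G h ℤ.* (+ (p ℕ.* e) ℤ.* A ℤ.+ legendre p b ℤ.* Gscaled p (suc k′) (¼ ∷ ¾ ∷ []) (⅓ ∷ ⅔ ∷ []) (tArg p a b))
        ≈⟨ *-congˡ (G h) (+-cong (*-congʳ A (≡⇒≈ (ℤP.pos-* p e))) (*-cong legendre-φ (≡⇒≈ (sumℤ-applyUpTo term id e)))) ⟩
      G h ℤ.* (+ p ℤ.* + e ℤ.* A ℤ.+ f ℤ.* Σ e term)
        ≡⟨ ℤP.*-distribˡ-+ (G h) (+ p ℤ.* + e ℤ.* A) (f ℤ.* Σ e term) ⟩
      G h ℤ.* (+ p ℤ.* + e ℤ.* A) ℤ.+ G h ℤ.* (f ℤ.* Σ e term)
        ≈⟨ +-cong (≈-refl {G h ℤ.* (+ p ℤ.* + e ℤ.* A)}) (sums e refl) ⟩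
      G h ℤ.* (+ p ℤ.* + e ℤ.* A) ℤ.+ (G h ℤ.* (f ℤ.* (+ p ℤ.* + p)) ℤ.+ + p ℤ.* (Σ e Z-term ℤ.- Z-term 0))
        ≈⟨ +-cong (≈-refl {G h ℤ.* (+ p ℤ.* + e ℤ.* A)}) (+-cong (≈-refl {G h ℤ.* (f ℤ.* (+ p ℤ.* + p))}) (*-congˡ (+ p) (+-cong (≈-trans curve-sum (*-congˡ (+ e) (*-congˡ (G h) aₚ-Φ))) (neg-cong Z-zero)))) ⟩
      G h ℤ.* (+ p ℤ.* + e ℤ.* A) ℤ.+ (G h ℤ.* (f ℤ.* (+ p ℤ.* + p)) ℤ.+ + p ℤ.* (+ e ℤ.* (G h ℤ.* (ℤ.- A ℤ.- f)) ℤ.- G h ℤ.* f))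
        ≡⟨ l (G h) (+ e) A f ⟩
      + 0 ∎)
      where
      A = aₚ p a b
      f = φ (+ b)
      sums : ∀ n → e ≡ n → G h ℤ.* (f ℤ.* Σ e term) ≈ G h ℤ.* (f ℤ.* (+ p ℤ.* + p)) ℤ.+ + p ℤ.* (Σ e Z-term ℤ.- Z-term 0)
      sums zero e≡0 = case subst (0 <_) e≡0 0<e of λ ()
      sums (suc e′) e≡ = terms-sum e′ e≡
      l : ∀ g e A f → g ℤ.* ((+ 1 ℤ.+ e) ℤ.* e ℤ.* A) ℤ.+ (g ℤ.* (f ℤ.* ((+ 1 ℤ.+ e) ℤ.* (+ 1 ℤ.+ e))) ℤ.+ (+ 1 ℤ.+ e) ℤ.* (e ℤ.* (g ℤ.* (ℤ.- A ℤ.- f)) ℤ.- g ℤ.* f)) ≡ + 0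
      l = solve-∀

-- The hypotheses on p and on the j-invariant, and the theorem.

open Congruences
open Fractions
open Summation

parity : ∀ n → ∃[ h ] (n ≡ h ℕ.+ h ⊎ n ≡ suc (h ℕ.+ h))
parity zero = 0 , inj₁ refl
parity (suc n) with parity n
... | h , inj₁ eq = h , inj₂ (cong suc eq)
... | h , inj₂ eq = suc h , inj₁ (cong suc (trans eq (sym (ℕP.+-suc h h))))

-- For odd e the prime p would be even, hence 2. This also removes e = 3, that is p = 4, and yields
-- the bound 4 ≤ e on which the estimates rest.
oddPrime : ∀ e → Prime (suc e) → 4 ≤ e ⊎ e ≡ 3 → ∃[ h ] OddPrime e h
oddPrime e pr l with parity e
... | h , inj₂ eq = ⊥-elim (even (prime⇒irreducible pr (ℕD.divides (suc h) (trans (cong suc eq) (l₁ h)))))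
  where
  l₁ : ∀ h → suc (suc (h ℕ.+ h)) ≡ suc h ℕ.* 2
  l₁ = solveℕ-∀
  even : 2 ≡ 1 ⊎ 2 ≡ suc e → ⊥
  even (inj₁ ())
  even (inj₂ refl) = case l of λ { (inj₁ (s≤s ())) ; (inj₂ ()) }
... | h , inj₁ eq = h , record { prime = pr ; e≡h+h = eq ; 4≤e = four l }
  where
  four : 4 ≤ e ⊎ e ≡ 3 → 4 ≤ e
  four (inj₁ q) = q
  four (inj₂ refl) = ⊥-elim (odd h eq)
    where
    odd : ∀ h → 3 ≡ h ℕ.+ h → ⊥
    odd (suc zero) ()
    odd (suc (suc h)) q = case trans q (cong (suc ∘ suc) (trans (ℕP.+-suc h (suc h)) (cong suc (ℕP.+-suc h h)))) of λ ()

module Nonvanishing {e h : ℕ} (P : OddPrime e h) (a b : ℕ) where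

  open PrimeModulus P
  open ModN P
  open import Relation.Binary.Reasoning.Setoid setoid

  private
    d A B : ℕ
    d = discE p a b
    A = 4 ℕ.* a ℕ.^ 3
    B = 27 ℕ.* b ℕ.^ 2

    -- Stated for a variable c because 1728 would be unfolded in unary.
    j-numerator : ∀ c x y → + (c ℕ.* 4 ℕ.* x ℕ.* y) ≡ + c ℤ.* (+ (4 ℕ.* x) ℤ.* + y)
    j-numerator c x y = trans (cong +_ (trans (cong (ℕ._* y) (ℕP.*-assoc c 4 x)) (ℕP.*-assoc c (4 ℕ.* x) y)))
      (trans (ℤP.pos-* c (4 ℕ.* x ℕ.* y)) (cong (+ c ℤ.*_) (ℤP.pos-* (4 ℕ.* x) y)))

    product≈0 : ∀ c x y → + x ≈ + 0 → + (c ℕ.* (x ℕ.* y)) ≈ + 0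
    product≈0 c x y z = begin
      + (c ℕ.* (x ℕ.* y)) ≡⟨ trans (ℤP.pos-* c (x ℕ.* y)) (cong (+ c ℤ.*_) (ℤP.pos-* x y)) ⟩
      + c ℤ.* (+ x ℤ.* + y) ≈⟨ *-congˡ (+ c) (*-congʳ (+ y) z) ⟩
      + c ℤ.* (+ 0 ℤ.* + y) ≡⟨ trans (cong (+ c ℤ.*_) (ℤP.*-zeroˡ (+ y))) (ℤP.*-zeroʳ (+ c)) ⟩
      + 0 ∎

    j≈0 : + a ≈ + 0 → ∀ c → + (c ℕ.* 4 ℕ.* a ℕ.^ 3 ℕ.* invFp p d) ≈ + 0
    j≈0 z c = begin
      + (c ℕ.* 4 ℕ.* a ℕ.^ 3 ℕ.* invFp p d) ≡⟨ j-numerator c (a ℕ.^ 3) (invFp p d) ⟩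
      + c ℤ.* (+ A ℤ.* + invFp p d) ≈⟨ *-congˡ (+ c) (*-congʳ (+ invFp p d) (product≈0 4 a (a ℕ.^ 2) z)) ⟩
      + c ℤ.* (+ 0 ℤ.* + invFp p d) ≡⟨ trans (cong (+ c ℤ.*_) (ℤP.*-zeroˡ (+ invFp p d))) (ℤP.*-zeroʳ (+ c)) ⟩
      + 0 ∎

    d≈A : + b ≈ + 0 → + d ≈ + A
    d≈A z = begin
      + d ≈⟨ modN-≈p (A ℕ.+ B) ⟩
      + (A ℕ.+ B) ≡⟨ ℤP.pos-+ A B ⟩
      + A ℤ.+ + B ≈⟨ +-cong (≈-refl {+ A}) (product≈0 27 b (b ℕ.^ 1) z) ⟩
      + A ℤ.+ + 0 ≡⟨ ℤP.+-identityʳ (+ A) ⟩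
      + A ∎

    j≈c : d ≢ 0 → + b ≈ + 0 → ∀ c → + (c ℕ.* 4 ℕ.* a ℕ.^ 3 ℕ.* invFp p d) ≈ + c
    j≈c d≢0 z c = begin
      + (c ℕ.* 4 ℕ.* a ℕ.^ 3 ℕ.* invFp p d) ≡⟨ j-numerator c (a ℕ.^ 3) (invFp p d) ⟩
      + c ℤ.* (+ A ℤ.* + invFp p d)
        ≈⟨ *-congˡ (+ c) (*-cong (≈-sym (d≈A z)) (≈-trans (modN-≈p (d ℕ.^ (e ℕ.∸ 1))) (≡⇒≈ (pos-^ d (e ℕ.∸ 1))))) ⟩
      + c ℤ.* (+ d) ℤ.^ suc (e ℕ.∸ 1)
        ≡⟨ cong (λ n → + c ℤ.* (+ d) ℤ.^ n) {suc (e ℕ.∸ 1)} {e} (ℕP.m+[n∸m]≡n {1} {e} (ℕP.≤-trans (s≤s z≤n) 4≤e)) ⟩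
      + c ℤ.* (+ d) ℤ.^ e
        ≈⟨ *-congˡ (+ c) (fermat-unit (+ d) (Unit-small d (ℕP.n≢0⇒n>0 d≢0) (modN-<p (A ℕ.+ B)))) ⟩
      + c ℤ.* + 1 ≡⟨ ℤP.*-identityʳ (+ c) ⟩
      + c ∎

  unit-a : jInv p a b ≢ 0 → Unit (+ a)
  unit-a j≢0 z = j≢0 (trans (cong-modN _ 0 (j≈0 z 1728)) refl)

  -- If p divided b, the discriminant term would be 4a³, so j = 1728 · 4a³/(4a³) = 1728; the
  -- division is legitimate because d is nonzero.
  unit-b : d ≢ 0 → jInv p a b ≢ modN 1728 p → Unit (+ b)
  unit-b d≢0 j≢ z = j≢ (cong-modN _ 1728 (j≈c d≢0 z 1728))

-- `Gscaled` is p²(1 - p) times ₂G₂ modulo pᵏ, so the integer here is p(p - 1) times the difference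
-- of the two sides of the formula. Divisibility by pᵏ for every k says that this difference is
-- zero.
theorem1p2 : (p : ℕ) → Prime p → p > 3 → (a b : ℕ) → a < p → b < p →
    discE p a b ≢ 0 → jInv p a b ≢ 0 → jInv p a b ≢ modN 1728 p →
    (k : ℕ) →
    (+ (p ℕ.^ k)) ∣
    (+ (p ℕ.* (p ℕ.∸ 1)) ℤ.* aₚ p a b ℤ.+
    legendre p b ℤ.*
    Gscaled p k ((+ 1 ℚ./ 4) ∷ (+ 3 ℚ./ 4) ∷ []) ((+ 1 ℚ./ 3) ∷ (+ 2 ℚ./ 3) ∷ [])
    (tArg p a b))
theorem1p2 p pr p>3 a b _ _ d≢0 j≢0 j≢1728 zero = ℕD.1∣ _
theorem1p2 (suc e) pr (s≤s 3≤e) a b _ _ d≢0 j≢0 j≢1728 (suc k′) =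
  ∣⇒∣ᵤ (Congruence.≈0⇒∣ (+ (suc e ℕ.^ suc k′)) (Assembly.conclusion P k′ a b (unit-a j≢0) (unit-b d≢0 j≢1728)))
  where
  P = proj₂ (oddPrime e pr (Sum.map₂ sym (ℕP.m≤n⇒m<n∨m≡n 3≤e)))
  open Nonvanishing P a b
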